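{- For every prime $p\ge 5$, every $r\ge 0$, and every $m\ge 0$, \[ A_{mp^r}^{\mathrm{mix}}\equiv A_m^{(\chi_3(p)^r)}\pmod p. \] Consequently, if $p\equiv 1\pmod 3$ then $A_{mp^r}^{\mathrm{mix}}\equiv A_m^{\mathrm{mix}}\pmod p$, whereas if $p\equiv 2\pmod 3$ then \[ A_{mp^{2r}}^{\mathrm{mix}}\equiv A_m^{\mathrm{mix}}\pmod p,\qquad A_{mp^{2r+1}}^{\mathrm{mix}}\equiv A_m^{(-1)}\pmod p. \]
   Context: $A_n^{\mathrm{mix}}:=108^n[z^n]\,{}_2F_1(\tfrac16,\tfrac13;1;z)^3$. Let $\chi_3$ be the nontrivial Dirichlet character mod $3$. Put $u(q):=q\prod_{n\ge1}(1-q^{3n})^{12}/(1-q^n)^{12}$, $t(q):=u/(1+27u)^2$, $H_{\mathrm{mix}}(q):=q/t(q)$. Let $C_0(q):=1+3\sum_{n\ge1}\bigl(\sum_{d\mid n}\chi_3(d)d^4\bigr)q^n$ and $uC_0(q):=\sum_{n\ge1}\bigl(\sum_{d\mid n}\chi_3(n/d)d^4\bigr)q^n$ (this series equals the product $u(q)C_0(q)$). For $\varepsilon\in\{\pm1\}$ define $C^{(\varepsilon)}:=C_0-27\varepsilon\,uC_0$ and $A_m^{(\varepsilon)}:=[q^m]C^{(\varepsilon)}(q)H_{\mathrm{mix}}(q)^m$. (One has $A_m^{(+1)}=A_m^{\mathrm{mix}}$.) -}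

module Defs where

open import Data.Nat as ℕ using (ℕ; zero; suc; _∸_; _%_; _!)
open import Data.Nat.Properties using (_!*_!≢0)
open import Data.Nat.Divisibility using (_∣?_)
open import Data.Integer as ℤ using (ℤ; +_)
open import Data.Rational as ℚ using (ℚ)
open import Data.List using (List; []; _∷_; map; upTo; zipWith; filter; foldr)
open import Data.Product using (Σ)
open import Relation.Binary.PropositionalEquality using (_≡_)
open import Relation.Nullary using (yes; no)

-- Formal power series are coefficient functions ℕ → R.

sumℤ : List ℤ → ℤ
sumℤ = foldr ℤ._+_ (+ 0)

sumℚ : List ℚ → ℚ
sumℚ = foldr ℚ._+_ ℚ.0ℚ

oneTo : ℕ → List ℕ
oneTo n = map suc (upTo n)

_⊛_ : (ℕ → ℤ) → (ℕ → ℤ) → (ℕ → ℤ)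
(f ⊛ g) n = sumℤ (map (λ i → f i ℤ.* g (n ∸ i)) (upTo (suc n)))

_⊕_ : (ℕ → ℤ) → (ℕ → ℤ) → (ℕ → ℤ)
(f ⊕ g) n = f n ℤ.+ g n

scale : ℤ → (ℕ → ℤ) → (ℕ → ℤ)
scale c f n = c ℤ.* f n

oneS : ℕ → ℤ
oneS zero = + 1
oneS (suc _) = + 0

powS : (ℕ → ℤ) → ℕ → (ℕ → ℤ)
powS f zero = oneS
powS f (suc k) = f ⊛ powS f k

qS : ℕ → ℤ
qS 1 = + 1
qS _ = + 0

-- multiplicative inverse of an integer series f with constant term f 0 = 1
-- (only applied to such series).  invRev f n = [b_n, ..., b_1, b_0].
invRev : (ℕ → ℤ) → ℕ → List ℤ
invRev f zero = + 1 ∷ []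
invRev f (suc n) =
  ℤ.- sumℤ (zipWith ℤ._*_ (map f (oneTo (suc n))) (invRev f n)) ∷ invRev f n

invS : (ℕ → ℤ) → (ℕ → ℤ)
invS f n with invRev f n
... | b ∷ _ = b
... | [] = + 0

-- division of a series with zero constant term by q
divQ : (ℕ → ℤ) → (ℕ → ℤ)
divQ f n = f (suc n)

_⊛ℚ_ : (ℕ → ℚ) → (ℕ → ℚ) → (ℕ → ℚ)
(f ⊛ℚ g) n = sumℚ (map (λ i → f i ℚ.* g (n ∸ i)) (upTo (suc n)))

fromℕℚ : ℕ → ℚ
fromℕℚ n = (+ n) ℚ./ 1

poch : ℚ → ℕ → ℚ
poch a zero = ℚ.1ℚ
poch a (suc k) = poch a k ℚ.* (a ℚ.+ fromℕℚ k)

-- [z^k] 2F1(1/6,1/3;1;z) = (1/6)_k (1/3)_k / ((1)_k k!), with (1)_k = k!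
F21coeff : ℕ → ℚ
F21coeff k = poch ((+ 1) ℚ./ 6) k ℚ.* poch ((+ 1) ℚ./ 3) k
             ℚ.* ((+ 1) ℚ./ (k ! ℕ.* k !))
  where instance _ = k !* k !≢0

Amix : ℕ → ℚ
Amix n = fromℕℚ (108 ℕ.^ n) ℚ.* ((F21coeff ⊛ℚ F21coeff) ⊛ℚ F21coeff) n

χ₃ : ℕ → ℤ
χ₃ d with d % 3
... | 1 = + 1
... | 2 = ℤ.-[1+ 0 ]
... | _ = + 0

divisors : ℕ → List ℕ
divisors n = filter (_∣? n) (oneTo n)

oneMinusQ3 : ℕ → ℕ → ℤ
oneMinusQ3 n zero = + 1
oneMinusQ3 n (suc j) with suc j ℕ.≟ 3 ℕ.* n
... | yes _ = ℤ.-[1+ 0 ]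
... | no _ = + 0

-- 1/(1 - q^n) = Σ_k q^{nk}   (n ≥ 1)
geomQ : ℕ → ℕ → ℤ
geomQ n j with n ∣? j
... | yes _ = + 1
... | no _ = + 0

etaFactor : ℕ → ℕ → ℤ
etaFactor n = powS (oneMinusQ3 n ⊛ geomQ n) 12

etaFin : ℕ → ℕ → ℤ
etaFin N = foldr (λ n acc → etaFactor n ⊛ acc) oneS (oneTo N)

-- P(q) = ∏_{n≥1} (1-q^{3n})^12/(1-q^n)^12 ; its coefficient of q^N
-- equals that of the finite product over n ≤ N (factors with n > N are
-- 1 + O(q^{N+1})).
etaProd : ℕ → ℤ
etaProd N = etaFin N N

uS : ℕ → ℤ
uS zero = + 0
uS (suc N) = etaProd N

tS : ℕ → ℤ
tS = uS ⊛ invS (powS (oneS ⊕ scale (+ 27) uS) 2)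

Hmix : ℕ → ℤ
Hmix = invS (divQ tS)

C0 : ℕ → ℤ
C0 zero = + 1
C0 (suc n) = + 3 ℤ.* sumℤ (map (λ d → χ₃ d ℤ.* (+ (d ℕ.^ 4))) (divisors (suc n)))

uC0 : ℕ → ℤ
uC0 zero = + 0
uC0 (suc n) = sumℤ (map term (filter (λ i → suc i ∣? suc n) (upTo (suc n))))
  where
  term : ℕ → ℤ
  term i = χ₃ (suc n ℕ./ suc i) ℤ.* (+ (suc i ℕ.^ 4))

Ceps : ℤ → ℕ → ℤ
Ceps ε n = C0 n ℤ.- (+ 27) ℤ.* ε ℤ.* uC0 n

Aeps : ℤ → ℕ → ℤ
Aeps ε m = (Ceps ε ⊛ powS Hmix m) m

_≡ℚ_[mod_] : ℚ → ℚ → ℕ → Set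
x ≡ℚ y [mod p ] = Σ ℤ (λ k → x ℚ.- y ≡ ((+ p) ℤ.* k) ℚ./ 1)

ℤtoℚ : ℤ → ℚ
ℤtoℚ z = z ℚ./ 1

{-# OPTIONS --safe #-}

-- With θ = q d/dq, the Lambert series a = 1 + 6 Σ_n Σ_{d|n} χ₃(d) q^n, B and C (Ramanujan's cubic
-- a, b³ and c³) satisfy
-- a² = θu/u, a³ = B + C and C = 27 u B, while C₀ = a² B and 27 uC₀ = a² C.  All of this, together with a
-- second order equation for a, follows from eight bilinear identities between Lambert series, and
-- each of those comes from x_a x_b = x_{a+b} (1 + x_a + x_b) for x_a = q^a/(1 - q^a) (or a twisted version)
-- by one step of Euclid's algorithm on the summation indices (a, b).  As a function of t, a solves the
-- equation of ₂F₁(1/6, 1/3; 1; 108 t), and a³ θt/t = C₀ - 27 uC₀ = C^{(+1)}; Lagrange inversion turns this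
-- into A^mix_m = A^{(+1)}_m.  Modulo p, H^{mp} is H(q^p)^m, and taking every p-th coefficient sends C^{(ε)}
-- to C^{(ε χ₃(p))}, since d⁴ kills the divisors divisible by p; iterating this r times gives the theorem.
module Submission where

open import Defs
open import Data.Nat as ℕ using (ℕ; zero; suc; _∸_; _≤_; _<_; z≤n; s≤s; _*_; _+_; _^_; _%_; NonZero)
import Data.Nat.Properties as ℕₚ
open import Data.Nat.Divisibility using (_∣_; divides; _∣?_; ∣m+n∣m⇒∣n; ∣-refl; ∣⇒≤)
open import Data.Nat.Induction using (<-rec)
open import Data.Nat.Primality using (Prime)
open import Data.Integer as ℤ using (ℤ; +_; -[1+_]; 0ℤ; 1ℤ)
  renaming (_+_ to infixl 6 _+ᶻ_; _*_ to infixl 7 _*ᶻ_; _-_ to infixl 6 _-ᶻ_; -_ to infix 8 -ᶻ_)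
import Data.Integer.Properties as ℤₚ
open import Data.Integer.Solver using (module +-*-Solver)
open import Data.Integer.Tactic.RingSolver using (solve-∀)
open import Data.List using (List; []; _∷_; _∷ʳ_; map; upTo; zipWith; filter; foldr; applyUpTo)
import Data.List.Properties as Listₚ
open import Data.Maybe using (Maybe; just; nothing)
open import Data.Product using (_×_; _,_)
open import Data.Sum using (inj₁; inj₂)
open import Data.Empty using (⊥-elim)
open import Function using (_∘_; id; _$_; it)
open import Relation.Nullary using (¬_; yes; no; Dec)
open import Relation.Binary.PropositionalEquality
open import Relation.Binary.Definitions using (tri<; tri≈; tri>)
open import Algebra.Bundles using (CommutativeRing)
import Algebra.Solver.Ring.AlmostCommutativeRing as ACR
open ACR using (_-Raw-AlmostCommutative⟶_)
import Algebra.Solver.Ring as RingSolver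

-- Level 3 modular forms occur only as q-expansions, so an identity that the theory would read off
-- from the dimension of a space must be proved coefficient by coefficient. What makes this possible
-- is the relation X(a,b) = d(a+b) + X(a+b,a) + X(a+b,b) for X(a,b) = x_a x_b and d(c) = x_c. If the
-- symmetrised weight of a double sum is twice the increment of a symmetric G from (a,b) to (a,a+b),
-- then computing the sum of G X in two ways removes every truly bilinear term. The divisor sum that
-- remains has sums of G along a + b = c as coefficients; on the diagonal, x_a² is expressed by θ
-- x_a, and this is the source of all derivatives in the identities. Two families of Lambert series
-- are needed, with the character on the divisor (α) or on the codivisor (γ). The second requires
-- products of a twisted and an untwisted factor; these are not symmetric in (a,b), and three
-- coupled relations take the place of one. The identities between series stay over the integers:
-- denominators are cleared by constants such as 72, which are cancelled afterwards. This
-- integrality is what later permits reduction modulo p.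

module PowerSeries where

  -- Finite sums of integers.

  ∑ : ℕ → (ℕ → ℤ) → ℤ
  ∑ zero f = 0ℤ
  ∑ (suc n) f = f 0 +ᶻ ∑ n (f ∘ suc)

  ∑-cong< : ∀ n {f g : ℕ → ℤ} → (∀ i → i < n → f i ≡ g i) → ∑ n f ≡ ∑ n g
  ∑-cong< zero h = refl
  ∑-cong< (suc n) h = cong₂ _+ᶻ_ (h 0 (s≤s z≤n)) (∑-cong< n (λ i i<n → h (suc i) (s≤s i<n)))

  ∑-cong : ∀ n {f g : ℕ → ℤ} → (∀ i → f i ≡ g i) → ∑ n f ≡ ∑ n g
  ∑-cong n h = ∑-cong< n (λ i _ → h i)

  ∑-0 : ∀ n → ∑ n (λ _ → 0ℤ) ≡ 0ℤ
  ∑-0 zero = refl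
  ∑-0 (suc n) = trans (ℤₚ.+-identityˡ _) (∑-0 n)

  ∑-zero : ∀ n {f : ℕ → ℤ} → (∀ i → i < n → f i ≡ 0ℤ) → ∑ n f ≡ 0ℤ
  ∑-zero n h = trans (∑-cong< n h) (∑-0 n)

  ∑-+ : ∀ n (f g : ℕ → ℤ) → ∑ n (λ i → f i +ᶻ g i) ≡ ∑ n f +ᶻ ∑ n g
  ∑-+ zero f g = refl
  ∑-+ (suc n) f g = trans (cong (f 0 +ᶻ g 0 +ᶻ_) (∑-+ n (f ∘ suc) (g ∘ suc))) (interchange (f 0) (g 0) _ _)
    where
    interchange : ∀ a b c d → a +ᶻ b +ᶻ (c +ᶻ d) ≡ (a +ᶻ c) +ᶻ (b +ᶻ d)
    interchange = solve-∀

  ∑-*ˡ : ∀ n c (f : ℕ → ℤ) → ∑ n (λ i → c *ᶻ f i) ≡ c *ᶻ ∑ n f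
  ∑-*ˡ zero c f = sym (ℤₚ.*-zeroʳ c)
  ∑-*ˡ (suc n) c f = trans (cong (c *ᶻ f 0 +ᶻ_) (∑-*ˡ n c (f ∘ suc))) (sym (ℤₚ.*-distribˡ-+ c (f 0) _))

  ∑-*ʳ : ∀ n c (f : ℕ → ℤ) → ∑ n (λ i → f i *ᶻ c) ≡ ∑ n f *ᶻ c
  ∑-*ʳ n c f = trans (∑-cong n (λ i → ℤₚ.*-comm (f i) c)) (trans (∑-*ˡ n c f) (ℤₚ.*-comm c _))

  ∑-last : ∀ n (f : ℕ → ℤ) → ∑ (suc n) f ≡ ∑ n f +ᶻ f n
  ∑-last zero f = trans (ℤₚ.+-identityʳ (f 0)) (sym (ℤₚ.+-identityˡ (f 0)))
  ∑-last (suc n) f = trans (cong (f 0 +ᶻ_) (∑-last n (f ∘ suc))) (sym (ℤₚ.+-assoc (f 0) _ _))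

  ∑-swap : ∀ m n (f : ℕ → ℕ → ℤ) → ∑ m (λ i → ∑ n (f i)) ≡ ∑ n (λ j → ∑ m (λ i → f i j))
  ∑-swap zero n f = sym (∑-0 n)
  ∑-swap (suc m) n f = trans (cong (∑ n (f 0) +ᶻ_) (∑-swap m n (f ∘ suc))) (sym (∑-+ n (f 0) _))

  ∑-extend : ∀ {m n} {f : ℕ → ℤ} → m ≤ n → (∀ i → m ≤ i → f i ≡ 0ℤ) → ∑ m f ≡ ∑ n f
  ∑-extend {n = n} z≤n h = sym (∑-zero n (λ i _ → h i z≤n))
  ∑-extend {f = f} (s≤s m≤n) h = cong (f 0 +ᶻ_) (∑-extend m≤n (λ i m≤i → h (suc i) (s≤s m≤i)))

  sumℤ-map-upTo : ∀ (f : ℕ → ℤ) n → sumℤ (map f (upTo n)) ≡ ∑ n f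
  sumℤ-map-upTo f n = trans (cong sumℤ (Listₚ.map-applyUpTo id f n)) (go f n)
    where
    go : ∀ (f : ℕ → ℤ) n → sumℤ (applyUpTo f n) ≡ ∑ n f
    go f zero = refl
    go f (suc n) = cong (f 0 +ᶻ_) (go (f ∘ suc) n)

  -- The commutative ring of integer power series.

  Series : Set
  Series = ℕ → ℤ

  ⊛-coeff : ∀ (f g : Series) n → (f ⊛ g) n ≡ ∑ (suc n) (λ i → f i *ᶻ g (n ∸ i))
  ⊛-coeff f g n = sumℤ-map-upTo (λ i → f i *ᶻ g (n ∸ i)) (suc n)

  ⊛-sucˡ : ∀ (f g : Series) n → (f ⊛ g) (suc n) ≡ f 0 *ᶻ g (suc n) +ᶻ ((f ∘ suc) ⊛ g) n
  ⊛-sucˡ f g n = trans (⊛-coeff f g (suc n)) (cong (f 0 *ᶻ g (suc n) +ᶻ_) (sym (⊛-coeff (f ∘ suc) g n)))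

  ⊛-0 : ∀ (f g : Series) → (f ⊛ g) 0 ≡ f 0 *ᶻ g 0
  ⊛-0 f g = ℤₚ.+-identityʳ _

  ⊛-cong≤ : ∀ n {f f' g g' : Series} → (∀ i → i ≤ n → f i ≡ f' i) → (∀ i → i ≤ n → g i ≡ g' i) → (f ⊛ g) n ≡ (f' ⊛ g') n
  ⊛-cong≤ n {f} {f'} {g} {g'} p q = trans (⊛-coeff f g n) (trans
    (∑-cong< (suc n) (λ i i<n → cong₂ _*ᶻ_ (p i (ℕₚ.≤-pred i<n)) (q (n ∸ i) (ℕₚ.m∸n≤m n i))))
    (sym (⊛-coeff f' g' n)))

  infix 4 _≈_
  -- A record and not a bare function type, so that both series can be inferred from the type of an
  -- equality proof.
  record _≈_ (f g : Series) : Set where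
    constructor mk≈
    field at : ∀ n → f n ≡ g n
  open _≈_ public

  constˢ : ℤ → Series
  constˢ c zero = c
  constˢ c (suc _) = 0ℤ

  0ˢ 1ˢ : Series
  0ˢ = constˢ 0ℤ
  1ˢ = constˢ 1ℤ

  0ˢ-at : ∀ n → 0ˢ n ≡ 0ℤ
  0ˢ-at zero = refl
  0ˢ-at (suc n) = refl

  1≈oneS : 1ˢ ≈ oneS
  1≈oneS = mk≈ λ { zero → refl ; (suc n) → refl }

  -- Splits off the last term instead of the first; commutativity matches this expansion against
  -- `⊛-sucˡ`.
  ⊛-sucʳ : ∀ (f g : Series) n → (f ⊛ g) (suc n) ≡ (f ⊛ (g ∘ suc)) n +ᶻ f (suc n) *ᶻ g 0
  ⊛-sucʳ f g zero = trans (⊛-sucˡ f g 0) (cong₂ _+ᶻ_ (sym (⊛-0 f (g ∘ suc))) (⊛-0 (f ∘ suc) g))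
  ⊛-sucʳ f g (suc n) = trans (⊛-sucˡ f g (suc n)) (trans
    (cong (f 0 *ᶻ g (suc (suc n)) +ᶻ_) (⊛-sucʳ (f ∘ suc) g n))
    (trans (sym (ℤₚ.+-assoc (f 0 *ᶻ g (suc (suc n))) _ _))
      (cong (_+ᶻ f (suc (suc n)) *ᶻ g 0) (sym (⊛-sucˡ f (g ∘ suc) n)))))

  ⊛-comm : ∀ f g n → (f ⊛ g) n ≡ (g ⊛ f) n
  ⊛-comm f g zero = trans (⊛-0 f g) (trans (ℤₚ.*-comm (f 0) (g 0)) (sym (⊛-0 g f)))
  ⊛-comm f g (suc n) = trans (⊛-sucˡ f g n) (trans
    (trans (ℤₚ.+-comm (f 0 *ᶻ g (suc n)) _) (cong₂ _+ᶻ_ (⊛-comm (f ∘ suc) g n) (ℤₚ.*-comm (f 0) (g (suc n)))))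
    (sym (⊛-sucʳ g f n)))

  ⊛-distribʳ : ∀ f g h n → ((g ⊕ h) ⊛ f) n ≡ (g ⊛ f) n +ᶻ (h ⊛ f) n
  ⊛-distribʳ f g h n = trans (⊛-coeff (g ⊕ h) f n) (trans
    (∑-cong (suc n) (λ i → ℤₚ.*-distribʳ-+ (f (n ∸ i)) (g i) (h i)))
    (trans (∑-+ (suc n) (λ i → g i *ᶻ f (n ∸ i)) (λ i → h i *ᶻ f (n ∸ i)))
      (sym (cong₂ _+ᶻ_ (⊛-coeff g f n) (⊛-coeff h f n)))))

  scale-⊛ : ∀ c f g n → (scale c f ⊛ g) n ≡ c *ᶻ (f ⊛ g) n
  scale-⊛ c f g n = trans (⊛-coeff (scale c f) g n) (trans
    (∑-cong (suc n) (λ i → ℤₚ.*-assoc c (f i) (g (n ∸ i))))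
    (trans (∑-*ˡ (suc n) c (λ i → f i *ᶻ g (n ∸ i))) (cong (c *ᶻ_) (sym (⊛-coeff f g n)))))

  -- Write f = f(0) + q (f ∘ suc) and recurse on f ∘ suc: distributivity and scaling then replace
  -- the reindexing of a double convolution.
  ⊛-assoc : ∀ f g h n → ((f ⊛ g) ⊛ h) n ≡ (f ⊛ (g ⊛ h)) n
  ⊛-assoc f g h zero = trans (⊛-0 (f ⊛ g) h) (trans (cong (_*ᶻ h 0) (⊛-0 f g))
    (trans (ℤₚ.*-assoc (f 0) (g 0) (h 0)) (sym (trans (⊛-0 f (g ⊛ h)) (cong (f 0 *ᶻ_) (⊛-0 g h))))))
  ⊛-assoc f g h (suc n) = begin
    ((f ⊛ g) ⊛ h) (suc n)
      ≡⟨ ⊛-sucˡ (f ⊛ g) h n ⟩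
    (f ⊛ g) 0 *ᶻ h (suc n) +ᶻ (((f ⊛ g) ∘ suc) ⊛ h) n
      ≡⟨ cong₂ _+ᶻ_ (cong (_*ᶻ h (suc n)) (⊛-0 f g))
           (⊛-cong≤ n {g = h} {g' = h} (λ i _ → ⊛-sucˡ f g i) (λ _ _ → refl)) ⟩
    f 0 *ᶻ g 0 *ᶻ h (suc n) +ᶻ ((scale (f 0) (g ∘ suc) ⊕ ((f ∘ suc) ⊛ g)) ⊛ h) n
      ≡⟨ cong (f 0 *ᶻ g 0 *ᶻ h (suc n) +ᶻ_) (⊛-distribʳ h (scale (f 0) (g ∘ suc)) ((f ∘ suc) ⊛ g) n) ⟩
    f 0 *ᶻ g 0 *ᶻ h (suc n) +ᶻ ((scale (f 0) (g ∘ suc) ⊛ h) n +ᶻ (((f ∘ suc) ⊛ g) ⊛ h) n)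
      ≡⟨ cong (f 0 *ᶻ g 0 *ᶻ h (suc n) +ᶻ_) (cong₂ _+ᶻ_ (scale-⊛ (f 0) (g ∘ suc) h n) (⊛-assoc (f ∘ suc) g h n)) ⟩
    f 0 *ᶻ g 0 *ᶻ h (suc n) +ᶻ (f 0 *ᶻ ((g ∘ suc) ⊛ h) n +ᶻ ((f ∘ suc) ⊛ (g ⊛ h)) n)
      ≡⟨ regroup (f 0) (g 0) (h (suc n)) _ _ ⟩
    f 0 *ᶻ (g 0 *ᶻ h (suc n) +ᶻ ((g ∘ suc) ⊛ h) n) +ᶻ ((f ∘ suc) ⊛ (g ⊛ h)) n
      ≡⟨ cong (λ z → f 0 *ᶻ z +ᶻ ((f ∘ suc) ⊛ (g ⊛ h)) n) (sym (⊛-sucˡ g h n)) ⟩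
    f 0 *ᶻ (g ⊛ h) (suc n) +ᶻ ((f ∘ suc) ⊛ (g ⊛ h)) n
      ≡⟨ sym (⊛-sucˡ f (g ⊛ h) n) ⟩
    (f ⊛ (g ⊛ h)) (suc n) ∎
    where
    open ≡-Reasoning
    regroup : ∀ a b c d e → a *ᶻ b *ᶻ c +ᶻ (a *ᶻ d +ᶻ e) ≡ a *ᶻ (b *ᶻ c +ᶻ d) +ᶻ e
    regroup = solve-∀

  ⊛-zeroˡ : ∀ f g n → (∀ i → f i ≡ 0ℤ) → (f ⊛ g) n ≡ 0ℤ
  ⊛-zeroˡ f g n f0 = trans (⊛-coeff f g n) (∑-zero (suc n) (λ i _ → cong (_*ᶻ g (n ∸ i)) (f0 i)))

  const-⊛ : ∀ c f n → (constˢ c ⊛ f) n ≡ c *ᶻ f n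
  const-⊛ c f zero = ⊛-0 (constˢ c) f
  const-⊛ c f (suc n) = trans (⊛-sucˡ (constˢ c) f n) (trans (cong (c *ᶻ f (suc n) +ᶻ_) (⊛-zeroˡ (constˢ c ∘ suc) f n (λ _ → refl))) (ℤₚ.+-identityʳ _))

  ≈-refl : ∀ {f} → f ≈ f
  ≈-refl = mk≈ λ _ → refl

  ≈-sym : ∀ {f g} → f ≈ g → g ≈ f
  ≈-sym (mk≈ p) = mk≈ λ n → sym (p n)

  ≈-trans : ∀ {f g h} → f ≈ g → g ≈ h → f ≈ h
  ≈-trans (mk≈ p) (mk≈ q) = mk≈ λ n → trans (p n) (q n)

  infixl 7 _*ˢ_
  infixl 6 _+ˢ_
  infix 8 -ˢ_
  opaque
    -- Opaque, so that terms are compared as formal sums and products and are not unfolded into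
    -- convolutions; coefficients are reached through `+ˢ-at`, `*ˢ-at` and `-ˢ-at`.
    _+ˢ_ _*ˢ_ : Series → Series → Series
    _+ˢ_ = _⊕_
    _*ˢ_ = _⊛_

    -ˢ_ : Series → Series
    (-ˢ f) n = -ᶻ f n

    +ˢ-at : ∀ f g n → (f +ˢ g) n ≡ f n +ᶻ g n
    +ˢ-at f g n = refl

    *ˢ-at : ∀ f g n → (f *ˢ g) n ≡ (f ⊛ g) n
    *ˢ-at f g n = refl

    -ˢ-at : ∀ f n → (-ˢ f) n ≡ -ᶻ f n
    -ˢ-at f n = refl

    +ˢ-cong : ∀ {f f' g g'} → f ≈ f' → g ≈ g' → f +ˢ g ≈ f' +ˢ g'
    +ˢ-cong (mk≈ p) (mk≈ q) = mk≈ λ n → cong₂ _+ᶻ_ (p n) (q n)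

    +ˢ-assoc : ∀ f g h → (f +ˢ g) +ˢ h ≈ f +ˢ (g +ˢ h)
    +ˢ-assoc f g h = mk≈ λ n → ℤₚ.+-assoc (f n) (g n) (h n)

    +ˢ-comm : ∀ f g → f +ˢ g ≈ g +ˢ f
    +ˢ-comm f g = mk≈ λ n → ℤₚ.+-comm (f n) (g n)

    +ˢ-identityˡ : ∀ f → 0ˢ +ˢ f ≈ f
    +ˢ-identityˡ f = mk≈ λ n → trans (cong (_+ᶻ f n) (0ˢ-at n)) (ℤₚ.+-identityˡ (f n))

    +ˢ-inverseˡ : ∀ f → -ˢ f +ˢ f ≈ 0ˢ
    +ˢ-inverseˡ f = mk≈ λ n → trans (ℤₚ.+-inverseˡ (f n)) (sym (0ˢ-at n))

    -ˢ-cong : ∀ {f g} → f ≈ g → -ˢ f ≈ -ˢ g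
    -ˢ-cong p = mk≈ λ n → cong -ᶻ_ (at p n)

    *ˢ-cong : ∀ {f f' g g'} → f ≈ f' → g ≈ g' → f *ˢ g ≈ f' *ˢ g'
    *ˢ-cong (mk≈ p) (mk≈ q) = mk≈ λ n → ⊛-cong≤ n (λ i _ → p i) (λ i _ → q i)

    *ˢ-assoc : ∀ f g h → (f *ˢ g) *ˢ h ≈ f *ˢ (g *ˢ h)
    *ˢ-assoc f g h = mk≈ (⊛-assoc f g h)

    *ˢ-comm : ∀ f g → f *ˢ g ≈ g *ˢ f
    *ˢ-comm f g = mk≈ (⊛-comm f g)

    *ˢ-identityˡ : ∀ f → 1ˢ *ˢ f ≈ f
    *ˢ-identityˡ f = mk≈ λ n → trans (const-⊛ 1ℤ f n) (ℤₚ.*-identityˡ (f n))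

    *ˢ-distribʳ : ∀ f g h → (g +ˢ h) *ˢ f ≈ g *ˢ f +ˢ h *ˢ f
    *ˢ-distribʳ f g h = mk≈ (⊛-distribʳ f g h)

  const-* : ∀ c f n → (constˢ c *ˢ f) n ≡ c *ᶻ f n
  const-* c f n = trans (*ˢ-at (constˢ c) f n) (const-⊛ c f n)

  seriesRing : CommutativeRing _ _
  seriesRing = record
    { Carrier = Series ; _≈_ = _≈_ ; _+_ = _+ˢ_ ; _*_ = _*ˢ_ ; -_ = -ˢ_ ; 0# = 0ˢ ; 1# = 1ˢ
    ; isCommutativeRing = record
      { isRing = record
        { +-isAbelianGroup = record
          { isGroup = record
            { isMonoid = record
              { isSemigroup = record
                { isMagma = record
                  { isEquivalence = record { refl = ≈-refl ; sym = ≈-sym ; trans = ≈-trans }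
                  ; ∙-cong = +ˢ-cong }
                ; assoc = +ˢ-assoc }
              ; identity = +ˢ-identityˡ , λ f → ≈-trans (+ˢ-comm f 0ˢ) (+ˢ-identityˡ f) }
            ; inverse = +ˢ-inverseˡ , λ f → ≈-trans (+ˢ-comm f (-ˢ f)) (+ˢ-inverseˡ f)
            ; ⁻¹-cong = -ˢ-cong }
          ; comm = +ˢ-comm }
        ; *-cong = *ˢ-cong
        ; *-assoc = *ˢ-assoc
        ; *-identity = *ˢ-identityˡ , λ f → ≈-trans (*ˢ-comm f 1ˢ) (*ˢ-identityˡ f)
        ; distrib = (λ f g h → ≈-trans (*ˢ-comm f (g +ˢ h)) (≈-trans (*ˢ-distribʳ f g h) (+ˢ-cong (*ˢ-comm g f) (*ˢ-comm h f))))
                  , *ˢ-distribʳ }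
      ; *-comm = *ˢ-comm } }

  module 𝒮 = CommutativeRing seriesRing
  open 𝒮 public using () renaming (_-_ to infixl 6 _-ˢ_)

  const-+ : ∀ c d n → constˢ (c +ᶻ d) n ≡ constˢ c n +ᶻ constˢ d n
  const-+ c d zero = refl
  const-+ c d (suc n) = refl

  private
    const-≟ : ∀ c d → Maybe (constˢ c ≈ constˢ d)
    const-≟ c d with c ℤₚ.≟ d
    ... | yes refl = just ≈-refl
    ... | no _ = nothing

  -- Embeds the integers as scalars with decidable equality, so that the solver can normalise
  -- identities with numerical coefficients.
  constˢ-morphism : ℤ.+-*-rawRing -Raw-AlmostCommutative⟶ ACR.fromCommutativeRing seriesRing
  constˢ-morphism = record
    { ⟦_⟧ = constˢ
    ; +-homo = λ c d → mk≈ λ n → trans (const-+ c d n) (sym (+ˢ-at (constˢ c) (constˢ d) n))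
    ; *-homo = λ c d → mk≈ λ { zero → sym (const-* c (constˢ d) 0) ; (suc n) → sym (trans (const-* c (constˢ d) (suc n)) (ℤₚ.*-zeroʳ c)) }
    ; -‿homo = λ c → mk≈ λ { zero → sym (-ˢ-at (constˢ c) 0) ; (suc n) → sym (-ˢ-at (constˢ c) (suc n)) }
    ; 0-homo = ≈-refl
    ; 1-homo = ≈-refl }

  module SeriesSolver = RingSolver ℤ.+-*-rawRing (ACR.fromCommutativeRing seriesRing) constˢ-morphism const-≟

open PowerSeries

-- Derivation, powers, inverses and the substitution of q^a for q.

module SeriesCalculus where

  *ˢ-0 : ∀ f g → (f *ˢ g) 0 ≡ f 0 *ᶻ g 0
  *ˢ-0 f g = trans (*ˢ-at f g 0) (⊛-0 f g)

  *ˢ-suc : ∀ f g n → (f *ˢ g) (suc n) ≡ f 0 *ᶻ g (suc n) +ᶻ ((f ∘ suc) *ˢ g) n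
  *ˢ-suc f g n = trans (*ˢ-at f g (suc n)) (trans (⊛-sucˡ f g n) (cong (f 0 *ᶻ g (suc n) +ᶻ_) (sym (*ˢ-at (f ∘ suc) g n))))

  ⊛≈*ˢ : ∀ f g → (f ⊛ g) ≈ f *ˢ g
  ⊛≈*ˢ f g = mk≈ λ n → sym (*ˢ-at f g n)

  θ : Series → Series
  θ f n = + n *ᶻ f n

  θ-cong : ∀ {f g} → f ≈ g → θ f ≈ θ g
  θ-cong p = mk≈ λ n → cong (+ n *ᶻ_) (at p n)

  θ-+ : ∀ f g → θ (f +ˢ g) ≈ θ f +ˢ θ g
  θ-+ f g = mk≈ λ n → trans (cong (+ n *ᶻ_) (+ˢ-at f g n)) (trans (ℤₚ.*-distribˡ-+ (+ n) (f n) (g n)) (sym (+ˢ-at (θ f) (θ g) n)))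

  θ-neg : ∀ f → θ (-ˢ f) ≈ -ˢ θ f
  θ-neg f = mk≈ λ n → trans (cong (+ n *ᶻ_) (-ˢ-at f n)) (trans (sym (ℤₚ.neg-distribʳ-* (+ n) (f n))) (sym (-ˢ-at (θ f) n)))

  θ-const : ∀ c → θ (constˢ c) ≈ 0ˢ
  θ-const c = mk≈ λ { zero → ℤₚ.*-zeroˡ c ; (suc n) → ℤₚ.*-zeroʳ (+ suc n) }

  -- In the term with indices i and n - i, the factor n splits as i + (n - i).
  θ-* : ∀ f g → θ (f *ˢ g) ≈ θ f *ˢ g +ˢ f *ˢ θ g
  θ-* f g = mk≈ λ n → trans (cong (+ n *ᶻ_) (trans (*ˢ-at f g n) (⊛-coeff f g n)))
    (trans (sym (∑-*ˡ (suc n) (+ n) (λ i → f i *ᶻ g (n ∸ i))))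
    (trans (∑-cong< (suc n) (λ i i<n → split n i (ℕₚ.≤-pred i<n)))
    (trans (∑-+ (suc n) (λ i → θ f i *ᶻ g (n ∸ i)) (λ i → f i *ᶻ θ g (n ∸ i)))
      (sym (trans (+ˢ-at (θ f *ˢ g) (f *ˢ θ g) n) (cong₂ _+ᶻ_ (trans (*ˢ-at (θ f) g n) (⊛-coeff (θ f) g n)) (trans (*ˢ-at f (θ g) n) (⊛-coeff f (θ g) n))))))))
    where
    ring : ∀ i j a b → (i +ᶻ j) *ᶻ (a *ᶻ b) ≡ (i *ᶻ a) *ᶻ b +ᶻ a *ᶻ (j *ᶻ b)
    ring = solve-∀
    split : ∀ n i → i ≤ n → + n *ᶻ (f i *ᶻ g (n ∸ i)) ≡ θ f i *ᶻ g (n ∸ i) +ᶻ f i *ᶻ θ g (n ∸ i)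
    split n i i≤n = trans (cong (λ z → + z *ᶻ (f i *ᶻ g (n ∸ i))) (sym (ℕₚ.m+[n∸m]≡n i≤n)))
      (ring (+ i) (+ (n ∸ i)) (f i) (g (n ∸ i)))

  infixr 8 _^ˢ_
  _^ˢ_ : Series → ℕ → Series
  f ^ˢ zero = 1ˢ
  f ^ˢ suc k = f *ˢ (f ^ˢ k)

  powS≈^ˢ : ∀ f k → powS f k ≈ f ^ˢ k
  powS≈^ˢ f zero = ≈-sym 1≈oneS
  powS≈^ˢ f (suc k) = ≈-trans (⊛≈*ˢ f (powS f k)) (*ˢ-cong ≈-refl (powS≈^ˢ f k))

  ^ˢ-cong : ∀ {f g} k → f ≈ g → f ^ˢ k ≈ g ^ˢ k
  ^ˢ-cong zero p = ≈-refl
  ^ˢ-cong (suc k) p = *ˢ-cong p (^ˢ-cong k p)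

  ^ˢ-+ : ∀ f j k → f ^ˢ (j + k) ≈ f ^ˢ j *ˢ f ^ˢ k
  ^ˢ-+ f zero k = ≈-sym (*ˢ-identityˡ (f ^ˢ k))
  ^ˢ-+ f (suc j) k = ≈-trans (*ˢ-cong ≈-refl (^ˢ-+ f j k)) (≈-sym (*ˢ-assoc f (f ^ˢ j) (f ^ˢ k)))

  ^ˢ-distrib-* : ∀ f g k → (f *ˢ g) ^ˢ k ≈ f ^ˢ k *ˢ g ^ˢ k
  ^ˢ-distrib-* f g zero = ≈-sym (*ˢ-identityˡ 1ˢ)
  ^ˢ-distrib-* f g (suc k) = ≈-trans (*ˢ-cong ≈-refl (^ˢ-distrib-* f g k)) (SeriesSolver.solve 4 (λ a b c d → (a :* b) :* (c :* d) := (a :* c) :* (b :* d)) ≈-refl f g (f ^ˢ k) (g ^ˢ k))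
    where open SeriesSolver

  ^ˢ-* : ∀ f j k → f ^ˢ (k * j) ≈ (f ^ˢ j) ^ˢ k
  ^ˢ-* f j zero = ≈-refl
  ^ˢ-* f j (suc k) = ≈-trans (^ˢ-+ f j (k * j)) (*ˢ-cong ≈-refl (^ˢ-* f j k))

  θ-^ : ∀ f k → θ (f ^ˢ suc k) ≈ constˢ (+ suc k) *ˢ (f ^ˢ k *ˢ θ f)
  θ-^ f zero = ≈-trans (θ-* f 1ˢ) (≈-trans (+ˢ-cong ≈-refl (*ˢ-cong ≈-refl (θ-const 1ℤ)))
    (solve 2 (λ f t → t :* con 1ℤ :+ f :* con 0ℤ := con 1ℤ :* (con 1ℤ :* t)) ≈-refl f (θ f)))
    where open SeriesSolver
  θ-^ f (suc k) = ≈-trans (θ-* f (f ^ˢ suc k)) (≈-trans (+ˢ-cong ≈-refl (*ˢ-cong ≈-refl (θ-^ f k)))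
    (≈-trans (solve 4 (λ f p t c → t :* (f :* p) :+ f :* (c :* (p :* t)) := (con 1ℤ :+ c) :* ((f :* p) :* t)) ≈-refl f (f ^ˢ k) (θ f) (constˢ (+ suc k)))
      (*ˢ-cong (mk≈ λ n → trans (+ˢ-at 1ˢ (constˢ (+ suc k)) n) (sym (const-+ 1ℤ (+ suc k) n))) ≈-refl)))
    where open SeriesSolver

  q*-0 : ∀ f → (qS *ˢ f) 0 ≡ 0ℤ
  q*-0 f = trans (*ˢ-0 qS f) (ℤₚ.*-zeroˡ (f 0))

  q*-suc : ∀ f n → (qS *ˢ f) (suc n) ≡ f n
  q*-suc f n = trans (*ˢ-suc qS f n) (trans (cong₂ _+ᶻ_ (ℤₚ.*-zeroˡ (f (suc n))) (at (≈-trans (*ˢ-cong tail≈ ≈-refl) (*ˢ-identityˡ f)) n)) (ℤₚ.+-identityˡ (f n)))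
    where
    tail≈ : (qS ∘ suc) ≈ 1ˢ
    tail≈ = mk≈ λ { zero → refl ; (suc n) → refl }

  q^*-+ : ∀ a f m → (qS ^ˢ a *ˢ f) (a + m) ≡ f m
  q^*-+ zero f m = at (*ˢ-identityˡ f) m
  q^*-+ (suc a) f m = trans (at (*ˢ-assoc qS (qS ^ˢ a) f) (suc a + m)) (trans (q*-suc (qS ^ˢ a *ˢ f) (a + m)) (q^*-+ a f m))

  q^*-< : ∀ a f {n} → n < a → (qS ^ˢ a *ˢ f) n ≡ 0ℤ
  q^*-< (suc a) f {zero} _ = trans (at (*ˢ-assoc qS (qS ^ˢ a) f) 0) (q*-0 (qS ^ˢ a *ˢ f))
  q^*-< (suc a) f {suc n} (s≤s n<a) = trans (at (*ˢ-assoc qS (qS ^ˢ a) f) (suc n)) (trans (q*-suc (qS ^ˢ a *ˢ f) n) (q^*-< a f n<a))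

  ∑-zipWith : ∀ (f g : ℕ → ℤ) n → sumℤ (zipWith _*ᶻ_ (applyUpTo f n) (applyUpTo g n)) ≡ ∑ n (λ i → f i *ᶻ g i)
  ∑-zipWith f g zero = refl
  ∑-zipWith f g (suc n) = cong (f 0 *ᶻ g 0 +ᶻ_) (∑-zipWith (f ∘ suc) (g ∘ suc) n)

  -- `invRev` lists the coefficients from the highest down, so zipping it with f(1), f(2), ...
  -- already is the convolution that determines the next coefficient.
  invRev≡ : ∀ f n → invRev f n ≡ applyUpTo (λ i → invS f (n ∸ i)) (suc n)
  invRev≡ f zero = refl
  invRev≡ f (suc n) = cong (invS f (suc n) ∷_) (invRev≡ f n)

  map-oneTo : ∀ {A : Set} (f : ℕ → A) n → map f (oneTo n) ≡ applyUpTo (f ∘ suc) n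
  map-oneTo f n = trans (sym (Listₚ.map-∘ (upTo n))) (Listₚ.map-applyUpTo id (f ∘ suc) n)

  invS-suc : ∀ f n → invS f (suc n) ≡ -ᶻ ∑ (suc n) (λ i → f (suc i) *ᶻ invS f (n ∸ i))
  invS-suc f n = cong -ᶻ_ (trans (cong₂ (λ xs ys → sumℤ (zipWith _*ᶻ_ xs ys)) (map-oneTo f (suc n)) (invRev≡ f n)) (∑-zipWith (f ∘ suc) (λ i → invS f (n ∸ i)) (suc n)))

  invS-inverse : ∀ f → f 0 ≡ 1ℤ → f *ˢ invS f ≈ 1ˢ
  invS-inverse f f0 = mk≈ go
    where
    go : ∀ n → (f *ˢ invS f) n ≡ 1ˢ n
    go zero = trans (*ˢ-0 f (invS f)) (cong (_*ᶻ 1ℤ) f0)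
    go (suc n) = trans (*ˢ-suc f (invS f) n) (trans (cong₂ _+ᶻ_
      (trans (cong (_*ᶻ invS f (suc n)) f0) (trans (ℤₚ.*-identityˡ (invS f (suc n))) (invS-suc f n)))
      (trans (*ˢ-at (f ∘ suc) (invS f) n) (⊛-coeff (f ∘ suc) (invS f) n))) (ℤₚ.+-inverseˡ (∑ (suc n) (λ i → f (suc i) *ᶻ invS f (n ∸ i)))))

  *ˢ-cancelˡ : ∀ f {g h} → f 0 ≡ 1ℤ → f *ˢ g ≈ f *ˢ h → g ≈ h
  *ˢ-cancelˡ f {g} {h} f0 p = ≈-trans (≈-sym (collapse g)) (≈-trans (*ˢ-cong ≈-refl p) (collapse h))
    where
    collapse : ∀ g → invS f *ˢ (f *ˢ g) ≈ g
    collapse g = ≈-trans (≈-sym (*ˢ-assoc (invS f) f g)) (≈-trans (*ˢ-cong (≈-trans (*ˢ-comm (invS f) f) (invS-inverse f f0)) ≈-refl) (*ˢ-identityˡ g))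

  -- The series f(q^a).
  V : ℕ → Series → Series
  V a f n with a ∣? n
  ... | yes (divides k _) = f k
  ... | no _ = 0ℤ

  V-∣ : ∀ a .{{_ : NonZero a}} f k → V a f (k * a) ≡ f k
  V-∣ a f k with a ∣? (k * a)
  ... | yes (divides j eq) = cong f (sym (ℕₚ.*-cancelʳ-≡ k j a eq))
  ... | no ¬d = ⊥-elim (¬d (divides k refl))

  V-∤ : ∀ a f {n} → ¬ a ∣ n → V a f n ≡ 0ℤ
  V-∤ a f {n} ¬d with a ∣? n
  ... | yes d = ⊥-elim (¬d d)
  ... | no _ = refl

  V-cong : ∀ a {f g} → f ≈ g → V a f ≈ V a g
  V-cong a {f} {g} p = mk≈ go
    where
    go : ∀ n → V a f n ≡ V a g n
    go n with a ∣? n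
    ... | yes (divides k _) = at p k
    ... | no _ = refl

  V-+ : ∀ a f g → V a (f +ˢ g) ≈ V a f +ˢ V a g
  V-+ a f g = mk≈ λ n → trans (go n) (sym (+ˢ-at (V a f) (V a g) n))
    where
    go : ∀ n → V a (f +ˢ g) n ≡ V a f n +ᶻ V a g n
    go n with a ∣? n
    ... | yes (divides k _) = +ˢ-at f g k
    ... | no _ = refl

  V-scale : ∀ a c f n → V a (scale c f) n ≡ c *ᶻ V a f n
  V-scale a c f n with a ∣? n
  ... | yes _ = refl
  ... | no _ = sym (ℤₚ.*-zeroʳ c)

  const-pos : ∀ c a .{{_ : NonZero a}} m → constˢ c (a + m) ≡ 0ℤ
  const-pos c (suc a) m = refl

  module _ (a : ℕ) .{{_ : NonZero a}} where

    V-0 : ∀ f → V a f 0 ≡ f 0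
    V-0 f = V-∣ a f 0

    V-+shift : ∀ f m → V a f (a + m) ≡ V a (f ∘ suc) m
    V-+shift f m with a ∣? m
    ... | yes (divides k refl) = V-∣ a f (suc k)
    ... | no ¬d = V-∤ a f (λ d → ¬d (∣m+n∣m⇒∣n d ∣-refl))

    V-< : ∀ f {n} → suc n < a → V a f (suc n) ≡ 0ℤ
    V-< f n<a = V-∤ a f (λ d → ℕₚ.<⇒≱ n<a (∣⇒≤ d))

    -- This recursion replaces the divisibility test in later proofs. Its cases are exponent 0,
    -- exponents strictly between 0 and a, and exponents a + m.
    V-suc : ∀ f → V a f ≈ constˢ (f 0) +ˢ qS ^ˢ a *ˢ V a (f ∘ suc)
    V-suc f = mk≈ λ n → trans (go n (n ℕ.<? a)) (sym (+ˢ-at (constˢ (f 0)) (qS ^ˢ a *ˢ V a (f ∘ suc)) n))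
      where
      c : ℕ → ℤ
      c = constˢ (f 0)
      go : ∀ n → Dec (n < a) → V a f n ≡ c n +ᶻ (qS ^ˢ a *ˢ V a (f ∘ suc)) n
      go zero (yes 0<a) = trans (V-0 f) (sym (trans (cong (c 0 +ᶻ_) (q^*-< a (V a (f ∘ suc)) 0<a)) (ℤₚ.+-identityʳ (c 0))))
      go (suc n) (yes n<a) = trans (V-< f n<a) (sym (cong (0ℤ +ᶻ_) (q^*-< a (V a (f ∘ suc)) n<a)))
      go n (no n≮a) with ℕₚ.≮⇒≥ n≮a
      ... | a≤n with ℕₚ.m≤n⇒∃[o]m+o≡n a≤n
      ... | m , refl = trans (V-+shift f m) (sym (trans (cong₂ _+ᶻ_ (const-pos (f 0) a m) (q^*-+ a (V a (f ∘ suc)) m)) (ℤₚ.+-identityˡ (V a (f ∘ suc) m))))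

    -- Removing the constant term of f lowers the exponent by a, hence strong induction; f is
    -- quantified in the induction hypothesis because it changes to f ∘ suc.
    V-* : ∀ f g → V a (f *ˢ g) ≈ V a f *ˢ V a g
    V-* f g = mk≈ λ n → <-rec P step n f g
      where
      P : ℕ → Set
      P n = ∀ f g → V a (f *ˢ g) n ≡ (V a f *ˢ V a g) n
      expand : ∀ f g n → (V a f *ˢ V a g) n ≡ f 0 *ᶻ V a g n +ᶻ (qS ^ˢ a *ˢ (V a (f ∘ suc) *ˢ V a g)) n
      expand f g n = trans (at (≈-trans (*ˢ-cong (V-suc f) ≈-refl) (𝒮.distribʳ (V a g) (constˢ (f 0)) (qS ^ˢ a *ˢ V a (f ∘ suc)))) n)
        (trans (+ˢ-at (constˢ (f 0) *ˢ V a g) (qS ^ˢ a *ˢ V a (f ∘ suc) *ˢ V a g) n) (cong₂ _+ᶻ_ (const-* (f 0) (V a g) n) (at (*ˢ-assoc (qS ^ˢ a) (V a (f ∘ suc)) (V a g)) n)))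
      step : ∀ n → (∀ {m} → m < n → P m) → P n
      step n rec f g with n ℕ.<? a
      step zero rec f g | yes 0<a = trans (V-0 (f *ˢ g)) (trans (*ˢ-0 f g) (sym (trans (*ˢ-0 (V a f) (V a g)) (cong₂ _*ᶻ_ (V-0 f) (V-0 g)))))
      step (suc n) rec f g | yes n<a = trans (V-< (f *ˢ g) n<a) (sym (trans (expand f g (suc n)) (cong₂ _+ᶻ_ (trans (cong (f 0 *ᶻ_) (V-< g n<a)) (ℤₚ.*-zeroʳ (f 0))) (q^*-< a (V a (f ∘ suc) *ˢ V a g) n<a))))
      step n rec f g | no n≮a with ℕₚ.m≤n⇒∃[o]m+o≡n (ℕₚ.≮⇒≥ n≮a)
      ... | m , refl = begin
        V a (f *ˢ g) (a + m)
          ≡⟨ V-+shift (f *ˢ g) m ⟩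
        V a ((f *ˢ g) ∘ suc) m
          ≡⟨ at (V-cong a (mk≈ λ n → trans (*ˢ-suc f g n) (sym (+ˢ-at (scale (f 0) (g ∘ suc)) ((f ∘ suc) *ˢ g) n)))) m ⟩
        V a (scale (f 0) (g ∘ suc) +ˢ (f ∘ suc) *ˢ g) m
          ≡⟨ trans (at (V-+ a (scale (f 0) (g ∘ suc)) ((f ∘ suc) *ˢ g)) m) (+ˢ-at _ _ m) ⟩
        V a (scale (f 0) (g ∘ suc)) m +ᶻ V a ((f ∘ suc) *ˢ g) m
          ≡⟨ cong₂ _+ᶻ_ (trans (V-scale a (f 0) (g ∘ suc) m) (cong (f 0 *ᶻ_) (sym (V-+shift g m)))) (rec (ℕₚ.m<n+m m (ℕ.>-nonZero⁻¹ a)) (f ∘ suc) g) ⟩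
        f 0 *ᶻ V a g (a + m) +ᶻ (V a (f ∘ suc) *ˢ V a g) m
          ≡⟨ cong (f 0 *ᶻ V a g (a + m) +ᶻ_) (sym (q^*-+ a (V a (f ∘ suc) *ˢ V a g) m)) ⟩
        f 0 *ᶻ V a g (a + m) +ᶻ (qS ^ˢ a *ˢ (V a (f ∘ suc) *ˢ V a g)) (a + m)
          ≡⟨ sym (expand f g (a + m)) ⟩
        (V a f *ˢ V a g) (a + m) ∎
        where open ≡-Reasoning

  V-const : ∀ a .{{_ : NonZero a}} c → V a (constˢ c) ≈ constˢ c
  V-const a c = ≈-trans (V-suc a (constˢ c)) (≈-trans (+ˢ-cong ≈-refl (≈-trans (*ˢ-cong (≈-refl {qS ^ˢ a}) (mk≈ V0)) (𝒮.zeroʳ (qS ^ˢ a)))) (𝒮.+-identityʳ (constˢ c)))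
    where
    V0 : ∀ n → V a (constˢ c ∘ suc) n ≡ 0ˢ n
    V0 n with a ∣? n
    ... | yes _ = sym (0ˢ-at n)
    ... | no _ = sym (0ˢ-at n)

  V-1 : ∀ a .{{_ : NonZero a}} → V a 1ˢ ≈ 1ˢ
  V-1 a = V-const a 1ℤ

  V-^ : ∀ a .{{_ : NonZero a}} f k → V a (f ^ˢ k) ≈ V a f ^ˢ k
  V-^ a f zero = V-1 a
  V-^ a f (suc k) = ≈-trans (V-* a f (f ^ˢ k)) (*ˢ-cong ≈-refl (V-^ a f k))

  V-q : ∀ a .{{_ : NonZero a}} → V a qS ≈ qS ^ˢ a
  V-q a = ≈-trans (V-suc a qS) (≈-trans (+ˢ-cong (≈-refl {0ˢ}) (*ˢ-cong (≈-refl {qS ^ˢ a}) (≈-trans (V-cong a tail≈) (V-1 a))))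
     (≈-trans (𝒮.+-identityˡ (qS ^ˢ a *ˢ 1ˢ)) (𝒮.*-identityʳ (qS ^ˢ a))))
    where
    tail≈ : (qS ∘ suc) ≈ 1ˢ
    tail≈ = mk≈ λ { zero → refl ; (suc n) → refl }

open SeriesCalculus

-- Functions modulo 3 and their geometric series.

module GeometricSeries where

  -- A three-element type for residues modulo 3: identities between character values become finitely
  -- many cases that hold by computation.
  data Res : Set where
    r0 r1 r2 : Res

  next : Res → Res
  next r0 = r1
  next r1 = r2
  next r2 = r0

  res : ℕ → Res
  res zero = r0
  res (suc n) = next (res n)

  infixl 6 _⊞_
  _⊞_ : Res → Res → Res
  r0 ⊞ s = s
  r1 ⊞ s = next s
  r2 ⊞ s = next (next s)

  next-⊞ : ∀ r s → next r ⊞ s ≡ next (r ⊞ s)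
  next-⊞ r0 s = refl
  next-⊞ r1 s = refl
  next-⊞ r2 r0 = refl
  next-⊞ r2 r1 = refl
  next-⊞ r2 r2 = refl

  res-+ : ∀ a b → res (a + b) ≡ res a ⊞ res b
  res-+ zero b = refl
  res-+ (suc a) b = trans (cong next (res-+ a b)) (sym (next-⊞ (res a) (res b)))

  -- κᵣ r = ω^r + ω^{-r} and χᵣ r = (ω^r - ω^{-r})/√-3 for a primitive cube root of unity ω.
  χᵣ κᵣ : Res → ℤ
  χᵣ r0 = + 0
  χᵣ r1 = + 1
  χᵣ r2 = -[1+ 0 ]
  κᵣ r0 = + 2
  κᵣ r1 = -[1+ 0 ]
  κᵣ r2 = -[1+ 0 ]

  χ κ : ℕ → ℤ
  χ n = χᵣ (res n)
  κ n = κᵣ (res n)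

  χ-sum : ∀ n → χ n +ᶻ χ (suc n) +ᶻ χ (suc (suc n)) ≡ 0ℤ
  χ-sum n with res n
  ... | r0 = refl
  ... | r1 = refl
  ... | r2 = refl

  κ-sum : ∀ n → κ n +ᶻ κ (suc n) +ᶻ κ (suc (suc n)) ≡ 0ℤ
  κ-sum n with res n
  ... | r0 = refl
  ... | r1 = refl
  ... | r2 = refl

  ones : ℕ → ℤ
  ones _ = 1ℤ

  dropConst : Series → Series
  dropConst ψ zero = 0ℤ
  dropConst ψ (suc n) = ψ (suc n)

  -- The sum of ψ(k) q^(ak) over k ≥ 1. The constant term has to be dropped because `ones` and `κ`
  -- do not vanish at 0.
  geo : (ℕ → ℤ) → ℕ → Series
  geo ψ a = V a (dropConst ψ)

  open SeriesSolver using (solve; _:=_; _:+_; _:*_; _:-_; con; :-_)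

  x̂ k̂ r̂ : Series
  x̂ = dropConst ones
  k̂ = dropConst χ
  r̂ = dropConst κ

  2ˢ : Series
  2ˢ = constˢ (+ 2)

  x̂-eq : x̂ ≈ qS +ˢ qS *ˢ x̂
  x̂-eq = mk≈ λ n → trans (go n) (sym (+ˢ-at qS (qS *ˢ x̂) n))
    where
    go : ∀ n → x̂ n ≡ qS n +ᶻ (qS *ˢ x̂) n
    go zero = sym (cong (0ℤ +ᶻ_) (q*-0 x̂))
    go (suc zero) = sym (cong (1ℤ +ᶻ_) (q*-suc x̂ 0))
    go (suc (suc n)) = sym (cong (0ℤ +ᶻ_) (q*-suc x̂ (suc n)))

  at₃ : ∀ f n → (f +ˢ qS *ˢ f +ˢ qS *ˢ (qS *ˢ f)) n ≡ f n +ᶻ (qS *ˢ f) n +ᶻ (qS *ˢ (qS *ˢ f)) n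
  at₃ f n = trans (+ˢ-at (f +ˢ qS *ˢ f) _ n) (cong (_+ᶻ (qS *ˢ (qS *ˢ f)) n) (+ˢ-at f (qS *ˢ f) n))

  -- The values of χ sum to zero over a period, so multiplication by 1 + q + q² leaves only boundary
  -- terms.
  k̂-eq : k̂ +ˢ qS *ˢ k̂ +ˢ qS *ˢ (qS *ˢ k̂) ≈ qS
  k̂-eq = mk≈ λ n → trans (at₃ k̂ n) (go n)
    where
    go : ∀ n → k̂ n +ᶻ (qS *ˢ k̂) n +ᶻ (qS *ˢ (qS *ˢ k̂)) n ≡ qS n
    go zero = cong₂ _+ᶻ_ (cong (0ℤ +ᶻ_) (q*-0 k̂)) (q*-0 (qS *ˢ k̂))
    go (suc zero) = cong₂ _+ᶻ_ (cong (1ℤ +ᶻ_) (q*-suc k̂ 0)) (trans (q*-suc (qS *ˢ k̂) 0) (q*-0 k̂))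
    go (suc (suc zero)) = cong₂ _+ᶻ_ (cong (-[1+ 0 ] +ᶻ_) (q*-suc k̂ 1)) (trans (q*-suc (qS *ˢ k̂) 1) (q*-suc k̂ 0))
    go (suc (suc (suc n))) = trans (cong₂ _+ᶻ_ (cong (χ (suc (suc (suc n))) +ᶻ_) (q*-suc k̂ (suc (suc n)))) (trans (q*-suc (qS *ˢ k̂) (suc (suc n))) (q*-suc k̂ (suc n))))
      (trans (swap _ (χ (suc (suc n))) (χ (suc n))) (χ-sum (suc n)))
      where
      swap : ∀ a b c → a +ᶻ b +ᶻ c ≡ c +ᶻ b +ᶻ a
      swap = solve-∀

  r̂-eq : r̂ +ˢ qS *ˢ r̂ +ˢ qS *ˢ (qS *ˢ r̂) ≈ -ˢ (qS +ˢ 2ˢ *ˢ (qS *ˢ qS))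
  r̂-eq = mk≈ λ n → trans (at₃ r̂ n) (trans (go n) (sym (rhs n)))
    where
    rhs : ∀ n → (-ˢ (qS +ˢ 2ˢ *ˢ (qS *ˢ qS))) n ≡ -ᶻ (qS n +ᶻ + 2 *ᶻ (qS *ˢ qS) n)
    rhs n = trans (-ˢ-at _ n) (cong -ᶻ_ (trans (+ˢ-at qS _ n) (cong (qS n +ᶻ_) (const-* (+ 2) (qS *ˢ qS) n))))
    go : ∀ n → r̂ n +ᶻ (qS *ˢ r̂) n +ᶻ (qS *ˢ (qS *ˢ r̂)) n ≡ -ᶻ (qS n +ᶻ + 2 *ᶻ (qS *ˢ qS) n)
    go zero = trans (cong₂ _+ᶻ_ (cong (0ℤ +ᶻ_) (q*-0 r̂)) (q*-0 (qS *ˢ r̂))) (cong (λ z → -ᶻ (0ℤ +ᶻ + 2 *ᶻ z)) (sym (q*-0 qS)))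
    go (suc zero) = trans (cong₂ _+ᶻ_ (cong (-[1+ 0 ] +ᶻ_) (q*-suc r̂ 0)) (trans (q*-suc (qS *ˢ r̂) 0) (q*-0 r̂))) (cong (λ z → -ᶻ (1ℤ +ᶻ + 2 *ᶻ z)) (sym (q*-suc qS 0)))
    go (suc (suc zero)) = trans (cong₂ _+ᶻ_ (cong (-[1+ 0 ] +ᶻ_) (q*-suc r̂ 1)) (trans (q*-suc (qS *ˢ r̂) 1) (q*-suc r̂ 0))) (cong (λ z → -ᶻ (0ℤ +ᶻ + 2 *ᶻ z)) (sym (q*-suc qS 1)))
    go (suc (suc (suc n))) = trans (cong₂ _+ᶻ_ (cong (κ (suc (suc (suc n))) +ᶻ_) (q*-suc r̂ (suc (suc n)))) (trans (q*-suc (qS *ˢ r̂) (suc (suc n))) (q*-suc r̂ (suc n))))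
      (trans (swap _ (κ (suc (suc n))) (κ (suc n))) (trans (κ-sum (suc n)) (cong (λ z → -ᶻ (0ℤ +ᶻ + 2 *ᶻ z)) (sym (q*-suc qS (suc (suc n)))))))
      where
      swap : ∀ a b c → a +ᶻ b +ᶻ c ≡ c +ᶻ b +ᶻ a
      swap = solve-∀

  module _ {o₁ o₂ o₃ : Series} (z₁ : o₁ ≈ 0ˢ) (z₂ : o₂ ≈ 0ˢ) (z₃ : o₃ ≈ 0ˢ) where

    -- Ideal membership as a proof method: f - g is exhibited as a combination of series known to
    -- vanish, with cofactors A, B, C, and the ring solver checks the certificate.
    modulo : ∀ {f g} A B C → f ≈ g +ˢ (A *ˢ o₁ +ˢ B *ˢ o₂ +ˢ C *ˢ o₃) → f ≈ g
    modulo {f} {g} A B C p = ≈-trans p (≈-trans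
      (+ˢ-cong ≈-refl (+ˢ-cong (+ˢ-cong (*ˢ-cong ≈-refl z₁) (*ˢ-cong ≈-refl z₂)) (*ˢ-cong ≈-refl z₃)))
      (solve 4 (λ g A B C → g :+ (A :* con 0ℤ :+ B :* con 0ℤ :+ C :* con 0ℤ) := g) ≈-refl g A B C))

  ≈⇒-≈0 : ∀ {f g} → f ≈ g → g -ˢ f ≈ 0ˢ
  ≈⇒-≈0 {f} {g} p = ≈-trans (+ˢ-cong ≈-refl (-ˢ-cong p)) (𝒮.-‿inverseʳ g)

  module _ (P Q : Series) where

    private
      u : Series → Series
      u P = 1ˢ +ˢ P +ˢ P *ˢ P

    -- Here f, g, h are the inverses of 1 - P, 1 - Q, 1 - PQ, and the identity is 1 - PQ = (1 - P) +
    -- (1 - Q) - (1 - P)(1 - Q) divided by (1 - P)(1 - Q).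
    xx-core : ∀ f g h → f *ˢ (1ˢ -ˢ P) ≈ 1ˢ → g *ˢ (1ˢ -ˢ Q) ≈ 1ˢ → h *ˢ (1ˢ -ˢ P *ˢ Q) ≈ 1ˢ →
      (P *ˢ f) *ˢ (Q *ˢ g) ≈ (P *ˢ Q *ˢ h) *ˢ (f +ˢ g -ˢ 1ˢ)
    xx-core f g h zf zg zh = modulo (≈⇒-≈0 zf) (≈⇒-≈0 zg) (≈⇒-≈0 zh)
      (P *ˢ Q *ˢ h *ˢ (1ˢ -ˢ g)) (P *ˢ Q *ˢ h *ˢ (f *ˢ (1ˢ -ˢ P) -ˢ f)) (P *ˢ Q *ˢ f *ˢ g)
      (solve 5 (λ P Q f g h → (P :* f) :* (Q :* g) := (P :* Q :* h) :* (f :+ g :- con 1ℤ) :+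
        ((P :* Q :* h :* (con 1ℤ :- g)) :* (con 1ℤ :- f :* (con 1ℤ :- P)) :+ (P :* Q :* h :* (f :* (con 1ℤ :- P) :- f)) :* (con 1ℤ :- g :* (con 1ℤ :- Q))
         :+ (P :* Q :* f :* g) :* (con 1ℤ :- h :* (con 1ℤ :- P :* Q)))) ≈-refl P Q f g h)

    -- Let X_a(ζ) = ζq^a/(1 - ζq^a). Then X_a(ζ) X_b(η) = X_{a+b}(ζη) (1 + X_a(ζ) + X_b(η)), and for
    -- a primitive cube root of unity ω the series r and k are X(ω) + X(ω⁻¹) and (X(ω) -
    -- X(ω⁻¹))/√-3. The case ζ = ω, η = 1 minus its conjugate, divided by √-3, is the formula here.
    kx-core : ∀ e f g → e *ˢ u P ≈ 1ˢ → f *ˢ (1ˢ -ˢ Q) ≈ 1ˢ → g *ˢ u (P *ˢ Q) ≈ 1ˢ →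
      2ˢ *ˢ ((P *ˢ e) *ˢ (Q *ˢ f)) ≈ 2ˢ *ˢ ((P *ˢ Q *ˢ g) *ˢ (Q *ˢ f))
        +ˢ (-ˢ (P *ˢ Q +ˢ 2ˢ *ˢ ((P *ˢ Q) *ˢ (P *ˢ Q))) *ˢ g) *ˢ (P *ˢ e) +ˢ (P *ˢ Q *ˢ g) *ˢ (-ˢ (P +ˢ 2ˢ *ˢ (P *ˢ P)) *ˢ e) +ˢ 2ˢ *ˢ (P *ˢ Q *ˢ g)
    kx-core e f g ze zf zg = modulo (≈⇒-≈0 ze) (≈⇒-≈0 zf) (≈⇒-≈0 zg)
      (-ˢ (2ˢ *ˢ (P *ˢ Q *ˢ Q *ˢ g *ˢ f)) -ˢ 2ˢ *ˢ (P *ˢ Q *ˢ g))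
      ((P *ˢ Q +ˢ 2ˢ *ˢ (P *ˢ Q *ˢ P *ˢ Q)) *ˢ g *ˢ P *ˢ e +ˢ P *ˢ Q *ˢ g *ˢ (P +ˢ 2ˢ *ˢ (P *ˢ P)) *ˢ e -ˢ 2ˢ *ˢ (P *ˢ Q *ˢ g) *ˢ (e *ˢ u P))
      (2ˢ *ˢ (P *ˢ Q *ˢ e *ˢ f))
      (solve 5 (λ P Q e f g → let u = λ P → con 1ℤ :+ P :+ P :* P ; two = con (+ 2) in
        two :* ((P :* e) :* (Q :* f)) := two :* ((P :* Q :* g) :* (Q :* f))
        :+ (:- (P :* Q :+ two :* ((P :* Q) :* (P :* Q))) :* g) :* (P :* e) :+ (P :* Q :* g) :* (:- (P :+ two :* (P :* P)) :* e) :+ two :* (P :* Q :* g)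
        :+ ((:- (two :* (P :* Q :* Q :* g :* f)) :- two :* (P :* Q :* g)) :* (con 1ℤ :- e :* u P)
        :+ ((P :* Q :+ two :* (P :* Q :* P :* Q)) :* g :* P :* e :+ P :* Q :* g :* (P :+ two :* (P :* P)) :* e :- two :* (P :* Q :* g) :* (e :* u P)) :* (con 1ℤ :- f :* (con 1ℤ :- Q))
        :+ (two :* (P :* Q :* e :* f)) :* (con 1ℤ :- g :* u (P :* Q)))) ≈-refl P Q e f g)

    -- The same with ζ = η = ω: the product ζη = ω⁻¹ reverses the sign of k at a + b.
    kr-sym-core : ∀ e f g → e *ˢ u P ≈ 1ˢ → f *ˢ u Q ≈ 1ˢ → g *ˢ u (P *ˢ Q) ≈ 1ˢ →
      (P *ˢ e) *ˢ (-ˢ (Q +ˢ 2ˢ *ˢ (Q *ˢ Q)) *ˢ f) +ˢ (Q *ˢ f) *ˢ (-ˢ (P +ˢ 2ˢ *ˢ (P *ˢ P)) *ˢ e) ≈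
      (P *ˢ e +ˢ Q *ˢ f) *ˢ (-ˢ (P *ˢ Q +ˢ 2ˢ *ˢ ((P *ˢ Q) *ˢ (P *ˢ Q))) *ˢ g)
      -ˢ (P *ˢ Q *ˢ g) *ˢ (-ˢ (P +ˢ 2ˢ *ˢ (P *ˢ P)) *ˢ e +ˢ -ˢ (Q +ˢ 2ˢ *ˢ (Q *ˢ Q)) *ˢ f) -ˢ 2ˢ *ˢ (P *ˢ Q *ˢ g)
    kr-sym-core e f g ze zf zg = modulo (≈⇒-≈0 ze) (≈⇒-≈0 zf) (≈⇒-≈0 zg)
      (M Q P f +ˢ 2ˢ *ˢ (P *ˢ Q *ˢ g)) (M P Q e +ˢ 2ˢ *ˢ (P *ˢ Q *ˢ g) *ˢ (e *ˢ u P))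
      (-ˢ (P *ˢ Q *ˢ e *ˢ f *ˢ (2ˢ +ˢ 2ˢ *ˢ P +ˢ 2ˢ *ˢ Q)))
      (solve 5 (λ P Q e f g → let u = λ P → con 1ℤ :+ P :+ P :* P ; two = con (+ 2)
                                  M = λ P Q e → P :* Q :* g :* e :* (two :* (P :* P :* Q :- P :* P)) in
        (P :* e) :* (:- (Q :+ two :* (Q :* Q)) :* f) :+ (Q :* f) :* (:- (P :+ two :* (P :* P)) :* e) :=
        (P :* e :+ Q :* f) :* (:- (P :* Q :+ two :* ((P :* Q) :* (P :* Q))) :* g)
        :- (P :* Q :* g) :* (:- (P :+ two :* (P :* P)) :* e :+ :- (Q :+ two :* (Q :* Q)) :* f) :- two :* (P :* Q :* g)
        :+ ((M Q P f :+ two :* (P :* Q :* g)) :* (con 1ℤ :- e :* u P) :+ (M P Q e :+ two :* (P :* Q :* g) :* (e :* u P)) :* (con 1ℤ :- f :* u Q)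
        :+ (:- (P :* Q :* e :* f :* (two :+ two :* P :+ two :* Q))) :* (con 1ℤ :- g :* u (P :* Q)))) ≈-refl P Q e f g)
      where
      M : Series → Series → Series → Series
      M P Q e = P *ˢ Q *ˢ g *ˢ e *ˢ (2ˢ *ˢ (P *ˢ P *ˢ Q -ˢ P *ˢ P))

    -- The same with ζ = ω, η = ω⁻¹: now ζη = 1, so the factor at a + b is untwisted.
    kr-alt-core : ∀ e f g → e *ˢ u P ≈ 1ˢ → f *ˢ u Q ≈ 1ˢ → g *ˢ (1ˢ -ˢ P *ˢ Q) ≈ 1ˢ →
      (P *ˢ e) *ˢ (-ˢ (Q +ˢ 2ˢ *ˢ (Q *ˢ Q)) *ˢ f) -ˢ (Q *ˢ f) *ˢ (-ˢ (P +ˢ 2ˢ *ˢ (P *ˢ P)) *ˢ e) ≈ 2ˢ *ˢ (P *ˢ e -ˢ Q *ˢ f) *ˢ (P *ˢ Q *ˢ g)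
    kr-alt-core e f g ze zf zg = modulo (≈⇒-≈0 ze) (≈⇒-≈0 zf) (≈⇒-≈0 zg)
      (2ˢ *ˢ (P *ˢ Q *ˢ g *ˢ Q *ˢ f)) (-ˢ (2ˢ *ˢ (P *ˢ Q *ˢ g *ˢ P *ˢ e)))
      (2ˢ *ˢ (P *ˢ Q *ˢ e *ˢ f *ˢ (P -ˢ Q)))
      (solve 5 (λ P Q e f g → let u = λ P → con 1ℤ :+ P :+ P :* P ; two = con (+ 2) in
        (P :* e) :* (:- (Q :+ two :* (Q :* Q)) :* f) :- (Q :* f) :* (:- (P :+ two :* (P :* P)) :* e) := two :* (P :* e :- Q :* f) :* (P :* Q :* g)
        :+ ((two :* (P :* Q :* g :* Q :* f)) :* (con 1ℤ :- e :* u P) :+ (:- (two :* (P :* Q :* g :* P :* e))) :* (con 1ℤ :- f :* u Q)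
        :+ (two :* (P :* Q :* e :* f :* (P :- Q))) :* (con 1ℤ :- g :* (con 1ℤ :- P :* Q)))) ≈-refl P Q e f g)

  module Rational (a : ℕ) .{{_ : NonZero a}} where

    -- The inverses f of 1 - P and e of 1 + P + P² are written as polynomials in x, k and P, so that
    -- no series has to be divided: x = P/(1 - P) gives 1 + x = 1/(1 - P), and k = P/(1 + P + P²)
    -- gives 1 - (1 + P)k = 1/(1 + P + P²).
    P x k r f e : Series
    P = qS ^ˢ a
    x = geo ones a
    k = geo χ a
    r = geo κ a
    f = 1ˢ +ˢ x
    e = 1ˢ -ˢ (1ˢ +ˢ P) *ˢ k

    private
      V-qf : ∀ g → V a (qS *ˢ g) ≈ P *ˢ V a g
      V-qf g = ≈-trans (V-* a qS g) (*ˢ-cong (V-q a) ≈-refl)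
      V-cyc : ∀ g → V a (g +ˢ qS *ˢ g +ˢ qS *ˢ (qS *ˢ g)) ≈ V a g +ˢ P *ˢ V a g +ˢ P *ˢ (P *ˢ V a g)
      V-cyc g = ≈-trans (V-+ a _ _) (+ˢ-cong (≈-trans (V-+ a _ _) (+ˢ-cong ≈-refl (V-qf g))) (≈-trans (V-qf (qS *ˢ g)) (*ˢ-cong ≈-refl (V-qf g))))

      x-eq : x ≈ P +ˢ P *ˢ x
      x-eq = ≈-trans (V-cong a x̂-eq) (≈-trans (V-+ a qS (qS *ˢ x̂)) (+ˢ-cong (V-q a) (V-qf x̂)))

      k-eq : k +ˢ P *ˢ k +ˢ P *ˢ (P *ˢ k) ≈ P
      k-eq = ≈-trans (≈-sym (V-cyc k̂)) (≈-trans (V-cong a k̂-eq) (V-q a))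

      r-eq : r +ˢ P *ˢ r +ˢ P *ˢ (P *ˢ r) ≈ -ˢ (P +ˢ 2ˢ *ˢ (P *ˢ P))
      r-eq = ≈-trans (≈-sym (V-cyc r̂)) (≈-trans (V-cong a r̂-eq) (≈-trans (V-neg _) (-ˢ-cong (≈-trans (V-+ a qS _)
        (+ˢ-cong (V-q a) (≈-trans (V-* a 2ˢ (qS *ˢ qS)) (*ˢ-cong (V-const a (+ 2)) (≈-trans (V-qf qS) (*ˢ-cong ≈-refl (V-q a))))))))))
        where
        V-neg : ∀ g → V a (-ˢ g) ≈ -ˢ V a g
        V-neg g = mk≈ λ n → trans (h n) (sym (-ˢ-at (V a g) n))
          where
          h : ∀ n → V a (-ˢ g) n ≡ -ᶻ V a g n
          h n with a ∣? n
          ... | yes (divides j _) = -ˢ-at g j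
          ... | no _ = refl

    f-unit : f *ˢ (1ˢ -ˢ P) ≈ 1ˢ
    f-unit = ≈-trans (solve 2 (λ P x → (con 1ℤ :+ x) :* (con 1ℤ :- P) := con 1ℤ :+ (x :- (P :+ P :* x))) ≈-refl P x)
      (≈-trans (+ˢ-cong ≈-refl (≈⇒-≈0 (≈-sym x-eq))) (𝒮.+-identityʳ 1ˢ))

    x-rat : x ≈ P *ˢ f
    x-rat = ≈-trans x-eq (solve 2 (λ P x → P :+ P :* x := P :* (con 1ℤ :+ x)) ≈-refl P x)

    e-unit : e *ˢ (1ˢ +ˢ P +ˢ P *ˢ P) ≈ 1ˢ
    e-unit = ≈-trans (solve 2 (λ P k → (con 1ℤ :- (con 1ℤ :+ P) :* k) :* (con 1ℤ :+ P :+ P :* P) := con 1ℤ :+ (con 1ℤ :+ P) :* (P :- (k :+ P :* k :+ P :* (P :* k)))) ≈-refl P k)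
      (≈-trans (+ˢ-cong ≈-refl (≈-trans (*ˢ-cong ≈-refl (≈⇒-≈0 k-eq)) (𝒮.zeroʳ _))) (𝒮.+-identityʳ 1ˢ))

    k-rat : k ≈ P *ˢ e
    k-rat = ≈-trans (solve 2 (λ P k → k := P :* (con 1ℤ :- (con 1ℤ :+ P) :* k) :+ ((k :+ P :* k :+ P :* (P :* k)) :- P)) ≈-refl P k)
      (≈-trans (+ˢ-cong ≈-refl (≈⇒-≈0 (≈-sym k-eq))) (𝒮.+-identityʳ _))

    r-rat : r ≈ -ˢ (P +ˢ 2ˢ *ˢ (P *ˢ P)) *ˢ e
    r-rat = ≈-trans (≈-sym (𝒮.*-identityʳ r)) (≈-trans (*ˢ-cong ≈-refl (≈-sym e-unit))
      (≈-trans (solve 3 (λ P r e → r :* (e :* (con 1ℤ :+ P :+ P :* P)) := (r :+ P :* r :+ P :* (P :* r)) :* e) ≈-refl P r e) (*ˢ-cong r-eq ≈-refl)))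

  xs ks rs : ℕ → Series
  xs = geo ones
  ks = geo χ
  rs = geo κ

  module _ (a b : ℕ) .{{_ : NonZero a}} .{{_ : NonZero b}} .{{_ : NonZero (a + b)}} where

    private
      module A = Rational a
      module B = Rational b
      module C = Rational (a + b)
      c = a + b

      P≈ : C.P ≈ A.P *ˢ B.P
      P≈ = ^ˢ-+ qS a b

      C-x : C.x ≈ A.P *ˢ B.P *ˢ C.f
      C-x = ≈-trans C.x-rat (*ˢ-cong P≈ ≈-refl)
      C-k : C.k ≈ A.P *ˢ B.P *ˢ C.e
      C-k = ≈-trans C.k-rat (*ˢ-cong P≈ ≈-refl)
      C-r : C.r ≈ -ˢ (A.P *ˢ B.P +ˢ 2ˢ *ˢ ((A.P *ˢ B.P) *ˢ (A.P *ˢ B.P))) *ˢ C.e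
      C-r = ≈-trans C.r-rat (*ˢ-cong (-ˢ-cong (+ˢ-cong P≈ (*ˢ-cong ≈-refl (*ˢ-cong P≈ P≈)))) ≈-refl)
      C-f : C.f *ˢ (1ˢ -ˢ A.P *ˢ B.P) ≈ 1ˢ
      C-f = ≈-trans (*ˢ-cong ≈-refl (+ˢ-cong ≈-refl (-ˢ-cong (≈-sym P≈)))) C.f-unit
      C-e : C.e *ˢ (1ˢ +ˢ A.P *ˢ B.P +ˢ A.P *ˢ B.P *ˢ (A.P *ˢ B.P)) ≈ 1ˢ
      C-e = ≈-trans (*ˢ-cong ≈-refl (+ˢ-cong (+ˢ-cong ≈-refl (≈-sym P≈)) (*ˢ-cong (≈-sym P≈) (≈-sym P≈)))) C.e-unit

    xs-xs : xs a *ˢ xs b ≈ xs c *ˢ (1ˢ +ˢ xs a +ˢ xs b)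
    xs-xs = ≈-trans (*ˢ-cong A.x-rat B.x-rat) (≈-trans (xx-core A.P B.P A.f B.f C.f A.f-unit B.f-unit C-f)
      (*ˢ-cong (≈-sym C-x) (solve 2 (λ x y → (con 1ℤ :+ x) :+ (con 1ℤ :+ y) :- con 1ℤ := con 1ℤ :+ x :+ y) ≈-refl (xs a) (xs b))))

    ks-xs : 2ˢ *ˢ (ks a *ˢ xs b) ≈ 2ˢ *ˢ (ks c *ˢ xs b) +ˢ rs c *ˢ ks a +ˢ ks c *ˢ rs a +ˢ 2ˢ *ˢ ks c
    ks-xs = ≈-trans (*ˢ-cong ≈-refl (*ˢ-cong A.k-rat B.x-rat)) (≈-trans (kx-core A.P B.P A.e B.f C.e A.e-unit B.f-unit C-e)
      (≈-sym (+ˢ-cong (+ˢ-cong (+ˢ-cong (*ˢ-cong ≈-refl (*ˢ-cong C-k B.x-rat)) (*ˢ-cong C-r A.k-rat)) (*ˢ-cong C-k A.r-rat)) (*ˢ-cong ≈-refl C-k))))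

    ks-rs-sym : ks a *ˢ rs b +ˢ ks b *ˢ rs a ≈ (ks a +ˢ ks b) *ˢ rs c -ˢ ks c *ˢ (rs a +ˢ rs b) -ˢ 2ˢ *ˢ ks c
    ks-rs-sym = ≈-trans (+ˢ-cong (*ˢ-cong A.k-rat B.r-rat) (*ˢ-cong B.k-rat A.r-rat)) (≈-trans (kr-sym-core A.P B.P A.e B.e C.e A.e-unit B.e-unit C-e)
      (≈-sym (+ˢ-cong (+ˢ-cong (*ˢ-cong (+ˢ-cong A.k-rat B.k-rat) C-r) (-ˢ-cong (*ˢ-cong C-k (+ˢ-cong A.r-rat B.r-rat)))) (-ˢ-cong (*ˢ-cong ≈-refl C-k)))))

    ks-rs-alt : ks a *ˢ rs b -ˢ ks b *ˢ rs a ≈ 2ˢ *ˢ (ks a -ˢ ks b) *ˢ xs c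
    ks-rs-alt = ≈-trans (+ˢ-cong (*ˢ-cong A.k-rat B.r-rat) (-ˢ-cong (*ˢ-cong B.k-rat A.r-rat))) (≈-trans (kr-alt-core A.P B.P A.e B.e C.f A.e-unit B.e-unit C-f)
      (≈-sym (*ˢ-cong (*ˢ-cong ≈-refl (+ˢ-cong A.k-rat (-ˢ-cong B.k-rat))) C-x)))

open GeometricSeries

-- Derivatives of the geometric series, and double sums over pairs of indices.

module BilinearSums where

  open SeriesSolver using (solve; _:=_; _:+_; _:*_; _:-_; con; :-_)
  θ-q^ : ∀ a → θ (qS ^ˢ a) ≈ constˢ (+ a) *ˢ qS ^ˢ a
  θ-q^ zero = ≈-trans (θ-const 1ℤ) (≈-sym (𝒮.zeroˡ 1ˢ))
  θ-q^ (suc a) = ≈-trans (θ-* qS (qS ^ˢ a)) (≈-trans (+ˢ-cong (*ˢ-cong θq ≈-refl) (*ˢ-cong ≈-refl (θ-q^ a)))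
    (≈-trans (solve 3 (λ q p c → q :* p :+ q :* (c :* p) := (con 1ℤ :+ c) :* (q :* p)) ≈-refl qS (qS ^ˢ a) (constˢ (+ a)))
      (*ˢ-cong (mk≈ λ n → trans (+ˢ-at 1ˢ (constˢ (+ a)) n) (sym (const-+ 1ℤ (+ a) n))) ≈-refl)))
    where
    θq : θ qS ≈ qS
    θq = mk≈ λ { zero → refl ; (suc zero) → refl ; (suc (suc n)) → ℤₚ.*-zeroʳ (+ suc (suc n)) }

  module _ (a : ℕ) .{{_ : NonZero a}} where
    private
      module A = Rational a
      aˢ = constˢ (+ a)
    open A using (P; x; k; r; f; e)

    θxs : θ (xs a) ≈ aˢ *ˢ (xs a *ˢ (1ˢ +ˢ xs a))
    θxs = begin
      θ x                              ≈⟨ ≈-sym (𝒮.*-identityʳ (θ x)) ⟩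
      θ x *ˢ 1ˢ                        ≈⟨ *ˢ-cong ≈-refl (≈-sym A.f-unit) ⟩
      θ x *ˢ (f *ˢ (1ˢ -ˢ P))          ≈⟨ solve 4 (λ t f P s → t :* (f :* (con 1ℤ :- P)) := f :* ((t :* (con 1ℤ :- P) :- s) :+ s)) ≈-refl (θ x) f P (x *ˢ θ P) ⟩
      f *ˢ ((θ x *ˢ (1ˢ -ˢ P) -ˢ x *ˢ θ P) +ˢ x *ˢ θ P) ≈⟨ *ˢ-cong ≈-refl (+ˢ-cong (≈-trans (solve 4 (λ t x P s → t :* (con 1ℤ :- P) :- x :* s := t :- (t :* P :+ x :* s)) ≈-refl (θ x) x P (θ P)) (+ˢ-cong ≈-refl (-ˢ-cong (≈-sym (θ-* x P))))) ≈-refl) ⟩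
      f *ˢ ((θ x -ˢ θ (x *ˢ P)) +ˢ x *ˢ θ P) ≈⟨ *ˢ-cong ≈-refl (+ˢ-cong (≈-trans (≈-sym (≈-trans (θ-+ x (-ˢ (x *ˢ P))) (+ˢ-cong ≈-refl (θ-neg (x *ˢ P))))) (θ-cong x-xP)) ≈-refl) ⟩
      f *ˢ (θ P +ˢ x *ˢ θ P)           ≈⟨ *ˢ-cong ≈-refl (+ˢ-cong (θ-q^ a) (*ˢ-cong ≈-refl (θ-q^ a))) ⟩
      f *ˢ (aˢ *ˢ P +ˢ x *ˢ (aˢ *ˢ P)) ≈⟨ solve 4 (λ f c P x → f :* (c :* P :+ x :* (c :* P)) := c :* ((P :* f) :* (con 1ℤ :+ x))) ≈-refl f aˢ P x ⟩
      aˢ *ˢ ((P *ˢ f) *ˢ (1ˢ +ˢ x))    ≈⟨ *ˢ-cong ≈-refl (*ˢ-cong (≈-sym A.x-rat) ≈-refl) ⟩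
      aˢ *ˢ (x *ˢ (1ˢ +ˢ x)) ∎
      where
      open import Relation.Binary.Reasoning.Setoid 𝒮.setoid
      x-xP : x -ˢ x *ˢ P ≈ P
      x-xP = ≈-trans (+ˢ-cong A.x-rat ≈-refl) (≈-trans (solve 3 (λ P f x → P :* f :- x :* P := P :* (f :- x)) ≈-refl P f x)
        (solve 2 (λ P x → P :* ((con 1ℤ :+ x) :- x) := P) ≈-refl P x))

    -- Differentiate k (1 + P + P²) = P and multiply by e; the derivative of the denominator, a(P +
    -- 2P²), times e is -a r.
    θks : θ (ks a) ≈ aˢ *ˢ (ks a +ˢ ks a *ˢ rs a)
    θks = begin
      θ k                                    ≈⟨ ≈-sym (𝒮.*-identityˡ (θ k)) ⟩
      1ˢ *ˢ θ k                              ≈⟨ *ˢ-cong (≈-sym A.e-unit) ≈-refl ⟩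
      (e *ˢ u) *ˢ θ k                        ≈⟨ solve 5 (λ e u t k s → (e :* u) :* t := e :* ((t :* u :+ k :* s) :- k :* s)) ≈-refl e u (θ k) k (θ u) ⟩
      e *ˢ ((θ k *ˢ u +ˢ k *ˢ θ u) -ˢ k *ˢ θ u) ≈⟨ *ˢ-cong ≈-refl (+ˢ-cong (≈-trans (≈-sym (θ-* k u)) (θ-cong k-u)) ≈-refl) ⟩
      e *ˢ (θ P -ˢ k *ˢ θ u)                 ≈⟨ *ˢ-cong ≈-refl (+ˢ-cong (θ-q^ a) (-ˢ-cong (*ˢ-cong ≈-refl θu))) ⟩
      e *ˢ (aˢ *ˢ P -ˢ k *ˢ (aˢ *ˢ (P +ˢ 2ˢ *ˢ (P *ˢ P)))) ≈⟨ solve 4 (λ e c P k → e :* (c :* P :- k :* (c :* (P :+ con (+ 2) :* (P :* P)))) := c :* (P :* e :+ k :* (:- (P :+ con (+ 2) :* (P :* P)) :* e))) ≈-refl e aˢ P k ⟩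
      aˢ *ˢ (P *ˢ e +ˢ k *ˢ (-ˢ (P +ˢ 2ˢ *ˢ (P *ˢ P)) *ˢ e)) ≈⟨ *ˢ-cong ≈-refl (+ˢ-cong (≈-sym A.k-rat) (*ˢ-cong ≈-refl (≈-sym A.r-rat))) ⟩
      aˢ *ˢ (k +ˢ k *ˢ r) ∎
      where
      open import Relation.Binary.Reasoning.Setoid 𝒮.setoid
      u = 1ˢ +ˢ P +ˢ P *ˢ P
      k-u : k *ˢ u ≈ P
      k-u = ≈-trans (*ˢ-cong A.k-rat ≈-refl) (≈-trans (𝒮.*-assoc P e u) (≈-trans (*ˢ-cong ≈-refl A.e-unit) (𝒮.*-identityʳ P)))
      θu : θ u ≈ aˢ *ˢ (P +ˢ 2ˢ *ˢ (P *ˢ P))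
      θu = ≈-trans (θ-+ (1ˢ +ˢ P) (P *ˢ P)) (≈-trans (+ˢ-cong (≈-trans (θ-+ 1ˢ P) (+ˢ-cong (θ-const 1ℤ) (θ-q^ a)))
        (≈-trans (θ-* P P) (+ˢ-cong (*ˢ-cong (θ-q^ a) ≈-refl) (*ˢ-cong ≈-refl (θ-q^ a)))))
        (solve 2 (λ c P → con 0ℤ :+ c :* P :+ ((c :* P) :* P :+ P :* (c :* P)) := c :* (P :+ con (+ 2) :* (P :* P))) ≈-refl aˢ P))

    -- Partial fractions. The denominators 1 - P and 1 + P + P² are coprime, so no derivative
    -- appears on this diagonal, in contrast to x_a² and k_a r_a; the 6 clears denominators.
    ks-xs-diag : constˢ (+ 6) *ˢ (ks a *ˢ xs a) ≈ 2ˢ *ˢ xs a -ˢ rs a -ˢ constˢ (+ 3) *ˢ ks a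
    ks-xs-diag = ≈-trans (*ˢ-cong ≈-refl (*ˢ-cong A.k-rat A.x-rat)) (≈-trans
      (modulo (≈⇒-≈0 A.e-unit) (≈⇒-≈0 A.f-unit) (≈-refl {0ˢ}) (-ˢ (2ˢ *ˢ P *ˢ f)) (-ˢ (2ˢ *ˢ (P *ˢ P -ˢ P) *ˢ e)) 0ˢ
      (solve 3 (λ P e f → con (+ 6) :* ((P :* e) :* (P :* f)) := (con (+ 2) :* (P :* f) :- (:- (P :+ con (+ 2) :* (P :* P)) :* e) :- con (+ 3) :* (P :* e))
        :+ ((:- (con (+ 2) :* P :* f)) :* (con 1ℤ :- e :* (con 1ℤ :+ P :+ P :* P)) :+ (:- (con (+ 2) :* (P :* P :- P) :* e)) :* (con 1ℤ :- f :* (con 1ℤ :- P)) :+ con 0ℤ :* con 0ℤ)) ≈-refl P e f))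
      (≈-sym (+ˢ-cong (+ˢ-cong (*ˢ-cong ≈-refl A.x-rat) (-ˢ-cong A.r-rat)) (-ˢ-cong (*ˢ-cong ≈-refl A.k-rat)))))

  ∑₁ : ℕ → (ℕ → ℤ) → ℤ
  ∑₁ N f = ∑ N (f ∘ suc)

  ∑∑ : ℕ → (ℕ → ℕ → ℤ) → ℤ
  ∑∑ N T = ∑₁ N (λ a → ∑₁ N (T a))

  ∑₁-cong : ∀ N {f g : ℕ → ℤ} → (∀ a .{{_ : NonZero a}} → f a ≡ g a) → ∑₁ N f ≡ ∑₁ N g
  ∑₁-cong N h = ∑-cong N (λ i → h (suc i))

  ∑₁-cong≤ : ∀ N {f g : ℕ → ℤ} → (∀ a .{{_ : NonZero a}} → a ≤ N → f a ≡ g a) → ∑₁ N f ≡ ∑₁ N g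
  ∑₁-cong≤ N h = ∑-cong< N (λ i i<N → h (suc i) i<N)

  ∑∑-cong : ∀ N {S T : ℕ → ℕ → ℤ} → (∀ a b .{{_ : NonZero a}} .{{_ : NonZero b}} → S a b ≡ T a b) → ∑∑ N S ≡ ∑∑ N T
  ∑∑-cong N h = ∑₁-cong N (λ a → ∑₁-cong N (λ b → h a b))

  ∑∑-+ : ∀ N S T → ∑∑ N (λ a b → S a b +ᶻ T a b) ≡ ∑∑ N S +ᶻ ∑∑ N T
  ∑∑-+ N S T = trans (∑₁-cong N (λ a → ∑-+ N (S a ∘ suc) (T a ∘ suc))) (∑-+ N _ _)

  ∑∑-*ˡ : ∀ N c T → ∑∑ N (λ a b → c *ᶻ T a b) ≡ c *ᶻ ∑∑ N T
  ∑∑-*ˡ N c T = trans (∑₁-cong N (λ a → ∑-*ˡ N c (T a ∘ suc))) (∑-*ˡ N c _)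

  ∑∑-swap : ∀ N T → ∑∑ N T ≡ ∑∑ N (λ a b → T b a)
  ∑∑-swap N T = ∑-swap N N (λ i j → T (suc i) (suc j))

  ∑-append : ∀ m n (f : ℕ → ℤ) → ∑ (m + n) f ≡ ∑ m f +ᶻ ∑ n (λ i → f (m + i))
  ∑-append zero n f = sym (ℤₚ.+-identityˡ _)
  ∑-append (suc m) n f = trans (cong (f 0 +ᶻ_) (∑-append m n (f ∘ suc))) (sym (ℤₚ.+-assoc (f 0) _ _))

  module _ {N : ℕ} {f : ℕ → ℤ} (vanish : ∀ a → N < a → f a ≡ 0ℤ) where

    ∑₁-split : ∀ m → ∑₁ N f ≡ ∑₁ m f +ᶻ ∑₁ N (λ b → f (m + b))
    ∑₁-split m = trans (∑-extend (ℕₚ.m≤n+m N m) (λ i N≤i → vanish (suc i) (s≤s N≤i)))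
      (trans (∑-append m N (f ∘ suc)) (cong (∑₁ m f +ᶻ_) (∑-cong N (λ i → cong f (sym (ℕₚ.+-suc m i))))))

    ∑₁-split₃ : ∀ a .{{_ : NonZero a}} → ∑₁ N f ≡ ∑₁ (ℕ.pred a) f +ᶻ f a +ᶻ ∑₁ N (λ b → f (a + b))
    ∑₁-split₃ (suc a) = trans (∑₁-split (suc a)) (cong (_+ᶻ ∑₁ N (λ b → f (suc a + b))) (∑-last a (f ∘ suc)))

  -- The indicator of a < b as an integer weight: triangular sums become sums over a full square,
  -- whose order can be exchanged.
  lt : ℕ → ℕ → ℤ
  lt a zero = 0ℤ
  lt zero (suc b) = 1ℤ
  lt (suc a) (suc b) = lt a b

  lt-+ : ∀ a b .{{_ : NonZero b}} → lt a (a + b) ≡ 1ℤ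
  lt-+ zero (suc b) = refl
  lt-+ (suc a) b = lt-+ a b

  lt-≥ : ∀ a {b} → b ≤ a → lt a b ≡ 0ℤ
  lt-≥ a {zero} _ = refl
  lt-≥ (suc a) {suc b} (s≤s b≤a) = lt-≥ a b≤a

  lt-< : ∀ {a b} → a < b → lt a b ≡ 1ℤ
  lt-< {zero} {suc b} _ = refl
  lt-< {suc a} {suc b} (s≤s p) = lt-< p

  module _ {N : ℕ} where

    ∑₁-above : ∀ {f : ℕ → ℤ} → (∀ a → N < a → f a ≡ 0ℤ) → ∀ a → ∑₁ N (λ c → lt a c *ᶻ f c) ≡ ∑₁ N (λ b → f (a + b))
    ∑₁-above {f} vanish a = trans (∑₁-split {N} {λ c → lt a c *ᶻ f c} (λ c N<c → trans (cong (lt a c *ᶻ_) (vanish c N<c)) (ℤₚ.*-zeroʳ (lt a c))) a)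
      (trans (cong₂ _+ᶻ_ (trans (∑₁-cong≤ a (λ c c≤a → cong (_*ᶻ f c) (lt-≥ a c≤a))) (∑-0 a))
        (∑₁-cong N (λ b → trans (cong (_*ᶻ f (a + b)) (lt-+ a b)) (ℤₚ.*-identityˡ _)))) (ℤₚ.+-identityˡ _))

    ∑₁-below : ∀ (f : ℕ → ℤ) c .{{_ : NonZero c}} → c ≤ N → ∑₁ N (λ a → lt a c *ᶻ f a) ≡ ∑₁ (ℕ.pred c) f
    ∑₁-below f (suc c) c<N = trans (sym (∑-extend {c} {N} (ℕₚ.≤-trans (ℕₚ.n≤1+n c) c<N) (λ i c≤i → cong (_*ᶻ f (suc i)) (lt-≥ (suc i) (s≤s c≤i)))))
      (∑₁-cong≤ c (λ a a≤c → trans (cong (_*ᶻ f a) (lt-< (s≤s a≤c))) (ℤₚ.*-identityˡ (f a))))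

    module _ {T : ℕ → ℕ → ℤ} (vanishˡ : ∀ a b → N < a → T a b ≡ 0ℤ) (vanishʳ : ∀ a b → N < b → T a b ≡ 0ℤ) where

      ∑∑-below : ∑₁ N (λ a → ∑₁ (ℕ.pred a) (T a)) ≡ ∑∑ N (λ a b → T (a + b) b)
      ∑∑-below = trans (sym (∑₁-cong≤ N (λ a a≤N → ∑₁-below (T a) a a≤N)))
        (trans (∑∑-swap N (λ a b → lt b a *ᶻ T a b))
          (trans (∑₁-cong N (λ b → trans (∑₁-above (λ a N<a → vanishˡ a b N<a) b) (∑₁-cong N (λ a → cong (λ z → T z b) (ℕₚ.+-comm b a)))))
            (∑∑-swap N (λ b a → T (a + b) b))))

      -- The square is cut along its diagonal: pairs above it are (a, a+b), pairs below it (a+b, b).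
      -- As T vanishes beyond N, a and b may again run over the whole square.
      euclid : ∑∑ N T ≡ ∑∑ N (λ a b → T a (a + b)) +ᶻ ∑∑ N (λ a b → T (a + b) b) +ᶻ ∑₁ N (λ a → T a a)
      euclid = trans (∑₁-cong N (λ a → ∑₁-split₃ {N} {T a} (vanishʳ a) a)) (trans (∑-+ N _ _)
        (trans (cong (_+ᶻ ∑∑ N (λ a b → T a (a + b))) (trans (∑-+ N _ _) (cong (_+ᶻ ∑₁ N (λ a → T a a)) ∑∑-below)))
          (rot (∑∑ N (λ a b → T (a + b) b)) (∑₁ N (λ a → T a a)) (∑∑ N (λ a b → T a (a + b))))))
        where
        rot : ∀ x y z → x +ᶻ y +ᶻ z ≡ z +ᶻ x +ᶻ y
        rot = solve-∀

    -- Groups the pairs by c = a + b; sums c beyond N contribute nothing.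
    ∑∑-antidiagonal : ∀ (F : ℕ → ℕ → ℤ) (d : ℕ → ℤ) → (∀ c → N < c → d c ≡ 0ℤ) →
      ∑∑ N (λ a b → F a b *ᶻ d (a + b)) ≡ ∑₁ N (λ c → ∑₁ (ℕ.pred c) (λ a → F a (c ∸ a)) *ᶻ d c)
    ∑∑-antidiagonal F d vanish = trans
      (∑₁-cong N (λ a → trans (∑₁-cong N (λ b → cong (λ z → F a z *ᶻ d (a + b)) (sym (ℕₚ.m+n∸m≡n a b))))
        (sym (∑₁-above {λ c → F a (c ∸ a) *ᶻ d c} (λ c N<c → trans (cong (F a (c ∸ a) *ᶻ_) (vanish c N<c)) (ℤₚ.*-zeroʳ (F a (c ∸ a)))) a))))
      (trans (∑∑-swap N (λ a c → lt a c *ᶻ (F a (c ∸ a) *ᶻ d c)))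
        (∑₁-cong≤ N (λ c c≤N → trans (∑₁-cong N (λ a → sym (ℤₚ.*-assoc (lt a c) (F a (c ∸ a)) (d c))))
          (trans (∑-*ʳ N (d c) _) (cong (_*ᶻ d c) (∑₁-below (λ a → F a (c ∸ a)) c c≤N))))))

open BilinearSums

-- Bilinear sums under one step of Euclid's algorithm.

module EuclideanSums where

  private
    0*-vanish : ∀ {x} y → x ≡ 0ℤ → y *ᶻ x ≡ 0ℤ
    0*-vanish y refl = ℤₚ.*-zeroʳ y

  module Symmetric (N : ℕ) (X : ℕ → ℕ → ℤ) (d : ℕ → ℤ)
    (X-sym : ∀ a b → X a b ≡ X b a)
    (X-vanish : ∀ a b → N < a → X a b ≡ 0ℤ)
    (d-vanish : ∀ c → N < c → d c ≡ 0ℤ)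
    (X-rel : ∀ a b .{{_ : NonZero a}} .{{_ : NonZero b}} → X a b ≡ d (a + b) +ᶻ X (a + b) a +ᶻ X (a + b) b)
    where

    private
      X-vanishʳ : ∀ a b → N < b → X a b ≡ 0ℤ
      X-vanishʳ a b N<b = trans (X-sym a b) (X-vanish b a N<b)

      euclidX : ∀ (T : ℕ → ℕ → ℤ) → ∑∑ N (λ a b → T a b *ᶻ X a b) ≡
        ∑∑ N (λ a b → (T a (a + b) +ᶻ T (a + b) a) *ᶻ X a (a + b)) +ᶻ ∑₁ N (λ a → T a a *ᶻ X a a)
      euclidX T = trans (euclid {N} {λ a b → T a b *ᶻ X a b} (λ a b N<a → 0*-vanish (T a b) (X-vanish a b N<a)) (λ a b N<b → 0*-vanish (T a b) (X-vanishʳ a b N<b)))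
        (cong (_+ᶻ ∑₁ N (λ a → T a a *ᶻ X a a)) (trans (cong (∑∑ N (λ a b → T a (a + b) *ᶻ X a (a + b)) +ᶻ_) (trans (∑∑-swap N (λ a b → T (a + b) b *ᶻ X (a + b) b))
          (∑∑-cong N (λ a b → trans (cong (λ z → T z a *ᶻ X z a) (ℕₚ.+-comm b a)) (cong (T (a + b) a *ᶻ_) (X-sym (a + b) a))))))
          (trans (sym (∑∑-+ N (λ a b → T a (a + b) *ᶻ X a (a + b)) (λ a b → T (a + b) a *ᶻ X a (a + b)))) (∑∑-cong N (λ a b → sym (ℤₚ.*-distribʳ-+ (X a (a + b)) (T a (a + b)) (T (a + b) a)))))))

    -- The symmetrised T is twice the change of G under one step of Euclid's algorithm, so that after such
    -- a step only divisor sums and diagonal terms survive.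
    bilinear : ∀ (T G : ℕ → ℕ → ℤ) → (∀ a b → G a b ≡ G b a) →
      (∀ a b → T a (a + b) +ᶻ T (a + b) a ≡ + 2 *ᶻ (G a (a + b) -ᶻ G a b)) →
      ∑∑ N (λ a b → T a b *ᶻ X a b) ≡
      ∑₁ N (λ c → ∑₁ (ℕ.pred c) (λ a → G a (c ∸ a)) *ᶻ d c) +ᶻ ∑₁ N (λ a → (T a a -ᶻ G a a) *ᶻ X a a)
    bilinear T G G-sym T-G = begin
      ∑∑ N (λ a b → T a b *ᶻ X a b)
        ≡⟨ euclidX T ⟩
      ∑∑ N (λ a b → (T a (a + b) +ᶻ T (a + b) a) *ᶻ X a (a + b)) +ᶻ tDiag
        ≡⟨ cong (_+ᶻ tDiag) (trans (∑∑-cong N (λ a b → trans (cong (_*ᶻ X a (a + b)) (T-G a b)) (dist (G a (a + b)) (G a b) (X a (a + b)))))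
             (∑∑-+ N (λ a b → (G a (a + b) +ᶻ G a (a + b)) *ᶻ X a (a + b)) (λ a b → -[1+ 1 ] *ᶻ (G a b *ᶻ X a (a + b))))) ⟩
      ∑∑ N (λ a b → (G a (a + b) +ᶻ G a (a + b)) *ᶻ X a (a + b)) +ᶻ ∑∑ N (λ a b → -[1+ 1 ] *ᶻ (G a b *ᶻ X a (a + b))) +ᶻ tDiag
        ≡⟨ cong₂ (λ u v → u +ᶻ v +ᶻ tDiag) upper (∑∑-*ˡ N -[1+ 1 ] (λ a b → G a b *ᶻ X a (a + b))) ⟩
      (∑∑ N (λ a b → G a b *ᶻ X a b) -ᶻ gDiag) +ᶻ -[1+ 1 ] *ᶻ S +ᶻ tDiag
        ≡⟨ cong (λ u → (u -ᶻ gDiag) +ᶻ -[1+ 1 ] *ᶻ S +ᶻ tDiag) GX ⟩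
      (GD +ᶻ + 2 *ᶻ S -ᶻ gDiag) +ᶻ -[1+ 1 ] *ᶻ S +ᶻ tDiag
        ≡⟨ cancel GD S gDiag tDiag ⟩
      GD +ᶻ (tDiag +ᶻ -[1+ 0 ] *ᶻ gDiag)
        ≡⟨ cong₂ _+ᶻ_ (∑∑-antidiagonal G d d-vanish) (trans (cong (tDiag +ᶻ_) (sym (∑-*ˡ N -[1+ 0 ] (λ i → G (suc i) (suc i) *ᶻ X (suc i) (suc i)))))
             (trans (sym (∑-+ N (λ i → T (suc i) (suc i) *ᶻ X (suc i) (suc i)) (λ i → -[1+ 0 ] *ᶻ (G (suc i) (suc i) *ᶻ X (suc i) (suc i))))) (∑₁-cong N (λ a → diag (T a a) (G a a) (X a a))))) ⟩
      ∑₁ N (λ c → ∑₁ (ℕ.pred c) (λ a → G a (c ∸ a)) *ᶻ d c) +ᶻ ∑₁ N (λ a → (T a a -ᶻ G a a) *ᶻ X a a) ∎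
      where
      open ≡-Reasoning
      tDiag = ∑₁ N (λ a → T a a *ᶻ X a a)
      gDiag = ∑₁ N (λ a → G a a *ᶻ X a a)
      S = ∑∑ N (λ a b → G a b *ᶻ X a (a + b))
      GD = ∑∑ N (λ a b → G a b *ᶻ d (a + b))
      dist : ∀ g h x → + 2 *ᶻ (g -ᶻ h) *ᶻ x ≡ (g +ᶻ g) *ᶻ x +ᶻ -[1+ 1 ] *ᶻ (h *ᶻ x)
      dist = solve-∀
      cancel : ∀ g s u t → (g +ᶻ + 2 *ᶻ s -ᶻ u) +ᶻ -[1+ 1 ] *ᶻ s +ᶻ t ≡ g +ᶻ (t +ᶻ -[1+ 0 ] *ᶻ u)
      cancel = solve-∀
      diag : ∀ t g x → t *ᶻ x +ᶻ -[1+ 0 ] *ᶻ (g *ᶻ x) ≡ (t -ᶻ g) *ᶻ x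
      diag = solve-∀
      move : ∀ {x y z : ℤ} → x ≡ y +ᶻ z → y ≡ x -ᶻ z
      move {y = y} {z} refl = sym (trans (ℤₚ.+-assoc y z (-ᶻ z)) (trans (cong (y +ᶻ_) (ℤₚ.+-inverseʳ z)) (ℤₚ.+-identityʳ y)))
      -- The sum of G X is evaluated twice, here by Euclid's step and in `GX` by `X-rel`; the
      -- unknown `S` drops out between the two in `cancel`.
      upper : ∑∑ N (λ a b → (G a (a + b) +ᶻ G a (a + b)) *ᶻ X a (a + b)) ≡ ∑∑ N (λ a b → G a b *ᶻ X a b) -ᶻ gDiag
      upper = move (trans (euclidX G) (cong (_+ᶻ gDiag) (∑∑-cong N (λ a b → cong (λ z → (G a (a + b) +ᶻ z) *ᶻ X a (a + b)) (G-sym (a + b) a)))))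
      GX : ∑∑ N (λ a b → G a b *ᶻ X a b) ≡ GD +ᶻ + 2 *ᶻ S
      GX = trans (∑∑-cong N (λ a b → trans (cong (G a b *ᶻ_) (X-rel a b)) (dist₃ (G a b) (d (a + b)) (X (a + b) a) (X (a + b) b))))
        (trans (∑∑-+ N (λ a b → G a b *ᶻ d (a + b) +ᶻ G a b *ᶻ X (a + b) a) (λ a b → G a b *ᶻ X (a + b) b))
        (trans (cong₂ _+ᶻ_ (∑∑-+ N (λ a b → G a b *ᶻ d (a + b)) (λ a b → G a b *ᶻ X (a + b) a)) (trans (∑∑-swap N (λ a b → G a b *ᶻ X (a + b) b))
            (∑∑-cong N (λ a b → trans (cong₂ _*ᶻ_ (G-sym b a) (trans (cong (λ z → X z a) (ℕₚ.+-comm b a)) (X-sym (a + b) a))) refl))))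
          (trans (cong (λ z → GD +ᶻ z +ᶻ S) (∑∑-cong N (λ a b → cong (G a b *ᶻ_) (X-sym (a + b) a)))) (two GD S))))
        where
        dist₃ : ∀ g x y z → g *ᶻ (x +ᶻ y +ᶻ z) ≡ g *ᶻ x +ᶻ g *ᶻ y +ᶻ g *ᶻ z
        dist₃ = solve-∀
        two : ∀ g s → g +ᶻ s +ᶻ s ≡ g +ᶻ + 2 *ᶻ s
        two = solve-∀

  module Twisted (N : ℕ) (KX KR : ℕ → ℕ → ℤ) (k : ℕ → ℤ)
    (KX-vanishˡ : ∀ a b → N < a → KX a b ≡ 0ℤ) (KX-vanishʳ : ∀ a b → N < b → KX a b ≡ 0ℤ)
    (KR-vanishˡ : ∀ a b → N < a → KR a b ≡ 0ℤ) (KR-vanishʳ : ∀ a b → N < b → KR a b ≡ 0ℤ)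
    (k-vanish : ∀ c → N < c → k c ≡ 0ℤ)
    (KX-rel : ∀ a b .{{_ : NonZero a}} .{{_ : NonZero b}} → + 2 *ᶻ KX a b ≡ + 2 *ᶻ KX (a + b) b +ᶻ KR a (a + b) +ᶻ KR (a + b) a +ᶻ + 2 *ᶻ k (a + b))
    (KR-sym : ∀ a b .{{_ : NonZero a}} .{{_ : NonZero b}} → KR a b +ᶻ KR b a ≡ KR a (a + b) +ᶻ KR b (a + b) -ᶻ (KR (a + b) a +ᶻ KR (a + b) b) -ᶻ + 2 *ᶻ k (a + b))
    (KR-alt : ∀ a b .{{_ : NonZero a}} .{{_ : NonZero b}} → KR a b -ᶻ KR b a ≡ + 2 *ᶻ (KX a (a + b) -ᶻ KX b (a + b)))
    where

    private
      euclidT : ∀ (P Y : ℕ → ℕ → ℤ) → (∀ a b → N < a → Y a b ≡ 0ℤ) → (∀ a b → N < b → Y a b ≡ 0ℤ) → ∑∑ N (λ a b → P a b *ᶻ Y a b) ≡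
        ∑∑ N (λ a b → P a (a + b) *ᶻ Y a (a + b)) +ᶻ ∑∑ N (λ a b → P (a + b) b *ᶻ Y (a + b) b) +ᶻ ∑₁ N (λ a → P a a *ᶻ Y a a)
      euclidT P Y l r = euclid {N} {λ a b → P a b *ᶻ Y a b} (λ a b N<a → 0*-vanish (P a b) (l a b N<a)) (λ a b N<b → 0*-vanish (P a b) (r a b N<b))

      rename : ∀ (g : ℕ → ℕ → ℤ) (Y : ℕ → ℕ → ℤ) → ∑∑ N (λ a b → g a b *ᶻ Y b (a + b)) ≡ ∑∑ N (λ a b → g b a *ᶻ Y a (a + b))
      rename g Y = trans (∑∑-swap N (λ a b → g a b *ᶻ Y b (a + b))) (∑∑-cong N (λ a b → cong (λ z → g b a *ᶻ Y a z) (ℕₚ.+-comm b a)))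

      rename′ : ∀ (g : ℕ → ℕ → ℤ) (Y : ℕ → ℕ → ℤ) → ∑∑ N (λ a b → g a b *ᶻ Y (a + b) a) ≡ ∑∑ N (λ a b → g b a *ᶻ Y (a + b) b)
      rename′ g Y = trans (∑∑-swap N (λ a b → g a b *ᶻ Y (a + b) a)) (∑∑-cong N (λ a b → cong (λ z → g b a *ᶻ Y z b) (ℕₚ.+-comm b a)))

    -- The weights g₁, h₂, h₃ multiply KX-rel, KR-sym and KR-alt respectively.
    twisted : ∀ (P Q g₁ h₂ h₃ : ℕ → ℕ → ℤ) → (∀ a b → h₂ a b ≡ h₂ b a) → (∀ a b → h₃ a b ≡ -ᶻ h₃ b a) →
      (∀ a b → P a (a + b) ≡ + 2 *ᶻ (g₁ a (a + b) -ᶻ h₃ a b)) →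
      (∀ a b → P (a + b) b ≡ + 2 *ᶻ (g₁ (a + b) b -ᶻ g₁ a b)) →
      (∀ a b → Q a (a + b) ≡ h₂ a (a + b) -ᶻ h₂ a b +ᶻ h₃ a (a + b) -ᶻ g₁ a b) →
      (∀ a b → Q (a + b) b ≡ h₂ (a + b) b +ᶻ h₂ a b +ᶻ h₃ (a + b) b -ᶻ g₁ b a) →
      ∑∑ N (λ a b → P a b *ᶻ KX a b) +ᶻ ∑∑ N (λ a b → Q a b *ᶻ KR a b) ≡
      ∑₁ N (λ c → ∑₁ (ℕ.pred c) (λ a → + 2 *ᶻ g₁ a (c ∸ a) -ᶻ h₂ a (c ∸ a)) *ᶻ k c)
      +ᶻ (∑₁ N (λ a → (P a a -ᶻ + 2 *ᶻ g₁ a a) *ᶻ KX a a) +ᶻ ∑₁ N (λ a → (Q a a -ᶻ h₂ a a) *ᶻ KR a a))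
    twisted P Q g₁ h₂ h₃ h₂-sym h₃-alt P₁ P₂ Q₁ Q₂ = begin
      ∑∑ N (λ a b → P a b *ᶻ KX a b) +ᶻ ∑∑ N (λ a b → Q a b *ᶻ KR a b)
        ≡⟨ cong₂ _+ᶻ_ (euclidT P KX KX-vanishˡ KX-vanishʳ) (euclidT Q KR KR-vanishˡ KR-vanishʳ) ⟩
      (U KX (λ a b → P a (a + b)) +ᶻ L KX (λ a b → P (a + b) b) +ᶻ D KX P) +ᶻ (U KR (λ a b → Q a (a + b)) +ᶻ L KR (λ a b → Q (a + b) b) +ᶻ D KR Q)
        ≡⟨ cong₂ _+ᶻ_ (cong (_+ᶻ D KX P) (cong₂ _+ᶻ_ UP LP)) (cong (_+ᶻ D KR Q) (cong₂ _+ᶻ_ UQ LQ)) ⟩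
      (+ 2 *ᶻ (ug -ᶻ uh) +ᶻ + 2 *ᶻ (lg -ᶻ l) +ᶻ D KX P) +ᶻ ((u₂ -ᶻ v₂ +ᶻ u₃ -ᶻ v₁) +ᶻ (l₂ +ᶻ w₂ +ᶻ l₃ -ᶻ w₁) +ᶻ D KR Q)
        -- Regrouped so that each of the three brackets is the weighted sum of one relation,
        -- evaluated in `E₁`, `E₂` and `E₃`; the last group is the diagonal.
        ≡⟨ collect ug uh lg l (D KX P) (D KR Q) u₂ v₂ u₃ v₁ l₂ w₂ l₃ w₁ dg d₂ ⟩
      (+ 2 *ᶻ (ug +ᶻ lg +ᶻ dg) -ᶻ + 2 *ᶻ l -ᶻ v₁ -ᶻ w₁) -ᶻ (v₂ -ᶻ w₂ -ᶻ (u₂ +ᶻ l₂ +ᶻ d₂)) +ᶻ ((u₃ +ᶻ l₃) -ᶻ + 2 *ᶻ uh) +ᶻ ((D KX P -ᶻ + 2 *ᶻ dg) +ᶻ (D KR Q -ᶻ d₂))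
        ≡⟨ cong₂ _+ᶻ_ (cong₂ _+ᶻ_ (cong₂ _-ᶻ_ E₁ E₂) E₃) (cong₂ _+ᶻ_ (diff KX P g₁ (+ 2)) (trans (cong (λ z → D KR Q -ᶻ z) (sym (ℤₚ.*-identityˡ d₂))) (trans (diff KR Q h₂ 1ℤ) (∑₁-cong N (λ a → cong (λ z → (Q a a -ᶻ z) *ᶻ KR a a) (ℤₚ.*-identityˡ (h₂ a a))))))) ⟩
      + 2 *ᶻ C g₁ -ᶻ C h₂ +ᶻ 0ℤ +ᶻ rest
        ≡⟨ cong (_+ᶻ rest) (trans (ℤₚ.+-identityʳ _) (sym C-lin)) ⟩
      C (λ a b → + 2 *ᶻ g₁ a b -ᶻ h₂ a b) +ᶻ rest
        ≡⟨ cong (_+ᶻ rest) (∑∑-antidiagonal (λ a b → + 2 *ᶻ g₁ a b -ᶻ h₂ a b) k k-vanish) ⟩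
      ∑₁ N (λ c → ∑₁ (ℕ.pred c) (λ a → + 2 *ᶻ g₁ a (c ∸ a) -ᶻ h₂ a (c ∸ a)) *ᶻ k c) +ᶻ rest ∎
      where
      open ≡-Reasoning
      Arr = ℕ → ℕ → ℤ
      U L : Arr → Arr → ℤ
      U Y f = ∑∑ N (λ a b → f a b *ᶻ Y a (a + b))
      L Y f = ∑∑ N (λ a b → f a b *ᶻ Y (a + b) b)
      D : Arr → Arr → ℤ
      D Y f = ∑₁ N (λ a → f a a *ᶻ Y a a)
      C : Arr → ℤ
      C f = ∑∑ N (λ a b → f a b *ᶻ k (a + b))
      ↑ ↓ ᵀ : Arr → Arr
      ↑ f a b = f a (a + b)
      ↓ f a b = f (a + b) b
      ᵀ f a b = f b a
      ug = U KX (↑ g₁)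
      uh = U KX h₃
      lg = L KX (↓ g₁)
      l = L KX g₁
      u₂ = U KR (↑ h₂)
      v₂ = U KR h₂
      u₃ = U KR (↑ h₃)
      v₁ = U KR g₁
      l₂ = L KR (↓ h₂)
      w₂ = L KR h₂
      l₃ = L KR (↓ h₃)
      w₁ = L KR (ᵀ g₁)
      dg = D KX g₁
      d₂ = D KR h₂
      rest = ∑₁ N (λ a → (P a a -ᶻ + 2 *ᶻ g₁ a a) *ᶻ KX a a) +ᶻ ∑₁ N (λ a → (Q a a -ᶻ h₂ a a) *ᶻ KR a a)

      lin₂ : ∀ (Y f g : Arr) c d → ∑∑ N (λ a b → (c *ᶻ f a b +ᶻ d *ᶻ g a b) *ᶻ Y a b) ≡ c *ᶻ ∑∑ N (λ a b → f a b *ᶻ Y a b) +ᶻ d *ᶻ ∑∑ N (λ a b → g a b *ᶻ Y a b)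
      lin₂ Y f g c d = trans (∑∑-cong N (λ a b → ring c d (f a b) (g a b) (Y a b))) (trans (∑∑-+ N (λ a b → c *ᶻ (f a b *ᶻ Y a b)) (λ a b → d *ᶻ (g a b *ᶻ Y a b)))
        (cong₂ _+ᶻ_ (∑∑-*ˡ N c (λ a b → f a b *ᶻ Y a b)) (∑∑-*ˡ N d (λ a b → g a b *ᶻ Y a b))))
        where
        ring : ∀ c d f g y → (c *ᶻ f +ᶻ d *ᶻ g) *ᶻ y ≡ c *ᶻ (f *ᶻ y) +ᶻ d *ᶻ (g *ᶻ y)
        ring = solve-∀

      lin₄ : ∀ (Y f g h i : Arr) c₁ c₂ c₃ c₄ → ∑∑ N (λ a b → ((c₁ *ᶻ f a b +ᶻ c₂ *ᶻ g a b) +ᶻ (c₃ *ᶻ h a b +ᶻ c₄ *ᶻ i a b)) *ᶻ Y a b) ≡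
        (c₁ *ᶻ ∑∑ N (λ a b → f a b *ᶻ Y a b) +ᶻ c₂ *ᶻ ∑∑ N (λ a b → g a b *ᶻ Y a b)) +ᶻ (c₃ *ᶻ ∑∑ N (λ a b → h a b *ᶻ Y a b) +ᶻ c₄ *ᶻ ∑∑ N (λ a b → i a b *ᶻ Y a b))
      lin₄ Y f g h i c₁ c₂ c₃ c₄ = trans (∑∑-cong N (λ a b → ℤₚ.*-distribʳ-+ (Y a b) (c₁ *ᶻ f a b +ᶻ c₂ *ᶻ g a b) (c₃ *ᶻ h a b +ᶻ c₄ *ᶻ i a b)))
        (trans (∑∑-+ N (λ a b → (c₁ *ᶻ f a b +ᶻ c₂ *ᶻ g a b) *ᶻ Y a b) (λ a b → (c₃ *ᶻ h a b +ᶻ c₄ *ᶻ i a b) *ᶻ Y a b)) (cong₂ _+ᶻ_ (lin₂ Y f g c₁ c₂) (lin₂ Y h i c₃ c₄)))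

      -1ᶻ = -[1+ 0 ]

      r₂ : ∀ x y → + 2 *ᶻ (x -ᶻ y) ≡ + 2 *ᶻ x +ᶻ -[1+ 1 ] *ᶻ y
      r₂ = solve-∀
      r₄ : ∀ x y z w → x -ᶻ y +ᶻ z -ᶻ w ≡ (1ℤ *ᶻ x +ᶻ -1ᶻ *ᶻ y) +ᶻ (1ℤ *ᶻ z +ᶻ -1ᶻ *ᶻ w)
      r₄ = solve-∀
      r₄′ : ∀ x y z w → x +ᶻ y +ᶻ z -ᶻ w ≡ (1ℤ *ᶻ x +ᶻ 1ℤ *ᶻ y) +ᶻ (1ℤ *ᶻ z +ᶻ -1ᶻ *ᶻ w)
      r₄′ = solve-∀

      UP : U KX (↑ P) ≡ + 2 *ᶻ (ug -ᶻ uh)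
      UP = trans (∑∑-cong N (λ a b → cong (_*ᶻ KX a (a + b)) (trans (P₁ a b) (r₂ (↑ g₁ a b) (h₃ a b)))))
        (trans (lin₂ (λ a b → KX a (a + b)) (↑ g₁) h₃ (+ 2) -[1+ 1 ]) (sym (r₂ ug uh)))
      LP : L KX (↓ P) ≡ + 2 *ᶻ (lg -ᶻ l)
      LP = trans (∑∑-cong N (λ a b → cong (_*ᶻ KX (a + b) b) (trans (P₂ a b) (r₂ (↓ g₁ a b) (g₁ a b)))))
        (trans (lin₂ (λ a b → KX (a + b) b) (↓ g₁) g₁ (+ 2) -[1+ 1 ]) (sym (r₂ lg l)))
      UQ : U KR (↑ Q) ≡ u₂ -ᶻ v₂ +ᶻ u₃ -ᶻ v₁
      UQ = trans (∑∑-cong N (λ a b → cong (_*ᶻ KR a (a + b)) (trans (Q₁ a b) (r₄ (↑ h₂ a b) (h₂ a b) (↑ h₃ a b) (g₁ a b)))))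
        (trans (lin₄ (λ a b → KR a (a + b)) (↑ h₂) h₂ (↑ h₃) g₁ 1ℤ -1ᶻ 1ℤ -1ᶻ) (sym (r₄ u₂ v₂ u₃ v₁)))
      LQ : L KR (↓ Q) ≡ l₂ +ᶻ w₂ +ᶻ l₃ -ᶻ w₁
      LQ = trans (∑∑-cong N (λ a b → cong (_*ᶻ KR (a + b) b) (trans (Q₂ a b) (r₄′ (↓ h₂ a b) (h₂ a b) (↓ h₃ a b) (ᵀ g₁ a b)))))
        (trans (lin₄ (λ a b → KR (a + b) b) (↓ h₂) h₂ (↓ h₃) (ᵀ g₁) 1ℤ 1ℤ 1ℤ -1ᶻ) (sym (r₄′ l₂ w₂ l₃ w₁)))

      collect : ∀ ug uh lg l p q u₂ v₂ u₃ v₁ l₂ w₂ l₃ w₁ dg d₂ →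
        (+ 2 *ᶻ (ug -ᶻ uh) +ᶻ + 2 *ᶻ (lg -ᶻ l) +ᶻ p) +ᶻ ((u₂ -ᶻ v₂ +ᶻ u₃ -ᶻ v₁) +ᶻ (l₂ +ᶻ w₂ +ᶻ l₃ -ᶻ w₁) +ᶻ q) ≡
        (+ 2 *ᶻ (ug +ᶻ lg +ᶻ dg) -ᶻ + 2 *ᶻ l -ᶻ v₁ -ᶻ w₁) -ᶻ (v₂ -ᶻ w₂ -ᶻ (u₂ +ᶻ l₂ +ᶻ d₂)) +ᶻ ((u₃ +ᶻ l₃) -ᶻ + 2 *ᶻ uh) +ᶻ ((p -ᶻ + 2 *ᶻ dg) +ᶻ (q -ᶻ d₂))
      collect = solve-∀

      diff : ∀ (Y f g : Arr) c → D Y f -ᶻ c *ᶻ D Y g ≡ ∑₁ N (λ a → (f a a -ᶻ c *ᶻ g a a) *ᶻ Y a a)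
      diff Y f g c = trans (cong (D Y f +ᶻ_) (trans (ℤₚ.neg-distribˡ-* c (D Y g)) (sym (∑-*ˡ N (-ᶻ c) (λ i → g (suc i) (suc i) *ᶻ Y (suc i) (suc i))))))
        (trans (sym (∑-+ N (λ i → f (suc i) (suc i) *ᶻ Y (suc i) (suc i)) (λ i → -ᶻ c *ᶻ (g (suc i) (suc i) *ᶻ Y (suc i) (suc i))))) (∑₁-cong N (λ a → ring (f a a) (g a a) c (Y a a))))
        where
        ring : ∀ f g c y → f *ᶻ y +ᶻ -ᶻ c *ᶻ (g *ᶻ y) ≡ (f -ᶻ c *ᶻ g) *ᶻ y
        ring = solve-∀

      C-lin : C (λ a b → + 2 *ᶻ g₁ a b -ᶻ h₂ a b) ≡ + 2 *ᶻ C g₁ -ᶻ C h₂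
      C-lin = trans (∑∑-cong N (λ a b → cong (_*ᶻ k (a + b)) (ring (g₁ a b) (h₂ a b)))) (trans (lin₂ (λ a b → k (a + b)) g₁ h₂ (+ 2) -1ᶻ) (sym (ring (C g₁) (C h₂))))
        where
        ring : ∀ x y → + 2 *ᶻ x -ᶻ y ≡ + 2 *ᶻ x +ᶻ -1ᶻ *ᶻ y
        ring = solve-∀

      split₄ : ∀ (A B Y Z : Arr) → ∑∑ N (λ a b → A a b +ᶻ B a b +ᶻ Y a b +ᶻ Z a b) ≡ ∑∑ N A +ᶻ ∑∑ N B +ᶻ ∑∑ N Y +ᶻ ∑∑ N Z
      split₄ A B Y Z = trans (∑∑-+ N (λ a b → A a b +ᶻ B a b +ᶻ Y a b) Z) (cong (_+ᶻ ∑∑ N Z) (trans (∑∑-+ N (λ a b → A a b +ᶻ B a b) Y) (cong (_+ᶻ ∑∑ N Y) (∑∑-+ N A B))))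

      -- The bracket ug + lg + dg is the sum of g₁ KX after Euclid's step; expanding the same sum by
      -- `KX-rel` leaves only the term in k.
      E₁ : + 2 *ᶻ (ug +ᶻ lg +ᶻ dg) -ᶻ + 2 *ᶻ l -ᶻ v₁ -ᶻ w₁ ≡ + 2 *ᶻ C g₁
      E₁ = trans (cong (λ z → + 2 *ᶻ z -ᶻ + 2 *ᶻ l -ᶻ v₁ -ᶻ w₁) (sym (euclidT g₁ KX KX-vanishˡ KX-vanishʳ)))
        (trans (cong (λ z → z -ᶻ + 2 *ᶻ l -ᶻ v₁ -ᶻ w₁) expand) (ring (+ 2 *ᶻ l) v₁ w₁ (+ 2 *ᶻ C g₁)))
        where
        ring : ∀ l v w c → l +ᶻ v +ᶻ w +ᶻ c -ᶻ l -ᶻ v -ᶻ w ≡ c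
        ring = solve-∀
        term : ∀ g x y z w → g *ᶻ (+ 2 *ᶻ x +ᶻ y +ᶻ z +ᶻ + 2 *ᶻ w) ≡ + 2 *ᶻ (g *ᶻ x) +ᶻ g *ᶻ y +ᶻ g *ᶻ z +ᶻ + 2 *ᶻ (g *ᶻ w)
        term = solve-∀
        comm₂ : ∀ g x → + 2 *ᶻ (g *ᶻ x) ≡ g *ᶻ (+ 2 *ᶻ x)
        comm₂ = solve-∀
        expand : + 2 *ᶻ ∑∑ N (λ a b → g₁ a b *ᶻ KX a b) ≡ + 2 *ᶻ l +ᶻ v₁ +ᶻ w₁ +ᶻ + 2 *ᶻ C g₁
        expand = trans (sym (∑∑-*ˡ N (+ 2) (λ a b → g₁ a b *ᶻ KX a b))) (trans
          (∑∑-cong N (λ a b → trans (comm₂ (g₁ a b) (KX a b)) (trans (cong (g₁ a b *ᶻ_) (KX-rel a b)) (term (g₁ a b) (KX (a + b) b) (KR a (a + b)) (KR (a + b) a) (k (a + b))))))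
          (trans (split₄ (λ a b → + 2 *ᶻ (g₁ a b *ᶻ KX (a + b) b)) (λ a b → g₁ a b *ᶻ KR a (a + b)) (λ a b → g₁ a b *ᶻ KR (a + b) a) (λ a b → + 2 *ᶻ (g₁ a b *ᶻ k (a + b))))
          (cong₂ _+ᶻ_ (cong₂ _+ᶻ_ (cong (_+ᶻ v₁) (∑∑-*ˡ N (+ 2) (λ a b → g₁ a b *ᶻ KX (a + b) b))) (rename′ g₁ KR)) (∑∑-*ˡ N (+ 2) (λ a b → g₁ a b *ᶻ k (a + b))))))

      half : ∀ {x y} → + 2 *ᶻ x ≡ + 2 *ᶻ y → x ≡ y
      half {x} {y} = ℤₚ.*-cancelˡ-≡ (+ 2) x y

      -- `KR-sym` knows only KR(a,b) + KR(b,a). As h₂ is symmetric this suffices: swapping a and b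
      -- shows twice the sum to be the sum of the symmetrised products.
      E₂ : v₂ -ᶻ w₂ -ᶻ (u₂ +ᶻ l₂ +ᶻ d₂) ≡ C h₂
      E₂ = trans (cong (λ z → v₂ -ᶻ w₂ -ᶻ z) (trans (sym (euclidT h₂ KR KR-vanishˡ KR-vanishʳ)) (half {S} {v₂ -ᶻ w₂ -ᶻ C h₂} doubled))) (ring v₂ w₂ (C h₂))
        where
        S = ∑∑ N (λ a b → h₂ a b *ᶻ KR a b)
        ring : ∀ v w c → v -ᶻ w -ᶻ (v -ᶻ w -ᶻ c) ≡ c
        ring = solve-∀
        term : ∀ h x y z w k → h *ᶻ (x +ᶻ y -ᶻ (z +ᶻ w) -ᶻ + 2 *ᶻ k) ≡ (1ℤ *ᶻ (h *ᶻ x +ᶻ h *ᶻ y)) +ᶻ -1ᶻ *ᶻ (h *ᶻ z +ᶻ h *ᶻ w) +ᶻ -[1+ 1 ] *ᶻ (h *ᶻ k) +ᶻ 0ℤ *ᶻ (h *ᶻ k)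
        term = solve-∀
        final : ∀ v w c → 1ℤ *ᶻ (v +ᶻ v) +ᶻ -1ᶻ *ᶻ (w +ᶻ w) +ᶻ -[1+ 1 ] *ᶻ c +ᶻ 0ℤ *ᶻ c ≡ + 2 *ᶻ (v -ᶻ w -ᶻ c)
        final = solve-∀
        twice : ∀ x → + 2 *ᶻ x ≡ x +ᶻ x
        twice = solve-∀
        H : Arr → Arr → Arr
        H f Y a b = f a b *ᶻ Y a b
        doubled : + 2 *ᶻ S ≡ + 2 *ᶻ (v₂ -ᶻ w₂ -ᶻ C h₂)
        doubled = trans (twice S) (trans (cong (S +ᶻ_) (trans (∑∑-swap N (λ a b → h₂ a b *ᶻ KR a b)) (∑∑-cong N (λ a b → cong (_*ᶻ KR b a) (h₂-sym b a)))))
          (trans (sym (∑∑-+ N (λ a b → h₂ a b *ᶻ KR a b) (λ a b → h₂ a b *ᶻ KR b a)))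
          (trans (∑∑-cong N (λ a b → trans (sym (ℤₚ.*-distribˡ-+ (h₂ a b) (KR a b) (KR b a))) (trans (cong (h₂ a b *ᶻ_) (KR-sym a b))
             (term (h₂ a b) (KR a (a + b)) (KR b (a + b)) (KR (a + b) a) (KR (a + b) b) (k (a + b))))))
          (trans (split₄ (λ a b → 1ℤ *ᶻ (h₂ a b *ᶻ KR a (a + b) +ᶻ h₂ a b *ᶻ KR b (a + b))) (λ a b → -1ᶻ *ᶻ (h₂ a b *ᶻ KR (a + b) a +ᶻ h₂ a b *ᶻ KR (a + b) b))
                    (λ a b → -[1+ 1 ] *ᶻ (h₂ a b *ᶻ k (a + b))) (λ a b → 0ℤ *ᶻ (h₂ a b *ᶻ k (a + b))))
          (trans (cong₂ _+ᶻ_ (cong₂ _+ᶻ_ (cong₂ _+ᶻ_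
               (trans (∑∑-*ˡ N 1ℤ (λ a b → h₂ a b *ᶻ KR a (a + b) +ᶻ h₂ a b *ᶻ KR b (a + b))) (cong (1ℤ *ᶻ_) (trans (∑∑-+ N (λ a b → h₂ a b *ᶻ KR a (a + b)) (λ a b → h₂ a b *ᶻ KR b (a + b)))
                 (cong (v₂ +ᶻ_) (trans (rename h₂ KR) (∑∑-cong N (λ a b → cong (_*ᶻ KR a (a + b)) (h₂-sym b a))))))))
               (trans (∑∑-*ˡ N -1ᶻ (λ a b → h₂ a b *ᶻ KR (a + b) a +ᶻ h₂ a b *ᶻ KR (a + b) b)) (cong (-1ᶻ *ᶻ_) (trans (∑∑-+ N (λ a b → h₂ a b *ᶻ KR (a + b) a) (λ a b → h₂ a b *ᶻ KR (a + b) b))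
                 (cong (_+ᶻ w₂) (trans (rename′ h₂ KR) (∑∑-cong N (λ a b → cong (_*ᶻ KR (a + b) b) (h₂-sym b a)))))))))
               (∑∑-*ˡ N -[1+ 1 ] (λ a b → h₂ a b *ᶻ k (a + b)))) (∑∑-*ˡ N 0ℤ (λ a b → h₂ a b *ᶻ k (a + b))))
            (final v₂ w₂ (C h₂)))))))

      h₃-diag : ∀ a → h₃ a a ≡ 0ℤ
      h₃-diag a = ℤₚ.*-cancelˡ-≡ (+ 2) (h₃ a a) 0ℤ (trans (twice (h₃ a a)) (trans (cong (h₃ a a +ᶻ_) (h₃-alt a a)) (ℤₚ.+-inverseʳ (h₃ a a))))
        where
        twice : ∀ x → + 2 *ᶻ x ≡ x +ᶻ x
        twice = solve-∀

      -- As in `E₂`, with an antisymmetric weight matched to the difference KR(a,b) - KR(b,a);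
      -- antisymmetry also removes the diagonal.
      E₃ : (u₃ +ᶻ l₃) -ᶻ + 2 *ᶻ uh ≡ 0ℤ
      E₃ = trans (cong (_-ᶻ + 2 *ᶻ uh) (trans (sym (ℤₚ.+-identityʳ (u₃ +ᶻ l₃))) (trans (cong (u₃ +ᶻ l₃ +ᶻ_) (sym diag0)) (trans (sym (euclidT h₃ KR KR-vanishˡ KR-vanishʳ)) (half {S} {+ 2 *ᶻ uh} doubled)))))
        (ℤₚ.+-inverseʳ (+ 2 *ᶻ uh))
        where
        S = ∑∑ N (λ a b → h₃ a b *ᶻ KR a b)
        diag0 : D KR h₃ ≡ 0ℤ
        diag0 = trans (∑₁-cong N (λ a → cong (_*ᶻ KR a a) (h₃-diag a))) (∑-0 N)
        twice : ∀ x → + 2 *ᶻ x ≡ x +ᶻ x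
        twice = solve-∀
        negl : ∀ h x y → h *ᶻ x +ᶻ -ᶻ h *ᶻ y ≡ h *ᶻ (x -ᶻ y)
        negl = solve-∀
        term : ∀ h x y → h *ᶻ (+ 2 *ᶻ (x -ᶻ y)) ≡ + 2 *ᶻ (h *ᶻ x) +ᶻ + 2 *ᶻ (-ᶻ h *ᶻ y)
        term = solve-∀
        dbl : ∀ u → + 2 *ᶻ u +ᶻ + 2 *ᶻ u ≡ + 2 *ᶻ (+ 2 *ᶻ u)
        dbl = solve-∀
        doubled : + 2 *ᶻ S ≡ + 2 *ᶻ (+ 2 *ᶻ uh)
        doubled = trans (twice S) (trans (cong (S +ᶻ_) (trans (∑∑-swap N (λ a b → h₃ a b *ᶻ KR a b)) (∑∑-cong N (λ a b → cong (_*ᶻ KR b a) (h₃-alt b a)))))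
          (trans (sym (∑∑-+ N (λ a b → h₃ a b *ᶻ KR a b) (λ a b → -ᶻ h₃ a b *ᶻ KR b a)))
          (trans (∑∑-cong N (λ a b → trans (negl (h₃ a b) (KR a b) (KR b a)) (trans (cong (h₃ a b *ᶻ_) (KR-alt a b)) (term (h₃ a b) (KX a (a + b)) (KX b (a + b))))))
          (trans (∑∑-+ N (λ a b → + 2 *ᶻ (h₃ a b *ᶻ KX a (a + b))) (λ a b → + 2 *ᶻ (-ᶻ h₃ a b *ᶻ KX b (a + b))))
          (trans (cong₂ _+ᶻ_ (∑∑-*ˡ N (+ 2) (λ a b → h₃ a b *ᶻ KX a (a + b)))
            (trans (∑∑-*ˡ N (+ 2) (λ a b → -ᶻ h₃ a b *ᶻ KX b (a + b))) (cong (+ 2 *ᶻ_) (trans (rename (λ a b → -ᶻ h₃ a b) KX) (∑∑-cong N (λ a b → cong (_*ᶻ KX a (a + b)) (sym (h₃-alt a b))))))))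
            (dbl uh))))))

open EuclideanSums

-- The weights of the double sums, their primitives and indefinite sums.

module ResidueWeights where

  open +-*-Solver using (Polynomial) renaming (solve to solveᶻ; _:+_ to infixl 6 _⊞ᵖ_; _:*_ to infixl 7 _⊠ᵖ_; con to conᶻ; _:=_ to _≔_)
  -- Weight functions of a pair of natural numbers depend on the residues r, s and polynomially on the
  -- values x, y; they are written once for integers and for the polynomials of the ring solver.
  module Weights {A : Set} (plus times : A → A → A) (c : ℤ → A) where

    infixl 6 _⊹_
    infixl 7 _✶_
    _⊹_ _✶_ : A → A → A
    _⊹_ = plus
    _✶_ = times

    X K : Res → A
    X r = c (χᵣ r)
    K r = c (κᵣ r)

    n1 n2 n3 n6 : A
    n1 = c -[1+ 0 ]
    n2 = c -[1+ 1 ]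
    n3 = c -[1+ 2 ]
    n6 = c -[1+ 5 ]

    -- 36 times indefinite sums of 1, χ, κ, xχ, xκ, x²χ, x²κ, x³χ, x³κ.
    s₀ sχ₀ sκ₀ sχ₁ sκ₁ sχ₂ sκ₂ sχ₃ sκ₃ : Res → A → A
    s₀ r x = c (+ 36) ✶ x
    sχ₀ r x = c (-[1+ 17 ]) ✶ X r ⊹ n6 ✶ K r
    sκ₀ r x = c (+ 18) ✶ X r ⊹ c (-[1+ 17 ]) ✶ K r
    sχ₁ r x = c (+ 12) ✶ X r ⊹ x ✶ sχ₀ r x
    sκ₁ r x = c (+ 12) ✶ K r ⊹ x ✶ sκ₀ r x
    sχ₂ r x = c (+ 4) ✶ K r ⊹ c (+ 24) ✶ (x ✶ X r) ⊹ x ✶ (x ✶ sχ₀ r x)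
    sκ₂ r x = c (-[1+ 11 ]) ✶ X r ⊹ c (+ 24) ✶ (x ✶ K r) ⊹ x ✶ (x ✶ sκ₀ r x)
    sχ₃ r x = c (-[1+ 11 ]) ✶ X r ⊹ c (+ 12) ✶ (x ✶ K r) ⊹ c (+ 36) ✶ (x ✶ (x ✶ X r)) ⊹ x ✶ (x ✶ (x ✶ sχ₀ r x))
    sκ₃ r x = c (-[1+ 11 ]) ✶ K r ⊹ c (-[1+ 35 ]) ✶ (x ✶ X r) ⊹ c (+ 36) ✶ (x ✶ (x ✶ K r)) ⊹ x ✶ (x ✶ (x ✶ sκ₀ r x))

    Weight : Set
    Weight = Res → Res → A → A → A

    -- T is the weight of a product of Lambert series, G its primitive under Euclid's algorithm,
    -- and Ψ (as a function of the second pair of arguments) an indefinite sum of 72 G along x + y = z.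
    T₀ G₀ Ψ₀ T₁ G₁ Ψ₁ T₂ G₂ Ψ₂ T₃ G₃ Ψ₃ T₄ G₄ Ψ₄ T₅ G₅ Ψ₅ : Weight

    T₀ r s x y = c (+ 3) ✶ (X r ✶ X s)
    G₀ r s x y = n1 ✶ (K r ⊹ K s ⊹ K (r ⊞ s))
    Ψ₀ t r z x = n2 ✶ sκ₀ r x ⊹ n3 ✶ X t ✶ sχ₀ r x ⊹ n2 ✶ K t ✶ s₀ r x ⊹ n1 ✶ K t ✶ sκ₀ r x

    T₁ r s x y = c (+ 2) ✶ (X r ✶ (K s ✶ y))
    G₁ r s x y = x ✶ X r ⊹ y ✶ X s ⊹ (x ⊹ y) ✶ X (r ⊞ s)
    Ψ₁ t r z x = c (+ 2) ✶ sχ₁ r x ⊹ n1 ✶ X t ✶ sκ₁ r x ⊹ K t ✶ sχ₁ r x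
      ⊹ z ✶ (c (+ 2) ✶ X t ✶ s₀ r x ⊹ X t ✶ sκ₀ r x ⊹ n1 ✶ K t ✶ sχ₀ r x)

    T₂ r s x y = (K r ✶ x) ✶ (K s ✶ y) ⊹ c (+ 6) ✶ (X r ✶ (X s ✶ (y ✶ y)))
    G₂ r s x y = (x ✶ x ⊹ x ✶ y ⊹ y ✶ y) ✶ K (r ⊞ s ⊞ s)
    Ψ₂ t r z x = n3 ✶ X t ✶ sχ₂ r x ⊹ K t ✶ sκ₂ r x ⊹ z ✶ (c (+ 3) ✶ X t ✶ sχ₁ r x ⊹ n1 ✶ K t ✶ sκ₁ r x)
      ⊹ z ✶ z ✶ (n3 ✶ X t ✶ sχ₀ r x ⊹ K t ✶ sκ₀ r x)

    T₃ r s x y = c (+ 18) ✶ (X r ✶ (X s ✶ (y ✶ y)))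
    G₃ r s x y = n1 ✶ (x ✶ x ✶ K r ⊹ y ✶ y ✶ K s ⊹ (x ⊹ y) ✶ (x ⊹ y) ✶ K (r ⊞ s)) ⊹ c (+ 2) ✶ G₂ r s x y
    Ψ₃ t r z x = n2 ✶ sκ₂ r x ⊹ c (-[1+ 8 ]) ✶ X t ✶ sχ₂ r x ⊹ K t ✶ sκ₂ r x ⊹ c (+ 12) ✶ z ✶ X t ✶ sχ₁ r x
      ⊹ z ✶ z ✶ (c (-[1+ 8 ]) ✶ X t ✶ sχ₀ r x ⊹ n2 ✶ K t ✶ s₀ r x ⊹ K t ✶ sκ₀ r x)

    T₄ r s x y = c (+ 6) ✶ (X r ✶ (K s ✶ (y ✶ (y ✶ y))))
    G₄ r s x y = x ✶ x ✶ x ✶ X r ⊹ y ✶ y ✶ y ✶ X s ⊹ (x ⊹ y) ✶ (x ⊹ y) ✶ (x ⊹ y) ✶ X (r ⊞ s)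
      ⊹ (c (+ 2) ✶ y ✶ y ✶ y ⊹ c (+ 3) ✶ x ✶ y ✶ y ⊹ n3 ✶ x ✶ x ✶ y ⊹ n2 ✶ x ✶ x ✶ x) ✶ X (r ⊞ s ⊞ s)
    Ψ₄ t r z x = c (+ 2) ✶ sχ₃ r x ⊹ n3 ✶ X t ✶ sκ₃ r x ⊹ n1 ✶ K t ✶ sχ₃ r x ⊹ c (+ 6) ✶ z ✶ X t ✶ sκ₂ r x ⊹ c (+ 6) ✶ z ✶ z ✶ K t ✶ sχ₁ r x
      ⊹ z ✶ z ✶ z ✶ (c (+ 2) ✶ X t ✶ s₀ r x ⊹ n1 ✶ X t ✶ sκ₀ r x ⊹ n3 ✶ K t ✶ sχ₀ r x)

    T₅ r s x y = c (+ 18) ✶ ((K r ✶ x) ✶ (X s ✶ (y ✶ y)))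
    G₅ r s x y = c (+ 2) ✶ (x ✶ x ✶ x ✶ X r ⊹ y ✶ y ✶ y ✶ X s ⊹ (x ⊹ y) ✶ (x ⊹ y) ✶ (x ⊹ y) ✶ X (r ⊞ s))
      ⊹ (n2 ✶ y ✶ y ✶ y ⊹ n3 ✶ x ✶ y ✶ y ⊹ c (+ 3) ✶ x ✶ x ✶ y ⊹ c (+ 2) ✶ x ✶ x ✶ x) ✶ X (r ⊞ s ⊞ s)
    Ψ₅ t r z x = c (+ 4) ✶ sχ₃ r x ⊹ c (+ 4) ✶ K t ✶ sχ₃ r x ⊹ z ✶ (c (+ 3) ✶ X t ✶ sκ₂ r x ⊹ c (-[1+ 8 ]) ✶ K t ✶ sχ₂ r x)
      ⊹ z ✶ z ✶ (c (-[1+ 8 ]) ✶ X t ✶ sκ₁ r x ⊹ c (+ 3) ✶ K t ✶ sχ₁ r x) ⊹ z ✶ z ✶ z ✶ (c (+ 4) ✶ X t ✶ s₀ r x ⊹ c (+ 4) ✶ X t ✶ sκ₀ r x)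

  module W = Weights _+ᶻ_ _*ᶻ_ id
  private module P = Weights (_⊞ᵖ_ {2}) _⊠ᵖ_ conᶻ

  -- The hypothesis of `bilinear` in terms of residues and values. Differences are written with a
  -- factor -1 because `Weights` provides only sums, products and constants.
  IsPrimitive : W.Weight → W.Weight → Set
  IsPrimitive T G = ∀ r s x y → T r (r ⊞ s) x (x +ᶻ y) +ᶻ T (r ⊞ s) r (x +ᶻ y) x ≡ + 2 *ᶻ (G r (r ⊞ s) x (x +ᶻ y) +ᶻ -[1+ 0 ] *ᶻ G r s x y)

  -- Along a + b = c the first two slots that matter, residue and value of c, stay fixed, and a
  -- moves by one. In 72 = 36 · 2 the 36 belongs to the elementary indefinite sums, and the 2 to
  -- addition formulas such as κ(t - r) = (κ(t)κ(r) + 3χ(t)χ(r))/2.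
  IsIndefiniteSum : W.Weight → W.Weight → Set
  IsIndefiniteSum G Ψ = ∀ r s x y → + 72 *ᶻ G r s x y ≡ Ψ (r ⊞ s) (next r) (x +ᶻ y) (1ℤ +ᶻ x) +ᶻ -[1+ 0 ] *ᶻ Ψ (r ⊞ s) r (x +ᶻ y) x

  IsSymmetric : W.Weight → Set
  IsSymmetric G = ∀ r s x y → G r s x y ≡ G s r y x

  private
    primEq : P.Weight → P.Weight → Res → Res → Polynomial 2 → Polynomial 2 → _
    primEq T G r s x y = T r (r ⊞ s) x (x ⊞ᵖ y) ⊞ᵖ T (r ⊞ s) r (x ⊞ᵖ y) x ≔ conᶻ (+ 2) ⊠ᵖ (G r (r ⊞ s) x (x ⊞ᵖ y) ⊞ᵖ conᶻ -[1+ 0 ] ⊠ᵖ G r s x y)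
    sumEq : P.Weight → P.Weight → Res → Res → Polynomial 2 → Polynomial 2 → _
    sumEq G Ψ r s x y = conᶻ (+ 72) ⊠ᵖ G r s x y ≔ Ψ (r ⊞ s) (next r) (x ⊞ᵖ y) (conᶻ 1ℤ ⊞ᵖ x) ⊞ᵖ conᶻ -[1+ 0 ] ⊠ᵖ Ψ (r ⊞ s) r (x ⊞ᵖ y) x
    symEq : P.Weight → Res → Res → Polynomial 2 → Polynomial 2 → _
    symEq G r s x y = G r s x y ≔ G s r y x
  -- By 3χ(r)χ(s) = κ(r - s) - κ(r + s), the symmetrised weight after one step is 2(κ(s) - κ(2r +
  -- s)), twice the increment of `G₀`. A pair of residues fixes all character values and leaves an
  -- identity of polynomials in x and y, here and for the other weights.
  isPrimitive₀ : IsPrimitive W.T₀ W.G₀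
  isPrimitive₀ r0 r0 = solveᶻ 2 (primEq P.T₀ P.G₀ r0 r0) refl
  isPrimitive₀ r0 r1 = solveᶻ 2 (primEq P.T₀ P.G₀ r0 r1) refl
  isPrimitive₀ r0 r2 = solveᶻ 2 (primEq P.T₀ P.G₀ r0 r2) refl
  isPrimitive₀ r1 r0 = solveᶻ 2 (primEq P.T₀ P.G₀ r1 r0) refl
  isPrimitive₀ r1 r1 = solveᶻ 2 (primEq P.T₀ P.G₀ r1 r1) refl
  isPrimitive₀ r1 r2 = solveᶻ 2 (primEq P.T₀ P.G₀ r1 r2) refl
  isPrimitive₀ r2 r0 = solveᶻ 2 (primEq P.T₀ P.G₀ r2 r0) refl
  isPrimitive₀ r2 r1 = solveᶻ 2 (primEq P.T₀ P.G₀ r2 r1) refl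
  isPrimitive₀ r2 r2 = solveᶻ 2 (primEq P.T₀ P.G₀ r2 r2) refl

  isSymmetric₀ : IsSymmetric W.G₀
  isSymmetric₀ r0 r0 = solveᶻ 2 (symEq P.G₀ r0 r0) refl
  isSymmetric₀ r0 r1 = solveᶻ 2 (symEq P.G₀ r0 r1) refl
  isSymmetric₀ r0 r2 = solveᶻ 2 (symEq P.G₀ r0 r2) refl
  isSymmetric₀ r1 r0 = solveᶻ 2 (symEq P.G₀ r1 r0) refl
  isSymmetric₀ r1 r1 = solveᶻ 2 (symEq P.G₀ r1 r1) refl
  isSymmetric₀ r1 r2 = solveᶻ 2 (symEq P.G₀ r1 r2) refl
  isSymmetric₀ r2 r0 = solveᶻ 2 (symEq P.G₀ r2 r0) refl
  isSymmetric₀ r2 r1 = solveᶻ 2 (symEq P.G₀ r2 r1) refl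
  isSymmetric₀ r2 r2 = solveᶻ 2 (symEq P.G₀ r2 r2) refl

  isIndefiniteSum₀ : IsIndefiniteSum W.G₀ W.Ψ₀
  isIndefiniteSum₀ r0 r0 = solveᶻ 2 (sumEq P.G₀ P.Ψ₀ r0 r0) refl
  isIndefiniteSum₀ r0 r1 = solveᶻ 2 (sumEq P.G₀ P.Ψ₀ r0 r1) refl
  isIndefiniteSum₀ r0 r2 = solveᶻ 2 (sumEq P.G₀ P.Ψ₀ r0 r2) refl
  isIndefiniteSum₀ r1 r0 = solveᶻ 2 (sumEq P.G₀ P.Ψ₀ r1 r0) refl
  isIndefiniteSum₀ r1 r1 = solveᶻ 2 (sumEq P.G₀ P.Ψ₀ r1 r1) refl
  isIndefiniteSum₀ r1 r2 = solveᶻ 2 (sumEq P.G₀ P.Ψ₀ r1 r2) refl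
  isIndefiniteSum₀ r2 r0 = solveᶻ 2 (sumEq P.G₀ P.Ψ₀ r2 r0) refl
  isIndefiniteSum₀ r2 r1 = solveᶻ 2 (sumEq P.G₀ P.Ψ₀ r2 r1) refl
  isIndefiniteSum₀ r2 r2 = solveᶻ 2 (sumEq P.G₀ P.Ψ₀ r2 r2) refl

  -- By χ(r)κ(s) = χ(r + s) + χ(r - s), the symmetrised weight is 2((2x + y)χ(2r + s) - yχ(s)),
  -- which is twice the increment of `G₁`.
  isPrimitive₁ : IsPrimitive W.T₁ W.G₁
  isPrimitive₁ r0 r0 = solveᶻ 2 (primEq P.T₁ P.G₁ r0 r0) refl
  isPrimitive₁ r0 r1 = solveᶻ 2 (primEq P.T₁ P.G₁ r0 r1) refl
  isPrimitive₁ r0 r2 = solveᶻ 2 (primEq P.T₁ P.G₁ r0 r2) refl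
  isPrimitive₁ r1 r0 = solveᶻ 2 (primEq P.T₁ P.G₁ r1 r0) refl
  isPrimitive₁ r1 r1 = solveᶻ 2 (primEq P.T₁ P.G₁ r1 r1) refl
  isPrimitive₁ r1 r2 = solveᶻ 2 (primEq P.T₁ P.G₁ r1 r2) refl
  isPrimitive₁ r2 r0 = solveᶻ 2 (primEq P.T₁ P.G₁ r2 r0) refl
  isPrimitive₁ r2 r1 = solveᶻ 2 (primEq P.T₁ P.G₁ r2 r1) refl
  isPrimitive₁ r2 r2 = solveᶻ 2 (primEq P.T₁ P.G₁ r2 r2) refl

  isSymmetric₁ : IsSymmetric W.G₁
  isSymmetric₁ r0 r0 = solveᶻ 2 (symEq P.G₁ r0 r0) refl
  isSymmetric₁ r0 r1 = solveᶻ 2 (symEq P.G₁ r0 r1) refl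
  isSymmetric₁ r0 r2 = solveᶻ 2 (symEq P.G₁ r0 r2) refl
  isSymmetric₁ r1 r0 = solveᶻ 2 (symEq P.G₁ r1 r0) refl
  isSymmetric₁ r1 r1 = solveᶻ 2 (symEq P.G₁ r1 r1) refl
  isSymmetric₁ r1 r2 = solveᶻ 2 (symEq P.G₁ r1 r2) refl
  isSymmetric₁ r2 r0 = solveᶻ 2 (symEq P.G₁ r2 r0) refl
  isSymmetric₁ r2 r1 = solveᶻ 2 (symEq P.G₁ r2 r1) refl
  isSymmetric₁ r2 r2 = solveᶻ 2 (symEq P.G₁ r2 r2) refl

  isIndefiniteSum₁ : IsIndefiniteSum W.G₁ W.Ψ₁
  isIndefiniteSum₁ r0 r0 = solveᶻ 2 (sumEq P.G₁ P.Ψ₁ r0 r0) refl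
  isIndefiniteSum₁ r0 r1 = solveᶻ 2 (sumEq P.G₁ P.Ψ₁ r0 r1) refl
  isIndefiniteSum₁ r0 r2 = solveᶻ 2 (sumEq P.G₁ P.Ψ₁ r0 r2) refl
  isIndefiniteSum₁ r1 r0 = solveᶻ 2 (sumEq P.G₁ P.Ψ₁ r1 r0) refl
  isIndefiniteSum₁ r1 r1 = solveᶻ 2 (sumEq P.G₁ P.Ψ₁ r1 r1) refl
  isIndefiniteSum₁ r1 r2 = solveᶻ 2 (sumEq P.G₁ P.Ψ₁ r1 r2) refl
  isIndefiniteSum₁ r2 r0 = solveᶻ 2 (sumEq P.G₁ P.Ψ₁ r2 r0) refl
  isIndefiniteSum₁ r2 r1 = solveᶻ 2 (sumEq P.G₁ P.Ψ₁ r2 r1) refl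
  isIndefiniteSum₁ r2 r2 = solveᶻ 2 (sumEq P.G₁ P.Ψ₁ r2 r2) refl

  -- Modulo 3, r + 2s is r - s. The two products in `T₂` are mixed so that the symmetrised weight is
  -- the increment of a single term, the norm form x² + xy + y² times κ(r - s).
  isPrimitive₂ : IsPrimitive W.T₂ W.G₂
  isPrimitive₂ r0 r0 = solveᶻ 2 (primEq P.T₂ P.G₂ r0 r0) refl
  isPrimitive₂ r0 r1 = solveᶻ 2 (primEq P.T₂ P.G₂ r0 r1) refl
  isPrimitive₂ r0 r2 = solveᶻ 2 (primEq P.T₂ P.G₂ r0 r2) refl
  isPrimitive₂ r1 r0 = solveᶻ 2 (primEq P.T₂ P.G₂ r1 r0) refl
  isPrimitive₂ r1 r1 = solveᶻ 2 (primEq P.T₂ P.G₂ r1 r1) refl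
  isPrimitive₂ r1 r2 = solveᶻ 2 (primEq P.T₂ P.G₂ r1 r2) refl
  isPrimitive₂ r2 r0 = solveᶻ 2 (primEq P.T₂ P.G₂ r2 r0) refl
  isPrimitive₂ r2 r1 = solveᶻ 2 (primEq P.T₂ P.G₂ r2 r1) refl
  isPrimitive₂ r2 r2 = solveᶻ 2 (primEq P.T₂ P.G₂ r2 r2) refl

  isSymmetric₂ : IsSymmetric W.G₂
  isSymmetric₂ r0 r0 = solveᶻ 2 (symEq P.G₂ r0 r0) refl
  isSymmetric₂ r0 r1 = solveᶻ 2 (symEq P.G₂ r0 r1) refl
  isSymmetric₂ r0 r2 = solveᶻ 2 (symEq P.G₂ r0 r2) refl
  isSymmetric₂ r1 r0 = solveᶻ 2 (symEq P.G₂ r1 r0) refl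
  isSymmetric₂ r1 r1 = solveᶻ 2 (symEq P.G₂ r1 r1) refl
  isSymmetric₂ r1 r2 = solveᶻ 2 (symEq P.G₂ r1 r2) refl
  isSymmetric₂ r2 r0 = solveᶻ 2 (symEq P.G₂ r2 r0) refl
  isSymmetric₂ r2 r1 = solveᶻ 2 (symEq P.G₂ r2 r1) refl
  isSymmetric₂ r2 r2 = solveᶻ 2 (symEq P.G₂ r2 r2) refl

  isIndefiniteSum₂ : IsIndefiniteSum W.G₂ W.Ψ₂
  isIndefiniteSum₂ r0 r0 = solveᶻ 2 (sumEq P.G₂ P.Ψ₂ r0 r0) refl
  isIndefiniteSum₂ r0 r1 = solveᶻ 2 (sumEq P.G₂ P.Ψ₂ r0 r1) refl
  isIndefiniteSum₂ r0 r2 = solveᶻ 2 (sumEq P.G₂ P.Ψ₂ r0 r2) refl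
  isIndefiniteSum₂ r1 r0 = solveᶻ 2 (sumEq P.G₂ P.Ψ₂ r1 r0) refl
  isIndefiniteSum₂ r1 r1 = solveᶻ 2 (sumEq P.G₂ P.Ψ₂ r1 r1) refl
  isIndefiniteSum₂ r1 r2 = solveᶻ 2 (sumEq P.G₂ P.Ψ₂ r1 r2) refl
  isIndefiniteSum₂ r2 r0 = solveᶻ 2 (sumEq P.G₂ P.Ψ₂ r2 r0) refl
  isIndefiniteSum₂ r2 r1 = solveᶻ 2 (sumEq P.G₂ P.Ψ₂ r2 r1) refl
  isIndefiniteSum₂ r2 r2 = solveᶻ 2 (sumEq P.G₂ P.Ψ₂ r2 r2) refl

  isPrimitive₃ : IsPrimitive W.T₃ W.G₃
  isPrimitive₃ r0 r0 = solveᶻ 2 (primEq P.T₃ P.G₃ r0 r0) refl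
  isPrimitive₃ r0 r1 = solveᶻ 2 (primEq P.T₃ P.G₃ r0 r1) refl
  isPrimitive₃ r0 r2 = solveᶻ 2 (primEq P.T₃ P.G₃ r0 r2) refl
  isPrimitive₃ r1 r0 = solveᶻ 2 (primEq P.T₃ P.G₃ r1 r0) refl
  isPrimitive₃ r1 r1 = solveᶻ 2 (primEq P.T₃ P.G₃ r1 r1) refl
  isPrimitive₃ r1 r2 = solveᶻ 2 (primEq P.T₃ P.G₃ r1 r2) refl
  isPrimitive₃ r2 r0 = solveᶻ 2 (primEq P.T₃ P.G₃ r2 r0) refl
  isPrimitive₃ r2 r1 = solveᶻ 2 (primEq P.T₃ P.G₃ r2 r1) refl
  isPrimitive₃ r2 r2 = solveᶻ 2 (primEq P.T₃ P.G₃ r2 r2) refl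

  isSymmetric₃ : IsSymmetric W.G₃
  isSymmetric₃ r0 r0 = solveᶻ 2 (symEq P.G₃ r0 r0) refl
  isSymmetric₃ r0 r1 = solveᶻ 2 (symEq P.G₃ r0 r1) refl
  isSymmetric₃ r0 r2 = solveᶻ 2 (symEq P.G₃ r0 r2) refl
  isSymmetric₃ r1 r0 = solveᶻ 2 (symEq P.G₃ r1 r0) refl
  isSymmetric₃ r1 r1 = solveᶻ 2 (symEq P.G₃ r1 r1) refl
  isSymmetric₃ r1 r2 = solveᶻ 2 (symEq P.G₃ r1 r2) refl
  isSymmetric₃ r2 r0 = solveᶻ 2 (symEq P.G₃ r2 r0) refl
  isSymmetric₃ r2 r1 = solveᶻ 2 (symEq P.G₃ r2 r1) refl
  isSymmetric₃ r2 r2 = solveᶻ 2 (symEq P.G₃ r2 r2) refl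

  isIndefiniteSum₃ : IsIndefiniteSum W.G₃ W.Ψ₃
  isIndefiniteSum₃ r0 r0 = solveᶻ 2 (sumEq P.G₃ P.Ψ₃ r0 r0) refl
  isIndefiniteSum₃ r0 r1 = solveᶻ 2 (sumEq P.G₃ P.Ψ₃ r0 r1) refl
  isIndefiniteSum₃ r0 r2 = solveᶻ 2 (sumEq P.G₃ P.Ψ₃ r0 r2) refl
  isIndefiniteSum₃ r1 r0 = solveᶻ 2 (sumEq P.G₃ P.Ψ₃ r1 r0) refl
  isIndefiniteSum₃ r1 r1 = solveᶻ 2 (sumEq P.G₃ P.Ψ₃ r1 r1) refl
  isIndefiniteSum₃ r1 r2 = solveᶻ 2 (sumEq P.G₃ P.Ψ₃ r1 r2) refl
  isIndefiniteSum₃ r2 r0 = solveᶻ 2 (sumEq P.G₃ P.Ψ₃ r2 r0) refl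
  isIndefiniteSum₃ r2 r1 = solveᶻ 2 (sumEq P.G₃ P.Ψ₃ r2 r1) refl
  isIndefiniteSum₃ r2 r2 = solveᶻ 2 (sumEq P.G₃ P.Ψ₃ r2 r2) refl

  isPrimitive₄ : IsPrimitive W.T₄ W.G₄
  isPrimitive₄ r0 r0 = solveᶻ 2 (primEq P.T₄ P.G₄ r0 r0) refl
  isPrimitive₄ r0 r1 = solveᶻ 2 (primEq P.T₄ P.G₄ r0 r1) refl
  isPrimitive₄ r0 r2 = solveᶻ 2 (primEq P.T₄ P.G₄ r0 r2) refl
  isPrimitive₄ r1 r0 = solveᶻ 2 (primEq P.T₄ P.G₄ r1 r0) refl
  isPrimitive₄ r1 r1 = solveᶻ 2 (primEq P.T₄ P.G₄ r1 r1) refl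
  isPrimitive₄ r1 r2 = solveᶻ 2 (primEq P.T₄ P.G₄ r1 r2) refl
  isPrimitive₄ r2 r0 = solveᶻ 2 (primEq P.T₄ P.G₄ r2 r0) refl
  isPrimitive₄ r2 r1 = solveᶻ 2 (primEq P.T₄ P.G₄ r2 r1) refl
  isPrimitive₄ r2 r2 = solveᶻ 2 (primEq P.T₄ P.G₄ r2 r2) refl

  isSymmetric₄ : IsSymmetric W.G₄
  isSymmetric₄ r0 r0 = solveᶻ 2 (symEq P.G₄ r0 r0) refl
  isSymmetric₄ r0 r1 = solveᶻ 2 (symEq P.G₄ r0 r1) refl
  isSymmetric₄ r0 r2 = solveᶻ 2 (symEq P.G₄ r0 r2) refl
  isSymmetric₄ r1 r0 = solveᶻ 2 (symEq P.G₄ r1 r0) refl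
  isSymmetric₄ r1 r1 = solveᶻ 2 (symEq P.G₄ r1 r1) refl
  isSymmetric₄ r1 r2 = solveᶻ 2 (symEq P.G₄ r1 r2) refl
  isSymmetric₄ r2 r0 = solveᶻ 2 (symEq P.G₄ r2 r0) refl
  isSymmetric₄ r2 r1 = solveᶻ 2 (symEq P.G₄ r2 r1) refl
  isSymmetric₄ r2 r2 = solveᶻ 2 (symEq P.G₄ r2 r2) refl

  isIndefiniteSum₄ : IsIndefiniteSum W.G₄ W.Ψ₄
  isIndefiniteSum₄ r0 r0 = solveᶻ 2 (sumEq P.G₄ P.Ψ₄ r0 r0) refl
  isIndefiniteSum₄ r0 r1 = solveᶻ 2 (sumEq P.G₄ P.Ψ₄ r0 r1) refl
  isIndefiniteSum₄ r0 r2 = solveᶻ 2 (sumEq P.G₄ P.Ψ₄ r0 r2) refl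
  isIndefiniteSum₄ r1 r0 = solveᶻ 2 (sumEq P.G₄ P.Ψ₄ r1 r0) refl
  isIndefiniteSum₄ r1 r1 = solveᶻ 2 (sumEq P.G₄ P.Ψ₄ r1 r1) refl
  isIndefiniteSum₄ r1 r2 = solveᶻ 2 (sumEq P.G₄ P.Ψ₄ r1 r2) refl
  isIndefiniteSum₄ r2 r0 = solveᶻ 2 (sumEq P.G₄ P.Ψ₄ r2 r0) refl
  isIndefiniteSum₄ r2 r1 = solveᶻ 2 (sumEq P.G₄ P.Ψ₄ r2 r1) refl
  isIndefiniteSum₄ r2 r2 = solveᶻ 2 (sumEq P.G₄ P.Ψ₄ r2 r2) refl

  isPrimitive₅ : IsPrimitive W.T₅ W.G₅
  isPrimitive₅ r0 r0 = solveᶻ 2 (primEq P.T₅ P.G₅ r0 r0) refl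
  isPrimitive₅ r0 r1 = solveᶻ 2 (primEq P.T₅ P.G₅ r0 r1) refl
  isPrimitive₅ r0 r2 = solveᶻ 2 (primEq P.T₅ P.G₅ r0 r2) refl
  isPrimitive₅ r1 r0 = solveᶻ 2 (primEq P.T₅ P.G₅ r1 r0) refl
  isPrimitive₅ r1 r1 = solveᶻ 2 (primEq P.T₅ P.G₅ r1 r1) refl
  isPrimitive₅ r1 r2 = solveᶻ 2 (primEq P.T₅ P.G₅ r1 r2) refl
  isPrimitive₅ r2 r0 = solveᶻ 2 (primEq P.T₅ P.G₅ r2 r0) refl
  isPrimitive₅ r2 r1 = solveᶻ 2 (primEq P.T₅ P.G₅ r2 r1) refl
  isPrimitive₅ r2 r2 = solveᶻ 2 (primEq P.T₅ P.G₅ r2 r2) refl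

  isSymmetric₅ : IsSymmetric W.G₅
  isSymmetric₅ r0 r0 = solveᶻ 2 (symEq P.G₅ r0 r0) refl
  isSymmetric₅ r0 r1 = solveᶻ 2 (symEq P.G₅ r0 r1) refl
  isSymmetric₅ r0 r2 = solveᶻ 2 (symEq P.G₅ r0 r2) refl
  isSymmetric₅ r1 r0 = solveᶻ 2 (symEq P.G₅ r1 r0) refl
  isSymmetric₅ r1 r1 = solveᶻ 2 (symEq P.G₅ r1 r1) refl
  isSymmetric₅ r1 r2 = solveᶻ 2 (symEq P.G₅ r1 r2) refl
  isSymmetric₅ r2 r0 = solveᶻ 2 (symEq P.G₅ r2 r0) refl
  isSymmetric₅ r2 r1 = solveᶻ 2 (symEq P.G₅ r2 r1) refl
  isSymmetric₅ r2 r2 = solveᶻ 2 (symEq P.G₅ r2 r2) refl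

  isIndefiniteSum₅ : IsIndefiniteSum W.G₅ W.Ψ₅
  isIndefiniteSum₅ r0 r0 = solveᶻ 2 (sumEq P.G₅ P.Ψ₅ r0 r0) refl
  isIndefiniteSum₅ r0 r1 = solveᶻ 2 (sumEq P.G₅ P.Ψ₅ r0 r1) refl
  isIndefiniteSum₅ r0 r2 = solveᶻ 2 (sumEq P.G₅ P.Ψ₅ r0 r2) refl
  isIndefiniteSum₅ r1 r0 = solveᶻ 2 (sumEq P.G₅ P.Ψ₅ r1 r0) refl
  isIndefiniteSum₅ r1 r1 = solveᶻ 2 (sumEq P.G₅ P.Ψ₅ r1 r1) refl
  isIndefiniteSum₅ r1 r2 = solveᶻ 2 (sumEq P.G₅ P.Ψ₅ r1 r2) refl
  isIndefiniteSum₅ r2 r0 = solveᶻ 2 (sumEq P.G₅ P.Ψ₅ r2 r0) refl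
  isIndefiniteSum₅ r2 r1 = solveᶻ 2 (sumEq P.G₅ P.Ψ₅ r2 r1) refl
  isIndefiniteSum₅ r2 r2 = solveᶻ 2 (sumEq P.G₅ P.Ψ₅ r2 r2) refl

open ResidueWeights

-- Lambert series and the closed form of their products.

module LambertSeries where

  open +-*-Solver using (Polynomial) renaming (solve to solveᶻ; _:+_ to infixl 6 _⊞ᵖ_; _:*_ to infixl 7 _⊠ᵖ_; con to conᶻ; _:=_ to _≔_)
  -- The coefficient of q^n is the sum of p(a)ψ(d) over ad = n. Stopping at a = n loses nothing
  -- because `geo ψ a` is divisible by q^a.
  Lam : (ℕ → ℤ) → (ℕ → ℤ) → Series
  Lam p ψ n = ∑₁ n (λ a → p a *ᶻ geo ψ a n)

  geo-vanish : ∀ ψ a .{{_ : NonZero a}} {n} → n < a → geo ψ a n ≡ 0ℤ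
  geo-vanish ψ a {zero} _ = V-0 a (dropConst ψ)
  geo-vanish ψ a {suc n} n<a = V-< a (dropConst ψ) n<a

  Lam-extend : ∀ p ψ {n N} → n ≤ N → Lam p ψ n ≡ ∑₁ N (λ a → p a *ᶻ geo ψ a n)
  Lam-extend p ψ n≤N = ∑-extend n≤N (λ i n≤i → trans (cong (p (suc i) *ᶻ_) (geo-vanish ψ (suc i) (s≤s n≤i))) (ℤₚ.*-zeroʳ (p (suc i))))

  ⊛-∑ˡ : ∀ N n (p : ℕ → ℤ) (g : ℕ → Series) h → ((λ i → ∑₁ N (λ a → p a *ᶻ g a i)) ⊛ h) n ≡ ∑₁ N (λ a → p a *ᶻ (g a ⊛ h) n)
  ⊛-∑ˡ N n p g h = trans (⊛-coeff (λ i → ∑₁ N (λ a → p a *ᶻ g a i)) h n) (trans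
    (∑-cong (suc n) (λ i → trans (sym (∑-*ʳ N (h (n ∸ i)) (λ a → p (suc a) *ᶻ g (suc a) i))) (∑₁-cong N (λ a → ℤₚ.*-assoc (p a) (g a i) (h (n ∸ i))))))
    (trans (∑-swap (suc n) N (λ i a → p (suc a) *ᶻ (g (suc a) i *ᶻ h (n ∸ i))))
      (∑₁-cong N (λ a → trans (∑-*ˡ (suc n) (p a) (λ i → g a i *ᶻ h (n ∸ i))) (cong (p a *ᶻ_) (sym (⊛-coeff (g a) h n)))))))

  Lam-* : ∀ p ψ r φ n → (Lam p ψ *ˢ Lam r φ) n ≡ ∑∑ n (λ a b → p a *ᶻ r b *ᶻ (geo ψ a *ˢ geo φ b) n)
  Lam-* p ψ r φ n = trans (*ˢ-at (Lam p ψ) (Lam r φ) n) (trans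
    (⊛-cong≤ n {Lam p ψ} {λ i → ∑₁ n (λ a → p a *ᶻ geo ψ a i)} {Lam r φ} {λ i → ∑₁ n (λ b → r b *ᶻ geo φ b i)} (λ i i≤n → Lam-extend p ψ i≤n) (λ i i≤n → Lam-extend r φ i≤n))
    (trans (⊛-∑ˡ n n p (geo ψ) (λ i → ∑₁ n (λ b → r b *ᶻ geo φ b i)))
      (∑₁-cong n (λ a → trans (cong (p a *ᶻ_) (trans (⊛-comm (geo ψ a) (λ i → ∑₁ n (λ b → r b *ᶻ geo φ b i)) n) (⊛-∑ˡ n n r (geo φ) (geo ψ a))))
        (trans (sym (∑-*ˡ n (p a) (λ b → r (suc b) *ᶻ (geo φ (suc b) ⊛ geo ψ a) n)))
          (∑₁-cong n (λ b → trans (sym (ℤₚ.*-assoc (p a) (r b) _)) (cong (p a *ᶻ r b *ᶻ_) (trans (⊛-comm (geo φ b) (geo ψ a) n) (sym (*ˢ-at (geo ψ a) (geo φ b) n)))))))))))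

  Lam-cong : ∀ {p p' ψ} → (∀ a → p a ≡ p' a) → Lam p ψ ≈ Lam p' ψ
  Lam-cong {ψ = ψ} h = mk≈ λ n → ∑₁-cong n (λ a → cong (_*ᶻ geo ψ a n) (h a))

  wt : W.Weight → ℕ → ℕ → ℤ
  wt T a b = T (res a) (res b) (+ a) (+ b)

  -- Divisor sums of weight 1 to 5: parity pairs the odd function χ with even powers and the even
  -- function κ with odd ones.
  p₀ p₁ p₂ p₃ p₄ : Res → ℤ → ℤ
  p₀ r x = χᵣ r
  p₁ r x = κᵣ r *ᶻ x
  p₂ r x = χᵣ r *ᶻ (x *ᶻ x)
  p₃ r x = κᵣ r *ᶻ (x *ᶻ (x *ᶻ x))
  p₄ r x = χᵣ r *ᶻ (x *ᶻ (x *ᶻ (x *ᶻ x)))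

  at-res : (Res → ℤ → ℤ) → ℕ → ℤ
  at-res p a = p (res a) (+ a)

  α₀ α₁ α₂ α₃ α₄ : Series
  α₀ = Lam (at-res p₀) ones
  α₁ = Lam (at-res p₁) ones
  α₂ = Lam (at-res p₂) ones
  α₃ = Lam (at-res p₃) ones
  α₄ = Lam (at-res p₄) ones

  +-nonZero : ∀ a b .{{_ : NonZero a}} → NonZero (a + b)
  +-nonZero (suc a) b = _

  -- The coefficient form of θ x = a(x + x²). The square on the diagonal turns into x with the
  -- factor n - a, and the n becomes a θ.
  xs-diag : ∀ a .{{_ : NonZero a}} n → + a *ᶻ (xs a *ˢ xs a) n ≡ (+ n -ᶻ + a) *ᶻ xs a n
  xs-diag a n = trans (move (at (θxs a) n)) (sym (ℤₚ.*-distribʳ-+ (xs a n) (+ n) (-ᶻ + a)) )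
    where
    ring : ∀ a x y → a *ᶻ y ≡ a *ᶻ (x +ᶻ y) +ᶻ -ᶻ a *ᶻ x
    ring = solve-∀
    expand : (constˢ (+ a) *ˢ (xs a *ˢ (1ˢ +ˢ xs a))) n ≡ + a *ᶻ (xs a n +ᶻ (xs a *ˢ xs a) n)
    expand = trans (const-* (+ a) _ n) (cong (+ a *ᶻ_) (trans (at (𝒮.distribˡ (xs a) 1ˢ (xs a)) n) (trans (+ˢ-at (xs a *ˢ 1ˢ) (xs a *ˢ xs a) n) (cong (_+ᶻ (xs a *ˢ xs a) n) (at (𝒮.*-identityʳ (xs a)) n)))))
    move : θ (xs a) n ≡ (constˢ (+ a) *ˢ (xs a *ˢ (1ˢ +ˢ xs a))) n → + a *ᶻ (xs a *ˢ xs a) n ≡ + n *ᶻ xs a n +ᶻ -ᶻ + a *ᶻ xs a n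
    move e = trans (ring (+ a) (xs a n) ((xs a *ˢ xs a) n)) (cong (_+ᶻ -ᶻ + a *ᶻ xs a n) (trans (sym expand) (sym e)))

  *ˢ-vanish : ∀ f g {n} → (∀ i → i ≤ n → f i ≡ 0ℤ) → (f *ˢ g) n ≡ 0ℤ
  *ˢ-vanish f g {n} f0 = trans (*ˢ-at f g n) (trans (⊛-coeff f g n) (∑-zero (suc n) (λ i i<n → cong (_*ᶻ g (n ∸ i)) (f0 i (ℕₚ.≤-pred i<n)))))

  geo-*-vanish : ∀ ψ g a {n} → n < a → (geo ψ a *ˢ g) n ≡ 0ℤ
  geo-*-vanish ψ g a@(suc _) n<a = *ˢ-vanish (geo ψ a) g (λ i i≤n → geo-vanish ψ a (ℕₚ.≤-<-trans i≤n n<a))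

  ∑-telescope : ∀ m (F : ℕ → ℤ) → ∑₁ m (λ a → F (suc a) +ᶻ -[1+ 0 ] *ᶻ F a) ≡ F (suc m) +ᶻ -[1+ 0 ] *ᶻ F 1
  ∑-telescope zero F = sym (cancel (F 1))
    where
    cancel : ∀ x → x +ᶻ -[1+ 0 ] *ᶻ x ≡ 0ℤ
    cancel = solve-∀
  ∑-telescope (suc m) F = trans (∑-last m (λ i → F (suc (suc i)) +ᶻ -[1+ 0 ] *ᶻ F (suc i))) (trans (cong (_+ᶻ (F (suc (suc m)) +ᶻ -[1+ 0 ] *ᶻ F (suc m))) (∑-telescope m F)) (ring (F (suc m)) (F 1) (F (suc (suc m)))))
    where
    ring : ∀ x y z → x +ᶻ -[1+ 0 ] *ᶻ y +ᶻ (z +ᶻ -[1+ 0 ] *ᶻ x) ≡ z +ᶻ -[1+ 0 ] *ᶻ y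
    ring = solve-∀

  module _ (n : ℕ) where

    private
      X : ℕ → ℕ → ℤ
      X a b = (xs a *ˢ xs b) n

      d : ℕ → ℤ
      d c = xs c n

      X-rel : ∀ a b .{{_ : NonZero a}} .{{_ : NonZero b}} → X a b ≡ d (a + b) +ᶻ X (a + b) a +ᶻ X (a + b) b
      X-rel a b = trans (at (xs-xs a b {{it}} {{it}} {{+-nonZero a b}}) n) (trans (at (distrib (xs (a + b)) (xs a) (xs b)) n)
        (trans (+ˢ-at (xs (a + b) +ˢ xs (a + b) *ˢ xs a) (xs (a + b) *ˢ xs b) n) (cong (_+ᶻ X (a + b) b) (+ˢ-at (xs (a + b)) (xs (a + b) *ˢ xs a) n))))
        where
        open SeriesSolver using (solve; _:=_; _:+_; _:*_; con)
        distrib : ∀ c a b → c *ˢ (1ˢ +ˢ a +ˢ b) ≈ c +ˢ c *ˢ a +ˢ c *ˢ b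
        distrib = solve 3 (λ c a b → c :* (con 1ℤ :+ a :+ b) := c :+ c :* a :+ c :* b) ≈-refl

      d-vanish : ∀ c → n < c → d c ≡ 0ℤ
      d-vanish (suc c) n<c = geo-vanish ones (suc c) n<c

    open Symmetric n X d (λ a b → at (*ˢ-comm (xs a) (xs b)) n) (λ a b n<a → geo-*-vanish ones (xs b) a n<a) d-vanish X-rel public

    module _ {T G Ψ : W.Weight} (T-G : IsPrimitive T G) (G-sym : IsSymmetric G) (G-Ψ : IsIndefiniteSum G Ψ) where

      Ψ-closed : ℕ → ℤ
      Ψ-closed c = Ψ (res c) (res c) (+ c) (+ c) +ᶻ -[1+ 0 ] *ᶻ Ψ (res c) r1 (+ c) 1ℤ

      -- The residue and the value of a + (c - a) do not depend on a, so the sum telescopes in a.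
      inner-sum : ∀ c .{{_ : NonZero c}} → + 72 *ᶻ ∑₁ (ℕ.pred c) (λ a → wt G a (c ∸ a)) ≡ Ψ-closed c
      inner-sum (suc m) = trans (sym (∑-*ˡ m (+ 72) (λ i → wt G (suc i) (m ∸ i)))) (trans
        (∑₁-cong≤ m (λ a a≤m → step a (suc m ∸ a) (ℕₚ.m+[n∸m]≡n (ℕₚ.≤-trans a≤m (ℕₚ.n≤1+n m)))))
        (∑-telescope m (λ a → Ψ (res (suc m)) (res a) (+ suc m) (+ a))))
        where
        step : ∀ a b {c} → a + b ≡ c → + 72 *ᶻ wt G a b ≡ Ψ (res c) (res (suc a)) (+ c) (+ suc a) +ᶻ -[1+ 0 ] *ᶻ Ψ (res c) (res a) (+ c) (+ a)
        step a b refl = trans (G-Ψ (res a) (res b) (+ a) (+ b)) (cong (λ t → Ψ t (next (res a)) (+ (a + b)) (+ suc a) +ᶻ -[1+ 0 ] *ᶻ Ψ t (res a) (+ (a + b)) (+ a)) (sym (res-+ a b)))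

      weighted-sum : + 72 *ᶻ ∑∑ n (λ a b → wt T a b *ᶻ X a b) ≡
        ∑₁ n (λ c → Ψ-closed c *ᶻ d c) +ᶻ ∑₁ n (λ a → + 72 *ᶻ ((wt T a a -ᶻ wt G a a) *ᶻ X a a))
      weighted-sum = trans (cong (+ 72 *ᶻ_) (bilinear (wt T) (wt G) (λ a b → G-sym (res a) (res b) (+ a) (+ b)) T-G′))
        (trans (ℤₚ.*-distribˡ-+ (+ 72) (∑₁ n (λ c → ∑₁ (ℕ.pred c) (λ a → wt G a (c ∸ a)) *ᶻ d c)) (∑₁ n (λ a → (wt T a a -ᶻ wt G a a) *ᶻ X a a)))
        (cong₂ _+ᶻ_ (trans (sym (∑-*ˡ n (+ 72) (λ i → ∑₁ i (λ a → wt G a (suc i ∸ a)) *ᶻ d (suc i))))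
             (∑₁-cong n (λ c → trans (sym (ℤₚ.*-assoc (+ 72) (∑₁ (ℕ.pred c) (λ a → wt G a (c ∸ a))) (d c))) (cong (_*ᶻ d c) (inner-sum c)))))
           (sym (∑-*ˡ n (+ 72) (λ i → (wt T (suc i) (suc i) -ᶻ wt G (suc i) (suc i)) *ᶻ X (suc i) (suc i))))))
        where
        neg : ∀ u v → u +ᶻ -[1+ 0 ] *ᶻ v ≡ u -ᶻ v
        neg = solve-∀
        T-G′ : ∀ a b → wt T a (a + b) +ᶻ wt T (a + b) a ≡ + 2 *ᶻ (wt G a (a + b) -ᶻ wt G a b)
        T-G′ a b = subst (λ t → T (res a) t (+ a) (+ (a + b)) +ᶻ T t (res a) (+ (a + b)) (+ a) ≡ + 2 *ᶻ (G (res a) t (+ a) (+ (a + b)) -ᶻ wt G a b)) (sym (res-+ a b))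
          (trans (T-G (res a) (res b) (+ a) (+ b)) (cong (+ 2 *ᶻ_) (neg (G (res a) (res a ⊞ res b) (+ a) (+ (a + b))) (wt G a b))))

      -- On the diagonal T - G has a factor x, and `xs-diag` trades x X(a,a) for (n - x) x_a. The
      -- coefficients u therefore may depend on n, while the hypothesis `close` only compares
      -- polynomials for each residue.
      lambert-product : ∀ (η : Res → ℤ → ℤ) (u₀ u₁ u₂ u₃ u₄ : ℤ → ℤ) →
        (∀ r x → T r r x x -ᶻ G r r x x ≡ η r x *ᶻ x) →
        (∀ r m x → Ψ r r x x +ᶻ -[1+ 0 ] *ᶻ Ψ r r1 x 1ℤ +ᶻ + 72 *ᶻ (η r x *ᶻ (m -ᶻ x)) ≡
          u₀ m *ᶻ p₀ r x +ᶻ u₁ m *ᶻ p₁ r x +ᶻ u₂ m *ᶻ p₂ r x +ᶻ u₃ m *ᶻ p₃ r x +ᶻ u₄ m *ᶻ p₄ r x) →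
        + 72 *ᶻ ∑∑ n (λ a b → wt T a b *ᶻ X a b) ≡
          u₀ (+ n) *ᶻ α₀ n +ᶻ u₁ (+ n) *ᶻ α₁ n +ᶻ u₂ (+ n) *ᶻ α₂ n +ᶻ u₃ (+ n) *ᶻ α₃ n +ᶻ u₄ (+ n) *ᶻ α₄ n
      lambert-product η u₀ u₁ u₂ u₃ u₄ diag close = trans weighted-sum (trans (sym (∑-+ n (λ i → Ψ-closed (suc i) *ᶻ d (suc i)) (λ i → + 72 *ᶻ ((wt T (suc i) (suc i) -ᶻ wt G (suc i) (suc i)) *ᶻ X (suc i) (suc i)))))
        (trans (∑₁-cong n term) (trans (∑-lin₅ (at-res p₀) (at-res p₁) (at-res p₂) (at-res p₃) (at-res p₄) (u₀ (+ n)) (u₁ (+ n)) (u₂ (+ n)) (u₃ (+ n)) (u₄ (+ n))) refl)))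
        where
        ∑-lin₅ : ∀ (q₀ q₁ q₂ q₃ q₄ : ℕ → ℤ) v₀ v₁ v₂ v₃ v₄ → ∑₁ n (λ c → (v₀ *ᶻ q₀ c +ᶻ v₁ *ᶻ q₁ c +ᶻ v₂ *ᶻ q₂ c +ᶻ v₃ *ᶻ q₃ c +ᶻ v₄ *ᶻ q₄ c) *ᶻ d c) ≡
          v₀ *ᶻ Lam q₀ ones n +ᶻ v₁ *ᶻ Lam q₁ ones n +ᶻ v₂ *ᶻ Lam q₂ ones n +ᶻ v₃ *ᶻ Lam q₃ ones n +ᶻ v₄ *ᶻ Lam q₄ ones n
        ∑-lin₅ q₀ q₁ q₂ q₃ q₄ v₀ v₁ v₂ v₃ v₄ = trans (add (λ c → v₀ *ᶻ q₀ c +ᶻ v₁ *ᶻ q₁ c +ᶻ v₂ *ᶻ q₂ c +ᶻ v₃ *ᶻ q₃ c) (λ c → v₄ *ᶻ q₄ c)) (cong₂ _+ᶻ_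
          (trans (add (λ c → v₀ *ᶻ q₀ c +ᶻ v₁ *ᶻ q₁ c +ᶻ v₂ *ᶻ q₂ c) (λ c → v₃ *ᶻ q₃ c)) (cong₂ _+ᶻ_
          (trans (add (λ c → v₀ *ᶻ q₀ c +ᶻ v₁ *ᶻ q₁ c) (λ c → v₂ *ᶻ q₂ c)) (cong₂ _+ᶻ_
          (trans (add (λ c → v₀ *ᶻ q₀ c) (λ c → v₁ *ᶻ q₁ c)) (cong₂ _+ᶻ_ (mul v₀ q₀) (mul v₁ q₁))) (mul v₂ q₂))) (mul v₃ q₃))) (mul v₄ q₄))
          where
          add : ∀ (f g : ℕ → ℤ) → ∑₁ n (λ c → (f c +ᶻ g c) *ᶻ d c) ≡ ∑₁ n (λ c → f c *ᶻ d c) +ᶻ ∑₁ n (λ c → g c *ᶻ d c)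
          add f g = trans (∑₁-cong n (λ c → ℤₚ.*-distribʳ-+ (d c) (f c) (g c))) (∑-+ n (λ i → f (suc i) *ᶻ d (suc i)) (λ i → g (suc i) *ᶻ d (suc i)))
          mul : ∀ v (q : ℕ → ℤ) → ∑₁ n (λ c → (v *ᶻ q c) *ᶻ d c) ≡ v *ᶻ Lam q ones n
          mul v q = trans (∑₁-cong n (λ c → ℤₚ.*-assoc v (q c) (d c))) (∑-*ˡ n v (λ i → q (suc i) *ᶻ d (suc i)))
        ring : ∀ ψ e a m x → ψ *ᶻ x +ᶻ + 72 *ᶻ (e *ᶻ ((m -ᶻ a) *ᶻ x)) ≡ (ψ +ᶻ + 72 *ᶻ (e *ᶻ (m -ᶻ a))) *ᶻ x
        ring = solve-∀
        term : ∀ c .{{_ : NonZero c}} → Ψ-closed c *ᶻ d c +ᶻ + 72 *ᶻ ((wt T c c -ᶻ wt G c c) *ᶻ X c c) ≡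
          (u₀ (+ n) *ᶻ at-res p₀ c +ᶻ u₁ (+ n) *ᶻ at-res p₁ c +ᶻ u₂ (+ n) *ᶻ at-res p₂ c +ᶻ u₃ (+ n) *ᶻ at-res p₃ c +ᶻ u₄ (+ n) *ᶻ at-res p₄ c) *ᶻ d c
        term c = trans (cong (λ z → Ψ-closed c *ᶻ d c +ᶻ + 72 *ᶻ z) (trans (cong (_*ᶻ X c c) (diag (res c) (+ c))) (trans (ℤₚ.*-assoc (η (res c) (+ c)) (+ c) (X c c)) (cong (η (res c) (+ c) *ᶻ_) (xs-diag c n)))))
          (trans (ring (Ψ-closed c) (η (res c) (+ c)) (+ c) (+ n) (d c)) (cong (_*ᶻ d c) (close (res c) (+ n) (+ c))))

open LambertSeries

-- Six identities for products of Lambert series with the character on the divisor.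

module LambertProducts where

  open +-*-Solver using (Polynomial) renaming (solve to solveᶻ; _:+_ to infixl 6 _⊞ᵖ_; _:*_ to infixl 7 _⊠ᵖ_; _:-_ to infixl 6 _⊟ᵖ_; con to conᶻ; _:=_ to _≔_)
  private module P = Weights (_⊞ᵖ_ {2}) _⊠ᵖ_ conᶻ

  private
    closedEq : P.Weight → (Res → Polynomial 2 → Polynomial 2) → (u₀ u₁ u₂ u₃ u₄ : Polynomial 2 → Polynomial 2) → Res → Polynomial 2 → Polynomial 2 → _
    closedEq Ψ η u₀ u₁ u₂ u₃ u₄ r m x =
      Ψ r r x x ⊞ᵖ conᶻ -[1+ 0 ] ⊠ᵖ Ψ r r1 x (conᶻ 1ℤ) ⊞ᵖ conᶻ (+ 72) ⊠ᵖ (η r x ⊠ᵖ (m ⊟ᵖ x)) ≔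
      u₀ m ⊠ᵖ P.X r ⊞ᵖ u₁ m ⊠ᵖ (P.K r ⊠ᵖ x) ⊞ᵖ u₂ m ⊠ᵖ (P.X r ⊠ᵖ (x ⊠ᵖ x)) ⊞ᵖ u₃ m ⊠ᵖ (P.K r ⊠ᵖ (x ⊠ᵖ (x ⊠ᵖ x))) ⊞ᵖ u₄ m ⊠ᵖ (P.X r ⊠ᵖ (x ⊠ᵖ (x ⊠ᵖ (x ⊠ᵖ x))))

    lin : ℤ → ℤ → ℤ → ℤ
    lin a b m = a +ᶻ b *ᶻ m
    linᵖ : ℤ → ℤ → Polynomial 2 → Polynomial 2
    linᵖ a b m = conᶻ a ⊞ᵖ conᶻ b ⊠ᵖ m

    scaled : ∀ n c (p r : Res → ℤ → ℤ) → ∑∑ n (λ a b → c *ᶻ (at-res p a *ᶻ at-res r b) *ᶻ (xs a *ˢ xs b) n) ≡ c *ᶻ (Lam (at-res p) ones *ˢ Lam (at-res r) ones) n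
    scaled n c p r = trans (∑∑-cong n (λ a b → ℤₚ.*-assoc c (at-res p a *ᶻ at-res r b) ((xs a *ˢ xs b) n)))
      (trans (∑∑-*ˡ n c (λ a b → at-res p a *ᶻ at-res r b *ᶻ (xs a *ˢ xs b) n)) (cong (c *ᶻ_) (sym (Lam-* (at-res p) ones (at-res r) ones n))))

  -- The term -144 n is 72 η n with the diagonal quotient η = -2χ; divided by 24 it will be -6 θα₀.
  product₁ : ∀ n → + 72 *ᶻ (+ 2 *ᶻ (α₀ *ˢ α₁) n) ≡
    lin (+ 48) -[1+ 143 ] (+ n) *ᶻ α₀ n +ᶻ -[1+ 23 ] *ᶻ α₁ n +ᶻ + 72 *ᶻ α₂ n +ᶻ 0ℤ *ᶻ α₃ n +ᶻ 0ℤ *ᶻ α₄ n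
  product₁ n = trans (cong (+ 72 *ᶻ_) (sym (scaled n (+ 2) p₀ p₁)))
    (lambert-product n {W.T₁} {W.G₁} {W.Ψ₁} isPrimitive₁ isSymmetric₁ isIndefiniteSum₁ (λ r x → -[1+ 1 ] *ᶻ χᵣ r)
      (lin (+ 48) -[1+ 143 ]) (λ _ → -[1+ 23 ]) (λ _ → + 72) (λ _ → 0ℤ) (λ _ → 0ℤ) diag close)
    where
    diagEq : Res → Polynomial 1 → _
    diagEq r x = D.T₁ r r x x ⊟ᵖ D.G₁ r r x x ≔ (conᶻ -[1+ 1 ] ⊠ᵖ conᶻ (χᵣ r)) ⊠ᵖ x
      where module D = Weights (_⊞ᵖ_ {1}) _⊠ᵖ_ conᶻ
    diag : ∀ r x → W.T₁ r r x x -ᶻ W.G₁ r r x x ≡ (-[1+ 1 ] *ᶻ χᵣ r) *ᶻ x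
    diag r0 = solveᶻ 1 (diagEq r0) refl
    diag r1 = solveᶻ 1 (diagEq r1) refl
    diag r2 = solveᶻ 1 (diagEq r2) refl
    eq : Res → Polynomial 2 → Polynomial 2 → _
    eq = closedEq P.Ψ₁ (λ r x → conᶻ -[1+ 1 ] ⊠ᵖ conᶻ (χᵣ r)) (linᵖ (+ 48) -[1+ 143 ]) (λ _ → conᶻ -[1+ 23 ]) (λ _ → conᶻ (+ 72)) (λ _ → conᶻ 0ℤ) (λ _ → conᶻ 0ℤ)
    close : ∀ r m x → _ ≡ _
    close r0 = solveᶻ 2 (eq r0) refl
    close r1 = solveᶻ 2 (eq r1) refl
    close r2 = solveᶻ 2 (eq r2) refl

  product₂ : ∀ n → + 72 *ᶻ ((α₁ *ˢ α₁) n +ᶻ + 6 *ᶻ (α₀ *ˢ α₂) n) ≡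
    + 48 *ᶻ α₀ n +ᶻ lin (+ 48) -[1+ 71 ] (+ n) *ᶻ α₁ n +ᶻ -[1+ 71 ] *ᶻ α₂ n +ᶻ 0ℤ *ᶻ α₃ n +ᶻ 0ℤ *ᶻ α₄ n
  product₂ n = trans (cong (+ 72 *ᶻ_) (trans (cong₂ _+ᶻ_ (trans (sym (ℤₚ.*-identityˡ _)) (sym (scaled n 1ℤ p₁ p₁))) (sym (scaled n (+ 6) p₀ p₂)))
      (trans (sym (∑∑-+ n (λ a b → 1ℤ *ᶻ (at-res p₁ a *ᶻ at-res p₁ b) *ᶻ (xs a *ˢ xs b) n) (λ a b → + 6 *ᶻ (at-res p₀ a *ᶻ at-res p₂ b) *ᶻ (xs a *ˢ xs b) n)))
        (∑∑-cong n (λ a b → trans (sym (ℤₚ.*-distribʳ-+ ((xs a *ˢ xs b) n) (1ℤ *ᶻ (at-res p₁ a *ᶻ at-res p₁ b)) (+ 6 *ᶻ (at-res p₀ a *ᶻ at-res p₂ b))))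
          (cong (λ z → (z +ᶻ + 6 *ᶻ (at-res p₀ a *ᶻ at-res p₂ b)) *ᶻ (xs a *ˢ xs b) n) (ℤₚ.*-identityˡ (at-res p₁ a *ᶻ at-res p₁ b))))))))
    (lambert-product n {W.T₂} {W.G₂} {W.Ψ₂} isPrimitive₂ isSymmetric₂ isIndefiniteSum₂ (λ r x → -[1+ 0 ] *ᶻ κᵣ r *ᶻ x)
      (λ _ → + 48) (lin (+ 48) -[1+ 71 ]) (λ _ → -[1+ 71 ]) (λ _ → 0ℤ) (λ _ → 0ℤ) diag close)
    where
    diagEq : Res → Polynomial 1 → _
    diagEq r x = D.T₂ r r x x ⊟ᵖ D.G₂ r r x x ≔ (conᶻ -[1+ 0 ] ⊠ᵖ conᶻ (κᵣ r) ⊠ᵖ x) ⊠ᵖ x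
      where module D = Weights (_⊞ᵖ_ {1}) _⊠ᵖ_ conᶻ
    diag : ∀ r x → W.T₂ r r x x -ᶻ W.G₂ r r x x ≡ (-[1+ 0 ] *ᶻ κᵣ r *ᶻ x) *ᶻ x
    diag r0 = solveᶻ 1 (diagEq r0) refl
    diag r1 = solveᶻ 1 (diagEq r1) refl
    diag r2 = solveᶻ 1 (diagEq r2) refl
    eq : Res → Polynomial 2 → Polynomial 2 → _
    eq = closedEq P.Ψ₂ (λ r x → conᶻ -[1+ 0 ] ⊠ᵖ conᶻ (κᵣ r) ⊠ᵖ x) (λ _ → conᶻ (+ 48)) (linᵖ (+ 48) -[1+ 71 ]) (λ _ → conᶻ -[1+ 71 ]) (λ _ → conᶻ 0ℤ) (λ _ → conᶻ 0ℤ)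
    close : ∀ r m x → _ ≡ _
    close r0 = solveᶻ 2 (eq r0) refl
    close r1 = solveᶻ 2 (eq r1) refl
    close r2 = solveᶻ 2 (eq r2) refl

  product₃ : ∀ n → + 72 *ᶻ (+ 18 *ᶻ (α₀ *ˢ α₂) n) ≡
    + 144 *ᶻ α₀ n +ᶻ 0ℤ *ᶻ α₁ n +ᶻ -[1+ 215 ] *ᶻ α₂ n +ᶻ -[1+ 71 ] *ᶻ α₃ n +ᶻ 0ℤ *ᶻ α₄ n
  product₃ n = trans (cong (+ 72 *ᶻ_) (sym (scaled n (+ 18) p₀ p₂)))
    (lambert-product n {W.T₃} {W.G₃} {W.Ψ₃} isPrimitive₃ isSymmetric₃ isIndefiniteSum₃ (λ r x → 0ℤ)
      (λ _ → + 144) (λ _ → 0ℤ) (λ _ → -[1+ 215 ]) (λ _ → -[1+ 71 ]) (λ _ → 0ℤ) diag close)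
    where
    diagEq : Res → Polynomial 1 → _
    diagEq r x = D.T₃ r r x x ⊟ᵖ D.G₃ r r x x ≔ (conᶻ 0ℤ) ⊠ᵖ x
      where module D = Weights (_⊞ᵖ_ {1}) _⊠ᵖ_ conᶻ
    diag : ∀ r x → W.T₃ r r x x -ᶻ W.G₃ r r x x ≡ (0ℤ) *ᶻ x
    diag r0 = solveᶻ 1 (diagEq r0) refl
    diag r1 = solveᶻ 1 (diagEq r1) refl
    diag r2 = solveᶻ 1 (diagEq r2) refl
    eq : Res → Polynomial 2 → Polynomial 2 → _
    eq = closedEq P.Ψ₃ (λ r x → conᶻ 0ℤ) (λ _ → conᶻ (+ 144)) (λ _ → conᶻ 0ℤ) (λ _ → conᶻ -[1+ 215 ]) (λ _ → conᶻ -[1+ 71 ]) (λ _ → conᶻ 0ℤ)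
    close : ∀ r m x → _ ≡ _
    close r0 = solveᶻ 2 (eq r0) refl
    close r1 = solveᶻ 2 (eq r1) refl
    close r2 = solveᶻ 2 (eq r2) refl

  product₄ : ∀ n → + 72 *ᶻ (+ 6 *ᶻ (α₀ *ˢ α₃) n) ≡
    -[1+ 143 ] *ᶻ α₀ n +ᶻ 0ℤ *ᶻ α₁ n +ᶻ 0ℤ *ᶻ α₂ n +ᶻ -[1+ 71 ] *ᶻ α₃ n +ᶻ + 72 *ᶻ α₄ n
  product₄ n = trans (cong (+ 72 *ᶻ_) (sym (scaled n (+ 6) p₀ p₃)))
    (lambert-product n {W.T₄} {W.G₄} {W.Ψ₄} isPrimitive₄ isSymmetric₄ isIndefiniteSum₄ (λ r x → 0ℤ)
      (λ _ → -[1+ 143 ]) (λ _ → 0ℤ) (λ _ → 0ℤ) (λ _ → -[1+ 71 ]) (λ _ → + 72) diag close)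
    where
    diagEq : Res → Polynomial 1 → _
    diagEq r x = D.T₄ r r x x ⊟ᵖ D.G₄ r r x x ≔ (conᶻ 0ℤ) ⊠ᵖ x
      where module D = Weights (_⊞ᵖ_ {1}) _⊠ᵖ_ conᶻ
    diag : ∀ r x → W.T₄ r r x x -ᶻ W.G₄ r r x x ≡ (0ℤ) *ᶻ x
    diag r0 = solveᶻ 1 (diagEq r0) refl
    diag r1 = solveᶻ 1 (diagEq r1) refl
    diag r2 = solveᶻ 1 (diagEq r2) refl
    eq : Res → Polynomial 2 → Polynomial 2 → _
    eq = closedEq P.Ψ₄ (λ r x → conᶻ 0ℤ) (λ _ → conᶻ -[1+ 143 ]) (λ _ → conᶻ 0ℤ) (λ _ → conᶻ 0ℤ) (λ _ → conᶻ -[1+ 71 ]) (λ _ → conᶻ (+ 72))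
    close : ∀ r m x → _ ≡ _
    close r0 = solveᶻ 2 (eq r0) refl
    close r1 = solveᶻ 2 (eq r1) refl
    close r2 = solveᶻ 2 (eq r2) refl

  product₅ : ∀ n → + 72 *ᶻ (+ 18 *ᶻ (α₁ *ˢ α₂) n) ≡
    0ℤ *ᶻ α₀ n +ᶻ + 144 *ᶻ α₁ n +ᶻ lin (+ 432) -[1+ 431 ] (+ n) *ᶻ α₂ n +ᶻ 0ℤ *ᶻ α₃ n +ᶻ + 144 *ᶻ α₄ n
  product₅ n = trans (cong (+ 72 *ᶻ_) (sym (scaled n (+ 18) p₁ p₂)))
    (lambert-product n {W.T₅} {W.G₅} {W.Ψ₅} isPrimitive₅ isSymmetric₅ isIndefiniteSum₅ (λ r x → -[1+ 5 ] *ᶻ χᵣ r *ᶻ x *ᶻ x)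
      (λ _ → 0ℤ) (λ _ → + 144) (lin (+ 432) -[1+ 431 ]) (λ _ → 0ℤ) (λ _ → + 144) diag close)
    where
    diagEq : Res → Polynomial 1 → _
    diagEq r x = D.T₅ r r x x ⊟ᵖ D.G₅ r r x x ≔ (conᶻ -[1+ 5 ] ⊠ᵖ conᶻ (χᵣ r) ⊠ᵖ x ⊠ᵖ x) ⊠ᵖ x
      where module D = Weights (_⊞ᵖ_ {1}) _⊠ᵖ_ conᶻ
    diag : ∀ r x → W.T₅ r r x x -ᶻ W.G₅ r r x x ≡ (-[1+ 5 ] *ᶻ χᵣ r *ᶻ x *ᶻ x) *ᶻ x
    diag r0 = solveᶻ 1 (diagEq r0) refl
    diag r1 = solveᶻ 1 (diagEq r1) refl
    diag r2 = solveᶻ 1 (diagEq r2) refl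
    eq : Res → Polynomial 2 → Polynomial 2 → _
    eq = closedEq P.Ψ₅ (λ r x → conᶻ -[1+ 5 ] ⊠ᵖ conᶻ (χᵣ r) ⊠ᵖ x ⊠ᵖ x) (λ _ → conᶻ 0ℤ) (λ _ → conᶻ (+ 144)) (linᵖ (+ 432) -[1+ 431 ]) (λ _ → conᶻ 0ℤ) (λ _ → conᶻ (+ 144))
    close : ∀ r m x → _ ≡ _
    close r0 = solveᶻ 2 (eq r0) refl
    close r1 = solveᶻ 2 (eq r1) refl
    close r2 = solveᶻ 2 (eq r2) refl

  ∑₁-multiples : ∀ m (g : ℕ → ℤ) → (∀ i → g (1 + i * 3) ≡ 0ℤ) → (∀ i → g (2 + i * 3) ≡ 0ℤ) → ∑₁ (m * 3) g ≡ ∑₁ m (λ a → g (a * 3))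
  ∑₁-multiples zero g h₁ h₂ = refl
  ∑₁-multiples (suc m) g h₁ h₂ = trans (cong₂ _+ᶻ_ (h₁ 0) (cong₂ _+ᶻ_ (h₂ 0) (cong (g 3 +ᶻ_) (∑₁-multiples m (λ a → g (3 + a)) (λ i → h₁ (suc i)) (λ i → h₂ (suc i))))))
    (trans (ℤₚ.+-identityˡ _) (ℤₚ.+-identityˡ _))

  res-*3 : ∀ i → res (i * 3) ≡ r0
  res-*3 zero = refl
  res-*3 (suc i) = cong (λ r → next (next (next r))) (res-*3 i)

  -- 1 + κ(a) is 3 on the multiples of 3 and 0 elsewhere.
  ∑₁-κ : ∀ n (f : ℕ → ℤ) → (∀ a → n < a → f a ≡ 0ℤ) → ∑₁ n (λ a → (1ℤ +ᶻ κ a) *ᶻ f a) ≡ + 3 *ᶻ ∑₁ n (λ a → f (a * 3))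
  ∑₁-κ n f vanish = trans (∑-extend (ℕₚ.m≤m*n n 3) (λ i n≤i → trans (cong ((1ℤ +ᶻ κ (suc i)) *ᶻ_) (vanish (suc i) (s≤s n≤i))) (ℤₚ.*-zeroʳ (1ℤ +ᶻ κ (suc i)))))
    (trans (∑₁-multiples n (λ a → (1ℤ +ᶻ κ a) *ᶻ f a)
        (λ i → cong (λ r → (1ℤ +ᶻ κᵣ (next r)) *ᶻ f (1 + i * 3)) (res-*3 i)) (λ i → cong (λ r → (1ℤ +ᶻ κᵣ (next (next r))) *ᶻ f (2 + i * 3)) (res-*3 i)))
      (trans (∑₁-cong n (λ a → cong (λ r → (1ℤ +ᶻ κᵣ r) *ᶻ f (a * 3)) (res-*3 a))) (∑-*ˡ n (+ 3) (λ i → f (suc i * 3)))))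

  ind : ℕ → ℕ → ℤ
  ind m n with m ℕ.≟ n
  ... | yes _ = 1ℤ
  ... | no _ = 0ℤ

  ind-yes : ∀ n → ind n n ≡ 1ℤ
  ind-yes n with n ℕ.≟ n
  ... | yes _ = refl
  ... | no n≢n = ⊥-elim (n≢n refl)

  ind-no : ∀ {m n} → ¬ m ≡ n → ind m n ≡ 0ℤ
  ind-no {m} {n} m≢n with m ℕ.≟ n
  ... | yes m≡n = ⊥-elim (m≢n m≡n)
  ... | no _ = refl

  ∑-single : ∀ N (f : ℕ → ℤ) k → k < N → (∀ i → ¬ i ≡ k → f i ≡ 0ℤ) → ∑ N f ≡ f k
  ∑-single (suc N) f zero _ h = trans (cong (f 0 +ᶻ_) (∑-zero N (λ i _ → h (suc i) (λ ())))) (ℤₚ.+-identityʳ (f 0))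
  ∑-single (suc N) f (suc k) (s≤s k<N) h = trans (cong₂ _+ᶻ_ (h 0 (λ ())) (∑-single N (f ∘ suc) k k<N (λ i i≢k → h (suc i) (λ e → i≢k (ℕₚ.suc-injective e))))) (ℤₚ.+-identityˡ _)

  geo-ind : ∀ ψ a .{{_ : NonZero a}} n → geo ψ a n ≡ ∑₁ n (λ d → ind (a * d) n *ᶻ ψ d)
  geo-ind ψ a zero = V-0 a (dropConst ψ)
  geo-ind ψ a n@(suc _) with a ∣? n
  ... | no a∤n = sym (∑-zero n (λ d _ → cong (_*ᶻ ψ (suc d)) (ind-no (λ e → a∤n (divides (suc d) (trans (sym e) (ℕₚ.*-comm a (suc d))))))))
  ... | yes (divides (suc k) eq) = sym (trans (∑-single n (λ d → ind (a * suc d) n *ᶻ ψ (suc d)) k (ℕₚ.≤-trans (ℕₚ.m≤m*n (suc k) a) (ℕₚ.≤-reflexive (sym eq)))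
          (λ i i≢k → cong (_*ᶻ ψ (suc i)) (ind-no (λ e → i≢k (ℕₚ.suc-injective (ℕₚ.*-cancelˡ-≡ (suc i) (suc k) a (trans e (trans eq (ℕₚ.*-comm (suc k) a)))))))))
        (trans (cong (_*ᶻ ψ (suc k)) (trans (cong (λ z → ind z n) (trans (ℕₚ.*-comm a (suc k)) (sym eq))) (ind-yes n))) (ℤₚ.*-identityˡ (ψ (suc k)))))

  Lam-ind : ∀ (p ψ : ℕ → ℤ) m .{{_ : NonZero m}} n → ∑₁ n (λ a → p a *ᶻ geo ψ (a * m) n) ≡ ∑∑ n (λ a d → ind (a * d * m) n *ᶻ (p a *ᶻ ψ d))
  Lam-ind p ψ m n = ∑₁-cong n (λ a → trans (cong (p a *ᶻ_) (geo-ind ψ (a * m) {{ℕₚ.m*n≢0 a m}} n)) (trans (sym (∑-*ˡ n (p a) (λ d → ind (a * m * suc d) n *ᶻ ψ (suc d))))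
    (∑₁-cong n (λ d → trans (rearrange (p a) (ind (a * m * d) n) (ψ d)) (cong (λ z → ind z n *ᶻ (p a *ᶻ ψ d)) (swap a m d))))))
    where
    rearrange : ∀ x y z → x *ᶻ (y *ᶻ z) ≡ y *ᶻ (x *ᶻ z)
    rearrange = solve-∀
    swap : ∀ a m d → a * m * d ≡ a * d * m
    swap a m d = trans (ℕₚ.*-assoc a m d) (trans (cong (a *_) (ℕₚ.*-comm m d)) (sym (ℕₚ.*-assoc a d m)))

  -- Both sides sum p(a)ψ(d) over the factorisations adm = n; the indicator `ind` makes the symmetry
  -- between a and d visible.
  Lam-swap : ∀ (p ψ : ℕ → ℤ) m .{{_ : NonZero m}} n → ∑₁ n (λ a → p a *ᶻ geo ψ (a * m) n) ≡ ∑₁ n (λ a → ψ a *ᶻ geo p (a * m) n)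
  Lam-swap p ψ m n = trans (Lam-ind p ψ m n) (trans (∑∑-swap n (λ a d → ind (a * d * m) n *ᶻ (p a *ᶻ ψ d)))
    (trans (∑∑-cong n (λ d a → cong₂ (λ z w → ind (z * m) n *ᶻ w) (ℕₚ.*-comm a d) (ℤₚ.*-comm (p a) (ψ d)))) (sym (Lam-ind ψ p m n))))

  -- The sums of σ(n)q^n and of σ(n)q^(3n): up to the factor -24, the nonconstant parts of E₂(q) and
  -- E₂(q³).
  ε₁ ε₃ : Series
  ε₁ = Lam +_ ones
  ε₃ n = ∑₁ n (λ a → + a *ᶻ xs (a * 3) n)

  private
    xs-vanish : ∀ n a → n < a → xs a n ≡ 0ℤ
    xs-vanish n (suc a) n<a = geo-vanish ones (suc a) n<a

  α₁-ε : ∀ n → α₁ n ≡ + 9 *ᶻ ε₃ n -ᶻ ε₁ n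
  α₁-ε n = trans (∑₁-cong n (λ a → split (κ a) (+ a) (xs a n))) (trans (∑-+ n (λ i → (1ℤ +ᶻ κ (suc i)) *ᶻ (+ suc i *ᶻ xs (suc i) n)) (λ i → -[1+ 0 ] *ᶻ (+ suc i *ᶻ xs (suc i) n)))
    (cong₂ _+ᶻ_ (trans (∑₁-κ n (λ a → + a *ᶻ xs a n) (λ a n<a → trans (cong (+ a *ᶻ_) (xs-vanish n a n<a)) (ℤₚ.*-zeroʳ (+ a))))
         (trans (cong (+ 3 *ᶻ_) (trans (∑₁-cong n (λ a → trans (cong (_*ᶻ xs (a * 3) n) (ℤₚ.pos-* a 3)) (three (+ a) (xs (a * 3) n)))) (∑-*ˡ n (+ 3) (λ i → + suc i *ᶻ xs (suc i * 3) n)))) (nine (ε₃ n))))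
       (trans (∑-*ˡ n -[1+ 0 ] (λ i → + suc i *ᶻ xs (suc i) n)) (ℤₚ.-1*i≡-i (ε₁ n)))))
    where
    split : ∀ k a x → k *ᶻ a *ᶻ x ≡ (1ℤ +ᶻ k) *ᶻ (a *ᶻ x) +ᶻ -[1+ 0 ] *ᶻ (a *ᶻ x)
    split = solve-∀
    three : ∀ a x → a *ᶻ + 3 *ᶻ x ≡ + 3 *ᶻ (a *ᶻ x)
    three = solve-∀
    nine : ∀ x → + 3 *ᶻ (+ 3 *ᶻ x) ≡ + 9 *ᶻ x
    nine = solve-∀

  -- x + x² = P/(1 - P)² is the sum of d P^d; on coefficients this is `xs-diag` with the factor a
  -- cancelled.
  xs-diag′ : ∀ a .{{_ : NonZero a}} n → xs a n +ᶻ (xs a *ˢ xs a) n ≡ geo +_ a n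
  xs-diag′ a n = ℤₚ.*-cancelˡ-≡ (+ a) _ _ (trans (ring₁ (+ a) (xs a n) ((xs a *ˢ xs a) n)) (trans (cong (+ a *ᶻ xs a n +ᶻ_) (xs-diag a n)) (trans (ring₂ (+ a) (+ n) (xs a n)) go)))
    where
    ring₁ : ∀ a x y → a *ᶻ (x +ᶻ y) ≡ a *ᶻ x +ᶻ a *ᶻ y
    ring₁ = solve-∀
    ring₂ : ∀ a n x → a *ᶻ x +ᶻ (n -ᶻ a) *ᶻ x ≡ n *ᶻ x
    ring₂ = solve-∀
    go : + n *ᶻ xs a n ≡ + a *ᶻ geo +_ a n
    go with a ∣? n
    ... | no _ = trans (ℤₚ.*-zeroʳ (+ n)) (sym (ℤₚ.*-zeroʳ (+ a)))
    ... | yes (divides zero refl) = sym (ℤₚ.*-zeroʳ (+ a))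
    ... | yes (divides (suc k) refl) = trans (ℤₚ.*-identityʳ (+ (suc k * a))) (trans (ℤₚ.pos-* (suc k) a) (ℤₚ.*-comm (+ suc k) (+ a)))

  -- The diagonal weight 2 + 2κ has no factor a, so `lambert-product` does not apply. Instead the
  -- divisor sum supplies the x_a that `xs-diag′` needs beside x_a², and 1 + κ restricts to
  -- multiples of 3, which produces `ε₃`.
  product₀ : ∀ n → + 3 *ᶻ (α₀ *ˢ α₀) n ≡ ε₁ n -ᶻ + 3 *ᶻ ε₃ n -ᶻ α₀ n
  product₀ n = ℤₚ.*-cancelˡ-≡ (+ 72) _ _ (trans (cong (+ 72 *ᶻ_) (sym (scaled n (+ 3) p₀ p₀))) (trans (weighted-sum n {W.T₀} {W.G₀} {W.Ψ₀} isPrimitive₀ isSymmetric₀ isIndefiniteSum₀)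
    (trans (sym (∑-+ n (λ i → Ψ-closed n {W.T₀} {W.G₀} {W.Ψ₀} isPrimitive₀ isSymmetric₀ isIndefiniteSum₀ (suc i) *ᶻ xs (suc i) n) (λ i → + 72 *ᶻ ((wt W.T₀ (suc i) (suc i) -ᶻ wt W.G₀ (suc i) (suc i)) *ᶻ (xs (suc i) *ˢ xs (suc i)) n))))
    (trans (∑₁-cong n (λ a → trans (cong₂ (λ u v → u *ᶻ xs a n +ᶻ + 72 *ᶻ (v *ᶻ (xs a *ˢ xs a) n)) (close (res a) (+ a)) (diag (res a) (+ a)))
        (trans (ring (κ a) (χ a) (+ a) (xs a n) ((xs a *ˢ xs a) n)) (cong (λ z → + 144 *ᶻ ((1ℤ +ᶻ κ a) *ᶻ z) +ᶻ (-[1+ 71 ] *ᶻ (χ a *ᶻ xs a n) +ᶻ -[1+ 71 ] *ᶻ (κ a *ᶻ + a *ᶻ xs a n))) (xs-diag′ a n)))))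
    (trans (∑-+ n (λ i → + 144 *ᶻ ((1ℤ +ᶻ κ (suc i)) *ᶻ geo +_ (suc i) n)) (λ i → -[1+ 71 ] *ᶻ (χ (suc i) *ᶻ xs (suc i) n) +ᶻ -[1+ 71 ] *ᶻ (κ (suc i) *ᶻ + suc i *ᶻ xs (suc i) n)))
    (trans (cong₂ _+ᶻ_ (trans (∑-*ˡ n (+ 144) (λ i → (1ℤ +ᶻ κ (suc i)) *ᶻ geo +_ (suc i) n)) (cong (+ 144 *ᶻ_) (trans (∑₁-κ n (λ a → geo +_ a n) (vanish n)) (cong (+ 3 *ᶻ_) ε₃-swap))))
        (trans (∑-+ n (λ i → -[1+ 71 ] *ᶻ (χ (suc i) *ᶻ xs (suc i) n)) (λ i → -[1+ 71 ] *ᶻ (κ (suc i) *ᶻ + suc i *ᶻ xs (suc i) n)))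
          (cong₂ _+ᶻ_ (∑-*ˡ n -[1+ 71 ] (λ i → χ (suc i) *ᶻ xs (suc i) n)) (trans (∑-*ˡ n -[1+ 71 ] (λ i → κ (suc i) *ᶻ + suc i *ᶻ xs (suc i) n)) (cong (-[1+ 71 ] *ᶻ_) (α₁-ε n))))))
      (final (ε₁ n) (ε₃ n) (α₀ n))))))))
    where
    final : ∀ e f a → + 144 *ᶻ (+ 3 *ᶻ f) +ᶻ (-[1+ 71 ] *ᶻ a +ᶻ -[1+ 71 ] *ᶻ (+ 9 *ᶻ f -ᶻ e)) ≡ + 72 *ᶻ (e -ᶻ + 3 *ᶻ f -ᶻ a)
    final = solve-∀
    ring : ∀ k c a x y → (+ 72 *ᶻ (+ 2 +ᶻ + 2 *ᶻ k -ᶻ c -ᶻ k *ᶻ a)) *ᶻ x +ᶻ + 72 *ᶻ ((+ 2 +ᶻ + 2 *ᶻ k) *ᶻ y) ≡ + 144 *ᶻ ((1ℤ +ᶻ k) *ᶻ (x +ᶻ y)) +ᶻ (-[1+ 71 ] *ᶻ (c *ᶻ x) +ᶻ -[1+ 71 ] *ᶻ (k *ᶻ a *ᶻ x))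
    ring = solve-∀
    vanish : ∀ n a → n < a → geo +_ a n ≡ 0ℤ
    vanish n (suc a) n<a = geo-vanish +_ (suc a) n<a
    ε₃-swap : ∑₁ n (λ a → geo +_ (a * 3) n) ≡ ε₃ n
    ε₃-swap = trans (∑₁-cong n (λ a → sym (ℤₚ.*-identityˡ (geo +_ (a * 3) n)))) (Lam-swap ones +_ 3 n)
    diag : ∀ r x → W.T₀ r r x x -ᶻ W.G₀ r r x x ≡ + 2 +ᶻ + 2 *ᶻ κᵣ r
    diag r0 x = refl
    diag r1 x = refl
    diag r2 x = refl
    eq : Res → Polynomial 1 → _
    eq r x = D.Ψ₀ r r x x ⊞ᵖ conᶻ -[1+ 0 ] ⊠ᵖ D.Ψ₀ r r1 x (conᶻ 1ℤ) ≔ conᶻ (+ 72) ⊠ᵖ (conᶻ (+ 2) ⊞ᵖ conᶻ (+ 2) ⊠ᵖ conᶻ (κᵣ r) ⊟ᵖ conᶻ (χᵣ r) ⊟ᵖ conᶻ (κᵣ r) ⊠ᵖ x)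
      where module D = Weights (_⊞ᵖ_ {1}) _⊠ᵖ_ conᶻ
    close : ∀ r x → W.Ψ₀ r r x x +ᶻ -[1+ 0 ] *ᶻ W.Ψ₀ r r1 x 1ℤ ≡ + 72 *ᶻ (+ 2 +ᶻ + 2 *ᶻ κᵣ r -ᶻ χᵣ r -ᶻ κᵣ r *ᶻ x)
    close r0 = solveᶻ 1 (eq r0) refl
    close r1 = solveᶻ 1 (eq r1) refl
    close r2 = solveᶻ 1 (eq r2) refl

open LambertProducts

-- Products involving Lambert series with the character on the codivisor.

module TwistedProducts where

  2·-at : ∀ f n → (2ˢ *ˢ f) n ≡ + 2 *ᶻ f n
  2·-at f n = const-* (+ 2) f n

  -ˢ-at₂ : ∀ f g n → (f -ˢ g) n ≡ f n -ᶻ g n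
  -ˢ-at₂ f g n = trans (+ˢ-at f (-ˢ g) n) (cong (f n +ᶻ_) (-ˢ-at g n))

  module _ (n : ℕ) where

    private
      KX KR : ℕ → ℕ → ℤ
      KX a b = (ks a *ˢ xs b) n
      KR a b = (ks a *ˢ rs b) n
      k : ℕ → ℤ
      k c = ks c n

      KX-rel : ∀ a b .{{_ : NonZero a}} .{{_ : NonZero b}} → + 2 *ᶻ KX a b ≡ + 2 *ᶻ KX (a + b) b +ᶻ KR a (a + b) +ᶻ KR (a + b) a +ᶻ + 2 *ᶻ k (a + b)
      KX-rel a b = trans (sym (2·-at (ks a *ˢ xs b) n)) (trans (at (ks-xs a b {{it}} {{it}} {{+-nonZero a b}}) n)
        (trans (+ˢ-at (2ˢ *ˢ (ks c *ˢ xs b) +ˢ rs c *ˢ ks a +ˢ ks c *ˢ rs a) (2ˢ *ˢ ks c) n) (cong₂ _+ᶻ_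
          (trans (+ˢ-at (2ˢ *ˢ (ks c *ˢ xs b) +ˢ rs c *ˢ ks a) (ks c *ˢ rs a) n) (cong (_+ᶻ KR c a)
            (trans (+ˢ-at (2ˢ *ˢ (ks c *ˢ xs b)) (rs c *ˢ ks a) n) (cong₂ _+ᶻ_ (2·-at (ks c *ˢ xs b) n) (at (*ˢ-comm (rs c) (ks a)) n)))))
          (2·-at (ks c) n))))
        where c = a + b

      KR-sym : ∀ a b .{{_ : NonZero a}} .{{_ : NonZero b}} → KR a b +ᶻ KR b a ≡ KR a (a + b) +ᶻ KR b (a + b) -ᶻ (KR (a + b) a +ᶻ KR (a + b) b) -ᶻ + 2 *ᶻ k (a + b)
      KR-sym a b = trans (sym (+ˢ-at (ks a *ˢ rs b) (ks b *ˢ rs a) n)) (trans (at (ks-rs-sym a b {{it}} {{it}} {{+-nonZero a b}}) n)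
        (trans (-ˢ-at₂ ((ks a +ˢ ks b) *ˢ rs c -ˢ ks c *ˢ (rs a +ˢ rs b)) (2ˢ *ˢ ks c) n) (cong₂ _-ᶻ_
          (trans (-ˢ-at₂ ((ks a +ˢ ks b) *ˢ rs c) (ks c *ˢ (rs a +ˢ rs b)) n) (cong₂ _-ᶻ_
             (trans (at (𝒮.distribʳ (rs c) (ks a) (ks b)) n) (+ˢ-at (ks a *ˢ rs c) (ks b *ˢ rs c) n))
             (trans (at (𝒮.distribˡ (ks c) (rs a) (rs b)) n) (+ˢ-at (ks c *ˢ rs a) (ks c *ˢ rs b) n))))
          (2·-at (ks c) n))))
        where c = a + b

      KR-alt : ∀ a b .{{_ : NonZero a}} .{{_ : NonZero b}} → KR a b -ᶻ KR b a ≡ + 2 *ᶻ (KX a (a + b) -ᶻ KX b (a + b))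
      KR-alt a b = trans (sym (-ˢ-at₂ (ks a *ˢ rs b) (ks b *ˢ rs a) n)) (trans (at (ks-rs-alt a b {{it}} {{it}} {{+-nonZero a b}}) n)
        (trans (at (*ˢ-assoc 2ˢ (ks a -ˢ ks b) (xs c)) n) (trans (2·-at ((ks a -ˢ ks b) *ˢ xs c) n) (cong (+ 2 *ᶻ_)
          (trans (at (distrib (ks a) (ks b) (xs c)) n) (-ˢ-at₂ (ks a *ˢ xs c) (ks b *ˢ xs c) n))))))
        where
        c = a + b
        open SeriesSolver using (solve; _:=_; _:-_; _:*_)
        distrib : ∀ a b x → (a -ˢ b) *ˢ x ≈ a *ˢ x -ˢ b *ˢ x
        distrib = solve 3 (λ a b x → (a :- b) :* x := a :* x :- b :* x) ≈-refl

      vanishʳ : ∀ ψ φ a b → n < b → (geo ψ a *ˢ geo φ b) n ≡ 0ℤ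
      vanishʳ ψ φ a b n<b = trans (at (*ˢ-comm (geo ψ a) (geo φ b)) n) (geo-*-vanish φ (geo ψ a) b n<b)

      k-vanish : ∀ c → n < c → k c ≡ 0ℤ
      k-vanish (suc c) n<c = geo-vanish χ (suc c) n<c

    open Twisted n KX KR k (λ a b → geo-*-vanish χ (xs b) a) (λ a b → vanishʳ χ ones a b) (λ a b → geo-*-vanish χ (rs b) a) (λ a b → vanishʳ χ κ a b)
      k-vanish KX-rel KR-sym KR-alt public

  -- The twisted counterpart of `xs-diag`, read off from `θks`.
  ks-rs-diag : ∀ a .{{_ : NonZero a}} n → + a *ᶻ (ks a *ˢ rs a) n ≡ (+ n -ᶻ + a) *ᶻ ks a n
  ks-rs-diag a n = trans (ring (+ a) (ks a n) ((ks a *ˢ rs a) n)) (trans (cong (_+ᶻ -ᶻ + a *ᶻ ks a n) (sym expand)) (sym (ℤₚ.*-distribʳ-+ (ks a n) (+ n) (-ᶻ + a))))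
    where
    ring : ∀ a x y → a *ᶻ y ≡ a *ᶻ (x +ᶻ y) +ᶻ -ᶻ a *ᶻ x
    ring = solve-∀
    expand : + n *ᶻ ks a n ≡ + a *ᶻ (ks a n +ᶻ (ks a *ˢ rs a) n)
    expand = trans (at (θks a) n) (trans (const-* (+ a) (ks a +ˢ ks a *ˢ rs a) n) (cong (+ a *ᶻ_) (+ˢ-at (ks a) (ks a *ˢ rs a) n)))

  ks-xs-diag′ : ∀ a .{{_ : NonZero a}} n → + 6 *ᶻ (ks a *ˢ xs a) n ≡ + 2 *ᶻ xs a n -ᶻ rs a n -ᶻ + 3 *ᶻ ks a n
  ks-xs-diag′ a n = trans (sym (const-* (+ 6) (ks a *ˢ xs a) n)) (trans (at (ks-xs-diag a) n)
    (trans (-ˢ-at₂ (2ˢ *ˢ xs a -ˢ rs a) (constˢ (+ 3) *ˢ ks a) n) (cong₂ _-ᶻ_ (trans (-ˢ-at₂ (2ˢ *ˢ xs a) (rs a) n) (cong (_-ᶻ rs a n) (2·-at (xs a) n))) (const-* (+ 3) (ks a) n))))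

  -- κ is 3 times the indicator of the multiples of 3, minus 1. It is checked on rational functions,
  -- using 1 - P³ = (1 - P)(1 + P + P²).
  rs-xs : ∀ a .{{_ : NonZero a}} n → rs a n ≡ + 3 *ᶻ xs (a * 3) n -ᶻ xs a n
  rs-xs a n = trans (at series n) (trans (-ˢ-at₂ (constˢ (+ 3) *ˢ xs (a * 3)) (xs a) n) (cong (_-ᶻ xs a n) (const-* (+ 3) (xs (a * 3)) n)))
    where
    open SeriesSolver using (solve; _:=_; _:+_; _:*_; _:-_; con; :-_)
    instance
      a*3≢0 : NonZero (a * 3)
      a*3≢0 = ℕₚ.m*n≢0 a 3
    module A = Rational a
    module A₃ = Rational (a * 3)
    P = A.P
    cube : A₃.P ≈ P *ˢ (P *ˢ P)
    cube = ≈-trans (subst (λ m → qS ^ˢ (a * 3) ≈ qS ^ˢ m) (ℕₚ.*-comm a 3) ≈-refl) (≈-trans (^ˢ-* qS a 3) (*ˢ-cong ≈-refl (*ˢ-cong ≈-refl (𝒮.*-identityʳ P))))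
    f₃-unit : A₃.f *ˢ (1ˢ -ˢ P *ˢ (P *ˢ P)) ≈ 1ˢ
    f₃-unit = ≈-trans (*ˢ-cong ≈-refl (+ˢ-cong ≈-refl (-ˢ-cong (≈-sym cube)))) A₃.f-unit
    core : ∀ e f g → e *ˢ (1ˢ +ˢ P +ˢ P *ˢ P) ≈ 1ˢ → f *ˢ (1ˢ -ˢ P) ≈ 1ˢ → g *ˢ (1ˢ -ˢ P *ˢ (P *ˢ P)) ≈ 1ˢ →
      -ˢ (P +ˢ 2ˢ *ˢ (P *ˢ P)) *ˢ e ≈ constˢ (+ 3) *ˢ ((P *ˢ (P *ˢ P)) *ˢ g) -ˢ P *ˢ f
    core e f g ze zf zg = modulo (≈⇒-≈0 ze) (≈⇒-≈0 zf) (≈⇒-≈0 zg)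
      (P *ˢ f -ˢ constˢ (+ 3) *ˢ (P *ˢ (P *ˢ P)) *ˢ g)
      (-ˢ (P +ˢ 2ˢ *ˢ (P *ˢ P)) *ˢ e -ˢ constˢ (+ 3) *ˢ (P *ˢ (P *ˢ P)) *ˢ g *ˢ (e *ˢ (1ˢ +ˢ P +ˢ P *ˢ P)))
      (constˢ (+ 3) *ˢ (P *ˢ (P *ˢ P)) *ˢ e *ˢ f)
      (solve 4 (λ P e f g → let u = con 1ℤ :+ P :+ P :* P ; three = con (+ 3) ; cb = P :* (P :* P) in
        :- (P :+ con (+ 2) :* (P :* P)) :* e := three :* (cb :* g) :- P :* f
        :+ ((P :* f :- three :* cb :* g) :* (con 1ℤ :- e :* u)
        :+ (:- (P :+ con (+ 2) :* (P :* P)) :* e :- three :* cb :* g :* (e :* u)) :* (con 1ℤ :- f :* (con 1ℤ :- P))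
        :+ (three :* cb :* e :* f) :* (con 1ℤ :- g :* (con 1ℤ :- cb)))) ≈-refl P e f g)
    series : rs a ≈ constˢ (+ 3) *ˢ xs (a * 3) -ˢ xs a
    series = ≈-trans A.r-rat (≈-trans (core A.e A.f A₃.f A.e-unit A.f-unit f₃-unit)
      (≈-sym (+ˢ-cong (*ˢ-cong ≈-refl (≈-trans A₃.x-rat (*ˢ-cong cube ≈-refl))) (-ˢ-cong A.x-rat))))

  -- Divisor sums with the function modulo 3 moved to the codivisor; `γ₂` and `γ₄` are expansions
  -- belonging to the other cusp of level 3.
  γ₂ γ₄ ρ₁ : Series
  γ₂ = Lam (λ a → + a *ᶻ + a) χ
  γ₄ = Lam (λ a → + a *ᶻ (+ a *ᶻ (+ a *ᶻ + a))) χ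
  ρ₁ = Lam +_ κ

  -- In weight one no power tells the divisor from the codivisor, so the two families meet.
  γ₀≈α₀ : ∀ n → Lam ones χ n ≡ α₀ n
  γ₀≈α₀ n = trans (∑₁-cong n (λ a → cong (λ m → 1ℤ *ᶻ geo χ m n) (sym (ℕₚ.*-identityʳ a)))) (trans (Lam-swap ones χ 1 n)
    (∑₁-cong n (λ a → cong (λ m → χ a *ᶻ geo ones m n) (ℕₚ.*-identityʳ a))))

  ρ₁-ε : ∀ n → ρ₁ n ≡ + 3 *ᶻ ε₃ n -ᶻ ε₁ n
  ρ₁-ε n = trans (∑₁-cong n (λ a → trans (cong (+ a *ᶻ_) (rs-xs a n)) (ring (+ a) (xs (a * 3) n) (xs a n))))
    (trans (∑-+ n (λ i → + 3 *ᶻ (+ suc i *ᶻ xs (suc i * 3) n)) (λ i → -[1+ 0 ] *ᶻ (+ suc i *ᶻ xs (suc i) n)))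
      (cong₂ _+ᶻ_ (∑-*ˡ n (+ 3) (λ i → + suc i *ᶻ xs (suc i * 3) n)) (trans (∑-*ˡ n -[1+ 0 ] (λ i → + suc i *ᶻ xs (suc i) n)) (ℤₚ.-1*i≡-i (ε₁ n)))))
    where
    ring : ∀ a x y → a *ᶻ (+ 3 *ᶻ x -ᶻ y) ≡ + 3 *ᶻ (a *ᶻ x) +ᶻ -[1+ 0 ] *ᶻ (a *ᶻ y)
    ring = solve-∀

  inner : ∀ (f : ℕ → ℕ → ℤ) (Ψ : ℤ → ℤ → ℤ) → (∀ a b → f a b ≡ Ψ (+ a +ᶻ + b) (1ℤ +ᶻ + a) +ᶻ -[1+ 0 ] *ᶻ Ψ (+ a +ᶻ + b) (+ a)) →
    ∀ c .{{_ : NonZero c}} → ∑₁ (ℕ.pred c) (λ a → f a (c ∸ a)) ≡ Ψ (+ c) (+ c) +ᶻ -[1+ 0 ] *ᶻ Ψ (+ c) 1ℤ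
  inner f Ψ step (suc m) = trans (∑₁-cong≤ m (λ a a≤m → go a (suc m ∸ a) (ℕₚ.m+[n∸m]≡n (ℕₚ.≤-trans a≤m (ℕₚ.n≤1+n m)))))
    (∑-telescope m (λ a → Ψ (+ suc m) (+ a)))
    where
    go : ∀ a b {c} → a + b ≡ c → f a b ≡ Ψ (+ c) (+ suc a) +ᶻ -[1+ 0 ] *ᶻ Ψ (+ c) (+ a)
    go a b refl = step a b

  private
    scaled : ∀ n c (p r φ : ℕ → ℤ) → ∑∑ n (λ a b → c *ᶻ (p a *ᶻ r b) *ᶻ (ks a *ˢ geo φ b) n) ≡ c *ᶻ (Lam p χ *ˢ Lam r φ) n
    scaled n c p r φ = trans (∑∑-cong n (λ a b → ℤₚ.*-assoc c (p a *ᶻ r b) ((ks a *ˢ geo φ b) n)))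
      (trans (∑∑-*ˡ n c (λ a b → p a *ᶻ r b *ᶻ (ks a *ˢ geo φ b) n)) (cong (c *ᶻ_) (sym (Lam-* p χ r φ n))))

    ∑-lin₂ : ∀ n (f g : ℕ → ℤ) u v → ∑₁ n (λ c → u *ᶻ f c +ᶻ v *ᶻ g c) ≡ u *ᶻ ∑₁ n f +ᶻ v *ᶻ ∑₁ n g
    ∑-lin₂ n f g u v = trans (∑-+ n (λ i → u *ᶻ f (suc i)) (λ i → v *ᶻ g (suc i))) (cong₂ _+ᶻ_ (∑-*ˡ n u (f ∘ suc)) (∑-*ˡ n v (g ∘ suc)))

  *-ρ₁ : ∀ f n → (f *ˢ ρ₁) n ≡ + 3 *ᶻ (f *ˢ ε₃) n -ᶻ (f *ˢ ε₁) n
  *-ρ₁ f n = trans (at (*ˢ-cong (≈-refl {f}) ρ₁≈) n) (trans (at (distrib f ε₃ ε₁) n) (trans (-ˢ-at₂ (constˢ (+ 3) *ˢ (f *ˢ ε₃)) (f *ˢ ε₁) n) (cong (_-ᶻ (f *ˢ ε₁) n) (const-* (+ 3) (f *ˢ ε₃) n))))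
    where
    open SeriesSolver using (solve; _:=_; _:*_; _:-_; con)
    ρ₁≈ : ρ₁ ≈ constˢ (+ 3) *ˢ ε₃ -ˢ ε₁
    ρ₁≈ = mk≈ λ n → trans (ρ₁-ε n) (sym (trans (-ˢ-at₂ (constˢ (+ 3) *ˢ ε₃) ε₁ n) (cong (_-ᶻ ε₁ n) (const-* (+ 3) ε₃ n))))
    distrib : ∀ f x y → f *ˢ (constˢ (+ 3) *ˢ x -ˢ y) ≈ constˢ (+ 3) *ˢ (f *ˢ x) -ˢ f *ˢ y
    distrib = solve 3 (λ f x y → f :* (con (+ 3) :* x :- y) := con (+ 3) :* (f :* x) :- f :* y) ≈-refl

  -- By `rs-xs`, 4x_b - 2r_b = 6(x_b - x_{3b}), which fixes the weights P and Q. The diagonal weight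
  -- of k_a x_a is -2a; multiplying everything by 3 supplies the 6 of `ks-xs-diag′`.
  twisted₁ : ∀ n → + 6 *ᶻ (Lam ones χ *ˢ ε₁) n -ᶻ + 6 *ᶻ (Lam ones χ *ˢ ε₃) n ≡ + 3 *ᶻ γ₂ n -ᶻ ε₁ n +ᶻ ε₃ n -ᶻ + 2 *ᶻ (+ n *ᶻ α₀ n)
  twisted₁ n = ℤₚ.*-cancelˡ-≡ (+ 3) _ _ (trans (lhs ((γ *ˢ ε₁) n) ((γ *ˢ ε₃) n) ((γ *ˢ ρ₁) n) γρ) (trans (cong (+ 3 *ᶻ_) (trans
    (cong₂ _+ᶻ_ (sym (scaled n (+ 4) ones +_ ones)) (sym (scaled n -[1+ 1 ] ones +_ κ)))
    (twisted n P Q g₁ h₂ h₃ (λ _ _ → refl) (λ a b → alt (+ a) (+ b)) (λ a b → c₁ (+ a) (+ b)) (λ a b → c₂ (+ a) (+ b)) (λ a b → c₃ (+ a) (+ b)) (λ a b → c₄ (+ a) (+ b)))))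
    (trans (ℤₚ.*-distribˡ-+ (+ 3) lin dia) (trans (cong₂ _+ᶻ_ lin≡ dia≡) (rhs (γ₂ n) (Lam +_ χ n) (+ n) (α₀ n) (ε₁ n) (ε₃ n))))))
    where
    γ = Lam ones χ
    P Q g₁ h₂ h₃ : ℕ → ℕ → ℤ
    P a b = + 4 *ᶻ (1ℤ *ᶻ + b)
    Q a b = -[1+ 1 ] *ᶻ (1ℤ *ᶻ + b)
    -- Linear forms, like P and Q: the four equations `c₁` to `c₄` are then linear in their
    -- coefficients.
    g₁ a b = + 2 *ᶻ + a +ᶻ + b
    h₂ a b = 0ℤ
    h₃ a b = + a -ᶻ + b
    alt : ∀ x y → x -ᶻ y ≡ -ᶻ (y -ᶻ x)
    alt = solve-∀
    c₁ : ∀ x y → + 4 *ᶻ (1ℤ *ᶻ (x +ᶻ y)) ≡ + 2 *ᶻ ((+ 2 *ᶻ x +ᶻ (x +ᶻ y)) -ᶻ (x -ᶻ y))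
    c₁ = solve-∀
    c₂ : ∀ x y → + 4 *ᶻ (1ℤ *ᶻ y) ≡ + 2 *ᶻ ((+ 2 *ᶻ (x +ᶻ y) +ᶻ y) -ᶻ (+ 2 *ᶻ x +ᶻ y))
    c₂ = solve-∀
    c₃ : ∀ x y → -[1+ 1 ] *ᶻ (1ℤ *ᶻ (x +ᶻ y)) ≡ 0ℤ -ᶻ 0ℤ +ᶻ (x -ᶻ (x +ᶻ y)) -ᶻ (+ 2 *ᶻ x +ᶻ y)
    c₃ = solve-∀
    c₄ : ∀ x y → -[1+ 1 ] *ᶻ (1ℤ *ᶻ y) ≡ 0ℤ +ᶻ 0ℤ +ᶻ ((x +ᶻ y) -ᶻ y) -ᶻ (+ 2 *ᶻ y +ᶻ x)
    c₄ = solve-∀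

    Ψ : ℤ → ℤ → ℤ
    Ψ z x = + 2 *ᶻ (z *ᶻ x) +ᶻ x *ᶻ (x -ᶻ 1ℤ)
    Ψ-step : ∀ x w → + 2 *ᶻ (+ 2 *ᶻ x +ᶻ w) -ᶻ 0ℤ ≡ Ψ (x +ᶻ w) (1ℤ +ᶻ x) +ᶻ -[1+ 0 ] *ᶻ Ψ (x +ᶻ w) x
    Ψ-step = ring
      where
      ring : ∀ x w → + 2 *ᶻ (+ 2 *ᶻ x +ᶻ w) -ᶻ 0ℤ ≡ (+ 2 *ᶻ ((x +ᶻ w) *ᶻ (1ℤ +ᶻ x)) +ᶻ (1ℤ +ᶻ x) *ᶻ (1ℤ +ᶻ x -ᶻ 1ℤ)) +ᶻ -[1+ 0 ] *ᶻ (+ 2 *ᶻ ((x +ᶻ w) *ᶻ x) +ᶻ x *ᶻ (x -ᶻ 1ℤ))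
      ring = solve-∀
    closedΨ : ∀ c k → + 3 *ᶻ ((+ 2 *ᶻ (c *ᶻ c) +ᶻ c *ᶻ (c -ᶻ 1ℤ) +ᶻ -[1+ 0 ] *ᶻ (+ 2 *ᶻ (c *ᶻ 1ℤ) +ᶻ 1ℤ *ᶻ (1ℤ -ᶻ 1ℤ))) *ᶻ k) ≡ + 9 *ᶻ (c *ᶻ c *ᶻ k) +ᶻ -[1+ 8 ] *ᶻ (c *ᶻ k)
    closedΨ = solve-∀

    lin dia : ℤ
    lin = ∑₁ n (λ c → ∑₁ (ℕ.pred c) (λ a → + 2 *ᶻ g₁ a (c ∸ a) -ᶻ h₂ a (c ∸ a)) *ᶻ ks c n)
    dia = ∑₁ n (λ a → (P a a -ᶻ + 2 *ᶻ g₁ a a) *ᶻ (ks a *ˢ xs a) n) +ᶻ ∑₁ n (λ a → (Q a a -ᶻ h₂ a a) *ᶻ (ks a *ˢ rs a) n)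
    lin≡ : + 3 *ᶻ lin ≡ + 9 *ᶻ γ₂ n +ᶻ -[1+ 8 ] *ᶻ Lam +_ χ n
    lin≡ = trans (sym (∑-*ˡ n (+ 3) (λ i → ∑₁ i (λ a → + 2 *ᶻ g₁ a (suc i ∸ a) -ᶻ h₂ a (suc i ∸ a)) *ᶻ ks (suc i) n)))
      (trans (∑₁-cong n (λ c → trans (cong (λ z → + 3 *ᶻ (z *ᶻ ks c n)) (inner (λ a b → + 2 *ᶻ g₁ a b -ᶻ h₂ a b) Ψ (λ a b → Ψ-step (+ a) (+ b)) c)) (closedΨ (+ c) (ks c n))))
        (∑-lin₂ n (λ c → + c *ᶻ + c *ᶻ ks c n) (λ c → + c *ᶻ ks c n) (+ 9) -[1+ 8 ]))
    dia≡ : + 3 *ᶻ dia ≡ (-[1+ 1 ] *ᶻ ε₁ n +ᶻ 1ℤ *ᶻ (+ 3 *ᶻ ε₃ n -ᶻ ε₁ n)) +ᶻ (+ 9 *ᶻ Lam +_ χ n +ᶻ (-[1+ 5 ] *ᶻ + n) *ᶻ α₀ n)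
    dia≡ = trans (cong (+ 3 *ᶻ_) (sym (∑-+ n (λ i → (P (suc i) (suc i) -ᶻ + 2 *ᶻ g₁ (suc i) (suc i)) *ᶻ (ks (suc i) *ˢ xs (suc i)) n) (λ i → (Q (suc i) (suc i) -ᶻ h₂ (suc i) (suc i)) *ᶻ (ks (suc i) *ˢ rs (suc i)) n))))
      (trans (sym (∑-*ˡ n (+ 3) (λ i → (P (suc i) (suc i) -ᶻ + 2 *ᶻ g₁ (suc i) (suc i)) *ᶻ (ks (suc i) *ˢ xs (suc i)) n +ᶻ (Q (suc i) (suc i) -ᶻ h₂ (suc i) (suc i)) *ᶻ (ks (suc i) *ˢ rs (suc i)) n)))
      (trans (∑₁-cong n (λ a → trans (ring₁ (+ a) ((ks a *ˢ xs a) n) ((ks a *ˢ rs a) n)) (trans (cong₂ (λ u v → -ᶻ + a *ᶻ u +ᶻ -[1+ 5 ] *ᶻ v) (ks-xs-diag′ a n) (ks-rs-diag a n)) (ring₂ (+ a) (+ n) (xs a n) (rs a n) (ks a n)))))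
      (trans (∑-+ n (λ i → -[1+ 1 ] *ᶻ (+ suc i *ᶻ xs (suc i) n) +ᶻ 1ℤ *ᶻ (+ suc i *ᶻ rs (suc i) n)) (λ i → + 9 *ᶻ (+ suc i *ᶻ ks (suc i) n) +ᶻ (-[1+ 5 ] *ᶻ + n) *ᶻ (1ℤ *ᶻ ks (suc i) n)))
      (cong₂ _+ᶻ_ (trans (∑-lin₂ n (λ a → + a *ᶻ xs a n) (λ a → + a *ᶻ rs a n) -[1+ 1 ] 1ℤ) (cong (λ z → -[1+ 1 ] *ᶻ ε₁ n +ᶻ 1ℤ *ᶻ z) (ρ₁-ε n)))
        (trans (∑-lin₂ n (λ a → + a *ᶻ ks a n) (λ a → 1ℤ *ᶻ ks a n) (+ 9) (-[1+ 5 ] *ᶻ + n)) (cong (λ z → + 9 *ᶻ Lam +_ χ n +ᶻ (-[1+ 5 ] *ᶻ + n) *ᶻ z) (γ₀≈α₀ n)))))))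
      where
      ring₁ : ∀ a X R → + 3 *ᶻ ((+ 4 *ᶻ (1ℤ *ᶻ a) -ᶻ + 2 *ᶻ (+ 2 *ᶻ a +ᶻ a)) *ᶻ X +ᶻ (-[1+ 1 ] *ᶻ (1ℤ *ᶻ a) -ᶻ 0ℤ) *ᶻ R) ≡ -ᶻ a *ᶻ (+ 6 *ᶻ X) +ᶻ -[1+ 5 ] *ᶻ (a *ᶻ R)
      ring₁ = solve-∀
      ring₂ : ∀ a n x r k → -ᶻ a *ᶻ (+ 2 *ᶻ x -ᶻ r -ᶻ + 3 *ᶻ k) +ᶻ -[1+ 5 ] *ᶻ ((n -ᶻ a) *ᶻ k) ≡
        (-[1+ 1 ] *ᶻ (a *ᶻ x) +ᶻ 1ℤ *ᶻ (a *ᶻ r)) +ᶻ (+ 9 *ᶻ (a *ᶻ k) +ᶻ (-[1+ 5 ] *ᶻ n) *ᶻ (1ℤ *ᶻ k))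
      ring₂ = solve-∀
    rhs : ∀ g₂ g₁ n a e f → (+ 9 *ᶻ g₂ +ᶻ -[1+ 8 ] *ᶻ g₁) +ᶻ ((-[1+ 1 ] *ᶻ e +ᶻ 1ℤ *ᶻ (+ 3 *ᶻ f -ᶻ e)) +ᶻ (+ 9 *ᶻ g₁ +ᶻ (-[1+ 5 ] *ᶻ n) *ᶻ a)) ≡
      + 3 *ᶻ (+ 3 *ᶻ g₂ -ᶻ e +ᶻ f -ᶻ + 2 *ᶻ (n *ᶻ a))
    rhs = solve-∀
    γρ : (γ *ˢ ρ₁) n ≡ + 3 *ᶻ (γ *ˢ ε₃) n -ᶻ (γ *ˢ ε₁) n
    γρ = *-ρ₁ γ n
    lhs : ∀ x y z → z ≡ + 3 *ᶻ y -ᶻ x → + 3 *ᶻ (+ 6 *ᶻ x -ᶻ + 6 *ᶻ y) ≡ + 3 *ᶻ (+ 4 *ᶻ x +ᶻ -[1+ 1 ] *ᶻ z)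
    lhs x y z refl = ring x y
      where
      ring : ∀ x y → + 3 *ᶻ (+ 6 *ᶻ x -ᶻ + 6 *ᶻ y) ≡ + 3 *ᶻ (+ 4 *ᶻ x +ᶻ -[1+ 1 ] *ᶻ (+ 3 *ᶻ y -ᶻ x))
      ring = solve-∀

  -- The weights now have degree three. On the diagonal k_a x_a has weight 12a³ - 2 · 6a³ = 0, so
  -- only k_a r_a survives and gives θγ₂.
  twisted₂ : ∀ n → + 18 *ᶻ (γ₂ *ˢ ε₁) n -ᶻ + 18 *ᶻ (γ₂ *ˢ ε₃) n ≡ + 2 *ᶻ γ₄ n -ᶻ + 2 *ᶻ (+ n *ᶻ γ₂ n)
  twisted₂ n = trans (lhs ((γ₂ *ˢ ε₁) n) ((γ₂ *ˢ ε₃) n) ((γ₂ *ˢ ρ₁) n) (*-ρ₁ γ₂ n)) (trans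
    (cong₂ _+ᶻ_ (sym (scaled n (+ 12) sq +_ ones)) (sym (scaled n -[1+ 5 ] sq +_ κ)))
    (trans (twisted n P Q g₁ h₂ h₃ (λ a b → h-sym (+ a) (+ b)) (λ a b → h-alt (+ a) (+ b)) (λ a b → c₁ (+ a) (+ b)) (λ a b → c₂ (+ a) (+ b)) (λ a b → c₃ (+ a) (+ b)) (λ a b → c₄ (+ a) (+ b)))
    (trans (cong (lin +ᶻ_) (sym (∑-+ n (λ i → (P (suc i) (suc i) -ᶻ + 2 *ᶻ g₁ (suc i) (suc i)) *ᶻ (ks (suc i) *ˢ xs (suc i)) n) (λ i → (Q (suc i) (suc i) -ᶻ h₂ (suc i) (suc i)) *ᶻ (ks (suc i) *ˢ rs (suc i)) n))))
    (trans (sym (∑-+ n (λ i → ∑₁ i (λ a → + 2 *ᶻ g₁ a (suc i ∸ a) -ᶻ h₂ a (suc i ∸ a)) *ᶻ ks (suc i) n) (λ i → (P (suc i) (suc i) -ᶻ + 2 *ᶻ g₁ (suc i) (suc i)) *ᶻ (ks (suc i) *ˢ xs (suc i)) n +ᶻ (Q (suc i) (suc i) -ᶻ h₂ (suc i) (suc i)) *ᶻ (ks (suc i) *ˢ rs (suc i)) n)))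
    (trans (∑₁-cong n (λ a → trans (cong₂ _+ᶻ_ (cong (_*ᶻ ks a n) (inner (λ a b → + 2 *ᶻ g₁ a b -ᶻ h₂ a b) Ψ (λ a b → Ψ-step (+ a) (+ b)) a)) (trans (dia₁ (+ a) ((ks a *ˢ xs a) n) ((ks a *ˢ rs a) n)) (cong (-[1+ 1 ] *ᶻ (+ a *ᶻ + a) *ᶻ_) (ks-rs-diag a n)))) (term (+ a) (+ n) (ks a n))))
    (trans (∑-lin₂ n (λ a → + a *ᶻ (+ a *ᶻ (+ a *ᶻ + a)) *ᶻ ks a n) (λ a → + a *ᶻ + a *ᶻ ks a n) (+ 2) (-[1+ 1 ] *ᶻ + n)) (rhs (γ₄ n) (γ₂ n) (+ n))))))))
    where
    sq : ℕ → ℤ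
    sq a = + a *ᶻ + a
    P Q g₁ h₂ h₃ : ℕ → ℕ → ℤ
    P a b = + 12 *ᶻ (sq a *ᶻ + b)
    Q a b = -[1+ 5 ] *ᶻ (sq a *ᶻ + b)
    g₁ a b = + a *ᶻ (+ b *ᶻ + b) +ᶻ + 3 *ᶻ (+ a *ᶻ + a *ᶻ + b) +ᶻ + 2 *ᶻ (+ a *ᶻ + a *ᶻ + a)
    h₂ a b = -[1+ 1 ] *ᶻ (+ a *ᶻ + b *ᶻ (+ a +ᶻ + b))
    h₃ a b = + a *ᶻ + b *ᶻ (+ b -ᶻ + a)
    h-sym : ∀ x y → -[1+ 1 ] *ᶻ (x *ᶻ y *ᶻ (x +ᶻ y)) ≡ -[1+ 1 ] *ᶻ (y *ᶻ x *ᶻ (y +ᶻ x))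
    h-sym = solve-∀
    h-alt : ∀ x y → x *ᶻ y *ᶻ (y -ᶻ x) ≡ -ᶻ (y *ᶻ x *ᶻ (x -ᶻ y))
    h-alt = solve-∀
    G H A : ℤ → ℤ → ℤ
    G x y = x *ᶻ (y *ᶻ y) +ᶻ + 3 *ᶻ (x *ᶻ x *ᶻ y) +ᶻ + 2 *ᶻ (x *ᶻ x *ᶻ x)
    H x y = -[1+ 1 ] *ᶻ (x *ᶻ y *ᶻ (x +ᶻ y))
    A x y = x *ᶻ y *ᶻ (y -ᶻ x)
    open +-*-Solver renaming (solve to solveᶻ)
    Gᵖ Hᵖ Aᵖ : Polynomial 2 → Polynomial 2 → Polynomial 2
    Gᵖ x y = x :* (y :* y) :+ con (+ 3) :* (x :* x :* y) :+ con (+ 2) :* (x :* x :* x)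
    Hᵖ x y = con -[1+ 1 ] :* (x :* y :* (x :+ y))
    Aᵖ x y = x :* y :* (y :- x)
    c₁ : ∀ x y → + 12 *ᶻ (x *ᶻ x *ᶻ (x +ᶻ y)) ≡ + 2 *ᶻ (G x (x +ᶻ y) -ᶻ A x y)
    c₁ = solveᶻ 2 (λ x y → con (+ 12) :* (x :* x :* (x :+ y)) := con (+ 2) :* (Gᵖ x (x :+ y) :- Aᵖ x y)) refl
    c₂ : ∀ x y → + 12 *ᶻ ((x +ᶻ y) *ᶻ (x +ᶻ y) *ᶻ y) ≡ + 2 *ᶻ (G (x +ᶻ y) y -ᶻ G x y)
    c₂ = solveᶻ 2 (λ x y → con (+ 12) :* ((x :+ y) :* (x :+ y) :* y) := con (+ 2) :* (Gᵖ (x :+ y) y :- Gᵖ x y)) refl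
    c₃ : ∀ x y → -[1+ 5 ] *ᶻ (x *ᶻ x *ᶻ (x +ᶻ y)) ≡ H x (x +ᶻ y) -ᶻ H x y +ᶻ A x (x +ᶻ y) -ᶻ G x y
    c₃ = solveᶻ 2 (λ x y → con -[1+ 5 ] :* (x :* x :* (x :+ y)) := Hᵖ x (x :+ y) :- Hᵖ x y :+ Aᵖ x (x :+ y) :- Gᵖ x y) refl
    c₄ : ∀ x y → -[1+ 5 ] *ᶻ ((x +ᶻ y) *ᶻ (x +ᶻ y) *ᶻ y) ≡ H (x +ᶻ y) y +ᶻ H x y +ᶻ A (x +ᶻ y) y -ᶻ G y x
    c₄ = solveᶻ 2 (λ x y → con -[1+ 5 ] :* ((x :+ y) :* (x :+ y) :* y) := Hᵖ (x :+ y) y :+ Hᵖ x y :+ Aᵖ (x :+ y) y :- Gᵖ y x) refl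
    Ψ : ℤ → ℤ → ℤ
    Ψ z x = + 2 *ᶻ (z *ᶻ z *ᶻ (x *ᶻ (x -ᶻ 1ℤ)))
    Ψ-step : ∀ x y → + 2 *ᶻ G x y -ᶻ H x y ≡ Ψ (x +ᶻ y) (1ℤ +ᶻ x) +ᶻ -[1+ 0 ] *ᶻ Ψ (x +ᶻ y) x
    Ψ-step = solveᶻ 2 (λ x y → con (+ 2) :* Gᵖ x y :- Hᵖ x y := Ψᵖ (x :+ y) (con 1ℤ :+ x) :+ con -[1+ 0 ] :* Ψᵖ (x :+ y) x) refl
      where
      Ψᵖ : Polynomial 2 → Polynomial 2 → Polynomial 2
      Ψᵖ z x = con (+ 2) :* (z :* z :* (x :* (x :- con 1ℤ)))
    lin : ℤ
    lin = ∑₁ n (λ c → ∑₁ (ℕ.pred c) (λ a → + 2 *ᶻ g₁ a (c ∸ a) -ᶻ h₂ a (c ∸ a)) *ᶻ ks c n)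
    dia₁ : ∀ a X R → (+ 12 *ᶻ (a *ᶻ a *ᶻ a) -ᶻ + 2 *ᶻ (a *ᶻ (a *ᶻ a) +ᶻ + 3 *ᶻ (a *ᶻ a *ᶻ a) +ᶻ + 2 *ᶻ (a *ᶻ a *ᶻ a))) *ᶻ X +ᶻ (-[1+ 5 ] *ᶻ (a *ᶻ a *ᶻ a) -ᶻ -[1+ 1 ] *ᶻ (a *ᶻ a *ᶻ (a +ᶻ a))) *ᶻ R ≡
      -[1+ 1 ] *ᶻ (a *ᶻ a) *ᶻ (a *ᶻ R)
    dia₁ = solve-∀
    term : ∀ a n k → (+ 2 *ᶻ (a *ᶻ a *ᶻ (a *ᶻ (a -ᶻ 1ℤ))) +ᶻ -[1+ 0 ] *ᶻ (+ 2 *ᶻ (a *ᶻ a *ᶻ (1ℤ *ᶻ (1ℤ -ᶻ 1ℤ))))) *ᶻ k +ᶻ -[1+ 1 ] *ᶻ (a *ᶻ a) *ᶻ ((n -ᶻ a) *ᶻ k) ≡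
      + 2 *ᶻ (a *ᶻ (a *ᶻ (a *ᶻ a)) *ᶻ k) +ᶻ (-[1+ 1 ] *ᶻ n) *ᶻ (a *ᶻ a *ᶻ k)
    term = solve-∀
    rhs : ∀ g₄ g₂ n → + 2 *ᶻ g₄ +ᶻ (-[1+ 1 ] *ᶻ n) *ᶻ g₂ ≡ + 2 *ᶻ g₄ -ᶻ + 2 *ᶻ (n *ᶻ g₂)
    rhs = solve-∀
    lhs : ∀ x y z → z ≡ + 3 *ᶻ y -ᶻ x → + 18 *ᶻ x -ᶻ + 18 *ᶻ y ≡ + 12 *ᶻ x +ᶻ -[1+ 5 ] *ᶻ z
    lhs x y z refl = ring x y
      where
      ring : ∀ x y → + 18 *ᶻ x -ᶻ + 18 *ᶻ y ≡ + 12 *ᶻ x +ᶻ -[1+ 5 ] *ᶻ (+ 3 *ᶻ y -ᶻ x)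
      ring = solve-∀

open TwistedProducts

-- The product formulas as relations between forms of level 3.

module ModularForms where

  open SeriesSolver using (solve; _:=_; _:+_; _:*_; _:-_; con; :-_)
  -- Linear combinations as data: the same list is read as a series and, by `combAt`, as an integer
  -- for each coefficient, where a common factor can be cancelled.
  comb : List (ℤ × Series) → Series
  comb [] = 0ˢ
  comb ((c , f) ∷ fs) = constˢ c *ˢ f +ˢ comb fs

  combAt : List (ℤ × Series) → ℕ → ℤ
  combAt [] n = 0ℤ
  combAt ((c , f) ∷ fs) n = c *ᶻ f n +ᶻ combAt fs n

  comb-at : ∀ fs n → comb fs n ≡ combAt fs n
  comb-at [] n = 0ˢ-at n
  comb-at ((c , f) ∷ fs) n = trans (+ˢ-at (constˢ c *ˢ f) (comb fs) n) (cong₂ _+ᶻ_ (const-* c f n) (comb-at fs n))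

  comb-≈ : ∀ c .{{_ : ℤ.NonZero c}} fs gs → (∀ n → c *ᶻ combAt fs n ≡ c *ᶻ combAt gs n) → comb fs ≈ comb gs
  comb-≈ c fs gs h = mk≈ λ n → trans (comb-at fs n) (trans (ℤₚ.*-cancelˡ-≡ c (combAt fs n) (combAt gs n) (h n)) (sym (comb-at gs n)))

  comb₀ : comb ((+ 3 , α₀ *ˢ α₀) ∷ []) ≈ comb ((+ 1 , ε₁) ∷ (-[1+ 2 ] , ε₃) ∷ (-[1+ 0 ] , α₀) ∷ [])
  comb₀ = comb-≈ 1ℤ ((+ 3 , α₀ *ˢ α₀) ∷ [])
    ((+ 1 , ε₁) ∷ (-[1+ 2 ] , ε₃) ∷ (-[1+ 0 ] , α₀) ∷ []) λ n → cong (1ℤ *ᶻ_) (trans (ℤₚ.+-identityʳ (+ 3 *ᶻ (α₀ *ˢ α₀) n)) (trans (product₀ n) (ring (ε₁ n) (ε₃ n) (α₀ n))))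
    where
    ring : ∀ e f a → e -ᶻ + 3 *ᶻ f -ᶻ a ≡ + 1 *ᶻ e +ᶻ (-[1+ 2 ] *ᶻ f +ᶻ (-[1+ 0 ] *ᶻ a +ᶻ 0ℤ))
    ring = solve-∀

  comb₁ : comb ((+ 6 , α₀ *ˢ α₁) ∷ []) ≈ comb ((+ 2 , α₀) ∷ (-[1+ 5 ] , θ α₀) ∷ (-[1+ 0 ] , α₁) ∷ (+ 3 , α₂) ∷ [])
  comb₁ = comb-≈ (+ 24) ((+ 6 , α₀ *ˢ α₁) ∷ [])
    ((+ 2 , α₀) ∷ (-[1+ 5 ] , θ α₀) ∷ (-[1+ 0 ] , α₁) ∷ (+ 3 , α₂) ∷ []) λ n → trans (lhs ((α₀ *ˢ α₁) n)) (trans (product₁ n) (rhs (+ n) (α₀ n) (α₁ n) (α₂ n) (α₃ n) (α₄ n)))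
    where
    lhs : ∀ x → + 24 *ᶻ (+ 6 *ᶻ x +ᶻ 0ℤ) ≡ + 72 *ᶻ (+ 2 *ᶻ x)
    lhs = solve-∀
    rhs : ∀ n a b c d e → (+ 48 +ᶻ -[1+ 143 ] *ᶻ n) *ᶻ a +ᶻ -[1+ 23 ] *ᶻ b +ᶻ + 72 *ᶻ c +ᶻ 0ℤ *ᶻ d +ᶻ 0ℤ *ᶻ e ≡
      + 24 *ᶻ (+ 2 *ᶻ a +ᶻ (-[1+ 5 ] *ᶻ (n *ᶻ a) +ᶻ (-[1+ 0 ] *ᶻ b +ᶻ (+ 3 *ᶻ c +ᶻ 0ℤ))))
    rhs = solve-∀

  comb₂ : comb ((+ 3 , α₁ *ˢ α₁) ∷ (+ 18 , α₀ *ˢ α₂) ∷ []) ≈ comb ((+ 2 , α₀) ∷ (+ 2 , α₁) ∷ (-[1+ 2 ] , θ α₁) ∷ (-[1+ 2 ] , α₂) ∷ [])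
  comb₂ = comb-≈ (+ 24) ((+ 3 , α₁ *ˢ α₁) ∷ (+ 18 , α₀ *ˢ α₂) ∷ [])
    ((+ 2 , α₀) ∷ (+ 2 , α₁) ∷ (-[1+ 2 ] , θ α₁) ∷ (-[1+ 2 ] , α₂) ∷ []) λ n → trans (lhs ((α₁ *ˢ α₁) n) ((α₀ *ˢ α₂) n)) (trans (product₂ n) (rhs (+ n) (α₀ n) (α₁ n) (α₂ n) (α₃ n) (α₄ n)))
    where
    lhs : ∀ x y → + 24 *ᶻ (+ 3 *ᶻ x +ᶻ (+ 18 *ᶻ y +ᶻ 0ℤ)) ≡ + 72 *ᶻ (x +ᶻ + 6 *ᶻ y)
    lhs = solve-∀
    rhs : ∀ n a b c d e → + 48 *ᶻ a +ᶻ (+ 48 +ᶻ -[1+ 71 ] *ᶻ n) *ᶻ b +ᶻ -[1+ 71 ] *ᶻ c +ᶻ 0ℤ *ᶻ d +ᶻ 0ℤ *ᶻ e ≡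
      + 24 *ᶻ (+ 2 *ᶻ a +ᶻ (+ 2 *ᶻ b +ᶻ (-[1+ 2 ] *ᶻ (n *ᶻ b) +ᶻ (-[1+ 2 ] *ᶻ c +ᶻ 0ℤ))))
    rhs = solve-∀

  comb₃ : comb ((+ 18 , α₀ *ˢ α₂) ∷ []) ≈ comb ((+ 2 , α₀) ∷ (-[1+ 2 ] , α₂) ∷ (-[1+ 0 ] , α₃) ∷ [])
  comb₃ = comb-≈ (+ 72) ((+ 18 , α₀ *ˢ α₂) ∷ [])
    ((+ 2 , α₀) ∷ (-[1+ 2 ] , α₂) ∷ (-[1+ 0 ] , α₃) ∷ []) λ n → trans (lhs ((α₀ *ˢ α₂) n)) (trans (product₃ n) (rhs (α₀ n) (α₁ n) (α₂ n) (α₃ n) (α₄ n)))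
    where
    lhs : ∀ x → + 72 *ᶻ (+ 18 *ᶻ x +ᶻ 0ℤ) ≡ + 72 *ᶻ (+ 18 *ᶻ x)
    lhs = solve-∀
    rhs : ∀ a b c d e → + 144 *ᶻ a +ᶻ 0ℤ *ᶻ b +ᶻ -[1+ 215 ] *ᶻ c +ᶻ -[1+ 71 ] *ᶻ d +ᶻ 0ℤ *ᶻ e ≡
      + 72 *ᶻ (+ 2 *ᶻ a +ᶻ (-[1+ 2 ] *ᶻ c +ᶻ (-[1+ 0 ] *ᶻ d +ᶻ 0ℤ)))
    rhs = solve-∀

  comb₄ : comb ((+ 6 , α₀ *ˢ α₃) ∷ []) ≈ comb ((-[1+ 1 ] , α₀) ∷ (-[1+ 0 ] , α₃) ∷ (+ 1 , α₄) ∷ [])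
  comb₄ = comb-≈ (+ 72) ((+ 6 , α₀ *ˢ α₃) ∷ [])
    ((-[1+ 1 ] , α₀) ∷ (-[1+ 0 ] , α₃) ∷ (+ 1 , α₄) ∷ []) λ n → trans (lhs ((α₀ *ˢ α₃) n)) (trans (product₄ n) (rhs (α₀ n) (α₁ n) (α₂ n) (α₃ n) (α₄ n)))
    where
    lhs : ∀ x → + 72 *ᶻ (+ 6 *ᶻ x +ᶻ 0ℤ) ≡ + 72 *ᶻ (+ 6 *ᶻ x)
    lhs = solve-∀
    rhs : ∀ a b c d e → -[1+ 143 ] *ᶻ a +ᶻ 0ℤ *ᶻ b +ᶻ 0ℤ *ᶻ c +ᶻ -[1+ 71 ] *ᶻ d +ᶻ + 72 *ᶻ e ≡
      + 72 *ᶻ (-[1+ 1 ] *ᶻ a +ᶻ (-[1+ 0 ] *ᶻ d +ᶻ (+ 1 *ᶻ e +ᶻ 0ℤ)))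
    rhs = solve-∀

  comb₅ : comb ((+ 9 , α₁ *ˢ α₂) ∷ []) ≈ comb ((+ 1 , α₁) ∷ (+ 3 , α₂) ∷ (-[1+ 2 ] , θ α₂) ∷ (+ 1 , α₄) ∷ [])
  comb₅ = comb-≈ (+ 144) ((+ 9 , α₁ *ˢ α₂) ∷ [])
    ((+ 1 , α₁) ∷ (+ 3 , α₂) ∷ (-[1+ 2 ] , θ α₂) ∷ (+ 1 , α₄) ∷ []) λ n → trans (lhs ((α₁ *ˢ α₂) n)) (trans (product₅ n) (rhs (+ n) (α₀ n) (α₁ n) (α₂ n) (α₃ n) (α₄ n)))
    where
    lhs : ∀ x → + 144 *ᶻ (+ 9 *ᶻ x +ᶻ 0ℤ) ≡ + 72 *ᶻ (+ 18 *ᶻ x)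
    lhs = solve-∀
    rhs : ∀ n a b c d e → 0ℤ *ᶻ a +ᶻ + 144 *ᶻ b +ᶻ (+ 432 +ᶻ -[1+ 431 ] *ᶻ n) *ᶻ c +ᶻ 0ℤ *ᶻ d +ᶻ + 144 *ᶻ e ≡
      + 144 *ᶻ (+ 1 *ᶻ b +ᶻ (+ 3 *ᶻ c +ᶻ (-[1+ 2 ] *ᶻ (n *ᶻ c) +ᶻ (+ 1 *ᶻ e +ᶻ 0ℤ))))
    rhs = solve-∀

  comb₆ : comb ((+ 6 , α₀ *ˢ ε₁) ∷ (-[1+ 5 ] , α₀ *ˢ ε₃) ∷ []) ≈ comb ((+ 3 , γ₂) ∷ (-[1+ 0 ] , ε₁) ∷ (+ 1 , ε₃) ∷ (-[1+ 1 ] , θ α₀) ∷ [])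
  comb₆ = comb-≈ 1ℤ ((+ 6 , α₀ *ˢ ε₁) ∷ (-[1+ 5 ] , α₀ *ˢ ε₃) ∷ [])
    ((+ 3 , γ₂) ∷ (-[1+ 0 ] , ε₁) ∷ (+ 1 , ε₃) ∷ (-[1+ 1 ] , θ α₀) ∷ []) λ n → cong (1ℤ *ᶻ_) (trans (cong₂ (λ x y → + 6 *ᶻ x +ᶻ (-[1+ 5 ] *ᶻ y +ᶻ 0ℤ)) (at (*ˢ-cong (≈-sym γ₀≈) (≈-refl {ε₁})) n) (at (*ˢ-cong (≈-sym γ₀≈) (≈-refl {ε₃})) n))
    (trans (lhs ((Lam ones χ *ˢ ε₁) n) ((Lam ones χ *ˢ ε₃) n)) (trans (twisted₁ n) (rhs (γ₂ n) (ε₁ n) (ε₃ n) (+ n *ᶻ α₀ n)))))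
    where
    γ₀≈ : Lam ones χ ≈ α₀
    γ₀≈ = mk≈ γ₀≈α₀
    lhs : ∀ x y → + 6 *ᶻ x +ᶻ (-[1+ 5 ] *ᶻ y +ᶻ 0ℤ) ≡ + 6 *ᶻ x -ᶻ + 6 *ᶻ y
    lhs = solve-∀
    rhs : ∀ g e f t → + 3 *ᶻ g -ᶻ e +ᶻ f -ᶻ + 2 *ᶻ t ≡ + 3 *ᶻ g +ᶻ (-[1+ 0 ] *ᶻ e +ᶻ (+ 1 *ᶻ f +ᶻ (-[1+ 1 ] *ᶻ t +ᶻ 0ℤ)))
    rhs = solve-∀

  comb₇ : comb ((+ 9 , γ₂ *ˢ ε₁) ∷ (-[1+ 8 ] , γ₂ *ˢ ε₃) ∷ []) ≈ comb ((+ 1 , γ₄) ∷ (-[1+ 0 ] , θ γ₂) ∷ [])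
  comb₇ = comb-≈ (+ 2) ((+ 9 , γ₂ *ˢ ε₁) ∷ (-[1+ 8 ] , γ₂ *ˢ ε₃) ∷ [])
    ((+ 1 , γ₄) ∷ (-[1+ 0 ] , θ γ₂) ∷ []) λ n → trans (lhs ((γ₂ *ˢ ε₁) n) ((γ₂ *ˢ ε₃) n)) (trans (twisted₂ n) (rhs (γ₄ n) (+ n *ᶻ γ₂ n)))
    where
    lhs : ∀ x y → + 2 *ᶻ (+ 9 *ᶻ x +ᶻ (-[1+ 8 ] *ᶻ y +ᶻ 0ℤ)) ≡ + 18 *ᶻ x -ᶻ + 18 *ᶻ y
    lhs = solve-∀
    rhs : ∀ g t → + 2 *ᶻ g -ᶻ + 2 *ᶻ t ≡ + 2 *ᶻ (+ 1 *ᶻ g +ᶻ (-[1+ 0 ] *ᶻ t +ᶻ 0ℤ))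
    rhs = solve-∀

  comb₈ : comb ((+ 1 , α₁) ∷ []) ≈ comb ((+ 9 , ε₃) ∷ (-[1+ 0 ] , ε₁) ∷ [])
  comb₈ = comb-≈ 1ℤ ((+ 1 , α₁) ∷ [])
    ((+ 9 , ε₃) ∷ (-[1+ 0 ] , ε₁) ∷ []) λ n → cong (1ℤ *ᶻ_) (trans (lhs (α₁ n)) (trans (α₁-ε n) (rhs (ε₁ n) (ε₃ n))))
    where
    lhs : ∀ x → + 1 *ᶻ x +ᶻ 0ℤ ≡ x
    lhs = solve-∀
    rhs : ∀ e f → + 9 *ᶻ f -ᶻ e ≡ + 9 *ᶻ f +ᶻ (-[1+ 0 ] *ᶻ e +ᶻ 0ℤ)
    rhs = solve-∀

  -- Modular forms of level 3 in Ramanujan's cubic notation: a, B = b³, C = c³; S_B and S_C will be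
  -- the logarithmic derivatives of B and C.  E₅ and γ₄ are the paper's C₀ and uC₀.

  𝐚 𝐁 𝐂 S_B S_C 𝐞 E₅ : Series
  𝐚 = 1ˢ +ˢ constˢ (+ 6) *ˢ α₀
  𝐁 = 1ˢ -ˢ constˢ (+ 9) *ˢ α₂
  𝐂 = constˢ (+ 27) *ˢ γ₂
  S_B = constˢ (+ 9) *ˢ (ε₃ -ˢ ε₁)
  S_C = 1ˢ -ˢ constˢ (+ 3) *ˢ α₁
  𝐞 = 1ˢ +ˢ constˢ (+ 12) *ˢ (ε₁ -ˢ constˢ (+ 3) *ˢ ε₃)
  E₅ = 1ˢ +ˢ constˢ (+ 3) *ˢ α₄

  -- `modulo` for a single relation l ≈ r, with cofactor A.
  by : ∀ {l r f g} A → l ≈ r → f ≈ g +ˢ A *ˢ (l -ˢ r) → f ≈ g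
  by {l} {r} {f} {g} A p h = ≈-trans h (≈-trans (+ˢ-cong ≈-refl (≈-trans (*ˢ-cong ≈-refl (≈⇒-≈0 (≈-sym p))) (𝒮.zeroʳ A))) (𝒮.+-identityʳ g))

  θ-scale : ∀ c f → θ (constˢ c *ˢ f) ≈ constˢ c *ˢ θ f
  θ-scale c f = ≈-trans (θ-* (constˢ c) f) (≈-trans (+ˢ-cong (≈-trans (*ˢ-cong (θ-const c) ≈-refl) (𝒮.zeroˡ f)) ≈-refl) (𝒮.+-identityˡ (constˢ c *ˢ θ f)))

  θ-sub : ∀ f g → θ (f -ˢ g) ≈ θ f -ˢ θ g
  θ-sub f g = ≈-trans (θ-+ f (-ˢ g)) (+ˢ-cong ≈-refl (θ-neg g))

  θ𝐚 : θ 𝐚 ≈ constˢ (+ 6) *ˢ θ α₀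
  θ𝐚 = ≈-trans (θ-+ 1ˢ _) (≈-trans (+ˢ-cong (θ-const 1ℤ) (θ-scale (+ 6) α₀)) (𝒮.+-identityˡ _))

  θ𝐁 : θ 𝐁 ≈ -ˢ (constˢ (+ 9) *ˢ θ α₂)
  θ𝐁 = ≈-trans (θ-sub 1ˢ _) (≈-trans (+ˢ-cong (θ-const 1ℤ) (-ˢ-cong (θ-scale (+ 9) α₂))) (𝒮.+-identityˡ _))

  θS_C : θ S_C ≈ -ˢ (constˢ (+ 3) *ˢ θ α₁)
  θS_C = ≈-trans (θ-sub 1ˢ _) (≈-trans (+ˢ-cong (θ-const 1ℤ) (-ˢ-cong (θ-scale (+ 3) α₁))) (𝒮.+-identityˡ _))

  -- Provides a² in the additive form in which the logarithmic derivative of the eta quotient will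
  -- appear.
  𝐚²≈𝐞 : 𝐚 *ˢ 𝐚 ≈ 𝐞
  𝐚²≈𝐞 = by (constˢ (+ 12)) comb₀ (solve 3 (λ a e f → (con 1ℤ :+ con (+ 6) :* a) :* (con 1ℤ :+ con (+ 6) :* a) :=
    con 1ℤ :+ con (+ 12) :* (e :- con (+ 3) :* f) :+ con (+ 12) :* ((con (+ 3) :* (a :* a) :+ con 0ℤ) :- (con (+ 1) :* e :+ (con -[1+ 2 ] :* f :+ (con -[1+ 0 ] :* a :+ con 0ℤ))))) ≈-refl α₀ ε₁ ε₃)

  S_C≈ : S_C ≈ S_B +ˢ 𝐞
  S_C≈ = by (constˢ -[1+ 2 ]) comb₈ (solve 3 (λ a e f → con 1ℤ :- con (+ 3) :* a := con (+ 9) :* (f :- e) :+ (con 1ℤ :+ con (+ 12) :* (e :- con (+ 3) :* f))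
    :+ con -[1+ 2 ] :* ((con (+ 1) :* a :+ con 0ℤ) :- (con (+ 9) :* f :+ (con -[1+ 0 ] :* e :+ con 0ℤ)))) ≈-refl α₁ ε₁ ε₃)

  3θ𝐚-C : constˢ (+ 3) *ˢ θ 𝐚 ≈ 𝐚 *ˢ S_C -ˢ 𝐁
  3θ𝐚-C = ≈-trans (*ˢ-cong ≈-refl θ𝐚) (by (constˢ (+ 3)) comb₁ (solve 4 (λ a b c t → con (+ 3) :* (con (+ 6) :* t) :=
    (con 1ℤ :+ con (+ 6) :* a) :* (con 1ℤ :- con (+ 3) :* b) :- (con 1ℤ :- con (+ 9) :* c)
    :+ con (+ 3) :* ((con (+ 6) :* (a :* b) :+ con 0ℤ) :- (con (+ 2) :* a :+ (con -[1+ 5 ] :* t :+ (con -[1+ 0 ] :* b :+ (con (+ 3) :* c :+ con 0ℤ)))))) ≈-refl α₀ α₁ α₂ (θ α₀)))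

  3θS_C : constˢ (+ 3) *ˢ θ S_C ≈ S_C *ˢ S_C -ˢ 𝐚 *ˢ 𝐁
  3θS_C = ≈-trans (*ˢ-cong ≈-refl θS_C) (by (constˢ -[1+ 2 ]) comb₂ (solve 4 (λ a b c t → con (+ 3) :* (:- (con (+ 3) :* t)) :=
    (con 1ℤ :- con (+ 3) :* b) :* (con 1ℤ :- con (+ 3) :* b) :- (con 1ℤ :+ con (+ 6) :* a) :* (con 1ℤ :- con (+ 9) :* c)
    :+ con -[1+ 2 ] :* ((con (+ 3) :* (b :* b) :+ (con (+ 18) :* (a :* c) :+ con 0ℤ)) :- (con (+ 2) :* a :+ (con (+ 2) :* b :+ (con -[1+ 2 ] :* t :+ (con -[1+ 2 ] :* c :+ con 0ℤ)))))) ≈-refl α₀ α₁ α₂ (θ α₁)))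

  𝐚𝐁 : 𝐚 *ˢ 𝐁 ≈ 1ˢ +ˢ constˢ (+ 3) *ˢ α₃
  𝐚𝐁 = by (constˢ -[1+ 2 ]) comb₃ (solve 3 (λ a c d → (con 1ℤ :+ con (+ 6) :* a) :* (con 1ℤ :- con (+ 9) :* c) := con 1ℤ :+ con (+ 3) :* d
    :+ con -[1+ 2 ] :* ((con (+ 18) :* (a :* c) :+ con 0ℤ) :- (con (+ 2) :* a :+ (con -[1+ 2 ] :* c :+ (con -[1+ 0 ] :* d :+ con 0ℤ))))) ≈-refl α₀ α₂ α₃)

  -- The weight is raised by one factor 𝐚 at a time, through α₃ in weight 4.
  𝐚²𝐁 : 𝐞 *ˢ 𝐁 ≈ E₅
  𝐚²𝐁 = ≈-trans (*ˢ-cong (≈-sym 𝐚²≈𝐞) ≈-refl) (≈-trans (𝒮.*-assoc 𝐚 𝐚 𝐁) (≈-trans (*ˢ-cong ≈-refl 𝐚𝐁) (by (constˢ (+ 3)) comb₄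
    (solve 3 (λ a d e → (con 1ℤ :+ con (+ 6) :* a) :* (con 1ℤ :+ con (+ 3) :* d) := con 1ℤ :+ con (+ 3) :* e
      :+ con (+ 3) :* ((con (+ 6) :* (a :* d) :+ con 0ℤ) :- (con -[1+ 1 ] :* a :+ (con -[1+ 0 ] :* d :+ (con (+ 1) :* e :+ con 0ℤ))))) ≈-refl α₀ α₃ α₄))))

  θ𝐁-C : θ 𝐁 ≈ 𝐁 *ˢ S_C -ˢ E₅
  θ𝐁-C = ≈-trans θ𝐁 (by (constˢ -[1+ 2 ]) comb₅ (solve 4 (λ b c e t → :- (con (+ 9) :* t) :=
    (con 1ℤ :- con (+ 9) :* c) :* (con 1ℤ :- con (+ 3) :* b) :- (con 1ℤ :+ con (+ 3) :* e)
    :+ con -[1+ 2 ] :* ((con (+ 9) :* (b :* c) :+ con 0ℤ) :- (con (+ 1) :* b :+ (con (+ 3) :* c :+ (con -[1+ 2 ] :* t :+ (con (+ 1) :* e :+ con 0ℤ)))))) ≈-refl α₁ α₂ α₄ (θ α₂)))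

  3θ𝐚-B : constˢ (+ 3) *ˢ θ 𝐚 ≈ 𝐚 *ˢ S_B +ˢ 𝐂
  3θ𝐚-B = ≈-trans (*ˢ-cong ≈-refl θ𝐚) (by (constˢ (+ 9)) comb₆ (solve 5 (λ a e f g t → con (+ 3) :* (con (+ 6) :* t) :=
    (con 1ℤ :+ con (+ 6) :* a) :* (con (+ 9) :* (f :- e)) :+ con (+ 27) :* g
    :+ con (+ 9) :* ((con (+ 6) :* (a :* e) :+ (con -[1+ 5 ] :* (a :* f) :+ con 0ℤ)) :- (con (+ 3) :* g :+ (con -[1+ 0 ] :* e :+ (con (+ 1) :* f :+ (con -[1+ 1 ] :* t :+ con 0ℤ)))))) ≈-refl α₀ ε₁ ε₃ γ₂ (θ α₀)))

  θ𝐂-B : θ 𝐂 ≈ 𝐂 *ˢ S_B +ˢ constˢ (+ 27) *ˢ γ₄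
  θ𝐂-B = ≈-trans (θ-scale (+ 27) γ₂) (by (constˢ (+ 27)) comb₇ (solve 5 (λ e f g h t → con (+ 27) :* t :=
    (con (+ 27) :* g) :* (con (+ 9) :* (f :- e)) :+ con (+ 27) :* h
    :+ con (+ 27) :* ((con (+ 9) :* (g :* e) :+ (con -[1+ 8 ] :* (g :* f) :+ con 0ℤ)) :- (con (+ 1) :* h :+ (con -[1+ 0 ] :* t :+ con 0ℤ)))) ≈-refl ε₁ ε₃ γ₂ γ₄ (θ γ₂)))

open ModularForms

-- Differential relations, the Hauptmodul and the equation of second order.

module ModularRelations where

  open SeriesSolver using (solve; _:=_; _:+_; _:*_; _:-_; con; :-_)
  3ˢ : Series
  3ˢ = constˢ (+ 3)

  constˢ-cancel : ∀ c .{{_ : ℤ.NonZero c}} {f g} → constˢ c *ˢ f ≈ constˢ c *ˢ g → f ≈ g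
  constˢ-cancel c {f} {g} p = mk≈ λ n → ℤₚ.*-cancelˡ-≡ c (f n) (g n) (trans (sym (const-* c f n)) (trans (at p n) (const-* c g n)))

  -- Equating the two formulas for 3θ𝐚 gives 𝐚(S_C - S_B) = 𝐁 + 𝐂, and S_C - S_B is 𝐞.
  𝐚³≈𝐁+𝐂 : 𝐚 *ˢ 𝐞 ≈ 𝐁 +ˢ 𝐂
  𝐚³≈𝐁+𝐂 = by 1ˢ (≈-trans (≈-sym 3θ𝐚-C) 3θ𝐚-B) (≈-trans (solve 5 (λ a e s B C → a :* e := (B :+ C) :+ con 1ℤ :* ((a :* (s :+ e) :- B) :- (a :* s :+ C))) ≈-refl 𝐚 𝐞 S_B 𝐁 𝐂)
    (+ˢ-cong ≈-refl (*ˢ-cong ≈-refl (+ˢ-cong (+ˢ-cong (*ˢ-cong ≈-refl (≈-sym S_C≈)) ≈-refl) ≈-refl))))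

  -- In `θ𝐁-C` the term E₅ is 𝐞𝐁, which lowers S_C to S_C - 𝐞 = S_B.
  θ𝐁-B : θ 𝐁 ≈ 𝐁 *ˢ S_B
  θ𝐁-B = ≈-trans θ𝐁-C (≈-trans (+ˢ-cong (*ˢ-cong ≈-refl S_C≈) (-ˢ-cong (≈-sym 𝐚²𝐁))) (solve 3 (λ B s e → B :* (s :+ e) :- e :* B := B :* s) ≈-refl 𝐁 S_B 𝐞))

  -- Differentiate 𝐂 = 𝐚³ - 𝐁: everything on the right already has a known derivative.
  θ𝐂-C : θ 𝐂 ≈ 𝐂 *ˢ S_C
  θ𝐂-C = begin
    θ 𝐂
      ≈⟨ solve 2 (λ b c → c := b :+ c :- b) ≈-refl (θ 𝐁) (θ 𝐂) ⟩
    θ 𝐁 +ˢ θ 𝐂 -ˢ θ 𝐁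
      ≈⟨ +ˢ-cong (≈-trans (≈-sym (θ-+ 𝐁 𝐂)) (θ-cong (≈-trans (≈-sym 𝐚³≈𝐁+𝐂) (*ˢ-cong ≈-refl (≈-sym 𝐚²≈𝐞))))) (-ˢ-cong θ𝐁-B) ⟩
    θ (𝐚 *ˢ (𝐚 *ˢ 𝐚)) -ˢ 𝐁 *ˢ S_B
      ≈⟨ +ˢ-cong (≈-trans (θ-* 𝐚 (𝐚 *ˢ 𝐚)) (+ˢ-cong ≈-refl (*ˢ-cong ≈-refl (θ-* 𝐚 𝐚)))) ≈-refl ⟩
    θ 𝐚 *ˢ (𝐚 *ˢ 𝐚) +ˢ 𝐚 *ˢ (θ 𝐚 *ˢ 𝐚 +ˢ 𝐚 *ˢ θ 𝐚) -ˢ 𝐁 *ˢ S_B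
      ≈⟨ solve 4 (λ t a B s → t :* (a :* a) :+ a :* (t :* a :+ a :* t) :- B :* s := (a :* a) :* (con (+ 3) :* t) :- B :* s) ≈-refl (θ 𝐚) 𝐚 𝐁 S_B ⟩
    (𝐚 *ˢ 𝐚) *ˢ (3ˢ *ˢ θ 𝐚) -ˢ 𝐁 *ˢ S_B
      ≈⟨ +ˢ-cong (*ˢ-cong 𝐚²≈𝐞 3θ𝐚-C) ≈-refl ⟩
    𝐞 *ˢ (𝐚 *ˢ S_C -ˢ 𝐁) -ˢ 𝐁 *ˢ S_B
      ≈⟨ solve 5 (λ e a s B s' → e :* (a :* s :- B) :- B :* s' := (a :* e) :* s :- B :* (s' :+ e)) ≈-refl 𝐞 𝐚 S_C 𝐁 S_B ⟩
    (𝐚 *ˢ 𝐞) *ˢ S_C -ˢ 𝐁 *ˢ (S_B +ˢ 𝐞)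
      ≈⟨ +ˢ-cong (*ˢ-cong 𝐚³≈𝐁+𝐂 ≈-refl) (-ˢ-cong (*ˢ-cong ≈-refl (≈-sym S_C≈))) ⟩
    (𝐁 +ˢ 𝐂) *ˢ S_C -ˢ 𝐁 *ˢ S_C
      ≈⟨ solve 3 (λ B C s → (B :+ C) :* s :- B :* s := C :* s) ≈-refl 𝐁 𝐂 S_C ⟩
    𝐂 *ˢ S_C ∎
    where open import Relation.Binary.Reasoning.Setoid 𝒮.setoid

  -- The two formulas for θ𝐂 differ by 𝐂(S_C - S_B) = 𝐞𝐂.
  27γ₄ : constˢ (+ 27) *ˢ γ₄ ≈ 𝐞 *ˢ 𝐂
  27γ₄ = ≈-trans (solve 3 (λ v C s → v := (C :* s :+ v) :- C :* s) ≈-refl (constˢ (+ 27) *ˢ γ₄) 𝐂 S_B)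
    (≈-trans (+ˢ-cong (≈-trans (≈-sym θ𝐂-B) (≈-trans θ𝐂-C (*ˢ-cong ≈-refl S_C≈))) ≈-refl) (solve 3 (λ C s e → C :* (s :+ e) :- C :* s := e :* C) ≈-refl 𝐂 S_B 𝐞))

  -- Coefficient n of the equation reads n f(n) = f(n) + (terms in lower coefficients). It forces
  -- f(0) = 0, leaves f(1) free, and determines all later coefficients.
  θ-unique : ∀ f s → s 0 ≡ 1ℤ → θ f ≈ f *ˢ s → f 1 ≡ 0ℤ → f ≈ 0ˢ
  θ-unique f s s0 ode f1 = mk≈ λ n → trans (<-rec (λ n → f n ≡ 0ℤ) step n) (sym (0ˢ-at n))
    where
    step : ∀ n → (∀ {m} → m < n → f m ≡ 0ℤ) → f n ≡ 0ℤ
    step zero _ = sym (trans (at ode 0) (trans (*ˢ-0 f s) (trans (cong (f 0 *ᶻ_) s0) (ℤₚ.*-identityʳ (f 0)))))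
    step (suc zero) _ = f1
    step n@(suc (suc m)) rec = ℤₚ.*-cancelˡ-≡ (+ suc m) (f n) 0ℤ (trans (drop (+ suc m) (f n) eq) (sym (ℤₚ.*-zeroʳ (+ suc m))))
      where
      lower : ∑ n (λ i → f i *ᶻ s (n ∸ i)) ≡ 0ℤ
      lower = ∑-zero n (λ i i<n → cong (_*ᶻ s (n ∸ i)) (rec i<n))
      eq : (1ℤ +ᶻ + suc m) *ᶻ f n ≡ f n
      eq = trans (at ode n) (trans (*ˢ-at f s n) (trans (⊛-coeff f s n) (trans (∑-last n (λ i → f i *ᶻ s (n ∸ i))) (trans (cong₂ _+ᶻ_ lower (trans (cong (λ z → f n *ᶻ s z) (ℕₚ.n∸n≡0 n)) (trans (cong (f n *ᶻ_) s0) (ℤₚ.*-identityʳ (f n))))) (ℤₚ.+-identityˡ (f n))))))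
      drop : ∀ c x → (1ℤ +ᶻ c) *ᶻ x ≡ x → c *ᶻ x ≡ 0ℤ
      drop c x h = trans (ring c x) (trans (cong (_-ᶻ x) h) (ℤₚ.+-inverseʳ x))
        where
        ring : ∀ c x → c *ᶻ x ≡ (1ℤ +ᶻ c) *ᶻ x -ᶻ x
        ring = solve-∀

  1-const-0 : ∀ c f → f 0 ≡ 0ℤ → (1ˢ -ˢ constˢ c *ˢ f) 0 ≡ 1ℤ
  1-const-0 c f f0 = trans (-ˢ-at₂ 1ˢ (constˢ c *ˢ f) 0) (cong (λ z → 1ℤ -ᶻ z) (trans (const-* c f 0) (trans (cong (c *ᶻ_) f0) (ℤₚ.*-zeroʳ c))))

  S_C-0 : S_C 0 ≡ 1ℤ
  S_C-0 = 1-const-0 (+ 3) α₁ refl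

  module Hauptmodul (u : Series) (u0 : u 0 ≡ 0ℤ) (u1 : u 1 ≡ 1ℤ) (θu : θ u ≈ u *ˢ 𝐞) where

    27ˢ : Series
    27ˢ = constˢ (+ 27)

    -- Both sides have the logarithmic derivative S_C, since θ(u𝐁) = u𝐁(𝐞 + S_B), and both begin
    -- with 27q.
    𝐂≈27u𝐁 : 𝐂 ≈ 27ˢ *ˢ (u *ˢ 𝐁)
    𝐂≈27u𝐁 = ≈-trans (solve 2 (λ C D → C := (C :- D) :+ D) ≈-refl 𝐂 D) (≈-trans (+ˢ-cong (θ-unique (𝐂 -ˢ D) S_C S_C-0 ode d1) ≈-refl) (𝒮.+-identityˡ D))
      where
      D = 27ˢ *ˢ (u *ˢ 𝐁)
      ode : θ (𝐂 -ˢ D) ≈ (𝐂 -ˢ D) *ˢ S_C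
      ode = ≈-trans (θ-sub 𝐂 D) (≈-trans (+ˢ-cong θ𝐂-C (-ˢ-cong (≈-trans (θ-scale (+ 27) (u *ˢ 𝐁)) (*ˢ-cong ≈-refl (≈-trans (θ-* u 𝐁) (+ˢ-cong (*ˢ-cong θu ≈-refl) (*ˢ-cong ≈-refl θ𝐁-B)))))))
        (≈-trans (solve 6 (λ C S u e B s → C :* S :- con (+ 27) :* ((u :* e) :* B :+ u :* (B :* s)) := C :* S :- con (+ 27) :* (u :* B) :* (s :+ e)) ≈-refl 𝐂 S_C u 𝐞 𝐁 S_B)
        (≈-trans (+ˢ-cong ≈-refl (-ˢ-cong (*ˢ-cong ≈-refl (≈-sym S_C≈)))) (solve 3 (λ C D S → C :* S :- D :* S := (C :- D) :* S) ≈-refl 𝐂 D S_C))))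
      uB : (u *ˢ 𝐁) 1 ≡ 1ℤ
      uB = trans (*ˢ-suc u 𝐁 0) (cong₂ _+ᶻ_ (cong (_*ᶻ 𝐁 1) u0) (trans (*ˢ-0 (u ∘ suc) 𝐁) (cong₂ _*ᶻ_ u1 (1-const-0 (+ 9) α₂ refl))))
      d1 : (𝐂 -ˢ D) 1 ≡ 0ℤ
      d1 = trans (-ˢ-at₂ 𝐂 D 1) (cong₂ _-ᶻ_ (const-* (+ 27) γ₂ 1) (trans (const-* (+ 27) (u *ˢ 𝐁) 1) (cong (+ 27 *ᶻ_) uB)))

    w : Series
    w = 1ˢ +ˢ 27ˢ *ˢ u

    𝐚³≈𝐁w : 𝐚 *ˢ 𝐞 ≈ 𝐁 *ˢ w
    𝐚³≈𝐁w = ≈-trans 𝐚³≈𝐁+𝐂 (≈-trans (+ˢ-cong ≈-refl 𝐂≈27u𝐁) (solve 2 (λ B u → B :+ con (+ 27) :* (u :* B) := B :* (con 1ℤ :+ con (+ 27) :* u)) ≈-refl 𝐁 u))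

    θw : θ w ≈ 27ˢ *ˢ (u *ˢ 𝐞)
    θw = ≈-trans (θ-+ 1ˢ (27ˢ *ˢ u)) (≈-trans (+ˢ-cong (θ-const 1ℤ) (≈-trans (θ-scale (+ 27) u) (*ˢ-cong ≈-refl θu))) (𝒮.+-identityˡ _))

    -- i = 1/w, t = u/w², g = (1 - 27 u)/w, so that θ t = t a² g.
    module _ (i : Series) (wi : w *ˢ i ≈ 1ˢ) where

      t g : Series
      t = u *ˢ (i *ˢ i)
      g = (1ˢ -ˢ 27ˢ *ˢ u) *ˢ i

      θi : θ i ≈ -ˢ (27ˢ *ˢ (u *ˢ 𝐞) *ˢ (i *ˢ i))
      θi = begin
        θ i
          ≈⟨ by (-ˢ θ i) wi (solve 3 (λ w i s → s := (w :* i) :* s :+ (:- s) :* (w :* i :- con 1ℤ)) ≈-refl w i (θ i)) ⟩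
        (w *ˢ i) *ˢ θ i
          ≈⟨ solve 4 (λ w i s r → (w :* i) :* s := i :* (r :* i :+ w :* s) :- r :* (i :* i)) ≈-refl w i (θ i) (θ w) ⟩
        i *ˢ (θ w *ˢ i +ˢ w *ˢ θ i) -ˢ θ w *ˢ (i *ˢ i)
          ≈⟨ +ˢ-cong (*ˢ-cong ≈-refl (≈-trans (≈-sym (θ-* w i)) (≈-trans (θ-cong wi) (θ-const 1ℤ)))) (-ˢ-cong (*ˢ-cong θw ≈-refl)) ⟩
        i *ˢ 0ˢ -ˢ 27ˢ *ˢ (u *ˢ 𝐞) *ˢ (i *ˢ i)
          ≈⟨ solve 2 (λ i s → i :* con 0ℤ :- s := :- s) ≈-refl i (27ˢ *ˢ (u *ˢ 𝐞) *ˢ (i *ˢ i)) ⟩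
        -ˢ (27ˢ *ˢ (u *ˢ 𝐞) *ˢ (i *ˢ i)) ∎
        where open import Relation.Binary.Reasoning.Setoid 𝒮.setoid

      -- θt/t is 𝐞 - 2 · 27u𝐞/w, and w - 54u = 1 - 27u.
      θt : θ t ≈ t *ˢ (𝐞 *ˢ g)
      θt = ≈-trans (θ-* u (i *ˢ i)) (≈-trans (+ˢ-cong (*ˢ-cong θu ≈-refl) (*ˢ-cong ≈-refl (≈-trans (θ-* i i) (+ˢ-cong (*ˢ-cong θi ≈-refl) (*ˢ-cong ≈-refl θi)))))
        (by (-ˢ (u *ˢ i *ˢ i *ˢ 𝐞)) wi (solve 3 (λ u e i → let w = con 1ℤ :+ con (+ 27) :* u ; s = :- (con (+ 27) :* (u :* e) :* (i :* i)) in
          (u :* e) :* (i :* i) :+ u :* (s :* i :+ i :* s) := u :* (i :* i) :* (e :* ((con 1ℤ :- con (+ 27) :* u) :* i)) :+ (:- (u :* i :* i :* e)) :* (w :* i :- con 1ℤ)) ≈-refl u 𝐞 i)))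

      θg : θ g ≈ -ˢ (constˢ (+ 54) *ˢ (𝐞 *ˢ t))
      θg = ≈-trans (θ-* (1ˢ -ˢ 27ˢ *ˢ u) i) (≈-trans (+ˢ-cong (*ˢ-cong (≈-trans (θ-sub 1ˢ (27ˢ *ˢ u)) (+ˢ-cong (θ-const 1ℤ) (-ˢ-cong (≈-trans (θ-scale (+ 27) u) (*ˢ-cong ≈-refl θu))))) ≈-refl) (*ˢ-cong ≈-refl θi))
        (by (27ˢ *ˢ u *ˢ 𝐞 *ˢ i) wi (solve 3 (λ u e i → let w = con 1ℤ :+ con (+ 27) :* u in
          (con 0ℤ :- con (+ 27) :* (u :* e)) :* i :+ (con 1ℤ :- con (+ 27) :* u) :* (:- (con (+ 27) :* (u :* e) :* (i :* i))) :=
          :- (con (+ 54) :* (e :* (u :* (i :* i)))) :+ (con (+ 27) :* u :* e :* i) :* (w :* i :- con 1ℤ)) ≈-refl u 𝐞 i)))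

      -- (1 + 27u)² - (1 - 27u)² = 108u; this is where 108 enters.
      g² : g *ˢ g ≈ 1ˢ -ˢ constˢ (+ 108) *ˢ t
      g² = by (w *ˢ i +ˢ 1ˢ) wi (solve 2 (λ u i → let w = con 1ℤ :+ con (+ 27) :* u ; v = con 1ℤ :- con (+ 27) :* u in
        (v :* i) :* (v :* i) := (con 1ℤ :- con (+ 108) :* (u :* (i :* i))) :+ (w :* i :+ con 1ℤ) :* (w :* i :- con 1ℤ)) ≈-refl u i)

      𝐁≈ : 𝐁 ≈ 𝐚 *ˢ 𝐞 *ˢ i
      𝐁≈ = by (-ˢ 𝐁) wi (≈-trans (solve 3 (λ B w i → B := (B :* w) :* i :+ (:- B) :* (w :* i :- con 1ℤ)) ≈-refl 𝐁 w i) (+ˢ-cong (*ˢ-cong (≈-sym 𝐚³≈𝐁w) ≈-refl) ≈-refl))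

      -- 𝐚³ = 𝐁w cancels the denominator of g and leaves 𝐞𝐁(1 - 27u), where 27u𝐁 is 𝐂.
      weight-5 : (𝐚 *ˢ (𝐚 *ˢ 𝐚)) *ˢ (𝐞 *ˢ g) ≈ E₅ -ˢ 27ˢ *ˢ γ₄
      weight-5 = begin
        (𝐚 *ˢ (𝐚 *ˢ 𝐚)) *ˢ (𝐞 *ˢ g)
          ≈⟨ *ˢ-cong (≈-trans (*ˢ-cong ≈-refl 𝐚²≈𝐞) 𝐚³≈𝐁w) ≈-refl ⟩
        (𝐁 *ˢ w) *ˢ (𝐞 *ˢ g)
          ≈⟨ by (𝐁 *ˢ 𝐞 *ˢ (1ˢ -ˢ 27ˢ *ˢ u)) wi (solve 5 (λ B w e u i → (B :* w) :* (e :* ((con 1ℤ :- con (+ 27) :* u) :* i)) :=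
               (e :* B :- e :* (con (+ 27) :* (u :* B))) :+ (B :* e :* (con 1ℤ :- con (+ 27) :* u)) :* (w :* i :- con 1ℤ)) ≈-refl 𝐁 w 𝐞 u i) ⟩
        𝐞 *ˢ 𝐁 -ˢ 𝐞 *ˢ (27ˢ *ˢ (u *ˢ 𝐁))
          ≈⟨ +ˢ-cong 𝐚²𝐁 (-ˢ-cong (≈-trans (*ˢ-cong ≈-refl (≈-sym 𝐂≈27u𝐁)) (≈-sym 27γ₄))) ⟩
        E₅ -ˢ 27ˢ *ˢ γ₄ ∎
        where open import Relation.Binary.Reasoning.Setoid 𝒮.setoid

      p : Series
      p = θ 𝐚

      3θp : 3ˢ *ˢ θ p ≈ p *ˢ S_C +ˢ 𝐚 *ˢ θ S_C -ˢ 𝐁 *ˢ S_B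
      3θp = ≈-trans (≈-sym (θ-scale (+ 3) p)) (≈-trans (θ-cong 3θ𝐚-C) (≈-trans (θ-sub (𝐚 *ˢ S_C) 𝐁) (+ˢ-cong (θ-* 𝐚 S_C) (-ˢ-cong θ𝐁-B))))

      -- Eliminates S_B and S_C from the first-order system; the factor 9 is there because the
      -- system is stated for 3θ𝐚 and 3θS_C.
      𝐚θp : 𝐚 *ˢ θ p ≈ 2ˢ *ˢ (p *ˢ p) +ˢ constˢ (+ 6) *ˢ (𝐞 *ˢ 𝐞 *ˢ 𝐞 *ˢ t)
      𝐚θp = constˢ-cancel (+ 9) (begin
        constˢ (+ 9) *ˢ (𝐚 *ˢ θ p)
          ≈⟨ ≈-trans (solve 2 (λ a q → con (+ 9) :* (a :* q) := con (+ 3) :* a :* (con (+ 3) :* q)) ≈-refl 𝐚 (θ p)) (*ˢ-cong ≈-refl 3θp) ⟩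
        3ˢ *ˢ 𝐚 *ˢ (p *ˢ S_C +ˢ 𝐚 *ˢ θ S_C -ˢ 𝐁 *ˢ S_B)
          ≈⟨ *ˢ-cong ≈-refl (+ˢ-cong ≈-refl (-ˢ-cong (*ˢ-cong ≈-refl S_B≈))) ⟩
        3ˢ *ˢ 𝐚 *ˢ (p *ˢ S_C +ˢ 𝐚 *ˢ θ S_C -ˢ 𝐁 *ˢ (S_C -ˢ 𝐞))
          ≈⟨ modulo (≈⇒-≈0 (≈-sym 3θ𝐚-C)) (≈⇒-≈0 (≈-sym 3θS_C)) (≈⇒-≈0 𝐚²≈𝐞)
               (-ˢ (𝐚 *ˢ S_C +ˢ constˢ (+ 6) *ˢ p -ˢ 2ˢ *ˢ 𝐁)) (𝐚 *ˢ 𝐚) (𝐚 *ˢ 𝐁)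
               (solve 6 (λ a p S s B e → con (+ 3) :* a :* (p :* S :+ a :* s :- B :* (S :- e)) :=
                 con (+ 18) :* (p :* p) :+ con (+ 2) :* (B :* (a :* e :- B)) :+
                 (:- (a :* S :+ con (+ 6) :* p :- con (+ 2) :* B) :* (con (+ 3) :* p :- (a :* S :- B)) :+ (a :* a) :* (con (+ 3) :* s :- (S :* S :- a :* B)) :+ (a :* B) :* (e :- a :* a)))
                 ≈-refl 𝐚 p S_C (θ S_C) 𝐁 𝐞) ⟩
        constˢ (+ 18) *ˢ (p *ˢ p) +ˢ 2ˢ *ˢ (𝐁 *ˢ (𝐚 *ˢ 𝐞 -ˢ 𝐁))
          ≈⟨ +ˢ-cong ≈-refl (*ˢ-cong ≈-refl (*ˢ-cong 𝐁≈ (≈-trans (+ˢ-cong 𝐚³≈𝐁w ≈-refl) (≈-trans (solve 2 (λ B u → B :* (con 1ℤ :+ con (+ 27) :* u) :- B := con (+ 27) :* u :* B) ≈-refl 𝐁 u) (*ˢ-cong ≈-refl 𝐁≈))))) ⟩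
        constˢ (+ 18) *ˢ (p *ˢ p) +ˢ 2ˢ *ˢ ((𝐚 *ˢ 𝐞 *ˢ i) *ˢ (27ˢ *ˢ u *ˢ (𝐚 *ˢ 𝐞 *ˢ i)))
          ≈⟨ by (constˢ (+ 54) *ˢ (𝐞 *ˢ 𝐞 *ˢ u *ˢ i *ˢ i)) 𝐚²≈𝐞 (solve 5 (λ p a e i u → con (+ 18) :* (p :* p) :+ con (+ 2) :* ((a :* e :* i) :* (con (+ 27) :* u :* (a :* e :* i))) :=
               con (+ 9) :* (con (+ 2) :* (p :* p) :+ con (+ 6) :* (e :* e :* e :* (u :* (i :* i)))) :+ con (+ 54) :* (e :* e :* u :* i :* i) :* (a :* a :- e)) ≈-refl p 𝐚 𝐞 i u) ⟩
        constˢ (+ 9) *ˢ (2ˢ *ˢ (p *ˢ p) +ˢ constˢ (+ 6) *ˢ (𝐞 *ˢ 𝐞 *ˢ 𝐞 *ˢ t)) ∎)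
        where
        open import Relation.Binary.Reasoning.Setoid 𝒮.setoid
        S_B≈ : S_B ≈ S_C -ˢ 𝐞
        S_B≈ = ≈-trans (solve 2 (λ s e → s := (s :+ e) :- e) ≈-refl S_B 𝐞) (+ˢ-cong (≈-sym S_C≈) ≈-refl)

      θ𝐞 : θ 𝐞 ≈ 2ˢ *ˢ (𝐚 *ˢ p)
      θ𝐞 = ≈-trans (θ-cong (≈-sym 𝐚²≈𝐞)) (≈-trans (θ-* 𝐚 𝐚) (solve 2 (λ a p → p :* a :+ a :* p := con (+ 2) :* (a :* p)) ≈-refl 𝐚 p))

      module _ (j : Series) (Gj : (𝐞 *ˢ g) *ˢ j ≈ 1ˢ) where

        private
          G = 𝐞 *ˢ g

        -- Since θt = tG and Gj = 1, the operator f ↦ (θf)j is t d/dt. These are its first and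
        -- second application to 𝐚.
        a₁ a₂ : Series
        a₁ = p *ˢ j
        a₂ = θ a₁ *ˢ j

        θG : θ G ≈ 2ˢ *ˢ (𝐚 *ˢ p) *ˢ g -ˢ constˢ (+ 54) *ˢ (𝐞 *ˢ 𝐞 *ˢ t)
        θG = ≈-trans (θ-* 𝐞 g) (≈-trans (+ˢ-cong (*ˢ-cong θ𝐞 ≈-refl) (*ˢ-cong ≈-refl θg)) (solve 4 (λ a g e t → a :* g :+ e :* (:- (con (+ 54) :* (e :* t))) := a :* g :- con (+ 54) :* (e :* e :* t)) ≈-refl (2ˢ *ˢ (𝐚 *ˢ p)) g 𝐞 t))

        θj : θ j ≈ -ˢ (θ G *ˢ (j *ˢ j))
        θj = begin
          θ j
            ≈⟨ by (-ˢ θ j) Gj (solve 3 (λ w i s → s := (w :* i) :* s :+ (:- s) :* (w :* i :- con 1ℤ)) ≈-refl G j (θ j)) ⟩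
          (G *ˢ j) *ˢ θ j
            ≈⟨ solve 4 (λ w i s r → (w :* i) :* s := i :* (r :* i :+ w :* s) :- r :* (i :* i)) ≈-refl G j (θ j) (θ G) ⟩
          j *ˢ (θ G *ˢ j +ˢ G *ˢ θ j) -ˢ θ G *ˢ (j *ˢ j)
            ≈⟨ +ˢ-cong (*ˢ-cong ≈-refl (≈-trans (≈-sym (θ-* G j)) (≈-trans (θ-cong Gj) (θ-const 1ℤ)))) ≈-refl ⟩
          j *ˢ 0ˢ -ˢ θ G *ˢ (j *ˢ j)
            ≈⟨ solve 2 (λ i s → i :* con 0ℤ :- s := :- s) ≈-refl j (θ G *ˢ (j *ˢ j)) ⟩
          -ˢ (θ G *ˢ (j *ˢ j)) ∎
          where open import Relation.Binary.Reasoning.Setoid 𝒮.setoid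

        -- The hypergeometric equation of ₂F₁(1/6, 1/3; 1; 108 t) for a as a function of t.
        hypergeometric : a₂ ≈ t *ˢ (constˢ (+ 108) *ˢ a₂ +ˢ constˢ (+ 54) *ˢ a₁ +ˢ constˢ (+ 6) *ˢ 𝐚)
        hypergeometric = begin
          a₂
            -- Splitting 1 as g² + 108t reduces the claim to a₂g², in which g cancels against j.
            ≈⟨ by (-ˢ a₂) g² (solve 3 (λ x g t → x := x :* (g :* g) :+ con (+ 108) :* (t :* x) :+ (:- x) :* (g :* g :- (con 1ℤ :- con (+ 108) :* t))) ≈-refl a₂ g t) ⟩
          a₂ *ˢ (g *ˢ g) +ˢ constˢ (+ 108) *ˢ (t *ˢ a₂)
            ≈⟨ +ˢ-cong a₂g² ≈-refl ⟩
          t *ˢ (constˢ (+ 54) *ˢ a₁ +ˢ constˢ (+ 6) *ˢ 𝐚) +ˢ constˢ (+ 108) *ˢ (t *ˢ a₂)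
            ≈⟨ solve 4 (λ t x y z → t :* (con (+ 54) :* y :+ con (+ 6) :* z) :+ con (+ 108) :* (t :* x) := t :* (con (+ 108) :* x :+ con (+ 54) :* y :+ con (+ 6) :* z)) ≈-refl t a₂ a₁ 𝐚 ⟩
          t *ˢ (constˢ (+ 108) *ˢ a₂ +ˢ constˢ (+ 54) *ˢ a₁ +ˢ constˢ (+ 6) *ˢ 𝐚) ∎
          where
          open import Relation.Binary.Reasoning.Setoid 𝒮.setoid
          6ˢ = constˢ (+ 6)
          54ˢ = constˢ (+ 54)
          -- The numerator of θ(p/G): the term 2p² of `𝐚θp` cancels against θ𝐞 = 2𝐚p.
          wronskian : θ p *ˢ G -ˢ p *ˢ θ G ≈ 6ˢ *ˢ (𝐚 *ˢ g *ˢ (𝐞 *ˢ 𝐞 *ˢ 𝐞 *ˢ t)) +ˢ 54ˢ *ˢ (𝐞 *ˢ 𝐞 *ˢ t *ˢ p)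
          wronskian = ≈-trans (+ˢ-cong ≈-refl (-ˢ-cong (*ˢ-cong ≈-refl θG))) (modulo (≈⇒-≈0 𝐚²≈𝐞) (≈⇒-≈0 (≈-sym 𝐚θp)) (≈-refl {0ˢ})
            (θ p *ˢ g) (𝐚 *ˢ g) 0ˢ
            (solve 6 (λ a p q g e t → q :* (e :* g) :- p :* (con (+ 2) :* (a :* p) :* g :- con (+ 54) :* (e :* e :* t)) :=
              con (+ 6) :* (a :* g :* (e :* e :* e :* t)) :+ con (+ 54) :* (e :* e :* t :* p)
              :+ ((q :* g) :* (e :- a :* a) :+ (a :* g) :* (a :* q :- (con (+ 2) :* (p :* p) :+ con (+ 6) :* (e :* e :* e :* t))) :+ con 0ℤ :* con 0ℤ)) ≈-refl 𝐚 p (θ p) g 𝐞 t))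
          a₂≈ : a₂ ≈ (θ p *ˢ G -ˢ p *ˢ θ G) *ˢ (j *ˢ j *ˢ j)
          a₂≈ = ≈-trans (*ˢ-cong (≈-trans (θ-* p j) (+ˢ-cong ≈-refl (*ˢ-cong ≈-refl θj))) ≈-refl)
            (by (-ˢ (θ p *ˢ j *ˢ j)) Gj (solve 5 (λ q j p r G → (q :* j :+ p :* (:- (r :* (j :* j)))) :* j :=
              (q :* G :- p :* r) :* (j :* j :* j) :+ (:- (q :* j :* j)) :* (G :* j :- con 1ℤ)) ≈-refl (θ p) j p (θ G) G))
          a₂g² : a₂ *ˢ (g *ˢ g) ≈ t *ˢ (54ˢ *ˢ a₁ +ˢ 6ˢ *ˢ 𝐚)
          a₂g² = ≈-trans (*ˢ-cong (≈-trans a₂≈ (*ˢ-cong wronskian ≈-refl)) ≈-refl)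
            (by (6ˢ *ˢ 𝐚 *ˢ t *ˢ ((𝐞 *ˢ g *ˢ j) *ˢ (𝐞 *ˢ g *ˢ j) +ˢ 𝐞 *ˢ g *ˢ j +ˢ 1ˢ) +ˢ 54ˢ *ˢ t *ˢ p *ˢ j *ˢ (𝐞 *ˢ g *ˢ j +ˢ 1ˢ)) Gj
            (solve 6 (λ a p g e t j → (con (+ 6) :* (a :* g :* (e :* e :* e :* t)) :+ con (+ 54) :* (e :* e :* t :* p)) :* (j :* j :* j) :* (g :* g) :=
              t :* (con (+ 54) :* (p :* j) :+ con (+ 6) :* a)
              :+ (con (+ 6) :* a :* t :* ((e :* g :* j) :* (e :* g :* j) :+ e :* g :* j :+ con 1ℤ) :+ con (+ 54) :* t :* p :* j :* (e :* g :* j :+ con 1ℤ)) :* ((e :* g) :* j :- con 1ℤ)) ≈-refl 𝐚 p g 𝐞 t j))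

open ModularRelations

-- The logarithmic derivative of the eta quotient.

module EtaQuotient where

  open SeriesSolver using (solve; _:=_; _:+_; _:*_; _:-_; con; :-_)
  geomQ≈ : ∀ a .{{_ : NonZero a}} → geomQ a ≈ 1ˢ +ˢ xs a
  geomQ≈ a = mk≈ λ n → trans (go n) (sym (+ˢ-at 1ˢ (xs a) n))
    where
    go : ∀ n → geomQ a n ≡ 1ˢ n +ᶻ xs a n
    go n with a ∣? n
    go zero | yes (divides zero _) = refl
    go zero | yes (divides (suc k) eq) = ⊥-elim (ℕ.≢-nonZero⁻¹ a (ℕₚ.m+n≡0⇒m≡0 a (sym eq)))
    go (suc n) | yes (divides (suc k) _) = refl
    go zero | no a∤0 = ⊥-elim (a∤0 (divides 0 refl))
    go (suc n) | no _ = refl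

  q^-at : ∀ a → (qS ^ˢ a) a ≡ 1ℤ
  q^-at a = trans (cong (qS ^ˢ a) (sym (ℕₚ.+-identityʳ a))) (trans (sym (at (𝒮.*-identityʳ (qS ^ˢ a)) (a + 0))) (q^*-+ a 1ˢ 0))

  q^-≢ : ∀ a n → ¬ n ≡ a → (qS ^ˢ a) n ≡ 0ℤ
  q^-≢ a n n≢a with ℕₚ.<-cmp n a
  ... | tri< n<a _ _ = trans (sym (at (𝒮.*-identityʳ (qS ^ˢ a)) n)) (q^*-< a 1ˢ n<a)
  ... | tri≈ _ n≡a _ = ⊥-elim (n≢a n≡a)
  ... | tri> _ _ a<n with ℕₚ.m≤n⇒∃[o]m+o≡n a<n
  ... | m , refl = trans (sym (at (𝒮.*-identityʳ (qS ^ˢ a)) (suc a + m))) (trans (cong (qS ^ˢ a *ˢ 1ˢ) (sym (ℕₚ.+-suc a m))) (q^*-+ a 1ˢ (suc m)))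

  oneMinusQ3≈ : ∀ a .{{_ : NonZero a}} → oneMinusQ3 a ≈ 1ˢ -ˢ qS ^ˢ (a * 3)
  oneMinusQ3≈ a@(suc a') = mk≈ λ n → trans (go n) (sym (-ˢ-at₂ 1ˢ (qS ^ˢ (a * 3)) n))
    where
    go : ∀ n → oneMinusQ3 a n ≡ 1ˢ n -ᶻ (qS ^ˢ (a * 3)) n
    go zero = cong (λ z → 1ℤ -ᶻ z) (sym (q^-≢ (a * 3) 0 (λ ())))
    go (suc n) with suc n ℕ.≟ 3 * a
    ... | yes e = cong (λ z → 0ℤ -ᶻ z) (sym (trans (cong (qS ^ˢ (a * 3)) (trans e (ℕₚ.*-comm 3 a))) (q^-at (a * 3))))
    ... | no ¬e = cong (λ z → 0ℤ -ᶻ z) (sym (q^-≢ (a * 3) (suc n) (λ e → ¬e (trans e (ℕₚ.*-comm a 3)))))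

  -- The logarithmic derivative of (1 - q^(3a))/(1 - q^a).
  logDer : ℕ → Series
  logDer a = constˢ (+ a) *ˢ (xs a -ˢ constˢ (+ 3) *ˢ xs (a * 3))

  etaBase : ℕ → Series
  etaBase a = (1ˢ -ˢ qS ^ˢ (a * 3)) *ˢ (1ˢ +ˢ xs a)

  etaFactor≈ : ∀ a .{{_ : NonZero a}} → etaFactor a ≈ etaBase a ^ˢ 12
  etaFactor≈ a = ≈-trans (powS≈^ˢ (oneMinusQ3 a ⊛ geomQ a) 12) (^ˢ-cong 12 (≈-trans (⊛≈*ˢ (oneMinusQ3 a) (geomQ a)) (*ˢ-cong (oneMinusQ3≈ a) (geomQ≈ a))))

  θ-etaBase : ∀ a .{{_ : NonZero a}} → θ (etaBase a) ≈ etaBase a *ˢ logDer a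
  θ-etaBase a = ≈-trans (θ-* (1ˢ -ˢ P) (1ˢ +ˢ x)) (≈-trans (+ˢ-cong (*ˢ-cong θ1-P ≈-refl) (*ˢ-cong ≈-refl (≈-trans (θ-+ 1ˢ x) (+ˢ-cong (θ-const 1ℤ) (θxs a)))))
    (solve 4 (λ P x y a → (con 0ℤ :- con (+ 3) :* a :* (y :* (con 1ℤ :- P))) :* (con 1ℤ :+ x) :+ (con 1ℤ :- P) :* (con 0ℤ :+ a :* (x :* (con 1ℤ :+ x))) :=
       (con 1ℤ :- P) :* (con 1ℤ :+ x) :* (a :* (x :- con (+ 3) :* y))) ≈-refl P x y (constˢ (+ a))))
    where
    instance
      a*3≢0 : NonZero (a * 3)
      a*3≢0 = ℕₚ.m*n≢0 a 3
    module R = Rational (a * 3)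
    P = qS ^ˢ (a * 3)
    x = xs a
    y = xs (a * 3)
    const3 : constˢ (+ (a * 3)) ≈ constˢ (+ 3) *ˢ constˢ (+ a)
    const3 = mk≈ λ { zero → trans (ℤₚ.pos-* a 3) (trans (ℤₚ.*-comm (+ a) (+ 3)) (sym (const-* (+ 3) (constˢ (+ a)) 0))) ; (suc n) → sym (const-* (+ 3) (constˢ (+ a)) (suc n)) }
    y-unit : y *ˢ (1ˢ -ˢ P) ≈ P
    y-unit = ≈-trans (*ˢ-cong R.x-rat ≈-refl) (≈-trans (𝒮.*-assoc P R.f (1ˢ -ˢ P)) (≈-trans (*ˢ-cong ≈-refl R.f-unit) (𝒮.*-identityʳ P)))
    θ1-P : θ (1ˢ -ˢ P) ≈ 0ˢ -ˢ constˢ (+ 3) *ˢ constˢ (+ a) *ˢ (y *ˢ (1ˢ -ˢ P))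
    θ1-P = ≈-trans (θ-sub 1ˢ P) (+ˢ-cong (θ-const 1ℤ) (-ˢ-cong (≈-trans (θ-q^ (a * 3)) (*ˢ-cong const3 (≈-sym y-unit)))))

  12ˢ : Series
  12ˢ = constˢ (+ 12)

  θ-etaFactor : ∀ a .{{_ : NonZero a}} → θ (etaFactor a) ≈ etaFactor a *ˢ (12ˢ *ˢ logDer a)
  θ-etaFactor a = ≈-trans (θ-cong (etaFactor≈ a)) (≈-trans (θ-^ f 11) (≈-trans (*ˢ-cong ≈-refl (*ˢ-cong ≈-refl (θ-etaBase a)))
    (≈-trans (solve 4 (λ c p f l → c :* (p :* (f :* l)) := (f :* p) :* (c :* l)) ≈-refl 12ˢ (f ^ˢ 11) f (logDer a)) (*ˢ-cong (≈-sym (etaFactor≈ a)) ≈-refl))))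
    where f = etaBase a

  L : Series
  L = 12ˢ *ˢ (ε₁ -ˢ constˢ (+ 3) *ˢ ε₃)

  logDer-sum : ∀ {n N} → n ≤ N → ∑₁ N (λ a → (12ˢ *ˢ logDer a) n) ≡ L n
  logDer-sum {n} {N} n≤N = trans (∑₁-cong N (λ a → term a))
    (trans (∑-+ N (λ i → + 12 *ᶻ (+ suc i *ᶻ xs (suc i) n)) (λ i → -[1+ 35 ] *ᶻ (+ suc i *ᶻ xs (suc i * 3) n)))
    (trans (cong₂ _+ᶻ_ (trans (∑-*ˡ N (+ 12) (λ i → + suc i *ᶻ xs (suc i) n)) (cong (+ 12 *ᶻ_) (sym (Lam-extend +_ ones n≤N))))
       (trans (∑-*ˡ N -[1+ 35 ] (λ i → + suc i *ᶻ xs (suc i * 3) n)) (cong (-[1+ 35 ] *ᶻ_) (sym ε₃-extend))))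
    (trans (ring (ε₁ n) (ε₃ n)) (sym (trans (const-* (+ 12) (ε₁ -ˢ constˢ (+ 3) *ˢ ε₃) n) (cong (+ 12 *ᶻ_) (trans (-ˢ-at₂ ε₁ (constˢ (+ 3) *ˢ ε₃) n) (cong (λ z → ε₁ n -ᶻ z) (const-* (+ 3) ε₃ n)))))))))
    where
    ring : ∀ x y → + 12 *ᶻ x +ᶻ -[1+ 35 ] *ᶻ y ≡ + 12 *ᶻ (x -ᶻ + 3 *ᶻ y)
    ring = solve-∀
    ring₂ : ∀ a x y → + 12 *ᶻ (a *ᶻ (x -ᶻ + 3 *ᶻ y)) ≡ + 12 *ᶻ (a *ᶻ x) +ᶻ -[1+ 35 ] *ᶻ (a *ᶻ y)
    ring₂ = solve-∀
    term : ∀ a → (12ˢ *ˢ logDer a) n ≡ + 12 *ᶻ (+ a *ᶻ xs a n) +ᶻ -[1+ 35 ] *ᶻ (+ a *ᶻ xs (a * 3) n)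
    term a = trans (const-* (+ 12) (logDer a) n) (trans (cong (+ 12 *ᶻ_) (trans (const-* (+ a) (xs a -ˢ constˢ (+ 3) *ˢ xs (a * 3)) n)
      (cong (+ a *ᶻ_) (trans (-ˢ-at₂ (xs a) (constˢ (+ 3) *ˢ xs (a * 3)) n) (cong (λ z → xs a n -ᶻ z) (const-* (+ 3) (xs (a * 3)) n)))))) (ring₂ (+ a) (xs a n) (xs (a * 3) n)))
    ε₃-extend : ε₃ n ≡ ∑₁ N (λ a → + a *ᶻ xs (a * 3) n)
    ε₃-extend = ∑-extend n≤N (λ i n≤i → trans (cong (+ suc i *ᶻ_) (geo-vanish ones (suc i * 3) (ℕₚ.≤-trans (s≤s n≤i) (ℕₚ.m≤m*n (suc i) 3)))) (ℤₚ.*-zeroʳ (+ suc i)))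

  -- Congruence modulo q^(N+1).
  Agree : ℕ → Series → Series → Set
  Agree N f g = ∀ i → i ≤ N → f i ≡ g i

  *ˢ-agree : ∀ {N f f' g g'} → Agree N f f' → Agree N g g' → Agree N (f *ˢ g) (f' *ˢ g')
  *ˢ-agree {N} {f} {f'} {g} {g'} p q n n≤N = trans (*ˢ-at f g n) (trans (⊛-cong≤ n {f} {f'} {g} {g'} (λ i i≤n → p i (ℕₚ.≤-trans i≤n n≤N)) (λ i i≤n → q i (ℕₚ.≤-trans i≤n n≤N))) (sym (*ˢ-at f' g' n)))

  1^ˢ : ∀ {N f} k → Agree N f 1ˢ → Agree N (f ^ˢ k) 1ˢ
  1^ˢ zero p i _ = refl
  1^ˢ {N} {f} (suc k) p i i≤N = trans (*ˢ-agree {N} {f} {1ˢ} {f ^ˢ k} {1ˢ} p (1^ˢ k p) i i≤N) (at (*ˢ-identityˡ 1ˢ) i)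

  θ-⊛ : ∀ F E l s → θ F ≈ F *ˢ l → θ E ≈ E *ˢ s → θ (F ⊛ E) ≈ (F ⊛ E) *ˢ (l +ˢ s)
  θ-⊛ F E l s θF θE = ≈-trans (θ-cong (⊛≈*ˢ F E)) (≈-trans (θ-* F E) (≈-trans (+ˢ-cong (*ˢ-cong θF ≈-refl) (*ˢ-cong ≈-refl θE))
    (≈-trans (solve 4 (λ F E l s → (F :* l) :* E :+ F :* (E :* s) := (F :* E) :* (l :+ s)) ≈-refl F E l s) (*ˢ-cong (≈-sym (⊛≈*ˢ F E)) ≈-refl))))

  ⊛-*ˢ-assoc : ∀ F E E' G → E' ≈ E *ˢ G → (F ⊛ E') ≈ (F ⊛ E) *ˢ G
  ⊛-*ˢ-assoc F E E' G p = ≈-trans (⊛≈*ˢ F E') (≈-trans (*ˢ-cong ≈-refl p) (≈-trans (≈-sym (𝒮.*-assoc F E G)) (*ˢ-cong (≈-sym (⊛≈*ˢ F E)) ≈-refl)))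

  *ˢ-agree-1 : ∀ {N} f g → Agree N g 1ˢ → Agree N (f *ˢ g) f
  *ˢ-agree-1 {N} f g p i i≤N = trans (*ˢ-agree {N} {f} {f} {g} {1ˢ} (λ _ _ → refl) p i i≤N) (at (𝒮.*-identityʳ f) i)

  θ-agree : ∀ {N f g} → Agree N f g → Agree N (θ f) (θ g)
  θ-agree p i i≤N = cong (+ i *ᶻ_) (p i i≤N)

  module InfiniteProduct (F D : ℕ → Series) (M : Series)
    (θF : ∀ a .{{_ : NonZero a}} → θ (F a) ≈ F a *ˢ D a)
    (F-agree : ∀ N → Agree N (F (suc N)) 1ˢ)
    (D-sum : ∀ {n N} → n ≤ N → ∑₁ N (λ a → D a n) ≡ M n) where

    Π : List ℕ → Series
    Π ks = foldr (λ n acc → F n ⊛ acc) oneS (map suc ks)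

    ΣD : List ℕ → Series
    ΣD [] = 0ˢ
    ΣD (k ∷ ks) = D (suc k) +ˢ ΣD ks

    -- The infinite product: its n-th coefficient is taken from the n-th partial product, after
    -- which it no longer changes.
    diagonal : Series
    diagonal n = Π (upTo n) n

    θ-Π : ∀ ks → θ (Π ks) ≈ Π ks *ˢ ΣD ks
    θ-Π [] = ≈-trans (θ-cong (≈-sym 1≈oneS)) (≈-trans (θ-const 1ℤ) (≈-sym (𝒮.zeroʳ oneS)))
    θ-Π (k ∷ ks) = θ-⊛ (F (suc k)) (Π ks) (D (suc k)) (ΣD ks) (θF (suc k)) (θ-Π ks)

    ΣD-at : ∀ (h : ℕ → ℕ) N n → ΣD (applyUpTo h N) n ≡ ∑ N (λ i → D (suc (h i)) n)
    ΣD-at h zero n = 0ˢ-at n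
    ΣD-at h (suc N) n = trans (+ˢ-at (D (suc (h 0))) (ΣD (applyUpTo (h ∘ suc) N)) n) (cong (D (suc (h 0)) n +ᶻ_) (ΣD-at (h ∘ suc) N n))

    -- `Π` is folded from the first factor, whereas the passage from N to N + 1 adds a last one.
    Π-∷ʳ : ∀ ks k → Π (ks ∷ʳ k) ≈ Π ks *ˢ F (suc k)
    Π-∷ʳ [] k = ≈-trans (⊛≈*ˢ (F (suc k)) oneS) (*ˢ-comm (F (suc k)) oneS)
    Π-∷ʳ (j ∷ ks) k = ⊛-*ˢ-assoc (F (suc j)) (Π ks) (Π (ks ∷ʳ k)) (F (suc k)) (Π-∷ʳ ks k)

    Π-suc : ∀ N → Π (upTo (suc N)) ≈ Π (upTo N) *ˢ F (suc N)
    Π-suc N = subst (λ ks → Π ks ≈ Π (upTo N) *ˢ F (suc N)) {upTo N ∷ʳ N} {upTo (suc N)} (Listₚ.upTo-∷ʳ N) (Π-∷ʳ (upTo N) N)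

    Π-stable : ∀ o n → Π (upTo (o + n)) n ≡ diagonal n
    Π-stable zero n = refl
    Π-stable (suc o) n = trans (at (Π-suc (o + n)) n)
      (trans (*ˢ-agree-1 (Π (upTo (o + n))) (F (suc (o + n))) (F-agree (o + n)) n (ℕₚ.m≤n+m n o)) (Π-stable o n))

    Π-agree : ∀ N → Agree N (Π (upTo N)) diagonal
    Π-agree N n n≤N = trans (cong (λ m → Π (upTo m) n) (sym (ℕₚ.m∸n+n≡m n≤N))) (Π-stable (N ∸ n) n)

    -- Up to exponent n only the first n factors matter, so the infinite statement is `θ-Π` for the
    -- n-th partial product.
    θ-diagonal : θ diagonal ≈ diagonal *ˢ M
    θ-diagonal = mk≈ λ n → trans (sym (θ-agree {n} {Π (upTo n)} {diagonal} (Π-agree n) n ℕₚ.≤-refl)) (trans (at (θ-Π (upTo n)) n)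
      (*ˢ-agree {n} {Π (upTo n)} {diagonal} {ΣD (upTo n)} {M} (Π-agree n) (λ i i≤n → trans (ΣD-at id n i) (D-sum i≤n)) n ℕₚ.≤-refl))

  etaFactor-agree : ∀ N → Agree N (etaFactor (suc N)) 1ˢ
  etaFactor-agree N i i≤N = trans (at (etaFactor≈ (suc N)) i) (1^ˢ {N} {etaBase (suc N)} 12 base i i≤N)
    where
    base : Agree N (etaBase (suc N)) 1ˢ
    base i i≤N = trans (*ˢ-agree {N} {1ˢ -ˢ qS ^ˢ (suc N * 3)} {1ˢ} {1ˢ +ˢ xs (suc N)} {1ˢ}
       (λ j j≤N → trans (-ˢ-at₂ 1ˢ (qS ^ˢ (suc N * 3)) j) (trans (cong (λ z → 1ˢ j -ᶻ z) (q^-≢ (suc N * 3) j (λ e → ℕₚ.<⇒≢ (ℕₚ.<-≤-trans (s≤s j≤N) (ℕₚ.m≤m*n (suc N) 3)) e))) (ℤₚ.+-identityʳ (1ˢ j))))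
       (λ j j≤N → trans (+ˢ-at 1ˢ (xs (suc N)) j) (trans (cong (1ˢ j +ᶻ_) (geo-vanish ones (suc N) (s≤s j≤N))) (ℤₚ.+-identityʳ (1ˢ j)))) i i≤N) (at (*ˢ-identityˡ 1ˢ) i)

  module EtaProduct = InfiniteProduct etaFactor (λ a → 12ˢ *ˢ logDer a) L θ-etaFactor etaFactor-agree logDer-sum

  θ-etaProd : θ etaProd ≈ etaProd *ˢ L
  θ-etaProd = EtaProduct.θ-diagonal

  uS≈ : uS ≈ qS *ˢ etaProd
  uS≈ = mk≈ λ { zero → sym (q*-0 etaProd) ; (suc n) → sym (q*-suc etaProd n) }

  -- In 𝐞 = 1 + L the 1 is contributed by the factor q of u.
  θ-uS : θ uS ≈ uS *ˢ 𝐞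
  θ-uS = ≈-trans (θ-cong uS≈) (≈-trans (θ-* qS etaProd) (≈-trans (+ˢ-cong (*ˢ-cong θq ≈-refl) (*ˢ-cong ≈-refl θ-etaProd))
    (≈-trans (solve 3 (λ q P L → q :* P :+ q :* (P :* L) := (q :* P) :* (con 1ℤ :+ L)) ≈-refl qS etaProd L) (*ˢ-cong (≈-sym uS≈) ≈-refl))))
    where
    θq : θ qS ≈ qS
    θq = mk≈ λ { zero → refl ; (suc zero) → refl ; (suc (suc n)) → ℤₚ.*-zeroʳ (+ suc (suc n)) }

open EtaQuotient

-- Expansion in powers of t by Lagrange inversion.

module LagrangeInversion where

  open SeriesSolver using (solve; _:=_; _:+_; _:*_; _:-_; con; :-_)
  open Hauptmodul uS refl refl θ-uS
  wᵢ : Series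
  wᵢ = invS w

  w-0 : w 0 ≡ 1ℤ
  w-0 = trans (+ˢ-at 1ˢ (27ˢ *ˢ uS) 0) (cong (1ℤ +ᶻ_) (const-* (+ 27) uS 0))

  w-wᵢ : w *ˢ wᵢ ≈ 1ˢ
  w-wᵢ = invS-inverse w w-0

  𝐭 𝐠 𝐆 : Series
  𝐭 = t wᵢ w-wᵢ
  𝐠 = g wᵢ w-wᵢ
  𝐆 = 𝐞 *ˢ 𝐠

  private
    denominator : Series
    denominator = powS (oneS ⊕ scale (+ 27) uS) 2

    denominator≈ : denominator ≈ w *ˢ w
    denominator≈ = ≈-trans (powS≈^ˢ (oneS ⊕ scale (+ 27) uS) 2) (≈-trans (*ˢ-cong base (*ˢ-cong base ≈-refl)) (*ˢ-cong ≈-refl (𝒮.*-identityʳ w)))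
      where
      base : (oneS ⊕ scale (+ 27) uS) ≈ w
      base = mk≈ λ n → trans (cong₂ _+ᶻ_ (sym (at 1≈oneS n)) (sym (const-* (+ 27) uS n))) (sym (+ˢ-at 1ˢ (27ˢ *ˢ uS) n))

    inverse≈ : invS denominator ≈ wᵢ *ˢ wᵢ
    inverse≈ = *ˢ-cancelˡ denominator d0 (≈-trans (invS-inverse denominator d0) (≈-sym (≈-trans (*ˢ-cong denominator≈ ≈-refl)
      (≈-trans (solve 2 (λ w i → (w :* w) :* (i :* i) := (w :* i) :* (w :* i)) ≈-refl w wᵢ) (≈-trans (*ˢ-cong w-wᵢ w-wᵢ) (*ˢ-identityˡ 1ˢ))))))
      where
      d0 : denominator 0 ≡ 1ℤ
      d0 = trans (at denominator≈ 0) (trans (*ˢ-0 w w) (cong₂ _*ᶻ_ w-0 w-0))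

  tS≈𝐭 : tS ≈ 𝐭
  tS≈𝐭 = ≈-trans (⊛≈*ˢ uS (invS denominator)) (*ˢ-cong ≈-refl inverse≈)

  𝐭-0 : 𝐭 0 ≡ 0ℤ
  𝐭-0 = trans (*ˢ-0 uS (wᵢ *ˢ wᵢ)) refl

  𝐭-1 : 𝐭 1 ≡ 1ℤ
  𝐭-1 = trans (*ˢ-suc uS (wᵢ *ˢ wᵢ) 0) (trans (cong (0ℤ *ᶻ (wᵢ *ˢ wᵢ) 1 +ᶻ_) (trans (*ˢ-0 (uS ∘ suc) (wᵢ *ˢ wᵢ)) (cong (1ℤ *ᶻ_) (*ˢ-0 wᵢ wᵢ)))) refl)

  H : Series
  H = Hmix

  H-𝐭 : H *ˢ 𝐭 ≈ qS
  H-𝐭 = ≈-trans (*ˢ-cong ≈-refl 𝐭≈) (≈-trans (solve 3 (λ h q d → h :* (q :* d) := q :* (d :* h)) ≈-refl H qS (divQ tS))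
    (≈-trans (*ˢ-cong ≈-refl (invS-inverse (divQ tS) (trans (at tS≈𝐭 1) 𝐭-1))) (𝒮.*-identityʳ qS)))
    where
    𝐭≈ : 𝐭 ≈ qS *ˢ divQ tS
    𝐭≈ = mk≈ λ { zero → trans 𝐭-0 (sym (q*-0 (divQ tS))) ; (suc n) → trans (sym (at tS≈𝐭 (suc n))) (sym (q*-suc (divQ tS) n)) }

  q-cancel : ∀ {f g} → qS *ˢ f ≈ qS *ˢ g → f ≈ g
  q-cancel {f} {g} p = mk≈ λ n → trans (sym (q*-suc f n)) (trans (at p (suc n)) (q*-suc g n))

  θq : θ qS ≈ qS
  θq = mk≈ λ { zero → refl ; (suc zero) → refl ; (suc (suc n)) → ℤₚ.*-zeroʳ (+ suc (suc n)) }

  -- The logarithmic derivative of H𝐭 = q. As 𝐭 has no constant term, the equation is multiplied by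
  -- q, which is then cancelled.
  θH : θ H ≈ H *ˢ (1ˢ -ˢ 𝐆)
  θH = q-cancel (≈-trans (*ˢ-cong (≈-sym H-𝐭) ≈-refl) (≈-trans (≈-trans
    (solve 4 (λ h t s r → (h :* t) :* s := h :* ((s :* t :+ h :* r) :- h :* r)) ≈-refl H 𝐭 (θ H) (θ 𝐭))
    (*ˢ-cong ≈-refl (+ˢ-cong (≈-trans (≈-sym (θ-* H 𝐭)) (≈-trans (θ-cong H-𝐭) (≈-trans θq (≈-sym H-𝐭)))) (-ˢ-cong (*ˢ-cong ≈-refl (θt wᵢ w-wᵢ))))))
    (≈-trans (solve 3 (λ h t G → h :* (h :* t :- h :* (t :* G)) := (h :* t) :* (h :* (con 1ℤ :- G))) ≈-refl H 𝐭 𝐆) (*ˢ-cong H-𝐭 ≈-refl))))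

  𝐆-0 : 𝐆 0 ≡ 1ℤ
  𝐆-0 = trans (*ˢ-0 𝐞 𝐠) (cong₂ _*ᶻ_ e0 (trans (*ˢ-0 (1ˢ -ˢ 27ˢ *ˢ uS) wᵢ) (cong (_*ᶻ 1ℤ) (1-const-0 (+ 27) uS refl))))
    where
    e0 : 𝐞 0 ≡ 1ℤ
    e0 = trans (+ˢ-at 1ˢ L 0) (cong (1ℤ +ᶻ_) (trans (const-* (+ 12) (ε₁ -ˢ constˢ (+ 3) *ˢ ε₃) 0) (cong (+ 12 *ᶻ_) (trans (-ˢ-at₂ ε₁ (constˢ (+ 3) *ˢ ε₃) 0) (cong (λ z → 0ℤ -ᶻ z) (const-* (+ 3) ε₃ 0))))))

  𝐚-0 : 𝐚 0 ≡ 1ℤ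
  𝐚-0 = trans (+ˢ-at 1ˢ (constˢ (+ 6) *ˢ α₀) 0) (cong (1ℤ +ᶻ_) (const-* (+ 6) α₀ 0))

  -- Lagrange inversion: Λ f lists the coefficients of f as a power series in t.

  Λ : Series → Series
  Λ f m = (f *ˢ 𝐆 *ˢ H ^ˢ m) m

  Λ-cong : ∀ {f g} → f ≈ g → Λ f ≈ Λ g
  Λ-cong p = mk≈ λ m → at (*ˢ-cong (*ˢ-cong p (≈-refl {𝐆})) (≈-refl {H ^ˢ m})) m

  Λ-+ : ∀ f g → Λ (f +ˢ g) ≈ Λ f +ˢ Λ g
  Λ-+ f g = mk≈ λ m → trans (at (solve 4 (λ f g G h → (f :+ g) :* G :* h := f :* G :* h :+ g :* G :* h) ≈-refl f g 𝐆 (H ^ˢ m)) m)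
    (trans (+ˢ-at (f *ˢ 𝐆 *ˢ H ^ˢ m) (g *ˢ 𝐆 *ˢ H ^ˢ m) m) (sym (+ˢ-at (Λ f) (Λ g) m)))

  Λ-scale : ∀ c f → Λ (constˢ c *ˢ f) ≈ constˢ c *ˢ Λ f
  Λ-scale c f = mk≈ λ m → trans (at (solve 4 (λ c f G h → c :* f :* G :* h := c :* (f :* G :* h)) ≈-refl (constˢ c) f 𝐆 (H ^ˢ m)) m)
    (trans (const-* c (f *ˢ 𝐆 *ˢ H ^ˢ m) m) (sym (const-* c (Λ f) m)))

  Λ-0 : ∀ f → Λ f 0 ≡ f 0
  Λ-0 f = trans (*ˢ-0 (f *ˢ 𝐆) 1ˢ) (trans (ℤₚ.*-identityʳ _) (trans (*ˢ-0 f 𝐆) (trans (cong (f 0 *ᶻ_) 𝐆-0) (ℤₚ.*-identityʳ (f 0)))))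

  -- 𝐭 H^(m+1) = q H^m moves the coefficient index down by one.
  Λ-𝐭 : ∀ f → Λ (𝐭 *ˢ f) ≈ qS *ˢ Λ f
  Λ-𝐭 f = mk≈ λ { zero → trans (Λ-0 (𝐭 *ˢ f)) (trans (*ˢ-0 𝐭 f) (trans (cong (_*ᶻ f 0) 𝐭-0) (sym (q*-0 (Λ f)))))
    ; (suc m) → trans (at (solve 5 (λ t f G h k → t :* f :* G :* (h :* k) := (h :* t) :* (f :* G :* k)) ≈-refl 𝐭 f 𝐆 H (H ^ˢ m)) (suc m))
        (trans (at (*ˢ-cong H-𝐭 (≈-refl {f *ˢ 𝐆 *ˢ H ^ˢ m})) (suc m)) (trans (q*-suc (f *ˢ 𝐆 *ˢ H ^ˢ m) m) (sym (q*-suc (Λ f) m)))) }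

  θ-H^ : ∀ m → θ (H ^ˢ m) ≈ constˢ (+ m) *ˢ (H ^ˢ m *ˢ (1ˢ -ˢ 𝐆))
  θ-H^ zero = ≈-trans (θ-const 1ℤ) (≈-sym (𝒮.zeroˡ _))
  θ-H^ (suc m) = ≈-trans (θ-^ H m) (*ˢ-cong ≈-refl (≈-trans (*ˢ-cong ≈-refl θH) (solve 3 (λ h k G → k :* (h :* G) := h :* k :* G) ≈-refl H (H ^ˢ m) (1ˢ -ˢ 𝐆))))

  -- Integration by parts: the m-th coefficient of θ(f H^m) is m times that of f H^m, and θ(H^m) = m
  -- H^m (1 - 𝐆). The hypothesis says that f₁ is t df/dt.
  Λ-θ : ∀ f f₁ → θ f ≈ f₁ *ˢ 𝐆 → Λ f₁ ≈ θ (Λ f)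
  Λ-θ f f₁ p = mk≈ λ m → trans (at (≈-trans (*ˢ-cong (≈-sym p) (≈-refl {H ^ˢ m})) (≈-trans
      (solve 4 (λ s k f r → s :* k := (s :* k :+ f :* r) :- f :* r) ≈-refl (θ f) (H ^ˢ m) f (θ (H ^ˢ m)))
      (+ˢ-cong (≈-sym (θ-* f (H ^ˢ m))) (-ˢ-cong (*ˢ-cong ≈-refl (θ-H^ m)))))) m)
    (trans (-ˢ-at₂ (θ (f *ˢ H ^ˢ m)) (f *ˢ (constˢ (+ m) *ˢ (H ^ˢ m *ˢ (1ˢ -ˢ 𝐆)))) m)
    (trans (cong (λ z → + m *ᶻ (f *ˢ H ^ˢ m) m -ᶻ z) (trans (at (solve 4 (λ f c k G → f :* (c :* (k :* (con 1ℤ :- G))) := c :* (f :* k :- f :* G :* k)) ≈-refl f (constˢ (+ m)) (H ^ˢ m) 𝐆) m)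
        (trans (const-* (+ m) (f *ˢ H ^ˢ m -ˢ f *ˢ 𝐆 *ˢ H ^ˢ m) m) (cong (+ m *ᶻ_) (-ˢ-at₂ (f *ˢ H ^ˢ m) (f *ˢ 𝐆 *ˢ H ^ˢ m) m)))))
      (ring (+ m) ((f *ˢ H ^ˢ m) m) ((f *ˢ 𝐆 *ˢ H ^ˢ m) m))))
    where
    ring : ∀ m x y → m *ᶻ x -ᶻ m *ᶻ (x -ᶻ y) ≡ m *ᶻ y
    ring = solve-∀

  -- By `Λ-θ` for a constant, m times its m-th coefficient is zero.
  Λ-const : ∀ c → Λ (constˢ c) ≈ constˢ c
  Λ-const c = mk≈ λ { zero → Λ-0 (constˢ c)
    ; (suc m) → ℤₚ.*-cancelˡ-≡ (+ suc m) _ _ (trans (sym (at (Λ-θ (constˢ c) 0ˢ (≈-trans (θ-const c) (≈-sym (𝒮.zeroˡ 𝐆)))) (suc m)))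
        (trans (trans (at (≈-trans (*ˢ-cong (𝒮.zeroˡ 𝐆) (≈-refl {H ^ˢ suc m})) (𝒮.zeroˡ (H ^ˢ suc m))) (suc m)) (0ˢ-at (suc m))) (sym (ℤₚ.*-zeroʳ (+ suc m))))) }

  -- f = f(0) + t f′ with f′ = H (f - f(0))/q, which reduces products to smaller coefficients.
  expand : ∀ f → f ≈ constˢ (f 0) +ˢ 𝐭 *ˢ ((f ∘ suc) *ˢ H)
  expand f = ≈-trans (mk≈ λ n → trans (go n) (sym (+ˢ-at (constˢ (f 0)) (qS *ˢ (f ∘ suc)) n))) (+ˢ-cong ≈-refl (≈-trans (*ˢ-cong (≈-sym H-𝐭) ≈-refl)
    (solve 3 (λ h t f → (h :* t) :* f := t :* (f :* h)) ≈-refl H 𝐭 (f ∘ suc))))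
    where
    go : ∀ n → f n ≡ constˢ (f 0) n +ᶻ (qS *ˢ (f ∘ suc)) n
    go zero = sym (trans (cong (f 0 +ᶻ_) (q*-0 (f ∘ suc))) (ℤₚ.+-identityʳ (f 0)))
    go (suc n) = sym (trans (cong (0ℤ +ᶻ_) (q*-suc (f ∘ suc) n)) (ℤₚ.+-identityˡ (f (suc n))))

  Λ-tail : ∀ f → Λ f ∘ suc ≈ Λ ((f ∘ suc) *ˢ H)
  Λ-tail f = mk≈ λ m → trans (at (≈-trans (Λ-cong (expand f)) (≈-trans (Λ-+ (constˢ (f 0)) _) (+ˢ-cong (Λ-const (f 0)) (Λ-𝐭 ((f ∘ suc) *ˢ H))))) (suc m))
    (trans (+ˢ-at (constˢ (f 0)) (qS *ˢ Λ ((f ∘ suc) *ˢ H)) (suc m)) (trans (cong (0ℤ +ᶻ_) (q*-suc (Λ ((f ∘ suc) *ˢ H)) m)) (ℤₚ.+-identityˡ _)))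

  -- Expanding f by `expand` lowers the index by one, with f replaced by f′; so the induction on the
  -- index is uniform in f. This makes the expansion of 𝐚³ the cube of the expansion of 𝐚.
  Λ-* : ∀ f g → Λ (f *ˢ g) ≈ Λ f *ˢ Λ g
  Λ-* f g = mk≈ λ m → go m f
    where
    go : ∀ m f → Λ (f *ˢ g) m ≡ (Λ f *ˢ Λ g) m
    go zero f = trans (Λ-0 (f *ˢ g)) (trans (*ˢ-0 f g) (sym (trans (*ˢ-0 (Λ f) (Λ g)) (cong₂ _*ᶻ_ (Λ-0 f) (Λ-0 g)))))
    go (suc m) f = begin
      Λ (f *ˢ g) (suc m)
        ≡⟨ at (≈-trans (Λ-cong (≈-trans (*ˢ-cong (expand f) ≈-refl) (solve 4 (λ c t f g → (c :+ t :* f) :* g := c :* g :+ t :* (f :* g)) ≈-refl (constˢ (f 0)) 𝐭 f′ g)))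
             (≈-trans (Λ-+ (constˢ (f 0) *ˢ g) (𝐭 *ˢ (f′ *ˢ g))) (+ˢ-cong (Λ-scale (f 0) g) (Λ-𝐭 (f′ *ˢ g))))) (suc m) ⟩
      (constˢ (f 0) *ˢ Λ g +ˢ qS *ˢ Λ (f′ *ˢ g)) (suc m)
        ≡⟨ trans (+ˢ-at (constˢ (f 0) *ˢ Λ g) (qS *ˢ Λ (f′ *ˢ g)) (suc m)) (cong₂ _+ᶻ_ (const-* (f 0) (Λ g) (suc m)) (trans (q*-suc (Λ (f′ *ˢ g)) m) (go m f′))) ⟩
      f 0 *ᶻ Λ g (suc m) +ᶻ (Λ f′ *ˢ Λ g) m
        ≡⟨ cong₂ _+ᶻ_ (cong (_*ᶻ Λ g (suc m)) (sym (Λ-0 f))) (at (*ˢ-cong (≈-sym (Λ-tail f)) (≈-refl {Λ g})) m) ⟩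
      Λ f 0 *ᶻ Λ g (suc m) +ᶻ ((Λ f ∘ suc) *ˢ Λ g) m
        ≡⟨ sym (*ˢ-suc (Λ f) (Λ g) m) ⟩
      (Λ f *ˢ Λ g) (suc m) ∎
      where
      open ≡-Reasoning
      f′ = (f ∘ suc) *ˢ H

  private
    𝐣 : Series
    𝐣 = invS 𝐆
    𝐆𝐣 : 𝐆 *ˢ 𝐣 ≈ 1ˢ
    𝐆𝐣 = invS-inverse 𝐆 𝐆-0

  𝐲 : Series
  𝐲 = Λ 𝐚

  𝐲-0 : 𝐲 0 ≡ 1ℤ
  𝐲-0 = trans (Λ-0 𝐚) 𝐚-0

  -- With δ = t d/dt, the right-hand operator is 108(δ + 1/6)(δ + 1/3) = 108δ² + 54δ + 6, and `Λ`
  -- turns δ into multiplication by m.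
  𝐲-recursion : ∀ m → + suc m *ᶻ (+ suc m *ᶻ 𝐲 (suc m)) ≡ + 108 *ᶻ (+ m *ᶻ (+ m *ᶻ 𝐲 m)) +ᶻ + 54 *ᶻ (+ m *ᶻ 𝐲 m) +ᶻ + 6 *ᶻ 𝐲 m
  𝐲-recursion m = trans (sym (at Λa₂ (suc m))) (trans (at (≈-trans (Λ-cong (hypergeometric wᵢ w-wᵢ 𝐣 𝐆𝐣)) (Λ-𝐭 rhs)) (suc m)) (trans (q*-suc (Λ rhs) m)
    (trans (at (≈-trans (Λ-+ (constˢ (+ 108) *ˢ A₂ +ˢ constˢ (+ 54) *ˢ A₁) (constˢ (+ 6) *ˢ 𝐚)) (+ˢ-cong (≈-trans (Λ-+ (constˢ (+ 108) *ˢ A₂) (constˢ (+ 54) *ˢ A₁)) (+ˢ-cong (≈-trans (Λ-scale (+ 108) A₂) (*ˢ-cong ≈-refl Λa₂)) (≈-trans (Λ-scale (+ 54) A₁) (*ˢ-cong ≈-refl Λa₁)))) (Λ-scale (+ 6) 𝐚))) m)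
    (trans (+ˢ-at (constˢ (+ 108) *ˢ θ (θ 𝐲) +ˢ constˢ (+ 54) *ˢ θ 𝐲) (constˢ (+ 6) *ˢ 𝐲) m) (cong₂ _+ᶻ_
      (trans (+ˢ-at (constˢ (+ 108) *ˢ θ (θ 𝐲)) (constˢ (+ 54) *ˢ θ 𝐲) m) (cong₂ _+ᶻ_ (const-* (+ 108) (θ (θ 𝐲)) m) (const-* (+ 54) (θ 𝐲) m))) (const-* (+ 6) 𝐲 m))))))
    where
    A₁ A₂ rhs : Series
    A₁ = a₁ wᵢ w-wᵢ 𝐣 𝐆𝐣
    A₂ = a₂ wᵢ w-wᵢ 𝐣 𝐆𝐣
    rhs = constˢ (+ 108) *ˢ A₂ +ˢ constˢ (+ 54) *ˢ A₁ +ˢ constˢ (+ 6) *ˢ 𝐚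
    unit : ∀ f → f ≈ f *ˢ 𝐣 *ˢ 𝐆
    unit f = ≈-trans (≈-sym (𝒮.*-identityʳ f)) (≈-trans (*ˢ-cong ≈-refl (≈-sym 𝐆𝐣)) (solve 3 (λ f G j → f :* (G :* j) := f :* j :* G) ≈-refl f 𝐆 𝐣))
    Λa₁ : Λ A₁ ≈ θ 𝐲
    Λa₁ = Λ-θ 𝐚 A₁ (unit (θ 𝐚))
    Λa₂ : Λ A₂ ≈ θ (θ 𝐲)
    Λa₂ = ≈-trans (Λ-θ A₁ A₂ (unit (θ A₁))) (θ-cong Λa₁)

  Λ-weight-5 : ∀ m → ((E₅ -ˢ 27ˢ *ˢ γ₄) *ˢ H ^ˢ m) m ≡ (𝐲 *ˢ (𝐲 *ˢ 𝐲)) m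
  Λ-weight-5 m = trans (at (*ˢ-cong (≈-sym (weight-5 wᵢ w-wᵢ)) (≈-refl {H ^ˢ m})) m) (at (≈-trans (Λ-* 𝐚 (𝐚 *ˢ 𝐚)) (*ˢ-cong (≈-refl {𝐲}) (Λ-* 𝐚 𝐚))) m)

open LagrangeInversion

-- Comparison with the rational hypergeometric coefficients.

module HypergeometricSeries where

  open import Data.Nat using (_!)
  open import Data.Rational as ℚ using (ℚ; 1ℚ; toℚᵘ) renaming (_+_ to infixl 6 _+ᵠ_; _*_ to infixl 7 _*ᵠ_)
  import Data.Rational.Properties as ℚₚ
  open import Data.Rational.Unnormalised as ℚᵘ using (mkℚᵘ; *≡*)
  import Data.Rational.Unnormalised.Properties as ℚᵘₚ
  import Data.Rational.Solver as ℚSolver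
  toℚᵘ-ι : ∀ z → toℚᵘ (ℤtoℚ z) ℚᵘ.≃ mkℚᵘ z 0
  toℚᵘ-ι z = ℚₚ.toℚᵘ-fromℚᵘ (mkℚᵘ z 0)

  ι-+ : ∀ x y → ℤtoℚ (x +ᶻ y) ≡ ℤtoℚ x +ᵠ ℤtoℚ y
  ι-+ x y = ℚₚ.toℚᵘ-injective (begin
    toℚᵘ (ℤtoℚ (x +ᶻ y))                    ≈⟨ toℚᵘ-ι (x +ᶻ y) ⟩
    mkℚᵘ (x +ᶻ y) 0                         ≈⟨ *≡* (ring x y) ⟩
    mkℚᵘ x 0 ℚᵘ.+ mkℚᵘ y 0                  ≈⟨ ℚᵘₚ.+-cong (toℚᵘ-ι x) (toℚᵘ-ι y) ⟨
    toℚᵘ (ℤtoℚ x) ℚᵘ.+ toℚᵘ (ℤtoℚ y)        ≈⟨ ℚₚ.toℚᵘ-homo-+ (ℤtoℚ x) (ℤtoℚ y) ⟨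
    toℚᵘ (ℤtoℚ x +ᵠ ℤtoℚ y) ∎)
    where
    open ℚᵘₚ.≃-Reasoning
    ring : ∀ x y → (x +ᶻ y) *ᶻ 1ℤ ≡ (x *ᶻ 1ℤ +ᶻ y *ᶻ 1ℤ) *ᶻ 1ℤ
    ring = solve-∀

  ι-* : ∀ x y → ℤtoℚ (x *ᶻ y) ≡ ℤtoℚ x *ᵠ ℤtoℚ y
  ι-* x y = ℚₚ.toℚᵘ-injective (begin
    toℚᵘ (ℤtoℚ (x *ᶻ y))                    ≈⟨ toℚᵘ-ι (x *ᶻ y) ⟩
    mkℚᵘ x 0 ℚᵘ.* mkℚᵘ y 0                  ≈⟨ ℚᵘₚ.*-cong (toℚᵘ-ι x) (toℚᵘ-ι y) ⟨
    toℚᵘ (ℤtoℚ x) ℚᵘ.* toℚᵘ (ℤtoℚ y)        ≈⟨ ℚₚ.toℚᵘ-homo-* (ℤtoℚ x) (ℤtoℚ y) ⟨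
    toℚᵘ (ℤtoℚ x *ᵠ ℤtoℚ y) ∎)
    where open ℚᵘₚ.≃-Reasoning

  ι-inverse : ∀ n .{{_ : NonZero n}} → ((+ 1) ℚ./ n) *ᵠ ℤtoℚ (+ n) ≡ 1ℚ
  ι-inverse (suc n) = ℚₚ.toℚᵘ-injective (begin
    toℚᵘ (((+ 1) ℚ./ suc n) *ᵠ ℤtoℚ (+ suc n))            ≈⟨ ℚₚ.toℚᵘ-homo-* ((+ 1) ℚ./ suc n) (ℤtoℚ (+ suc n)) ⟩
    toℚᵘ ((+ 1) ℚ./ suc n) ℚᵘ.* toℚᵘ (ℤtoℚ (+ suc n))     ≈⟨ ℚᵘₚ.*-cong (ℚₚ.toℚᵘ-fromℚᵘ (mkℚᵘ (+ 1) n)) (toℚᵘ-ι (+ suc n)) ⟩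
    mkℚᵘ (+ 1) n ℚᵘ.* mkℚᵘ (+ suc n) 0                    ≈⟨ *≡* (trans (ring (+ suc n)) (cong (λ m → 1ℤ *ᶻ + m) (sym (ℕₚ.*-identityʳ (suc n))))) ⟩
    toℚᵘ 1ℚ ∎)
    where
    open ℚᵘₚ.≃-Reasoning
    ring : ∀ x → (1ℤ *ᶻ x) *ᶻ 1ℤ ≡ 1ℤ *ᶻ x
    ring = solve-∀

  private
    module Alg where
      open ℚSolver.+-*-Solver using (solve; _:=_; _:*_; _:+_)

      regroup : ∀ N c P Q a b k D D' κ → D' *ᵠ (κ *ᵠ κ) ≡ D →
        κ *ᵠ (κ *ᵠ ((c *ᵠ N) *ᵠ ((P *ᵠ (a +ᵠ k)) *ᵠ (Q *ᵠ (b +ᵠ k)) *ᵠ D'))) ≡ (N *ᵠ (P *ᵠ Q *ᵠ D)) *ᵠ (c *ᵠ ((a +ᵠ k) *ᵠ (b +ᵠ k)))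
      regroup N c P Q a b k D D' κ refl = solve 9 (λ N c P Q x y D' κ z →
        κ :* (κ :* ((c :* N) :* ((P :* x) :* (Q :* y) :* D'))) := (N :* (P :* Q :* (D' :* (κ :* κ)))) :* (c :* (x :* y))) refl N c P Q (a +ᵠ k) (b +ᵠ k) D' κ κ

      indicial : ∀ c a b k s → c *ᵠ (c *ᵠ s) *ᵠ ((a +ᵠ k) *ᵠ (b +ᵠ k)) ≡ c *ᵠ ((a *ᵠ c +ᵠ c *ᵠ k) *ᵠ (b *ᵠ s +ᵠ s *ᵠ k))
      indicial = solve 5 (λ c a b k s → c :* (c :* s) :* ((a :+ k) :* (b :+ k)) := c :* ((a :* c :+ c :* k) :* (b :* s :+ s :* k))) refl

      swap-conv : ∀ N M f g → (N *ᵠ M) *ᵠ (f *ᵠ g) ≡ (N *ᵠ f) *ᵠ (M *ᵠ g)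
      swap-conv = solve 4 (λ N M f g → (N :* M) :* (f :* g) := (N :* f) :* (M :* g)) refl

  ι-cancel : ∀ n .{{_ : NonZero n}} {x y} → ℤtoℚ (+ n) *ᵠ x ≡ ℤtoℚ (+ n) *ᵠ y → x ≡ y
  ι-cancel n {x} {y} p = trans (sym (collapse x)) (trans (cong (((+ 1) ℚ./ n) *ᵠ_) p) (collapse y))
    where
    collapse : ∀ x → ((+ 1) ℚ./ n) *ᵠ (ℤtoℚ (+ n) *ᵠ x) ≡ x
    collapse x = trans (sym (ℚₚ.*-assoc ((+ 1) ℚ./ n) (ℤtoℚ (+ n)) x)) (trans (cong (_*ᵠ x) (ι-inverse n)) (ℚₚ.*-identityˡ x))

  inverse-square : ℕ → ℚ
  inverse-square k = ((+ 1) ℚ./ (k ! * k !)) {{ℕₚ._!*_!≢0 k k}}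

  inverse-square-suc : ∀ k → inverse-square (suc k) *ᵠ (ℤtoℚ (+ suc k) *ᵠ ℤtoℚ (+ suc k)) ≡ inverse-square k
  inverse-square-suc k = ι-cancel (k ! * k !) {{ℕₚ._!*_!≢0 k k}} (trans step (sym (trans (ℚₚ.*-comm (ℤtoℚ (+ (k ! * k !))) (inverse-square k)) (ι-inverse (k ! * k !) {{ℕₚ._!*_!≢0 k k}}))))
    where
    d = inverse-square (suc k)
    n! = k !
    rearrange : suc k * n! * (suc k * n!) ≡ n! * n! * (suc k * suc k)
    rearrange = trans (ℕₚ.[m*n]*[o*p]≡[m*o]*[n*p] (suc k) n! (suc k) n!) (ℕₚ.*-comm (suc k * suc k) (n! * n!))
    step : ℤtoℚ (+ (n! * n!)) *ᵠ (d *ᵠ (ℤtoℚ (+ suc k) *ᵠ ℤtoℚ (+ suc k))) ≡ 1ℚ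
    step = trans (cong (λ z → ℤtoℚ (+ (n! * n!)) *ᵠ (d *ᵠ z)) (sym (ι-* (+ suc k) (+ suc k))))
      (trans (move (ℤtoℚ (+ (n! * n!))) d (ℤtoℚ (+ suc k *ᶻ + suc k)))
      (trans (cong (d *ᵠ_) (trans (sym (ι-* (+ (n! * n!)) (+ suc k *ᶻ + suc k))) (cong ℤtoℚ (trans (cong (+ (n! * n!) *ᶻ_) (sym (ℤₚ.pos-* (suc k) (suc k)))) (trans (sym (ℤₚ.pos-* (n! * n!) (suc k * suc k))) (cong +_ (sym rearrange)))))))
        (ι-inverse (suc k ! * suc k !) {{ℕₚ._!*_!≢0 (suc k) (suc k)}})))
      where
      move : ∀ x y z → x *ᵠ (y *ᵠ z) ≡ y *ᵠ (x *ᵠ z)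
      move x y z = trans (sym (ℚₚ.*-assoc x y z)) (trans (cong (_*ᵠ z) (ℚₚ.*-comm x y)) (ℚₚ.*-assoc y x z))

  -- Both sides start with 1 and obey (k + 1)² y(k + 1) = 108(k + 1/6)(k + 1/3) y(k); in particular
  -- the left side is an integer.
  scaled-F : ∀ k → fromℕℚ (108 ^ k) *ᵠ F21coeff k ≡ ℤtoℚ (𝐲 k)
  scaled-F zero = trans refl (cong ℤtoℚ (sym 𝐲-0))
  scaled-F (suc k) = ι-cancel (suc k) (ι-cancel (suc k) (begin
    k+1 *ᵠ (k+1 *ᵠ (fromℕℚ (108 * 108 ^ k) *ᵠ (poch a k *ᵠ (a +ᵠ fromℕℚ k) *ᵠ (poch b k *ᵠ (b +ᵠ fromℕℚ k)) *ᵠ inverse-square (suc k))))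
      ≡⟨ cong (λ z → k+1 *ᵠ (k+1 *ᵠ (z *ᵠ (poch a k *ᵠ (a +ᵠ fromℕℚ k) *ᵠ (poch b k *ᵠ (b +ᵠ fromℕℚ k)) *ᵠ inverse-square (suc k))))) (trans (cong ℤtoℚ (ℤₚ.pos-* 108 (108 ^ k))) (ι-* (+ 108) (+ (108 ^ k)))) ⟩
    k+1 *ᵠ (k+1 *ᵠ ((ℤtoℚ (+ 108) *ᵠ fromℕℚ (108 ^ k)) *ᵠ (poch a k *ᵠ (a +ᵠ fromℕℚ k) *ᵠ (poch b k *ᵠ (b +ᵠ fromℕℚ k)) *ᵠ inverse-square (suc k))))
      ≡⟨ Alg.regroup (fromℕℚ (108 ^ k)) (ℤtoℚ (+ 108)) (poch a k) (poch b k) a b (fromℕℚ k) (inverse-square k) (inverse-square (suc k)) k+1 (inverse-square-suc k) ⟩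
    (fromℕℚ (108 ^ k) *ᵠ F21coeff k) *ᵠ (ℤtoℚ (+ 108) *ᵠ ((a +ᵠ fromℕℚ k) *ᵠ (b +ᵠ fromℕℚ k)))
      ≡⟨ cong₂ _*ᵠ_ (scaled-F k) indicial-value ⟩
    ℤtoℚ (𝐲 k) *ᵠ ℤtoℚ (+ 6 *ᶻ ((1ℤ +ᶻ + 6 *ᶻ + k) *ᶻ (1ℤ +ᶻ + 3 *ᶻ + k)))
      ≡⟨ trans (sym (ι-* (𝐲 k) _)) (cong ℤtoℚ (trans (ring (𝐲 k) (+ k)) (sym (𝐲-recursion k)))) ⟩
    ℤtoℚ (+ suc k *ᶻ (+ suc k *ᶻ 𝐲 (suc k)))
      ≡⟨ trans (ι-* (+ suc k) (+ suc k *ᶻ 𝐲 (suc k))) (cong (k+1 *ᵠ_) (ι-* (+ suc k) (𝐲 (suc k)))) ⟩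
    k+1 *ᵠ (k+1 *ᵠ ℤtoℚ (𝐲 (suc k))) ∎))
    where
    open ≡-Reasoning
    k+1 a b : ℚ
    k+1 = ℤtoℚ (+ suc k)
    a = (+ 1) ℚ./ 6
    b = (+ 1) ℚ./ 3
    ring : ∀ y k → y *ᶻ (+ 6 *ᶻ ((1ℤ +ᶻ + 6 *ᶻ k) *ᶻ (1ℤ +ᶻ + 3 *ᶻ k))) ≡ + 108 *ᶻ (k *ᶻ (k *ᶻ y)) +ᶻ + 54 *ᶻ (k *ᶻ y) +ᶻ + 6 *ᶻ y
    ring = solve-∀
    affine : ∀ x n .{{_ : NonZero n}} → ((+ 1) ℚ./ n) *ᵠ ℤtoℚ (+ n) +ᵠ ℤtoℚ (+ n) *ᵠ ℤtoℚ x ≡ ℤtoℚ (1ℤ +ᶻ + n *ᶻ x)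
    affine x n = trans (cong₂ _+ᵠ_ (ι-inverse n) (sym (ι-* (+ n) x))) (sym (ι-+ 1ℤ (+ n *ᶻ x)))
    indicial-value : ℤtoℚ (+ 108) *ᵠ ((a +ᵠ fromℕℚ k) *ᵠ (b +ᵠ fromℕℚ k)) ≡ ℤtoℚ (+ 6 *ᶻ ((1ℤ +ᶻ + 6 *ᶻ + k) *ᶻ (1ℤ +ᶻ + 3 *ᶻ + k)))
    -- 108 = 6 · (6 · 3): the inner 6 clears 1/6 and the 3 clears 1/3.
    indicial-value = trans (Alg.indicial (ℤtoℚ (+ 6)) a b (fromℕℚ k) (ℤtoℚ (+ 3)))
      (trans (cong (ℤtoℚ (+ 6) *ᵠ_) (trans (cong₂ _*ᵠ_ (affine (+ k) 6) (affine (+ k) 3)) (sym (ι-* (1ℤ +ᶻ + 6 *ᶻ + k) (1ℤ +ᶻ + 3 *ᶻ + k)))))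
        (sym (ι-* (+ 6) ((1ℤ +ᶻ + 6 *ᶻ + k) *ᶻ (1ℤ +ᶻ + 3 *ᶻ + k)))))

  sum-ι : ∀ n c (f : ℕ → ℚ) (g : ℕ → ℤ) → (∀ i → i < n → c *ᵠ f i ≡ ℤtoℚ (g i)) → c *ᵠ sumℚ (applyUpTo f n) ≡ ℤtoℚ (∑ n g)
  sum-ι zero c f g h = ℚₚ.*-zeroʳ c
  sum-ι (suc n) c f g h = trans (ℚₚ.*-distribˡ-+ c (f 0) (sumℚ (applyUpTo (f ∘ suc) n)))
    (trans (cong₂ _+ᵠ_ (h 0 (s≤s z≤n)) (sum-ι n c (f ∘ suc) (g ∘ suc) (λ i i<n → h (suc i) (s≤s i<n)))) (sym (ι-+ (g 0) (∑ n (g ∘ suc)))))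

  -- The weights 108^n amount to rescaling the variable: 108^n = 108^i · 108^(n-i) distributes them
  -- over each term of the convolution.
  ⊛ℚ-ι : ∀ {f g : ℕ → ℚ} {u v : Series} → (∀ k → fromℕℚ (108 ^ k) *ᵠ f k ≡ ℤtoℚ (u k)) → (∀ k → fromℕℚ (108 ^ k) *ᵠ g k ≡ ℤtoℚ (v k)) →
    ∀ n → fromℕℚ (108 ^ n) *ᵠ (f ⊛ℚ g) n ≡ ℤtoℚ ((u *ˢ v) n)
  ⊛ℚ-ι {f} {g} {u} {v} hf hg n = trans (cong (λ xs → fromℕℚ (108 ^ n) *ᵠ sumℚ xs) (Listₚ.map-applyUpTo id (λ i → f i *ᵠ g (n ∸ i)) (suc n)))
    (trans (sum-ι (suc n) (fromℕℚ (108 ^ n)) (λ i → f i *ᵠ g (n ∸ i)) (λ i → u i *ᶻ v (n ∸ i)) term) (cong ℤtoℚ (sym (trans (*ˢ-at u v n) (⊛-coeff u v n)))))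
    where
    power : ∀ i → i ≤ n → fromℕℚ (108 ^ n) ≡ fromℕℚ (108 ^ i) *ᵠ fromℕℚ (108 ^ (n ∸ i))
    power i i≤n = trans (cong ℤtoℚ (trans (cong +_ (trans (cong (108 ^_) (sym (ℕₚ.m+[n∸m]≡n i≤n))) (ℕₚ.^-distribˡ-+-* 108 i (n ∸ i)))) (ℤₚ.pos-* (108 ^ i) (108 ^ (n ∸ i))))) (ι-* (+ (108 ^ i)) (+ (108 ^ (n ∸ i))))
    term : ∀ i → i < suc n → fromℕℚ (108 ^ n) *ᵠ (f i *ᵠ g (n ∸ i)) ≡ ℤtoℚ (u i *ᶻ v (n ∸ i))
    term i (s≤s i≤n) = trans (cong (_*ᵠ (f i *ᵠ g (n ∸ i))) (power i i≤n)) (trans (Alg.swap-conv (fromℕℚ (108 ^ i)) (fromℕℚ (108 ^ (n ∸ i))) (f i) (g (n ∸ i)))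
      (trans (cong₂ _*ᵠ_ (hf i) (hg (n ∸ i))) (sym (ι-* (u i) (v (n ∸ i))))))

  Amix-𝐲 : ∀ n → Amix n ≡ ℤtoℚ ((𝐲 *ˢ (𝐲 *ˢ 𝐲)) n)
  Amix-𝐲 n = trans (⊛ℚ-ι {F21coeff ⊛ℚ F21coeff} {F21coeff} {𝐲 *ˢ 𝐲} {𝐲} (⊛ℚ-ι {F21coeff} {F21coeff} {𝐲} {𝐲} scaled-F scaled-F) scaled-F n) (cong ℤtoℚ (at (*ˢ-assoc 𝐲 𝐲 𝐲) n))

open HypergeometricSeries

-- Power series modulo a prime.

module CongruencesModPrime where

  open import Data.Nat using (_!)
  open import Data.Nat.Primality using (euclidsLemma; prime⇒nonZero; ¬prime[1])
  open import Data.Nat.Combinatorics using (_C_; nCn≡1; nCk≡nC[n∸k]; nCk≡n!/k![n-k]!; k![n∸k]!∣n!)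
  import Data.Nat.DivMod as DivMod
  open import Data.Nat.Divisibility using (∣1⇒≡1; m∣m*n)
  open import Data.Fin as Fin using (Fin; toℕ; fromℕ; inject₁)
  import Data.Fin.Properties as Finₚ
  import Algebra.Properties.CommutativeSemiring.Binomial as Binomial
  import Algebra.Properties.Monoid.Sum as MonoidSum
  module Modulo (p : ℕ) where

    infix 4 _≡ₚ_ _≈ₚ_ _,ₚ_
    record _≡ₚ_ (x y : ℤ) : Set where
      constructor _,ₚ_
      field
        quotient : ℤ
        equality : x ≡ y +ᶻ + p *ᶻ quotient

    ≡⇒≡ₚ : ∀ {x y} → x ≡ y → x ≡ₚ y
    ≡⇒≡ₚ {x} refl = 0ℤ ,ₚ sym (trans (cong (x +ᶻ_) (ℤₚ.*-zeroʳ (+ p))) (ℤₚ.+-identityʳ x))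

    ≡ₚ-sym : ∀ {x y} → x ≡ₚ y → y ≡ₚ x
    ≡ₚ-sym {y = y} (k ,ₚ refl) = (-ᶻ k) ,ₚ ring y (+ p) k
      where
      ring : ∀ y p k → y ≡ y +ᶻ p *ᶻ k +ᶻ p *ᶻ -ᶻ k
      ring = solve-∀

    ≡ₚ-trans : ∀ {x y z} → x ≡ₚ y → y ≡ₚ z → x ≡ₚ z
    ≡ₚ-trans {z = z} (k ,ₚ refl) (l ,ₚ refl) = (l +ᶻ k) ,ₚ ring z (+ p) l k
      where
      ring : ∀ z p l k → z +ᶻ p *ᶻ l +ᶻ p *ᶻ k ≡ z +ᶻ p *ᶻ (l +ᶻ k)
      ring = solve-∀

    +-≡ₚ : ∀ {x x' y y'} → x ≡ₚ x' → y ≡ₚ y' → x +ᶻ y ≡ₚ x' +ᶻ y'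
    +-≡ₚ {x' = x'} {y' = y'} (k ,ₚ refl) (l ,ₚ refl) = (k +ᶻ l) ,ₚ ring x' y' (+ p) k l
      where
      ring : ∀ x y p k l → x +ᶻ p *ᶻ k +ᶻ (y +ᶻ p *ᶻ l) ≡ x +ᶻ y +ᶻ p *ᶻ (k +ᶻ l)
      ring = solve-∀

    *-≡ₚ : ∀ {x x' y y'} → x ≡ₚ x' → y ≡ₚ y' → x *ᶻ y ≡ₚ x' *ᶻ y'
    *-≡ₚ {x' = x'} {y' = y'} (k ,ₚ refl) (l ,ₚ refl) = (x' *ᶻ l +ᶻ k *ᶻ y' +ᶻ + p *ᶻ k *ᶻ l) ,ₚ ring x' y' (+ p) k l
      where
      ring : ∀ x y p k l → (x +ᶻ p *ᶻ k) *ᶻ (y +ᶻ p *ᶻ l) ≡ x *ᶻ y +ᶻ p *ᶻ (x *ᶻ l +ᶻ k *ᶻ y +ᶻ p *ᶻ k *ᶻ l)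
      ring = solve-∀

    neg-≡ₚ : ∀ {x y} → x ≡ₚ y → -ᶻ x ≡ₚ -ᶻ y
    neg-≡ₚ {y = y} (k ,ₚ refl) = (-ᶻ k) ,ₚ ring y (+ p) k
      where
      ring : ∀ y p k → -ᶻ (y +ᶻ p *ᶻ k) ≡ -ᶻ y +ᶻ p *ᶻ -ᶻ k
      ring = solve-∀

    p*≡ₚ0 : ∀ k → + p *ᶻ k ≡ₚ 0ℤ
    p*≡ₚ0 k = k ,ₚ sym (ℤₚ.+-identityˡ (+ p *ᶻ k))

    ∑-≡ₚ : ∀ n {f g : ℕ → ℤ} → (∀ i → f i ≡ₚ g i) → ∑ n f ≡ₚ ∑ n g
    ∑-≡ₚ zero h = ≡⇒≡ₚ refl
    ∑-≡ₚ (suc n) h = +-≡ₚ (h 0) (∑-≡ₚ n (λ i → h (suc i)))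

    record _≈ₚ_ (f g : Series) : Set where
      constructor mk≈ₚ
      field at : ∀ n → f n ≡ₚ g n
    open _≈ₚ_ renaming (at to atₚ) public

    ≈⇒≈ₚ : ∀ {f g} → f ≈ g → f ≈ₚ g
    ≈⇒≈ₚ q = mk≈ₚ λ n → ≡⇒≡ₚ (at q n)

    ≈ₚ-trans : ∀ {f g h} → f ≈ₚ g → g ≈ₚ h → f ≈ₚ h
    ≈ₚ-trans a b = mk≈ₚ λ n → ≡ₚ-trans (atₚ a n) (atₚ b n)

    ≈ₚ-refl : ∀ {f} → f ≈ₚ f
    ≈ₚ-refl = ≈⇒≈ₚ ≈-refl

    ≈ₚ-sym : ∀ {f g} → f ≈ₚ g → g ≈ₚ f
    ≈ₚ-sym a = mk≈ₚ λ n → ≡ₚ-sym (atₚ a n)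

    via : ∀ {x x' y y'} → x ≡ x' → y ≡ y' → x' ≡ₚ y' → x ≡ₚ y
    via refl refl h = h

    +ˢ-≈ₚ : ∀ {f f' g g'} → f ≈ₚ f' → g ≈ₚ g' → f +ˢ g ≈ₚ f' +ˢ g'
    +ˢ-≈ₚ {f} {f'} {g} {g'} a b = mk≈ₚ λ n → via (+ˢ-at f g n) (+ˢ-at f' g' n) (+-≡ₚ (atₚ a n) (atₚ b n))

    *ˢ-≈ₚ : ∀ {f f' g g'} → f ≈ₚ f' → g ≈ₚ g' → f *ˢ g ≈ₚ f' *ˢ g'
    *ˢ-≈ₚ {f} {f'} {g} {g'} a b = mk≈ₚ λ n → via (trans (*ˢ-at f g n) (⊛-coeff f g n)) (trans (*ˢ-at f' g' n) (⊛-coeff f' g' n))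
      (∑-≡ₚ (suc n) (λ i → *-≡ₚ (atₚ a i) (atₚ b (n ∸ i))))

    ^ˢ-≈ₚ : ∀ {f g} k → f ≈ₚ g → f ^ˢ k ≈ₚ g ^ˢ k
    ^ˢ-≈ₚ zero q = ≈ₚ-refl
    ^ˢ-≈ₚ (suc k) q = *ˢ-≈ₚ q (^ˢ-≈ₚ k q)

    -- Equality of the ring is congruence modulo p, so that the general binomial theorem applies
    -- directly.
    seriesRingₚ : CommutativeRing _ _
    seriesRingₚ = record
      { Carrier = Series ; _≈_ = _≈ₚ_ ; _+_ = _+ˢ_ ; _*_ = _*ˢ_ ; -_ = -ˢ_ ; 0# = 0ˢ ; 1# = 1ˢ
      ; isCommutativeRing = record
        { isRing = record
          { +-isAbelianGroup = record
            { isGroup = record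
              { isMonoid = record
                { isSemigroup = record
                  { isMagma = record
                    { isEquivalence = record { refl = ≈ₚ-refl ; sym = ≈ₚ-sym ; trans = ≈ₚ-trans }
                    ; ∙-cong = +ˢ-≈ₚ }
                  ; assoc = λ f g h → ≈⇒≈ₚ (+ˢ-assoc f g h) }
                ; identity = (λ f → ≈⇒≈ₚ (𝒮.+-identityˡ f)) , λ f → ≈⇒≈ₚ (𝒮.+-identityʳ f) }
              ; inverse = (λ f → ≈⇒≈ₚ (𝒮.-‿inverseˡ f)) , λ f → ≈⇒≈ₚ (𝒮.-‿inverseʳ f)
              ; ⁻¹-cong = λ {f} {g} a → mk≈ₚ λ n → via (-ˢ-at f n) (-ˢ-at g n) (neg-≡ₚ (atₚ a n)) }
            ; comm = λ f g → ≈⇒≈ₚ (+ˢ-comm f g) }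
          ; *-cong = *ˢ-≈ₚ
          ; *-assoc = λ f g h → ≈⇒≈ₚ (*ˢ-assoc f g h)
          ; *-identity = (λ f → ≈⇒≈ₚ (𝒮.*-identityˡ f)) , λ f → ≈⇒≈ₚ (𝒮.*-identityʳ f)
          ; distrib = (λ f g h → ≈⇒≈ₚ (𝒮.distribˡ f g h)) , λ f g h → ≈⇒≈ₚ (𝒮.distribʳ f g h) }
        ; *-comm = λ f g → ≈⇒≈ₚ (*ˢ-comm f g) } }

    module 𝒮ₚ = CommutativeRing seriesRingₚ

  module _ {p : ℕ} (pr : Prime p) where

    prime∤! : ∀ k → k < p → ¬ p ∣ k !
    prime∤! zero _ p∣1 = ¬prime[1] (subst Prime (∣1⇒≡1 p∣1) pr)
    prime∤! (suc k) k<p p∣ with euclidsLemma (suc k) (k !) pr p∣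
    ... | inj₁ p∣k = ℕₚ.<⇒≱ k<p (∣⇒≤ p∣k)
    ... | inj₂ p∣k! = prime∤! k (ℕₚ.<-trans (ℕₚ.n<1+n k) k<p) p∣k!

    -- p divides p! = C(p,k) · k! (p-k)!, but neither factorial.
    prime∣C : ∀ k → 0 < k → k < p → p ∣ p C k
    prime∣C k 0<k k<p with euclidsLemma (p C k) (k ! * (p ∸ k) !) pr (subst (p ∣_) (sym C*) (p∣p! p ⦃ prime⇒nonZero pr ⦄))
      where
      k≤p : k ≤ p
      k≤p = ℕₚ.<⇒≤ k<p
      C* : (p C k) * (k ! * (p ∸ k) !) ≡ p !
      C* = trans (cong (_* (k ! * (p ∸ k) !)) (nCk≡n!/k![n-k]! k≤p)) (DivMod.m/n*n≡m {{ℕₚ._!*_!≢0 k (p ∸ k)}} (k![n∸k]!∣n! k≤p))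
      p∣p! : ∀ n .{{_ : NonZero n}} → n ∣ n !
      p∣p! (suc n) = m∣m*n (n !)
    ... | inj₁ p∣C = p∣C
    ... | inj₂ p∣k![p-k]! with euclidsLemma (k !) ((p ∸ k) !) pr p∣k![p-k]!
    ...   | inj₁ p∣k! = ⊥-elim (prime∤! k k<p p∣k!)
    ...   | inj₂ p∣[p-k]! = ⊥-elim (prime∤! (p ∸ k) (ℕₚ.∸-monoʳ-< 0<k (ℕₚ.<⇒≤ k<p)) p∣[p-k]!)

  -- The Frobenius congruence.

  module Frobenius (m : ℕ) (pr : Prime (suc m)) where

    p : ℕ
    p = suc m

    open Modulo p
    open import Algebra.Properties.Semiring.Exp 𝒮ₚ.semiring using () renaming (_^_ to infixr 8 _^^_)
    open import Algebra.Properties.Monoid.Mult 𝒮ₚ.+-monoid using () renaming (_×_ to infixr 8 _·_)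
    private module Sum = MonoidSum 𝒮ₚ.+-monoid

    ×-at : ∀ n f k → (n · f) k ≡ + n *ᶻ f k
    ×-at zero f k = 0ˢ-at k
    ×-at (suc n) f k = trans (+ˢ-at f (n · f) k) (trans (cong (f k +ᶻ_) (×-at n f k)) (ring (+ n) (f k)))
      where
      ring : ∀ n x → x +ᶻ n *ᶻ x ≡ (1ℤ +ᶻ n) *ᶻ x
      ring = solve-∀

    ∣⇒×≈ₚ0 : ∀ {n} f → p ∣ n → n · f ≈ₚ 0ˢ
    ∣⇒×≈ₚ0 f (divides q refl) = mk≈ₚ λ k → via (trans (×-at (q * p) f k) (trans (cong (_*ᶻ f k) (trans (ℤₚ.pos-* q p) (ℤₚ.*-comm (+ q) (+ p)))) (ℤₚ.*-assoc (+ p) (+ q) (f k)))) (0ˢ-at k) (p*≡ₚ0 (+ q *ᶻ f k))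

    ^≡^ˢ : ∀ f k → f ^^ k ≡ f ^ˢ k
    ^≡^ˢ f zero = refl
    ^≡^ˢ f (suc k) = cong (f *ˢ_) (^≡^ˢ f k)

    freshman : ∀ f g → (f +ˢ g) ^ˢ p ≈ₚ f ^ˢ p +ˢ g ^ˢ p
    freshman f g = begin
      (f +ˢ g) ^ˢ p
        ≡⟨ ^≡^ˢ (f +ˢ g) p ⟨
      (f +ˢ g) ^^ p
        ≈⟨ theorem p f g ⟩
      t Fin.zero +ˢ Sum.sum tail
        ≈⟨ +ˢ-≈ₚ first (≈ₚ-trans (Sum.sum-init-last tail) (+ˢ-≈ₚ (≈ₚ-trans (Sum.sum-cong-≋ middle) (Sum.sum-replicate-zero m)) last)) ⟩
      g ^ˢ p +ˢ (0ˢ +ˢ f ^ˢ p)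
        ≈⟨ ≈⇒≈ₚ (≈-trans (+ˢ-cong ≈-refl (𝒮.+-identityˡ (f ^ˢ p))) (+ˢ-comm (g ^ˢ p) (f ^ˢ p))) ⟩
      f ^ˢ p +ˢ g ^ˢ p ∎
      where
      open import Relation.Binary.Reasoning.Setoid 𝒮ₚ.setoid
      open Binomial 𝒮ₚ.commutativeSemiring using (theorem; binomialTerm)

      t : Fin (suc p) → Series
      t = binomialTerm f g p
      tail : Fin p → Series
      tail i = t (Fin.suc i)
      1× : ∀ h → 1 · h ≈ₚ h
      1× h = ≈⇒≈ₚ (𝒮.+-identityʳ h)
      first : t Fin.zero ≈ₚ g ^ˢ p
      first = ≈ₚ-trans (1× (f ^^ 0 *ˢ g ^^ p)) (≈ₚ-trans (≈⇒≈ₚ (*ˢ-identityˡ (g ^^ p))) (≈⇒≈ₚ (subst (g ^^ p ≈_) (^≡^ˢ g p) ≈-refl)))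
      middle : ∀ i → tail (inject₁ i) ≈ₚ 0ˢ
      middle i = ∣⇒×≈ₚ0 _ (prime∣C pr (suc (toℕ (inject₁ i))) (s≤s z≤n) (s≤s (subst (_< m) (sym (Finₚ.toℕ-inject₁ i)) (Finₚ.toℕ<n i))))
      last : tail (fromℕ m) ≈ₚ f ^ˢ p
      last = subst (λ k → (p C k) · (f ^^ k *ˢ g ^^ (p ∸ k)) ≈ₚ f ^ˢ p) (sym (cong suc (Finₚ.toℕ-fromℕ m)))
        (subst (λ c → c · (f ^^ p *ˢ g ^^ (p ∸ p)) ≈ₚ f ^ˢ p) (sym (nCn≡1 p))
          (≈ₚ-trans (1× (f ^^ p *ˢ g ^^ (p ∸ p))) (subst (λ j → f ^^ p *ˢ g ^^ j ≈ₚ f ^ˢ p) (sym (ℕₚ.n∸n≡0 p))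
            (≈ₚ-trans (≈⇒≈ₚ (𝒮.*-identityʳ (f ^^ p))) (≈⇒≈ₚ (subst (f ^^ p ≈_) (^≡^ˢ f p) ≈-refl))))))

    -- Induction on c = 1 + n by `freshman`.
    fermat : ∀ c → constˢ c ^ˢ p ≈ₚ constˢ c
    fermat (+ n) = go n
      where
      1^ : ∀ k → 1ˢ ^ˢ k ≈ 1ˢ
      1^ zero = ≈-refl
      1^ (suc k) = ≈-trans (*ˢ-identityˡ (1ˢ ^ˢ k)) (1^ k)
      go : ∀ n → constˢ (+ n) ^ˢ p ≈ₚ constˢ (+ n)
      go zero = ≈⇒≈ₚ (𝒮.zeroˡ _)
      go (suc n) = ≈ₚ-trans (^ˢ-≈ₚ p (≈⇒≈ₚ split)) (≈ₚ-trans (freshman 1ˢ (constˢ (+ n))) (≈ₚ-trans (+ˢ-≈ₚ (≈⇒≈ₚ (1^ p)) (go n)) (≈⇒≈ₚ (≈-sym split))))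
        where
        split : constˢ (+ suc n) ≈ 1ˢ +ˢ constˢ (+ n)
        split = mk≈ λ k → trans (const-+ 1ℤ (+ n) k) (sym (+ˢ-at 1ˢ (constˢ (+ n)) k))
    fermat c@(-[1+ n ]) = begin
      c⁻ ^ˢ p
        ≈⟨ ≈⇒≈ₚ (solve 2 (λ x y → x := (x :+ y) :- y) ≈-refl (c⁻ ^ˢ p) (c⁺ ^ˢ p)) ⟩
      (c⁻ ^ˢ p +ˢ c⁺ ^ˢ p) -ˢ c⁺ ^ˢ p
        -- The sign is handled by expanding 0 = (c⁻ + c⁺)^p, without any parity argument.
        ≈⟨ +ˢ-≈ₚ (≈ₚ-trans (≈ₚ-sym (freshman c⁻ c⁺)) (≈ₚ-trans (^ˢ-≈ₚ p (≈⇒≈ₚ c⁻+c⁺)) (≈⇒≈ₚ (𝒮.zeroˡ _)))) (𝒮ₚ.-‿cong (fermat (+ suc n))) ⟩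
      0ˢ -ˢ c⁺
        ≈⟨ ≈⇒≈ₚ (≈-trans (+ˢ-cong (≈-sym c⁻+c⁺) ≈-refl) (solve 2 (λ x y → (x :+ y) :- y := x) ≈-refl c⁻ c⁺)) ⟩
      c⁻ ∎
      where
      open import Relation.Binary.Reasoning.Setoid 𝒮ₚ.setoid
      open SeriesSolver using (solve; _:=_; _:+_; _:-_)
      c⁻ = constˢ c
      c⁺ = constˢ (+ suc n)
      c⁻+c⁺ : c⁻ +ˢ c⁺ ≈ 0ˢ
      c⁻+c⁺ = mk≈ λ k → trans (+ˢ-at c⁻ c⁺ k) (trans (sym (const-+ c (+ suc n) k)) (cong (λ z → constˢ z k) (ℤₚ.+-inverseˡ (+ suc n))))

    series-split : ∀ f → f ≈ constˢ (f 0) +ˢ qS *ˢ (f ∘ suc)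
    series-split f = mk≈ λ n → trans (go n) (sym (+ˢ-at (constˢ (f 0)) (qS *ˢ (f ∘ suc)) n))
      where
      go : ∀ n → f n ≡ constˢ (f 0) n +ᶻ (qS *ˢ (f ∘ suc)) n
      go zero = sym (trans (cong (f 0 +ᶻ_) (q*-0 (f ∘ suc))) (ℤₚ.+-identityʳ (f 0)))
      go (suc n) = sym (trans (cong (0ℤ +ᶻ_) (q*-suc (f ∘ suc) n)) (ℤₚ.+-identityˡ (f (suc n))))

    -- Raise f = f(0) + q (f ∘ suc) to the power p: the factor q^p lowers the exponent by p, and the
    -- rest is the recursion `V-suc`.
    frobenius : ∀ f → f ^ˢ p ≈ₚ V p f
    frobenius f = mk≈ₚ λ n → <-rec (λ n → ∀ f → (f ^ˢ p) n ≡ₚ V p f n) step n f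
      where
      step : ∀ n → (∀ {k} → k < n → ∀ f → (f ^ˢ p) k ≡ₚ V p f k) → ∀ f → (f ^ˢ p) n ≡ₚ V p f n
      step n rec f = ≡ₚ-trans (atₚ (≈ₚ-trans (^ˢ-≈ₚ p (≈⇒≈ₚ (series-split f))) (≈ₚ-trans (freshman (constˢ (f 0)) (qS *ˢ (f ∘ suc)))
          (+ˢ-≈ₚ (fermat (f 0)) (≈⇒≈ₚ (^ˢ-distrib-* qS (f ∘ suc) p))))) n)
        (via (+ˢ-at (constˢ (f 0)) (qS ^ˢ p *ˢ (f ∘ suc) ^ˢ p) n) (trans (at (V-suc p f) n) (+ˢ-at (constˢ (f 0)) (qS ^ˢ p *ˢ V p (f ∘ suc)) n))
          (+-≡ₚ (≡⇒≡ₚ {constˢ (f 0) n} refl) (lower (n ℕ.<? p))))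
        where
        lower : Dec (n < p) → (qS ^ˢ p *ˢ (f ∘ suc) ^ˢ p) n ≡ₚ (qS ^ˢ p *ˢ V p (f ∘ suc)) n
        lower (yes n<p) = via (q^*-< p ((f ∘ suc) ^ˢ p) n<p) (q^*-< p (V p (f ∘ suc)) n<p) (≡⇒≡ₚ refl)
        lower (no n≮p) with ℕₚ.m≤n⇒∃[o]m+o≡n (ℕₚ.≮⇒≥ n≮p)
        ... | o , refl = via (q^*-+ p ((f ∘ suc) ^ˢ p) o) (q^*-+ p (V p (f ∘ suc)) o) (rec (ℕₚ.m<n+m o (s≤s z≤n)) (f ∘ suc))

open CongruencesModPrime

-- Identification with the given series, and the action of U_p.

module HeckeOperator where

  open import Data.Nat.Primality using (prime⇒irreducible)
  open import Data.Nat.Coprimality using (Coprime; coprime-divisor)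
  import Data.Nat.DivMod as DivMod
  open import Data.Rational as ℚ using (ℚ)
  import Data.Rational.Properties as ℚₚ
  open import Relation.Unary using (Pred; Decidable)
  pick : ∀ {P : Set} → Dec P → ℤ → ℤ
  pick (yes _) x = x
  pick (no _) _ = 0ℤ

  sumℤ-filter : ∀ {P : Pred ℕ _} (P? : Decidable P) (f : ℕ → ℤ) xs → sumℤ (map f (filter P? xs)) ≡ sumℤ (map (λ x → pick (P? x) (f x)) xs)
  sumℤ-filter P? f [] = refl
  sumℤ-filter P? f (x ∷ xs) with P? x
  ... | yes _ = cong (f x +ᶻ_) (sumℤ-filter P? f xs)
  ... | no _ = trans (sumℤ-filter P? f xs) (sym (ℤₚ.+-identityˡ _))

  -- The table of `χ₃` as a function of the remainder, so that equal remainders can be substituted.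
  χ₃-mod : ℕ → ℤ
  χ₃-mod 1 = + 1
  χ₃-mod 2 = -[1+ 0 ]
  χ₃-mod _ = + 0

  χ₃≡mod : ∀ d → χ₃ d ≡ χ₃-mod (d % 3)
  χ₃≡mod d with d % 3
  ... | 0 = refl
  ... | 1 = refl
  ... | 2 = refl
  ... | suc (suc (suc _)) = refl

  χ₃≡χ : ∀ d → χ₃ d ≡ χ d
  χ₃≡χ zero = refl
  χ₃≡χ (suc zero) = refl
  χ₃≡χ (suc (suc zero)) = refl
  χ₃≡χ (suc (suc (suc d))) = trans (χ₃≡mod (3 + d)) (trans (cong χ₃-mod (trans (cong (_% 3) (ℕₚ.+-comm 3 d)) (DivMod.[m+n]%n≡m%n d 3))) (trans (sym (χ₃≡mod d)) (trans (χ₃≡χ d) (cong χᵣ (next³ (res d))))))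
    where
    next³ : ∀ r → r ≡ next (next (next r))
    next³ r0 = refl
    next³ r1 = refl
    next³ r2 = refl

  fourth : ∀ a → + (a ^ 4) ≡ + a *ᶻ (+ a *ᶻ (+ a *ᶻ + a))
  fourth a = trans (ℤₚ.pos-* a (a * (a * (a * 1)))) (cong (+ a *ᶻ_) (trans (ℤₚ.pos-* a (a * (a * 1))) (cong (+ a *ᶻ_) (trans (ℤₚ.pos-* a (a * 1)) (cong (λ z → + a *ᶻ + z) (ℕₚ.*-identityʳ a))))))

  pick-xs : ∀ a n x → pick (a ∣? suc n) x ≡ x *ᶻ xs a (suc n)
  pick-xs a n x with a ∣? suc n
  ... | yes (divides (suc k) _) = sym (ℤₚ.*-identityʳ x)
  ... | no _ = sym (ℤₚ.*-zeroʳ x)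

  sumℤ-oneTo : ∀ (f : ℕ → ℤ) n → sumℤ (map f (oneTo n)) ≡ ∑₁ n f
  sumℤ-oneTo f n = trans (cong sumℤ (sym (Listₚ.map-∘ {g = f} {f = suc} (upTo n)))) (sumℤ-map-upTo (f ∘ suc) n)

  C0≈E₅ : C0 ≈ E₅
  C0≈E₅ = mk≈ λ { zero → sym (trans (+ˢ-at 1ˢ (constˢ (+ 3) *ˢ α₄) 0) (cong (1ℤ +ᶻ_) (const-* (+ 3) α₄ 0)))
    ; (suc n) → trans (cong (+ 3 *ᶻ_) (divisor-sum n)) (sym (trans (+ˢ-at 1ˢ (constˢ (+ 3) *ˢ α₄) (suc n)) (trans (ℤₚ.+-identityˡ _) (const-* (+ 3) α₄ (suc n))))) }
    where
    term : ∀ n a → pick (a ∣? suc n) (χ₃ a *ᶻ + (a ^ 4)) ≡ at-res p₄ a *ᶻ xs a (suc n)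
    term n a = trans (pick-xs a n (χ₃ a *ᶻ + (a ^ 4))) (cong (_*ᶻ xs a (suc n)) (cong₂ _*ᶻ_ (χ₃≡χ a) (fourth a)))
    divisor-sum : ∀ n → sumℤ (map (λ d → χ₃ d *ᶻ + (d ^ 4)) (divisors (suc n))) ≡ α₄ (suc n)
    divisor-sum n = trans (sumℤ-filter (_∣? suc n) (λ d → χ₃ d *ᶻ + (d ^ 4)) (oneTo (suc n)))
      (trans (sumℤ-oneTo (λ a → pick (a ∣? suc n) (χ₃ a *ᶻ + (a ^ 4))) (suc n)) (∑₁-cong (suc n) (λ a → term n a)))

  uC0≈γ₄ : uC0 ≈ γ₄
  uC0≈γ₄ = mk≈ λ { zero → refl ; (suc n) → trans (sumℤ-filter (λ i → suc i ∣? suc n) (f n) (upTo (suc n)))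
      (trans (sumℤ-map-upTo (λ i → pick (suc i ∣? suc n) (f n i)) (suc n)) (∑-cong (suc n) (λ i → term n i))) }
    where
    f : ℕ → ℕ → ℤ
    f n i = χ₃ (suc n ℕ./ suc i) *ᶻ + (suc i ^ 4)
    term : ∀ n i → pick (suc i ∣? suc n) (f n i) ≡ + suc i *ᶻ (+ suc i *ᶻ (+ suc i *ᶻ + suc i)) *ᶻ ks (suc i) (suc n)
    term n i with suc i ∣? suc n
    ... | no _ = sym (ℤₚ.*-zeroʳ (+ suc i *ᶻ (+ suc i *ᶻ (+ suc i *ᶻ + suc i))))
    ... | yes (divides (suc k) eq) = trans (cong₂ _*ᶻ_ (trans (χ₃≡χ (suc n ℕ./ suc i)) (cong χ (trans (cong (ℕ._/ suc i) eq) (DivMod.m*n/n≡m (suc k) (suc i))))) (fourth (suc i))) (ℤₚ.*-comm (χ (suc k)) _)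

  Ceps≈ : ∀ ε → Ceps ε ≈ E₅ -ˢ constˢ (+ 27 *ᶻ ε) *ˢ γ₄
  Ceps≈ ε = mk≈ λ n → trans (cong₂ (λ x y → x -ᶻ + 27 *ᶻ ε *ᶻ y) (at C0≈E₅ n) (at uC0≈γ₄ n))
    (sym (trans (-ˢ-at₂ E₅ (constˢ (+ 27 *ᶻ ε) *ˢ γ₄) n) (cong (λ z → E₅ n -ᶻ z) (const-* (+ 27 *ᶻ ε) γ₄ n))))

  Aeps≡ : ∀ ε m → Aeps ε m ≡ ((E₅ -ˢ constˢ (+ 27 *ᶻ ε) *ˢ γ₄) *ˢ H ^ˢ m) m
  Aeps≡ ε m = trans (sym (*ˢ-at (Ceps ε) (powS Hmix m) m)) (at (*ˢ-cong (Ceps≈ ε) (powS≈^ˢ Hmix m)) m)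

  Amix≡Aeps : ∀ m → Amix m ≡ ℤtoℚ (Aeps (+ 1) m)
  Amix≡Aeps m = trans (Amix-𝐲 m) (cong ℤtoℚ (sym (trans (Aeps≡ (+ 1) m) (Λ-weight-5 m))))

  infixl 7 _⊠_
  _⊠_ : Res → Res → Res
  r0 ⊠ s = r0
  r1 ⊠ s = s
  r2 ⊠ s = s ⊞ s

  next-⊠ : ∀ r s → s ⊞ (r ⊠ s) ≡ next r ⊠ s
  next-⊠ r0 r0 = refl
  next-⊠ r0 r1 = refl
  next-⊠ r0 r2 = refl
  next-⊠ r1 s = refl
  next-⊠ r2 r0 = refl
  next-⊠ r2 r1 = refl
  next-⊠ r2 r2 = refl

  res-* : ∀ a b → res (a * b) ≡ res a ⊠ res b
  res-* zero b = refl
  res-* (suc a) b = trans (res-+ b (a * b)) (trans (cong (res b ⊞_) (res-* a b)) (next-⊠ (res a) (res b)))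

  χᵣ-⊠ : ∀ r s → χᵣ (r ⊠ s) ≡ χᵣ s *ᶻ χᵣ r
  χᵣ-⊠ r0 s = sym (ℤₚ.*-zeroʳ (χᵣ s))
  χᵣ-⊠ r1 s = sym (ℤₚ.*-identityʳ (χᵣ s))
  χᵣ-⊠ r2 r0 = refl
  χᵣ-⊠ r2 r1 = refl
  χᵣ-⊠ r2 r2 = refl

  χ-* : ∀ a b → χ (a * b) ≡ χ b *ᶻ χ a
  χ-* a b = trans (cong χᵣ (res-* a b)) (χᵣ-⊠ (res a) (res b))

  module Hecke (m : ℕ) (pr : Prime (suc m)) where

    open Frobenius m pr
    open Modulo p

    -- The operator U_p, left inverse to the substitution `V p`.
    U : Series → Series
    U f n = f (n * p)

    -- Removing the constant term of g lowers the exponent np by p on the left and n by one on the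
    -- right.
    U-* : ∀ n f g → (f *ˢ V p g) (n * p) ≡ (U f *ˢ g) n
    U-* n f g = trans (at (*ˢ-comm f (V p g)) (n * p)) (trans (go n g) (at (*ˢ-comm g (U f)) n))
      where
      split : ∀ g k → (V p g *ˢ f) k ≡ g 0 *ᶻ f k +ᶻ (qS ^ˢ p *ˢ (V p (g ∘ suc) *ˢ f)) k
      split g k = trans (at (≈-trans (*ˢ-cong (V-suc p g) ≈-refl) (𝒮.distribʳ f (constˢ (g 0)) (qS ^ˢ p *ˢ V p (g ∘ suc)))) k)
        (trans (+ˢ-at (constˢ (g 0) *ˢ f) (qS ^ˢ p *ˢ V p (g ∘ suc) *ˢ f) k) (cong₂ _+ᶻ_ (const-* (g 0) f k) (at (*ˢ-assoc (qS ^ˢ p) (V p (g ∘ suc)) f) k)))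
      go : ∀ n g → (V p g *ˢ f) (n * p) ≡ (g *ˢ U f) n
      go zero g = trans (*ˢ-0 (V p g) f) (trans (cong (_*ᶻ f 0) (V-0 p g)) (sym (*ˢ-0 g (U f))))
      go (suc n) g = trans (split g (p + n * p)) (trans (cong (g 0 *ᶻ f (p + n * p) +ᶻ_) (trans (q^*-+ p (V p (g ∘ suc) *ˢ f) (n * p)) (go n (g ∘ suc)))) (sym (*ˢ-suc g (U f) n)))

    ∤⇒∣ : ∀ {a} j → ¬ p ∣ a → a ∣ j * p → a ∣ j
    ∤⇒∣ {a} j p∤a a∣jp = coprime-divisor coprime (subst (a ∣_) (ℕₚ.*-comm j p) a∣jp)
      where
      coprime : Coprime a p
      coprime (d∣a , d∣p) with prime⇒irreducible pr d∣p
      ... | inj₁ d≡1 = d≡1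
      ... | inj₂ refl = ⊥-elim (p∤a d∣a)

    geo-U : ∀ c ψ → (∀ k → dropConst ψ (k * p) ≡ c *ᶻ dropConst ψ k) → ∀ a .{{_ : NonZero a}} j → ¬ p ∣ a → geo ψ a (j * p) ≡ c *ᶻ geo ψ a j
    geo-U c ψ h a j p∤a with a ∣? j
    ... | yes (divides k refl) = trans (cong (V a (dropConst ψ)) (trans (ℕₚ.*-assoc k a p) (trans (cong (k *_) (ℕₚ.*-comm a p)) (sym (ℕₚ.*-assoc k p a))))) (trans (V-∣ a (dropConst ψ) (k * p)) (h k))
    ... | no a∤j = trans (V-∤ a (dropConst ψ) (λ d → a∤j (∤⇒∣ j p∤a d))) (sym (ℤₚ.*-zeroʳ c))

    -- Terms with p ∣ a vanish mod p because the weight is divisible by a; the others match.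
    Lam-U : ∀ c (w : ℕ → ℤ) ψ → (∀ k → dropConst ψ (k * p) ≡ c *ᶻ dropConst ψ k) → ∀ j →
      Lam (λ a → + a *ᶻ w a) ψ (j * p) ≡ₚ c *ᶻ Lam (λ a → + a *ᶻ w a) ψ j
    Lam-U c w ψ h j = via refl (trans (cong (c *ᶻ_) (Lam-extend (λ a → + a *ᶻ w a) ψ (ℕₚ.m≤m*n j p))) (sym (∑-*ˡ (j * p) c (λ i → + suc i *ᶻ w (suc i) *ᶻ geo ψ (suc i) j))))
      (∑-≡ₚ (j * p) (λ i → term (suc i)))
      where
      rearrange : ∀ w c x → w *ᶻ (c *ᶻ x) ≡ c *ᶻ (w *ᶻ x)
      rearrange = solve-∀
      factor : ∀ q p w x → q *ᶻ p *ᶻ w *ᶻ x ≡ p *ᶻ (q *ᶻ w *ᶻ x)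
      factor = solve-∀
      zeros : ∀ a x → p ∣ a → + a *ᶻ w a *ᶻ x ≡ₚ 0ℤ
      zeros _ x (divides q refl) = via (trans (cong (λ z → z *ᶻ w (q * p) *ᶻ x) (ℤₚ.pos-* q p)) (factor (+ q) (+ p) (w (q * p)) x)) refl (p*≡ₚ0 (+ q *ᶻ w (q * p) *ᶻ x))
      term : ∀ a .{{_ : NonZero a}} → + a *ᶻ w a *ᶻ geo ψ a (j * p) ≡ₚ c *ᶻ (+ a *ᶻ w a *ᶻ geo ψ a j)
      term a with p ∣? a
      ... | yes p∣a = ≡ₚ-trans (zeros a (geo ψ a (j * p)) p∣a) (≡ₚ-sym (via (sym (rearrange (+ a *ᶻ w a) c (geo ψ a j))) refl (zeros a (c *ᶻ geo ψ a j) p∣a)))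
      ... | no p∤a = ≡⇒≡ₚ (trans (cong (+ a *ᶻ w a *ᶻ_) (geo-U c ψ h a j p∤a)) (rearrange (+ a *ᶻ w a) c (geo ψ a j)))

    α₄-U : ∀ j → α₄ (j * p) ≡ₚ α₄ j
    α₄-U j = via (at weight (j * p)) (trans (at weight j) (sym (ℤₚ.*-identityˡ _))) (Lam-U 1ℤ (λ a → χ a *ᶻ (+ a *ᶻ (+ a *ᶻ + a))) ones (λ { zero → refl ; (suc k) → refl }) j)
      where
      ring : ∀ c a → c *ᶻ (a *ᶻ (a *ᶻ (a *ᶻ a))) ≡ a *ᶻ (c *ᶻ (a *ᶻ (a *ᶻ a)))
      ring = solve-∀
      weight : α₄ ≈ Lam (λ a → + a *ᶻ (χ a *ᶻ (+ a *ᶻ (+ a *ᶻ + a)))) ones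
      weight = Lam-cong (λ a → ring (χ a) (+ a))

    -- Here the codivisor absorbs the factor p and yields χ(p); in α₄ the character sits on the
    -- divisor, which does not change. This contrast turns ε into εχ(p).
    γ₄-U : ∀ j → γ₄ (j * p) ≡ₚ χ p *ᶻ γ₄ j
    γ₄-U = Lam-U (χ p) (λ a → + a *ᶻ (+ a *ᶻ + a)) χ (λ { zero → sym (ℤₚ.*-zeroʳ (χ p)) ; (suc k) → χ-* (suc k) p })

    weight₅ : ℤ → Series
    weight₅ ε = E₅ -ˢ constˢ (+ 27 *ᶻ ε) *ˢ γ₄

    weight₅-at : ∀ ε n → weight₅ ε n ≡ (1ˢ n +ᶻ + 3 *ᶻ α₄ n) +ᶻ -ᶻ (+ 27 *ᶻ ε *ᶻ γ₄ n)
    weight₅-at ε n = trans (-ˢ-at₂ E₅ (constˢ (+ 27 *ᶻ ε) *ˢ γ₄) n) (cong₂ _-ᶻ_ (trans (+ˢ-at 1ˢ (constˢ (+ 3) *ˢ α₄) n) (cong (1ˢ n +ᶻ_) (const-* (+ 3) α₄ n))) (const-* (+ 27 *ᶻ ε) γ₄ n))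

    U-weight₅ : ∀ ε → U (weight₅ ε) ≈ₚ weight₅ (ε *ᶻ χ p)
    U-weight₅ ε = mk≈ₚ λ n → via (weight₅-at ε (n * p)) (trans (weight₅-at (ε *ᶻ χ p) n) (cong (λ z → (1ˢ n +ᶻ + 3 *ᶻ α₄ n) +ᶻ -ᶻ z) (ring ε (χ p) (γ₄ n))))
      (+-≡ₚ (+-≡ₚ (≡⇒≡ₚ (1-at n)) (*-≡ₚ (≡⇒≡ₚ {+ 3} refl) (α₄-U n))) (neg-≡ₚ (*-≡ₚ (≡⇒≡ₚ {+ 27 *ᶻ ε} refl) (γ₄-U n))))
      where
      ring : ∀ e c g → + 27 *ᶻ (e *ᶻ c) *ᶻ g ≡ + 27 *ᶻ e *ᶻ (c *ᶻ g)
      ring = solve-∀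
      1-at : ∀ n → 1ˢ (n * p) ≡ 1ˢ n
      1-at zero = refl
      1-at (suc n) = refl

    coefficient-step : ∀ (W W′ h : Series) → U W ≈ₚ W′ → ∀ n → (W *ˢ h ^ˢ (n * p)) (n * p) ≡ₚ (W′ *ˢ h ^ˢ n) n
    coefficient-step W W′ h UW n = ≡ₚ-trans (atₚ (*ˢ-≈ₚ (≈ₚ-refl {W}) power) (n * p)) (≡ₚ-trans (≡⇒≡ₚ (U-* n W (h ^ˢ n))) (atₚ (*ˢ-≈ₚ UW (≈ₚ-refl {h ^ˢ n})) n))
      where
      power : h ^ˢ (n * p) ≈ₚ V p (h ^ˢ n)
      power = ≈ₚ-trans (≈⇒≈ₚ (^ˢ-* h p n)) (≈ₚ-trans (^ˢ-≈ₚ n (frobenius h)) (≈⇒≈ₚ (≈-sym (V-^ p h n))))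

    Aeps-step : ∀ ε n → Aeps ε (n * p) ≡ₚ Aeps (ε *ᶻ χ₃ p) n
    Aeps-step ε n = subst (λ c → Aeps ε (n * p) ≡ₚ Aeps (ε *ᶻ c) n) (sym (χ₃≡χ p))
      (≡ₚ-trans (≡⇒≡ₚ (Aeps≡ ε (n * p))) (≡ₚ-trans (coefficient-step (weight₅ ε) (weight₅ (ε *ᶻ χ p)) H (U-weight₅ ε) n) (≡⇒≡ₚ (sym (Aeps≡ (ε *ᶻ χ p) n)))))

    Aeps-power : ∀ r ε n → Aeps ε (n * p ^ r) ≡ₚ Aeps (ε *ᶻ χ₃ p ℤ.^ r) n
    Aeps-power zero ε n = ≡⇒≡ₚ (cong₂ Aeps (sym (ℤₚ.*-identityʳ ε)) (ℕₚ.*-identityʳ n))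
    -- n p^(r+1) is read as (n p^r) p, so that one step strips the outer factor p.
    Aeps-power (suc r) ε n = ≡ₚ-trans (≡⇒≡ₚ (cong (Aeps ε) (trans (cong (n *_) (ℕₚ.*-comm p (p ^ r))) (sym (ℕₚ.*-assoc n (p ^ r) p)))))
      (≡ₚ-trans (Aeps-step ε (n * p ^ r)) (≡ₚ-trans (Aeps-power r (ε *ᶻ χ₃ p) n) (≡⇒≡ₚ (cong (λ e → Aeps e n) (ℤₚ.*-assoc ε (χ₃ p) (χ₃ p ℤ.^ r))))))

    ≡ₚ⇒≡ℚ : ∀ {x y} → x ≡ₚ y → ℤtoℚ x ≡ℚ ℤtoℚ y [mod p ]
    ≡ₚ⇒≡ℚ {x} {y} (k ,ₚ eq) = k , trans (cong (ℚ._- ℤtoℚ y) (trans (cong ℤtoℚ eq) (trans (ι-+ y (+ p *ᶻ k)) (ℚₚ.+-comm (ℤtoℚ y) (ℤtoℚ (+ p *ᶻ k))))))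
      (trans (ℚₚ.+-assoc (ℤtoℚ (+ p *ᶻ k)) (ℤtoℚ y) (ℚ.- ℤtoℚ y)) (trans (cong (ℤtoℚ (+ p *ᶻ k) ℚ.+_) (ℚₚ.+-inverseʳ (ℤtoℚ y))) (ℚₚ.+-identityʳ (ℤtoℚ (+ p *ᶻ k)))))

    Amix-power : ∀ r n → Amix (n * p ^ r) ≡ℚ ℤtoℚ (Aeps (χ₃ p ℤ.^ r) n) [mod p ]
    Amix-power r n = subst (λ z → z ≡ℚ ℤtoℚ (Aeps (χ₃ p ℤ.^ r) n) [mod p ]) (sym (Amix≡Aeps (n * p ^ r)))
      (≡ₚ⇒≡ℚ (subst (λ e → Aeps (+ 1) (n * p ^ r) ≡ₚ Aeps e n) (ℤₚ.*-identityˡ (χ₃ p ℤ.^ r)) (Aeps-power r (+ 1) n)))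

open HeckeOperator

-- The congruences, and their form in each class of p modulo 3.

theorem5p4 : (p : ℕ) → Prime p → 5 ≤ p →
    ((r m : ℕ) → Amix (m * p ^ r) ≡ℚ ℤtoℚ (Aeps (χ₃ p ℤ.^ r) m) [mod p ])
    × (p % 3 ≡ 1 → (r m : ℕ) → Amix (m * p ^ r) ≡ℚ Amix m [mod p ])
    × (p % 3 ≡ 2 → (r m : ℕ) →
    (Amix (m * p ^ (2 * r)) ≡ℚ Amix m [mod p ])
    × (Amix (m * p ^ (2 * r + 1)) ≡ℚ ℤtoℚ (Aeps -[1+ 0 ] m) [mod p ]))
theorem5p4 p@(suc n) pr _ = main , (λ p≡1 r m → subst (λ y → Amix (m * p ^ r) ≡ℚ y [mod p ]) (sym (Amix≡Aeps m)) (at-sign r (trans (cong (ℤ._^ r) (character p≡1)) (ℤₚ.^-zeroˡ r)) m))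
  , λ p≡2 r m → subst (λ y → Amix (m * p ^ (2 * r)) ≡ℚ y [mod p ]) (sym (Amix≡Aeps m)) (at-sign (2 * r) (even (character p≡2) r) m)
    , at-sign (2 * r + 1) (odd (character p≡2) r) m
  where
  main : (r m : ℕ) → Amix (m * p ^ r) ≡ℚ ℤtoℚ (Aeps (χ₃ p ℤ.^ r) m) [mod p ]
  main = Hecke.Amix-power n pr
  at-sign : ∀ r {ε} → χ₃ p ℤ.^ r ≡ ε → ∀ m → Amix (m * p ^ r) ≡ℚ ℤtoℚ (Aeps ε m) [mod p ]
  at-sign r refl m = main r m
  character : ∀ {c} → p % 3 ≡ c → χ₃ p ≡ χ₃-mod c
  character refl = χ₃≡mod p
  even : χ₃ p ≡ -[1+ 0 ] → ∀ r → χ₃ p ℤ.^ (2 * r) ≡ + 1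
  even χ≡ r = trans (cong (ℤ._^ (2 * r)) χ≡) (trans (sym (ℤₚ.^-*-assoc -[1+ 0 ] 2 r)) (ℤₚ.^-zeroˡ r))
  odd : χ₃ p ≡ -[1+ 0 ] → ∀ r → χ₃ p ℤ.^ (2 * r + 1) ≡ -[1+ 0 ]
  odd χ≡ r = trans (ℤₚ.^-distribˡ-+-* (χ₃ p) (2 * r) 1) (cong₂ _*ᶻ_ (even χ≡ r) (trans (ℤₚ.*-identityʳ (χ₃ p)) χ≡))
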